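{- Let $\Phi$ be of type $A_n$ or $C_n$. For every long simple root $\alpha_i$, let $W^i$ be the set of minimal length representatives of the left cosets $W/W\langle\Pi\setminus\{\alpha_i\}\rangle$, let $\mathcal T_i=\{\mathrm{conv}_0(B(I))\mid I\in\mathcal I_{ab}(\alpha_i)\}$, and set $$\mathcal T=\bigcup_{\alpha_i\in\Pi_\ell}W^i\mathcal T_i,\qquad \mathcal T^+=\{T\in\mathcal T\mid T\subseteq\mathcal P^+\},$$ where $W^i\mathcal T_i=\{w(T)\mid w\in W^i,\ T\in\mathcal T_i\}$. Then $\mathcal T$ is a triangulation of $\mathcal P$ and $\mathcal T^+$ is a triangulation of $\mathcal P^+$. In particular $\mathcal P^+=\mathcal P\cap\mathcal C^+$, where $\mathcal C^+$ is the cone of nonnegative linear combinations of $\Phi^+$.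
   Context: $\Phi$ is a finite irreducible crystallographic root system in a Euclidean space $E$ with inner product $(-,-)$, $\Pi=\{\alpha_1,\dots,\alpha_n\}$ a basis (Bourbaki numbering), $\Phi^+$ the positive roots, $\theta$ the highest root, $W$ the Weyl group, $W\langle S\rangle$ the subgroup generated by the reflections $s_\beta$, $\beta\in S$. $\Pi_\ell$ is the set of long simple roots (in type $A_n$ all roots are long; in type $C_n$, $\Pi_\ell=\{\alpha_n\}$). $\mathcal P=\mathrm{conv}(\Phi)$, $\mathcal P^+=\mathrm{conv}(\Phi^+\cup\{0\})$, and $\mathrm{conv}_0(S)=\mathrm{conv}(S\cup\{0\})$. The root poset is $\Phi^+$ ordered by $\beta\le\gamma$ iff $\gamma-\beta$ is a nonnegative integer combination of simple roots. An abelian ideal is a subset $I\subseteq\Phi^+$ closed upward in the root poset with $(I+I)\cap\Phi=\emptyset$. The border of $I$ is $B(I)=\{\beta\in I\mid$ for all $\gamma_1,\gamma_2\in\Pi$ with $\beta-\gamma_1,\beta-\gamma_2\in\Phi^+$, $\beta-\gamma_1-\gamma_2\notin I\}$. Affine setting: $\hat V=E\oplus\mathbb R\delta$ with the form extending $(-,-)$ with $\delta$ in its radical; $\hat\Phi=\{\beta+k\delta\mid\beta\in\Phi,k\in\mathbb Z\}$, $\alpha_0=-\theta+\delta$, $\hat\Pi=\Pi\cup\{\alpha_0\}$, $\hat\Phi^+=\Phi^+\cup\{\beta+k\delta\mid\beta\in\Phi,k\ge1\}$; $s_\beta(x)=x-\frac{2(x,\beta)}{(\beta,\beta)}\beta$;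 $\hat W$ is generated by $s_\beta$, $\beta\in\hat\Pi$; $N(w)=\{\beta\in\hat\Phi^+\mid w^{ -1}(\beta)\in-\hat\Phi^+\}$. For each abelian ideal $I$ there is a unique $w_I\in\hat W$ with $N(w_I)=\{\delta-\beta\mid\beta\in I\}$, and for a long root $\alpha\in\Phi^+$, $\mathcal I_{ab}(\alpha)=\{I$ abelian ideal $\mid w_I^{ -1}(-\theta+2\delta)=\alpha\}$. A triangulation of a polytope $Q$ is a finite set of simplices with union $Q$, any two meeting in a common (possibly empty) face.
   Formalization: The root systems A_n and C_n are taken in their standard coordinates, and the Euclidean space E, the points of the polytopes, simplices and cone, and the coefficients of convex and nonnegative combinations are rational instead of real. -}

module Defs where

open import Data.Bool using (Bool; true; false; if_then_else_)
open import Data.Nat as ℕ using (ℕ; zero; suc; _≡ᵇ_; _<ᵇ_)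
open import Data.Integer using (ℤ; +_)
open import Data.Rational as ℚ
  using (ℚ; 0ℚ; 1ℚ; _/_; ≢-nonZero)
  renaming (_+_ to _+q_; _*_ to _*q_; _-_ to _-q_; -_ to -q_; _≤_ to _≤q_; _÷_ to _÷q_)
open import Data.Rational.Properties using () renaming (_≟_ to _≟q_)
open import Data.Fin using (Fin; zero; suc; toℕ)
open import Data.List using (List; []; _∷_; length; lookup; concatMap; upTo; _++_; map; reverse)
open import Data.List.Relation.Unary.All using (All)
open import Data.Product using (Σ; _×_; _,_)
open import Data.Sum using (_⊎_)
open import Data.Unit using (⊤)
open import Relation.Nullary using (¬_; yes; no)
open import Relation.Binary.PropositionalEquality using (_≡_; _≢_)

-- Rational vector spaces ℚ^m (points of E are taken with rational
-- coordinates)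

V : ℕ → Set
V m = Fin m → ℚ

module _ {m : ℕ} where

  infix 4 _≐_
  _≐_ : V m → V m → Set
  u ≐ v = ∀ k → u k ≡ v k

  0v : V m
  0v _ = 0ℚ

  infixl 6 _+v_ _-v_
  infixl 7 _·v_
  _+v_ : V m → V m → V m
  (u +v v) k = u k +q v k

  _-v_ : V m → V m → V m
  (u -v v) k = u k -q v k

  -v_ : V m → V m
  (-v u) k = -q (u k)

  _·v_ : ℚ → V m → V m
  (c ·v u) k = c *q u k

sumℚ : {k : ℕ} → (Fin k → ℚ) → ℚ
sumℚ {zero}  f = 0ℚ
sumℚ {suc k} f = f zero +q sumℚ (λ j → f (suc j))

sumV : {m k : ℕ} → (Fin k → V m) → V m
sumV {m} {zero}  f = 0v
sumV {m} {suc k} f = f zero +v sumV (λ j → f (suc j))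

⟨_,_⟩ : {m : ℕ} → V m → V m → ℚ
⟨ u , v ⟩ = sumℚ (λ k → u k *q v k)

-- total division (only ever used with nonzero denominator)
divq : ℚ → ℚ → ℚ
divq p q with q ≟q 0ℚ
... | yes _ = 0ℚ
... | no q≢0 = _÷q_ p q {{≢-nonZero q≢0}}

2ℚ : ℚ
2ℚ = + 2 / 1

coef : {m : ℕ} → V m → V m → ℚ
coef x β = divq (2ℚ *q ⟨ x , β ⟩) ⟨ β , β ⟩

sref : {m : ℕ} → V m → V m → V m
sref β x = x -v (coef x β ·v β)

eN : {m : ℕ} → ℕ → V m
eN i k = if i ≡ᵇ toℕ k then 1ℚ else 0ℚ

Region : ℕ → Set₁
Region m = V m → Set

module _ {m : ℕ} where

  infix 4 _⊆ᵣ_ _≡ᵣ_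
  _⊆ᵣ_ : Region m → Region m → Set
  R ⊆ᵣ S = ∀ x → R x → S x

  _≡ᵣ_ : Region m → Region m → Set
  R ≡ᵣ S = (R ⊆ᵣ S) × (S ⊆ᵣ R)

  _∩ᵣ_ : Region m → Region m → Region m
  (R ∩ᵣ S) x = R x × S x

  ConvSub : (L : List (V m)) → (Fin (length L) → Set) → Region m
  ConvSub L S x =
    Σ (Fin (length L) → ℚ) λ c →
      (∀ j → 0ℚ ≤q c j) × (∀ j → c j ≢ 0ℚ → S j) ×
      (sumℚ c ≡ 1ℚ) × (sumV (λ j → c j ·v lookup L j) ≐ x)

  Conv : List (V m) → Region m
  Conv L = ConvSub L (λ _ → ⊤)

  AffInd : List (V m) → Set
  AffInd L = ∀ (c : Fin (length L) → ℚ) → sumℚ c ≡ 0ℚ →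
             sumV (λ j → c j ·v lookup L j) ≐ 0v → ∀ j → c j ≡ 0ℚ

  IsSimplex : Region m → Set
  IsSimplex R = Σ (List (V m)) λ vs → AffInd vs × (R ≡ᵣ Conv vs)

  -- faces of a simplex conv(vs) are conv(F), F ⊆ vs (F may be empty)
  -- R₁ and R₂ meet in a common (possibly empty) face
  CommonFace : Region m → Region m → Set
  CommonFace R₁ R₂ =
    Σ (List (V m)) λ vs₁ → AffInd vs₁ × (R₁ ≡ᵣ Conv vs₁) ×
    Σ (List (V m)) λ vs₂ → AffInd vs₂ × (R₂ ≡ᵣ Conv vs₂) ×
    Σ (Fin (length vs₁) → Bool) λ F₁ → Σ (Fin (length vs₂) → Bool) λ F₂ →
      ((R₁ ∩ᵣ R₂) ≡ᵣ ConvSub vs₁ (λ j → F₁ j ≡ true)) ×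
      ((R₁ ∩ᵣ R₂) ≡ᵣ ConvSub vs₂ (λ j → F₂ j ≡ true))

  record IsTriangulation {Ix : Set} (reg : Ix → Region m) (Q : Region m) : Set where
    field
      finite  : Σ (List Ix) λ L → ∀ ix → Σ (Fin (length L)) λ j → reg ix ≡ᵣ reg (lookup L j)
      simplex : ∀ ix → IsSimplex (reg ix)
      cover   : Q ≡ᵣ (λ x → Σ Ix λ ix → reg ix x)
      meet    : ∀ ix jx → CommonFace (reg ix) (reg jx)

record RootData : Set where
  field
    rank     : ℕ
    dim      : ℕ
    simple   : Fin rank → V dim
    posRoots : List (V dim)
    θ        : V dim

-- Type A_n in ℚ^{n+1}: α_i = e_i - e_{i+1}, Φ⁺ = {e_i - e_j | i < j},
-- θ = e_1 - e_{n+1}  (indices shifted to start at 0)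
typeA : ℕ → RootData
typeA n = record
  { rank = n ; dim = suc n
  ; simple = λ i → eN (toℕ i) -v eN (suc (toℕ i))
  ; posRoots = concatMap (λ i → concatMap (λ j →
       if i <ᵇ j then (eN i -v eN j) ∷ [] else []) (upTo (suc n))) (upTo (suc n))
  ; θ = eN 0 -v eN n }

typeC : ℕ → RootData
typeC n = record
  { rank = n ; dim = n
  ; simple = λ i → if suc (toℕ i) <ᵇ n then eN (toℕ i) -v eN (suc (toℕ i))
                   else 2ℚ ·v eN (toℕ i)
  ; posRoots = concatMap (λ i → concatMap (λ j →
       if i <ᵇ j then (eN i -v eN j) ∷ (eN i +v eN j) ∷ [] else []) (upTo n)) (upTo n)
       ++ map (λ i → 2ℚ ·v eN i) (upTo n)
  ; θ = 2ℚ ·v eN 0 }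

module RS (R : RootData) where
  open RootData R public

  N : ℕ
  N = length posRoots

  pos : Fin N → V dim
  pos = lookup posRoots

  IsPos : V dim → Set
  IsPos v = Σ (Fin N) λ a → v ≐ pos a

  IsRoot : V dim → Set
  IsRoot v = IsPos v ⊎ IsPos (-v v)

  _≼_ : V dim → V dim → Set
  β ≼ γ = Σ (Fin rank → ℕ) λ c → (γ -v β) ≐ sumV (λ i → ((+ c i) / 1) ·v simple i)

  Subset⁺ : Set
  Subset⁺ = Fin N → Bool

  InI : Subset⁺ → V dim → Set
  InI I v = Σ (Fin N) λ a → (I a ≡ true) × (v ≐ pos a)

  IsAbelianIdeal : Subset⁺ → Set
  IsAbelianIdeal I =
    (∀ a b → I a ≡ true → pos a ≼ pos b → I b ≡ true) ×
    (∀ a b → I a ≡ true → I b ≡ true → ¬ IsRoot (pos a +v pos b))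

  Border : Subset⁺ → Fin N → Set
  Border I a = (I a ≡ true) ×
    (∀ i j → IsPos (pos a -v simple i) → IsPos (pos a -v simple j) →
       ¬ InI I ((pos a -v simple i) -v simple j))

  conv₀B : Subset⁺ → Region dim
  conv₀B I = ConvSub (0v ∷ posRoots) S
    where
    S : Fin (suc N) → Set
    S zero    = ⊤
    S (suc a) = Border I a

  -- long simple roots (θ is long)
  Long : Fin rank → Set
  Long i = ⟨ simple i , simple i ⟩ ≡ ⟨ θ , θ ⟩

  actW : List (Fin rank) → V dim → V dim
  actW []      x = x
  actW (i ∷ w) x = sref (simple i) (actW w x)

  -- w (a word) is of minimal length in its coset w W⟨Π ∖ {α_i}⟩,
  -- i.e. the element actW w belongs to W^i (and w is a reduced word)
  MinRep : Fin rank → List (Fin rank) → Set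
  MinRep i w = ∀ (u : List (Fin rank)) → All (λ j → j ≢ i) u →
               ∀ (x : List (Fin rank)) → (∀ v → actW x v ≐ actW w (actW u v)) →
               length w ℕ.≤ length x

  -- affine space V̂ = E ⊕ ℚδ, pairs (vector part, δ-coefficient)
  Vh : Set
  Vh = V dim × ℚ

  _≐h_ : Vh → Vh → Set
  (x , d) ≐h (y , e) = (x ≐ y) × (d ≡ e)

  negh : Vh → Vh
  negh (x , d) = (-v x , -q d)

  srefh : Vh → Vh → Vh
  srefh (β , k) (x , d) = (x -v (coef x β ·v β) , d -q (coef x β *q k))

  affSimple : Fin (suc rank) → Vh
  affSimple zero    = (-v θ , 1ℚ)
  affSimple (suc i) = (simple i , 0ℚ)

  actŴ : List (Fin (suc rank)) → Vh → Vh
  actŴ []      x = x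
  actŴ (i ∷ w) x = srefh (affSimple i) (actŴ w x)

  -- action of w⁻¹ (reflections are involutions)
  actŴinv : List (Fin (suc rank)) → Vh → Vh
  actŴinv w = actŴ (reverse w)

  AffPos : Vh → Set
  AffPos (v , d) = (IsPos v × d ≡ 0ℚ) ⊎ (IsRoot v × Σ ℕ λ k → d ≡ (+ suc k) / 1)

  InN : List (Fin (suc rank)) → Vh → Set
  InN w x = AffPos x × AffPos (negh (actŴinv w x))

  IsWI : Subset⁺ → List (Fin (suc rank)) → Set
  IsWI I w = ∀ x →
    (InN w x → Σ (Fin N) λ a → (I a ≡ true) × (x ≐h (-v pos a , 1ℚ))) ×
    ((Σ (Fin N) λ a → (I a ≡ true) × (x ≐h (-v pos a , 1ℚ))) → InN w x)

  InIab : V dim → Subset⁺ → Set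
  InIab α I = IsAbelianIdeal I ×
    Σ (List (Fin (suc rank))) λ w → IsWI I w × (actŴinv w (-v θ , 2ℚ) ≐h (α , 0ℚ))

  TIx : Set
  TIx = Σ (Fin rank) λ i → Long i ×
        Σ (List (Fin rank)) λ w → MinRep i w ×
        Σ Subset⁺ λ I → InIab (simple i) I

  regT : TIx → Region dim
  regT (i , _ , w , _ , I , _) x = Σ (V dim) λ y → conv₀B I y × (x ≐ actW w y)

  𝓟 : Region dim
  𝓟 = Conv (posRoots ++ map -v_ posRoots)

  𝓟⁺ : Region dim
  𝓟⁺ = Conv (0v ∷ posRoots)

  𝓒⁺ : Region dim
  𝓒⁺ x = Σ (Fin N → ℚ) λ c → (∀ a → 0ℚ ≤q c a) × (sumV (λ a → c a ·v pos a) ≐ x)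

  TIx⁺ : Set
  TIx⁺ = Σ TIx λ t → regT t ⊆ᵣ 𝓟⁺

  regT⁺ : TIx⁺ → Region dim
  regT⁺ (t , _) = regT t

  Conclusion : Set
  Conclusion = IsTriangulation regT 𝓟 × IsTriangulation regT⁺ 𝓟⁺ × (𝓟⁺ ≡ᵣ (𝓟 ∩ᵣ 𝓒⁺))

{-# OPTIONS --safe #-}
-- Both root systems consist of the differences e p − e q of positions p ≠ q (for C_n the positions are
-- 1 < … < n < −n < … < −1 with e (−p) = − e p), with p < q for the positive ones. The elements of W^i are the
-- words whose permutation w of the positions increases on {r < h} and on {r ≥ h}, and 𝓘ab(α_i) consists of the
-- upper sets I of the rectangle r < h ≤ s that contain its first row and its last column: w_I is the shuffle of
-- the two blocks prescribed by I. Hence the vertices of w(conv₀(B(I))) are 0 and roots e p − e q whose pairs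
-- (p, q) form a chain for the product order, no position being both a source and a sink. A nonnegative
-- combination supported on such a chain is the monotone coupling of the positive and negative parts of its
-- value, so it is determined by it: this gives affine independence and the common faces. Conversely the monotone
-- coupling of any point of 𝓟 is supported on the border of an ideal, which gives the covering. If the partial
-- sums of the coordinates are nonnegative, that is on the positive cone, all pairs of a suitable such border
-- satisfy p < q, and the simplex lies in 𝓟⁺.
module Submission where

open import Defs
open import Data.Nat using (ℕ; _≤_)
open import Data.Product using (_×_)

open import Data.Bool using (Bool; true; false; not; _∧_; _∨_; if_then_else_)
import Data.Bool.Properties as Boolₚ
open import Data.Empty using (⊥; ⊥-elim)
open import Data.Fin as Fin using (Fin; zero; suc; toℕ; inject₁; fromℕ; opposite)
import Data.Fin.Properties as Finₚ
open import Data.Integer as ℤ using (ℤ)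
import Data.Integer.Properties as ℤₚ
import Data.Integer.Tactic.RingSolver as ℤ-Solver
open import Data.List as List using (List; []; _∷_; length; lookup; _++_; reverse; concatMap; upTo)
open import Data.List.Membership.Propositional using (_∈_; find; lose)
import Data.List.Membership.Propositional.Properties as ∈ₚ
import Data.List.Properties as Listₚ
open import Data.List.Relation.Unary.All using (All; []; _∷_)
open import Data.List.Relation.Unary.Any as Any using (Any; here; there)
import Data.List.Relation.Unary.Any.Properties as Anyₚ
open import Data.Maybe using (Maybe; just; nothing)
open import Data.Nat as ℕ using (zero; suc)
import Data.Nat.Properties as ℕₚ
import Data.Nat.Tactic.RingSolver as ℕ-Solver
open import Data.Product using (Σ; _,_; proj₁; proj₂; ∃; ∃₂)
open import Data.Rational as ℚ using (ℚ; 0ℚ; 1ℚ; ½; _+_; _*_; _-_; -_; _<_; _⊓_; _⊔_) renaming (_≤_ to _≤q_)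
import Data.Rational.Properties as ℚₚ
import Data.Rational.Unnormalised as ℚᵘ
import Data.Rational.Unnormalised.Properties as ℚᵘₚ
open import Data.Sum as Sum using (_⊎_; inj₁; inj₂)
open import Data.Unit using (⊤; tt)
open import Function using (_∘_; id; case_of_)
open import Relation.Binary.Definitions using (tri<; tri≈; tri>)
open import Relation.Binary.PropositionalEquality hiding (J)
open import Relation.Binary.PropositionalEquality.WithK using (≡-irrelevant)
open import Relation.Nullary using (¬_; Dec; yes; no; contradiction)
open import Relation.Nullary.Decidable using (⌊_⌋; from-no; map′; ¬?; _×-dec_; _→-dec_; _⊎-dec_)
open import Tactic.RingSolver using (solve-∀)
open import Tactic.RingSolver.Core.AlmostCommutativeRing using (AlmostCommutativeRing; fromCommutativeRing)

-- The field `finite` asks for an explicit list of simplices, but the index type `TIx` is infinite: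
-- words are arbitrary lists and `InIab` asks for some affine word. Hence both implications between
-- `InIab` and the finite, decidable conditions `Hook` are proved: one gives the shape of the given
-- ideals, the other turns ideals built from points or from an enumeration into indices. In type C a
-- root is in general the difference of two mirrored pairs of positions, while a simplex needs each
-- vertex once. So uniqueness is proved for mirror-symmetrized coefficients and carried back to a
-- chosen half of the pairs. The same doubling is the origin of `φ`, which is 1 in type C and 0 in
-- type A, and of the normalisation `κ`, the inverse of `1ℚ + φ`. A point with vanishing coordinates
-- does not determine which positions are sources. The rule `tie` decides, chosen so that sources
-- and sinks both exist, that mirror images get opposite roles, and that for points of the positive
-- cone the first position is a source and the last a sink.

ℚ-ring : AlmostCommutativeRing _ _
ℚ-ring = fromCommutativeRing ℚₚ.+-*-commutativeRing isZero
  where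
  isZero : ∀ x → Maybe (0ℚ ≡ x)
  isZero x with 0ℚ ℚₚ.≟ x
  ... | yes p = just p
  ... | no  _ = nothing

0≤1 : 0ℚ ≤q 1ℚ
0≤1 = ℚₚ.nonNegative⁻¹ 1ℚ

+-nonneg : ∀ {x y} → 0ℚ ≤q x → 0ℚ ≤q y → 0ℚ ≤q x + y
+-nonneg = ℚₚ.+-mono-≤

*-nonneg : ∀ {x y} → 0ℚ ≤q x → 0ℚ ≤q y → 0ℚ ≤q x * y
*-nonneg {x} {y} p q = ℚₚ.nonNegative⁻¹ (x * y)
  {{ℚₚ.nonNeg*nonNeg⇒nonNeg x {{ℚ.nonNegative p}} y {{ℚ.nonNegative q}}}}

*-monoˡ : ∀ {c x y} → 0ℚ ≤q c → x ≤q y → c * x ≤q c * y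
*-monoˡ {c} p = ℚₚ.*-monoˡ-≤-nonNeg c {{ℚ.nonNegative p}}

≤-by : ∀ {x y} d → 0ℚ ≤q d → x + d ≡ y → x ≤q y
≤-by {x} d p refl = subst (_≤q x + d) (ℚₚ.+-identityʳ x) (ℚₚ.+-monoʳ-≤ x p)

x≤y⇒0≤y-x : ∀ {x y} → x ≤q y → 0ℚ ≤q y - x
x≤y⇒0≤y-x {x} {y} p = subst (_≤q y - x) (ℚₚ.+-inverseʳ x) (ℚₚ.+-monoˡ-≤ (- x) p)

0≤y-x⇒x≤y : ∀ {x y} → 0ℚ ≤q y - x → x ≤q y
0≤y-x⇒x≤y {x} {y} p = ≤-by (y - x) p (lem x y)
  where
  lem : ∀ x y → x + (y - x) ≡ y
  lem = solve-∀ ℚ-ring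

x-y≡0⇒x≡y : ∀ {x y} → x - y ≡ 0ℚ → x ≡ y
x-y≡0⇒x≡y {x} {y} p = trans (lem x y) (trans (cong (_+ y) p) (ℚₚ.+-identityˡ y))
  where
  lem : ∀ x y → x ≡ (x - y) + y
  lem = solve-∀ ℚ-ring

neg-nonpos : ∀ {x} → x ≤q 0ℚ → 0ℚ ≤q - x
neg-nonpos = ℚₚ.neg-antimono-≤

≤∧≢⇒< : ∀ {x y : ℚ} → x ≤q y → x ≢ y → x < y
≤∧≢⇒< p q = ℚₚ.≰⇒> (λ r → q (ℚₚ.≤-antisym p r))

nonneg-sum-zeroˡ : ∀ {x y} → 0ℚ ≤q x → 0ℚ ≤q y → x + y ≡ 0ℚ → x ≡ 0ℚ
nonneg-sum-zeroˡ {x} {y} p q e =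
  ℚₚ.≤-antisym (≤-by y q e) p

nonneg-sum-zeroʳ : ∀ {x y} → 0ℚ ≤q x → 0ℚ ≤q y → x + y ≡ 0ℚ → y ≡ 0ℚ
nonneg-sum-zeroʳ {x} {y} p q e = nonneg-sum-zeroˡ q p (trans (ℚₚ.+-comm y x) e)

-- Integers inside ℚ

toQ : ℤ → ℚ
toQ z = z ℚ./ 1

private
  toQᵘ : ∀ z → ℚ.toℚᵘ (toQ z) ℚᵘ.≃ ℚᵘ.mkℚᵘ z 0
  toQᵘ z = ℚₚ.toℚᵘ-fromℚᵘ (ℚᵘ.mkℚᵘ z 0)

toQ-+ : ∀ a b → toQ (a ℤ.+ b) ≡ toQ a + toQ b
toQ-+ a b = ℚₚ.toℚᵘ-injective
  (ℚᵘₚ.≃-trans (toQᵘ (a ℤ.+ b))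
  (ℚᵘₚ.≃-trans (ℚᵘ.*≡* (cong (ℤ._* ℤ.+ 1) (sym (cong₂ ℤ._+_ (ℤₚ.*-identityʳ a) (ℤₚ.*-identityʳ b)))))
  (ℚᵘₚ.≃-sym (ℚᵘₚ.≃-trans (ℚₚ.toℚᵘ-homo-+ (toQ a) (toQ b)) (ℚᵘₚ.+-cong (toQᵘ a) (toQᵘ b))))))

toQ-neg : ∀ a → toQ (ℤ.- a) ≡ - toQ a
toQ-neg a = ℚₚ.toℚᵘ-injective
  (ℚᵘₚ.≃-trans (toQᵘ (ℤ.- a))
  (ℚᵘₚ.≃-sym (ℚᵘₚ.≃-trans (ℚₚ.toℚᵘ-homo‿- (toQ a)) (ℚᵘₚ.-‿cong (toQᵘ a)))))

toQ-- : ∀ a b → toQ (a ℤ.- b) ≡ toQ a - toQ b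
toQ-- a b = trans (toQ-+ a (ℤ.- b)) (cong (toQ a +_) (toQ-neg b))

toQ-injective : ∀ {a b} → toQ a ≡ toQ b → a ≡ b
toQ-injective {a} {b} e = trans (sym (ℤₚ.*-identityʳ a)) (trans
  (ℚᵘₚ.drop-*≡* (ℚᵘₚ.≃-trans (ℚᵘₚ.≃-sym (toQᵘ a)) (ℚᵘₚ.≃-trans (ℚₚ.toℚᵘ-cong e) (toQᵘ b))))
  (ℤₚ.*-identityʳ b))

toQ-nonneg : ∀ n → 0ℚ ≤q toQ (ℤ.+ n)
toQ-nonneg n = ℚₚ.nonNegative⁻¹ (toQ (ℤ.+ n)) {{ℚₚ.normalize-nonNeg n 1}}

-- Indicators and Kronecker deltas

ind : Bool → ℚ
ind true  = 1ℚ
ind false = 0ℚ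

ind-nonneg : ∀ b → 0ℚ ≤q ind b
ind-nonneg true  = 0≤1
ind-nonneg false = ℚₚ.≤-refl

ind≤1 : ∀ b → ind b ≤q 1ℚ
ind≤1 true  = ℚₚ.≤-refl
ind≤1 false = 0≤1

ind-not : ∀ b → ind (not b) ≡ 1ℚ - ind b
ind-not true  = refl
ind-not false = refl

ind-injective : ∀ {a b} → ind a ≡ ind b → a ≡ b
ind-injective {true}  {true}  _ = refl
ind-injective {false} {false} _ = refl

_==_ : ∀ {n} → Fin n → Fin n → Bool
p == q = ⌊ p Fin.≟ q ⌋

==-refl : ∀ {n} (p : Fin n) → (p == p) ≡ true
==-refl p with p Fin.≟ p
... | yes _ = refl
... | no ¬e = contradiction refl ¬e

==-≢ : ∀ {n} {p q : Fin n} → p ≢ q → (p == q) ≡ false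
==-≢ {p = p} {q} ne with p Fin.≟ q
... | yes e = contradiction e ne
... | no _  = refl

==-true : ∀ {n} {p q : Fin n} → (p == q) ≡ true → p ≡ q
==-true {p = p} {q} h with p Fin.≟ q
... | yes e = e

δ : ∀ {n} → Fin n → Fin n → ℚ
δ p q = ind (p == q)

δ-refl : ∀ {n} (p : Fin n) → δ p p ≡ 1ℚ
δ-refl p = cong ind (==-refl p)

δ-≢ : ∀ {n} {p q : Fin n} → p ≢ q → δ p q ≡ 0ℚ
δ-≢ ne = cong ind (==-≢ ne)

δ-iff : ∀ {n m} {p q : Fin n} {p' q' : Fin m} → (p ≡ q → p' ≡ q') → (p' ≡ q' → p ≡ q) → δ p q ≡ δ p' q'
δ-iff {p = p} {q} {p'} {q'} f g with p Fin.≟ q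
... | yes e = sym (trans (cong (δ p') (sym (f e))) (δ-refl p'))
... | no ne = sym (δ-≢ (ne ∘ g))

δ-sym : ∀ {n} (p q : Fin n) → δ p q ≡ δ q p
δ-sym p q = δ-iff {p = p} {q} {q} {p} sym sym

-- Finite sums

sum-cong : ∀ {k} {f g : Fin k → ℚ} → (∀ j → f j ≡ g j) → sumℚ f ≡ sumℚ g
sum-cong {zero}  h = refl
sum-cong {suc k} h = cong₂ _+_ (h zero) (sum-cong (h ∘ suc))

sum-zero : ∀ {k} {f : Fin k → ℚ} → (∀ j → f j ≡ 0ℚ) → sumℚ f ≡ 0ℚ
sum-zero {zero}  h = refl
sum-zero {suc k} h = trans (cong₂ _+_ (h zero) (sum-zero (h ∘ suc))) (ℚₚ.+-identityˡ 0ℚ)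

sum-+ : ∀ {k} (f g : Fin k → ℚ) → sumℚ (λ j → f j + g j) ≡ sumℚ f + sumℚ g
sum-+ {zero}  f g = refl
sum-+ {suc k} f g = trans (cong (f zero + g zero +_) (sum-+ (f ∘ suc) (g ∘ suc)))
  (lem (f zero) (g zero) (sumℚ (f ∘ suc)) (sumℚ (g ∘ suc)))
  where
  lem : ∀ a b c d → a + b + (c + d) ≡ (a + c) + (b + d)
  lem = solve-∀ ℚ-ring

sum-* : ∀ {k} c (f : Fin k → ℚ) → sumℚ (λ j → c * f j) ≡ c * sumℚ f
sum-* {zero}  c f = sym (ℚₚ.*-zeroʳ c)
sum-* {suc k} c f = trans (cong (c * f zero +_) (sum-* c (f ∘ suc))) (sym (ℚₚ.*-distribˡ-+ c _ _))

sum-*ʳ : ∀ {k} (f : Fin k → ℚ) c → sumℚ (λ j → f j * c) ≡ sumℚ f * c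
sum-*ʳ f c = trans (sum-cong (λ j → ℚₚ.*-comm (f j) c)) (trans (sum-* c f) (ℚₚ.*-comm c _))

sum-neg : ∀ {k} (f : Fin k → ℚ) → sumℚ (λ j → - f j) ≡ - sumℚ f
sum-neg f = trans (sum-cong (λ j → lem (f j))) (trans (sum-* (- 1ℚ) f) (sym (lem (sumℚ f))))
  where
  lem : ∀ a → - a ≡ (- 1ℚ) * a
  lem = solve-∀ ℚ-ring

sum-- : ∀ {k} (f g : Fin k → ℚ) → sumℚ (λ j → f j - g j) ≡ sumℚ f - sumℚ g
sum-- f g = trans (sum-+ f (λ j → - g j)) (cong (sumℚ f +_) (sum-neg g))

sum-swap : ∀ {k l} (f : Fin k → Fin l → ℚ) →
  sumℚ (λ i → sumℚ (f i)) ≡ sumℚ (λ j → sumℚ (λ i → f i j))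
sum-swap {zero}  f = sym (sum-zero {f = λ j → sumℚ {zero} (λ i → f i j)} (λ _ → refl))
sum-swap {suc k} f = trans (cong (sumℚ (f zero) +_) (sum-swap (f ∘ suc)))
  (sym (sum-+ (f zero) (λ j → sumℚ (λ i → f (suc i) j))))

sum-nonneg : ∀ {k} {f : Fin k → ℚ} → (∀ j → 0ℚ ≤q f j) → 0ℚ ≤q sumℚ f
sum-nonneg {zero}  h = ℚₚ.≤-refl
sum-nonneg {suc k} h = +-nonneg (h zero) (sum-nonneg (h ∘ suc))

sum-mono : ∀ {k} {f g : Fin k → ℚ} → (∀ j → f j ≤q g j) → sumℚ f ≤q sumℚ g
sum-mono {zero}  h = ℚₚ.≤-refl
sum-mono {suc k} h = ℚₚ.+-mono-≤ (h zero) (sum-mono (h ∘ suc))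

sum-nonneg-zero : ∀ {k} {f : Fin k → ℚ} → (∀ j → 0ℚ ≤q f j) → sumℚ f ≡ 0ℚ → ∀ j → f j ≡ 0ℚ
sum-nonneg-zero {suc k} h e zero    = nonneg-sum-zeroˡ (h zero) (sum-nonneg (h ∘ suc)) e
sum-nonneg-zero {suc k} h e (suc j) =
  sum-nonneg-zero (h ∘ suc) (nonneg-sum-zeroʳ (h zero) (sum-nonneg (h ∘ suc)) e) j

sum-≤-≡ : ∀ {k} {f g : Fin k → ℚ} → (∀ j → f j ≤q g j) → sumℚ f ≡ sumℚ g → ∀ j → f j ≡ g j
sum-≤-≡ {f = f} {g} h e j = sym (x-y≡0⇒x≡y (sum-nonneg-zero (λ i → x≤y⇒0≤y-x (h i))
  (trans (sum-- g f) (trans (cong (λ z → sumℚ g - z) e) (ℚₚ.+-inverseʳ (sumℚ g)))) j))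

δ-suc : ∀ {n} (p q : Fin n) → δ (suc p) (suc q) ≡ δ p q
δ-suc p q = δ-iff {p = suc p} {suc q} {p} {q} Finₚ.suc-injective (cong suc)

sum-δ : ∀ {k} (p : Fin k) (f : Fin k → ℚ) → sumℚ (λ q → δ p q * f q) ≡ f p
sum-δ {suc k} zero f = trans (cong₂ _+_ (ℚₚ.*-identityˡ (f zero)) (sum-zero (λ j → ℚₚ.*-zeroˡ (f (suc j)))))
  (ℚₚ.+-identityʳ (f zero))
sum-δ {suc k} (suc p) f = trans (cong₂ _+_ (ℚₚ.*-zeroˡ (f zero))
    (trans (sum-cong (λ j → cong (_* f (suc j)) (δ-suc p j))) (sum-δ p (f ∘ suc))))
  (ℚₚ.+-identityˡ (f (suc p)))

sum-δ′ : ∀ {k} (p : Fin k) (f : Fin k → ℚ) → sumℚ (λ q → δ q p * f q) ≡ f p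
sum-δ′ p f = trans (sum-cong (λ q → cong (_* f q) (δ-sym q p))) (sum-δ p f)

sum-δ1 : ∀ {k} (p : Fin k) → sumℚ (λ q → δ p q) ≡ 1ℚ
sum-δ1 p = trans (sum-cong (λ q → sym (ℚₚ.*-identityʳ (δ p q)))) (sum-δ p (λ _ → 1ℚ))

-- Each term is expanded over `δ` and the two sums are swapped, so only the two inverse laws are
-- used.
sum-reindex : ∀ {k} (g h : Fin k → Fin k) → (∀ r → h (g r) ≡ r) → (∀ r → g (h r) ≡ r) →
  ∀ (f : Fin k → ℚ) → sumℚ (f ∘ g) ≡ sumℚ f
sum-reindex g h hg gh f = begin
  sumℚ (f ∘ g)                                ≡⟨ sum-cong (λ r → sym (sum-δ (g r) f)) ⟩
  sumℚ (λ r → sumℚ (λ s → δ (g r) s * f s))   ≡⟨ sum-swap (λ r s → δ (g r) s * f s) ⟩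
  sumℚ (λ s → sumℚ (λ r → δ (g r) s * f s))   ≡⟨ sum-cong (λ s → sum-*ʳ (λ r → δ (g r) s) (f s)) ⟩
  sumℚ (λ s → sumℚ (λ r → δ (g r) s) * f s)   ≡⟨ sum-cong (λ s → cong (_* f s) (trans (sum-cong (λ r →
      δ-iff {p = g r} {s} {h s} {r} (λ e → trans (cong h (sym e)) (hg r)) (λ e → trans (cong g (sym e)) (gh s))))
      (sum-δ1 (h s)))) ⟩
  sumℚ (λ s → 1ℚ * f s)                       ≡⟨ sum-cong (λ s → ℚₚ.*-identityˡ (f s)) ⟩
  sumℚ f                                      ∎
  where open ≡-Reasoning

sumV-at : ∀ {m k} (f : Fin k → V m) i → sumV f i ≡ sumℚ (λ j → f j i)
sumV-at {k = zero}  f i = refl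
sumV-at {k = suc k} f i = cong (f zero i +_) (sumV-at (f ∘ suc) i)

any-nonzero? : ∀ {k} (f : Fin k → ℚ) → (∃ λ j → f j ≢ 0ℚ) ⊎ (∀ j → f j ≡ 0ℚ)
any-nonzero? f with Finₚ.any? (λ j → ¬? (f j ℚₚ.≟ 0ℚ))
... | yes p = inj₁ p
... | no ¬p = inj₂ λ j → case f j ℚₚ.≟ 0ℚ of λ where
  (yes e) → e
  (no ne) → contradiction (j , ne) ¬p

-- Vectors and the inner product

≐-refl : ∀ {m} {u : V m} → u ≐ u
≐-refl k = refl

≐-sym : ∀ {m} {u v : V m} → u ≐ v → v ≐ u
≐-sym h k = sym (h k)

≐-trans : ∀ {m} {u v w : V m} → u ≐ v → v ≐ w → u ≐ w
≐-trans h g k = trans (h k) (g k)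

-v-cong : ∀ {m} {u u' v v' : V m} → u ≐ u' → v ≐ v' → (u -v v) ≐ (u' -v v')
-v-cong h g k = cong₂ _-_ (h k) (g k)

negv-cong : ∀ {m} {u u' : V m} → u ≐ u' → (-v u) ≐ (-v u')
negv-cong h k = cong -_ (h k)

·v-cong : ∀ {m} {c d} {u v : V m} → c ≡ d → u ≐ v → (c ·v u) ≐ (d ·v v)
·v-cong h g k = cong₂ _*_ h (g k)

neg-sub : ∀ {m} (u v : V m) → (-v (u -v v)) ≐ (v -v u)
neg-sub u v k = lem (u k) (v k)
  where
  lem : ∀ a b → - (a - b) ≡ b - a
  lem = solve-∀ ℚ-ring

_≐?_ : ∀ {m} (u v : V m) → Dec (u ≐ v)
u ≐? v = Finₚ.all? (λ k → u k ℚₚ.≟ v k)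

ip-cong : ∀ {m} {u u' v v' : V m} → u ≐ u' → v ≐ v' → ⟨ u , v ⟩ ≡ ⟨ u' , v' ⟩
ip-cong h g = sum-cong (λ k → cong₂ _*_ (h k) (g k))

ip-comm : ∀ {m} (u v : V m) → ⟨ u , v ⟩ ≡ ⟨ v , u ⟩
ip-comm u v = sum-cong (λ k → ℚₚ.*-comm (u k) (v k))

ip-+ˡ : ∀ {m} (u v w : V m) → ⟨ u +v v , w ⟩ ≡ ⟨ u , w ⟩ + ⟨ v , w ⟩
ip-+ˡ u v w = trans (sum-cong (λ k → ℚₚ.*-distribʳ-+ (w k) (u k) (v k))) (sum-+ (λ k → u k * w k) (λ k → v k * w k))

ip-·ˡ : ∀ {m} c (u w : V m) → ⟨ c ·v u , w ⟩ ≡ c * ⟨ u , w ⟩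
ip-·ˡ c u w = trans (sum-cong (λ k → ℚₚ.*-assoc c (u k) (w k))) (sum-* c (λ k → u k * w k))

ip-negˡ : ∀ {m} (u w : V m) → ⟨ -v u , w ⟩ ≡ - ⟨ u , w ⟩
ip-negˡ u w = trans (sum-cong (λ k → sym (ℚₚ.neg-distribˡ-* (u k) (w k)))) (sum-neg (λ k → u k * w k))

ip--ˡ : ∀ {m} (u v w : V m) → ⟨ u -v v , w ⟩ ≡ ⟨ u , w ⟩ - ⟨ v , w ⟩
ip--ˡ u v w = trans (ip-+ˡ u (-v v) w) (cong (⟨ u , w ⟩ +_) (ip-negˡ v w))

ip--ʳ : ∀ {m} (u v w : V m) → ⟨ w , u -v v ⟩ ≡ ⟨ w , u ⟩ - ⟨ w , v ⟩
ip--ʳ u v w = trans (ip-comm w (u -v v)) (trans (ip--ˡ u v w) (cong₂ _-_ (ip-comm u w) (ip-comm v w)))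

ip-·ʳ : ∀ {m} c (u w : V m) → ⟨ w , c ·v u ⟩ ≡ c * ⟨ w , u ⟩
ip-·ʳ c u w = trans (ip-comm w (c ·v u)) (trans (ip-·ˡ c u w) (cong (c *_) (ip-comm u w)))

ip-negʳ : ∀ {m} (u w : V m) → ⟨ w , -v u ⟩ ≡ - ⟨ w , u ⟩
ip-negʳ u w = trans (ip-comm w (-v u)) (trans (ip-negˡ u w) (cong -_ (ip-comm u w)))

-- Linear forms, linear maps and nonnegative combinations

record LinearForm {m} (φ : V m → ℚ) : Set where
  field
    form-cong : ∀ {u v} → u ≐ v → φ u ≡ φ v
    form-+    : ∀ u v → φ (u +v v) ≡ φ u + φ v
    form-·    : ∀ c u → φ (c ·v u) ≡ c * φ u

  form-0 : ∀ {u} → u ≐ 0v → φ u ≡ 0ℚ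
  form-0 {u} h = trans (form-cong {u} {0ℚ ·v u} (λ k → trans (h k) (sym (ℚₚ.*-zeroˡ (u k)))))
    (trans (form-· 0ℚ u) (ℚₚ.*-zeroˡ (φ u)))

  form-neg : ∀ u → φ (-v u) ≡ - φ u
  form-neg u = trans (form-cong {v = (- 1ℚ) ·v u} (λ k → lem (u k))) (trans (form-· (- 1ℚ) u) (sym (lem (φ u))))
    where
    lem : ∀ a → - a ≡ (- 1ℚ) * a
    lem = solve-∀ ℚ-ring

  form-- : ∀ u v → φ (u -v v) ≡ φ u - φ v
  form-- u v = trans (form-+ u (-v v)) (cong (φ u +_) (form-neg v))

  form-sum : ∀ {k} (c : Fin k → ℚ) (f : Fin k → V m) →
    φ (sumV (λ j → c j ·v f j)) ≡ sumℚ (λ j → c j * φ (f j))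
  form-sum {zero}  c f = form-0 ≐-refl
  form-sum {suc k} c f = trans (form-+ (c zero ·v f zero) (sumV (λ j → c (suc j) ·v f (suc j))))
    (cong₂ _+_ (form-· (c zero) (f zero)) (form-sum (c ∘ suc) (f ∘ suc)))

neg-form : ∀ {m} {φ : V m → ℚ} → LinearForm φ → LinearForm (λ x → - φ x)
neg-form {φ = φ} L = record
  { form-cong = λ h → cong -_ (form-cong h)
  ; form-+ = λ u v → trans (cong -_ (form-+ u v)) (ℚₚ.neg-distrib-+ (φ u) (φ v))
  ; form-· = λ c u → trans (cong -_ (form-· c u)) (ℚₚ.neg-distribʳ-* c (φ u)) }
  where open LinearForm L

ip-form : ∀ {m} (w : V m) → LinearForm (λ x → ⟨ x , w ⟩)
ip-form w = record
  { form-cong = λ h → ip-cong h (≐-refl {u = w})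
  ; form-+ = λ u v → ip-+ˡ u v w
  ; form-· = λ c u → ip-·ˡ c u w }

sum-form : ∀ {m k} {φ : Fin k → V m → ℚ} → (∀ r → LinearForm (φ r)) → LinearForm (λ x → sumℚ (λ r → φ r x))
sum-form {φ = φ} L = record
  { form-cong = λ h → sum-cong (λ r → LinearForm.form-cong (L r) h)
  ; form-+ = λ u v → trans (sum-cong (λ r → LinearForm.form-+ (L r) u v)) (sum-+ (λ r → φ r u) (λ r → φ r v))
  ; form-· = λ c u → trans (sum-cong (λ r → LinearForm.form-· (L r) c u)) (sum-* c (λ r → φ r u)) }

scale-form : ∀ {m} {φ : V m → ℚ} c → LinearForm φ → LinearForm (λ x → c * φ x)
scale-form {φ = φ} c L = record
  { form-cong = λ h → cong (c *_) (form-cong h)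
  ; form-+ = λ u v → trans (cong (c *_) (form-+ u v)) (ℚₚ.*-distribˡ-+ c (φ u) (φ v))
  ; form-· = λ d u → trans (cong (c *_) (form-· d u)) (lem c d (φ u)) }
  where
  open LinearForm L
  lem : ∀ a b c → a * (b * c) ≡ b * (a * c)
  lem = solve-∀ ℚ-ring

record LinearMap {m} (f : V m → V m) : Set where
  field
    map-cong : ∀ {u v} → u ≐ v → f u ≐ f v
    map-+    : ∀ u v → f (u +v v) ≐ (f u +v f v)
    map-·    : ∀ c u → f (c ·v u) ≐ (c ·v f u)

  map-0 : ∀ {u} → u ≐ 0v → f u ≐ 0v
  map-0 {u} h k = trans (map-cong {u} {0ℚ ·v u} (λ k → trans (h k) (sym (ℚₚ.*-zeroˡ (u k)))) k)
    (trans (map-· 0ℚ u k) (ℚₚ.*-zeroˡ (f u k)))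

  map-neg : ∀ u → f (-v u) ≐ (-v f u)
  map-neg u k = trans (map-cong {v = (- 1ℚ) ·v u} (λ k → lem (u k)) k) (trans (map-· (- 1ℚ) u k) (sym (lem (f u k))))
    where
    lem : ∀ a → - a ≡ (- 1ℚ) * a
    lem = solve-∀ ℚ-ring

  map-- : ∀ u v → f (u -v v) ≐ (f u -v f v)
  map-- u v k = trans (map-+ u (-v v) k) (cong (f u k +_) (map-neg v k))

-- Nonnegative combinations of total weight `s` of vectors satisfying `P`. The generators are given
-- by a predicate and not by an indexed family, so that combinations can be moved along linear maps
-- and between vertex sets; weight and value enter through equations, so that they can be replaced
-- by equal ones.
data Comb {m} (P : V m → Set) : ℚ → V m → Set where
  nil  : ∀ {x} → x ≐ 0v → Comb P 0ℚ x
  cons : ∀ {c v s y t x} → 0ℚ ≤q c → P v → Comb P s y → t ≡ c + s → x ≐ ((c ·v v) +v y) → Comb P t x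

module _ {m} {P : V m → Set} where

  Comb-resp : ∀ {s t x y} → s ≡ t → x ≐ y → Comb P s x → Comb P t y
  Comb-resp refl h (nil e) = nil (λ k → trans (sym (h k)) (e k))
  Comb-resp refl h (cons p q r s e) = cons p q r s (λ k → trans (sym (h k)) (e k))

  Comb-+ : ∀ {s t x y} → Comb P s x → Comb P t y → Comb P (s + t) (x +v y)
  Comb-+ {y = y} (nil e) b = Comb-resp (sym (ℚₚ.+-identityˡ _))
    (λ k → sym (trans (cong (_+ y k) (e k)) (ℚₚ.+-identityˡ (y k)))) b
  Comb-+ {t = t} {y = y} (cons {c} {v} {s} {y'} p q r e h) b = cons p q (Comb-+ r b)
    (trans (cong (_+ t) e) (ℚₚ.+-assoc c s t))
    (λ k → trans (cong (_+ y k) (h k)) (ℚₚ.+-assoc (c * v k) (y' k) (y k)))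

  Comb-single : ∀ {c v} → 0ℚ ≤q c → P v → Comb P c (c ·v v)
  Comb-single {c} {v} p q = cons p q (nil ≐-refl) (sym (ℚₚ.+-identityʳ c)) (λ k → sym (ℚₚ.+-identityʳ (c * v k)))

  Comb-weight : ∀ {c v} → 0ℚ ≤q c → (c ≢ 0ℚ → P v) → Comb P c (c ·v v)
  Comb-weight {c} {v} p q with c ℚₚ.≟ 0ℚ
  ... | yes refl = nil (λ k → ℚₚ.*-zeroˡ (v k))
  ... | no ne    = Comb-single p (q ne)

  Comb-sum : ∀ {k} (s : Fin k → ℚ) (f : Fin k → V m) → (∀ j → Comb P (s j) (f j)) → Comb P (sumℚ s) (sumV f)
  Comb-sum {zero}  s f h = nil ≐-refl
  Comb-sum {suc k} s f h = Comb-+ (h zero) (Comb-sum (s ∘ suc) (f ∘ suc) (h ∘ suc))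

  Comb-fin : ∀ {k} (c : Fin k → ℚ) (f : Fin k → V m) → (∀ j → 0ℚ ≤q c j) → (∀ j → c j ≢ 0ℚ → P (f j)) →
    Comb P (sumℚ c) (sumV (λ j → c j ·v f j))
  Comb-fin c f p q = Comb-sum c (λ j → c j ·v f j) (λ j → Comb-weight (p j) (q j))

  Comb-map : ∀ {Q : V m → Set} {f : V m → V m} → LinearMap f → (∀ {v} → P v → Q (f v)) →
    ∀ {s x} → Comb P s x → Comb Q s (f x)
  Comb-map L h (nil e) = nil (LinearMap.map-0 L e)
  Comb-map {f = f} L h (cons {c} {v} {y = y} p q r e g) = cons p (h q) (Comb-map L h r) e
    (≐-trans (L .LinearMap.map-cong g) (≐-trans (L .LinearMap.map-+ (c ·v v) y)
      (λ k → cong (_+ f y k) (L .LinearMap.map-· c v k))))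

  Comb-mono : ∀ {Q : V m → Set} → (∀ {v} → P v → Q v) → ∀ {s x} → Comb P s x → Comb Q s x
  Comb-mono h (nil e) = nil e
  Comb-mono h (cons p q r e g) = cons p (h q) (Comb-mono h r) e g

  -- Used for the bound on the mass of a point and, through the negated form, for vanishing and
  -- nonnegativity of forms on hulls.
  Comb-bound : ∀ {φ : V m → ℚ} {K} → LinearForm φ → (∀ {v} → P v → φ v ≤q K) →
    ∀ {s x} → Comb P s x → φ x ≤q s * K
  Comb-bound {K = K} L h (nil e) = ℚₚ.≤-reflexive (trans (LinearForm.form-0 L e) (sym (ℚₚ.*-zeroˡ K)))
  Comb-bound {φ} {K} L h {s = t} {x} (cons {c} {v} {s} {y} p q r e g) = begin
    φ x                  ≡⟨ form-cong g ⟩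
    φ ((c ·v v) +v y)    ≡⟨ form-+ (c ·v v) y ⟩
    φ (c ·v v) + φ y     ≡⟨ cong (_+ φ y) (form-· c v) ⟩
    c * φ v + φ y        ≤⟨ ℚₚ.+-mono-≤ (*-monoˡ p (h q)) (Comb-bound L h r) ⟩
    c * K + s * K        ≡⟨ ℚₚ.*-distribʳ-+ K c s ⟨
    (c + s) * K          ≡⟨ cong (_* K) e ⟨
    t * K                ∎
    where
    open ℚₚ.≤-Reasoning
    open LinearForm L

  -- Different terms may be sent to the same index, so each term adds its weight to the coefficient
  -- already collected there.
  Comb-coeffs : ∀ {k} (f : Fin k → V m) (S : Fin k → Set) → (∀ {v} → P v → ∃ λ j → S j × v ≐ f j) →
    ∀ {s x} → Comb P s x → Σ (Fin k → ℚ) λ c →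
      (∀ j → 0ℚ ≤q c j) × (∀ j → c j ≢ 0ℚ → S j) × (sumℚ c ≡ s) × (sumV (λ j → c j ·v f j) ≐ x)
  Comb-coeffs {k} f S h (nil e) = (λ _ → 0ℚ) , (λ _ → ℚₚ.≤-refl) , (λ _ ne → contradiction refl ne) ,
    sum-zero {k} (λ _ → refl) , (λ i → trans (sumV-at (λ j → 0ℚ ·v f j) i)
      (trans (sum-zero (λ j → ℚₚ.*-zeroˡ (f j i))) (sym (e i))))
  Comb-coeffs {k} f S h {x = x} (cons {c} {v} {s} {y} p q r refl g) with h q | Comb-coeffs f S h r
  ... | j₀ , Sj₀ , v≐ | d , d≥0 , dS , d≡ , dx =
    (λ j → δ j₀ j * c + d j) ,
    (λ j → +-nonneg (*-nonneg (ind-nonneg (j₀ == j)) p) (d≥0 j)) , supp ,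
    trans (sum-+ (λ j → δ j₀ j * c) d) (cong₂ _+_ (sum-δ j₀ (λ _ → c)) d≡) , vec
    where
    supp : ∀ j → δ j₀ j * c + d j ≢ 0ℚ → S j
    supp j ne with j₀ Fin.≟ j
    ... | yes refl = Sj₀
    ... | no _ = dS j (λ e → ne (trans (cong₂ _+_ (ℚₚ.*-zeroˡ c) e) (ℚₚ.+-identityˡ 0ℚ)))
    lem : ∀ a b d e → (a * b + d) * e ≡ a * (b * e) + d * e
    lem = solve-∀ ℚ-ring
    vec : sumV (λ j → (δ j₀ j * c + d j) ·v f j) ≐ x
    vec i = begin
      sumV (λ j → (δ j₀ j * c + d j) ·v f j) i           ≡⟨ sumV-at (λ j → (δ j₀ j * c + d j) ·v f j) i ⟩
      sumℚ (λ j → (δ j₀ j * c + d j) * f j i)            ≡⟨ sum-cong (λ j → lem (δ j₀ j) c (d j) (f j i)) ⟩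
      sumℚ (λ j → δ j₀ j * (c * f j i) + d j * f j i)    ≡⟨ sum-+ (λ j → δ j₀ j * (c * f j i)) (λ j → d j * f j i) ⟩
      sumℚ (λ j → δ j₀ j * (c * f j i)) + sumℚ (λ j → d j * f j i)
        ≡⟨ cong₂ _+_ (trans (sum-δ j₀ (λ j → c * f j i)) (cong (c *_) (sym (v≐ i))))
                     (trans (sym (sumV-at (λ j → d j ·v f j) i)) (dx i)) ⟩
      c * v i + y i                                      ≡⟨ g i ⟨
      x i                                                ∎
      where open ≡-Reasoning

-- The weight not used by a combination is absorbed by the vertex 0.

Conv₀ : ∀ {m} → (V m → Set) → Region m
Conv₀ P x = ∃ λ s → s ≤q 1ℚ × Comb P s x

Conv₀-mono : ∀ {m} {P Q : V m → Set} → (∀ {v} → P v → Q v) → Conv₀ P ⊆ᵣ Conv₀ Q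
Conv₀-mono h x (s , s≤1 , c) = s , s≤1 , Comb-mono h c

zero-head : ∀ c y → c * 0ℚ + y ≡ y
zero-head = solve-∀ ℚ-ring

module _ {m} (L : List (V m)) (S : Fin (length (0v ∷ L)) → Set) (S0 : S zero) where

  In : V m → Set
  In v = ∃ λ j → S (suc j) × v ≐ lookup L j

  ConvSub⇒Conv₀ : ConvSub (0v ∷ L) S ⊆ᵣ Conv₀ In
  ConvSub⇒Conv₀ x (c , c≥0 , cS , c1 , cx) = sumℚ (c ∘ suc) , ≤-by (c zero) (c≥0 zero) (trans (ℚₚ.+-comm (sumℚ (c ∘ suc)) (c zero)) c1) ,
    Comb-resp refl (λ k → trans (sym (zero-head (c zero) (sumV (λ j → c (suc j) ·v lookup L j) k))) (cx k))
      (Comb-fin (c ∘ suc) (lookup L) (c≥0 ∘ suc) (λ j ne → j , cS (suc j) ne , ≐-refl))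

  Conv₀⇒ConvSub : Conv₀ In ⊆ᵣ ConvSub (0v ∷ L) S
  Conv₀⇒ConvSub x (s , s≤1 , C) with Comb-coeffs (lookup L) (S ∘ suc) id C
  ... | c , c≥0 , cS , cs , cx = c' , c'≥0 , c'S ,
      trans (cong ((1ℚ - s) +_) cs) (lem s) ,
      λ k → trans (zero-head (1ℚ - s) (sumV (λ j → c j ·v lookup L j) k)) (cx k)
    where
    lem : ∀ s → (1ℚ - s) + s ≡ 1ℚ
    lem = solve-∀ ℚ-ring
    c' : Fin (length (0v ∷ L)) → ℚ
    c' zero    = 1ℚ - s
    c' (suc j) = c j
    c'≥0 : ∀ j → 0ℚ ≤q c' j
    c'≥0 zero    = x≤y⇒0≤y-x s≤1
    c'≥0 (suc j) = c≥0 j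
    c'S : ∀ j → c' j ≢ 0ℚ → S j
    c'S zero    _ = S0
    c'S (suc j)   = cS j

<ᵇ-true : ∀ {m n} → m ℕ.< n → (m ℕ.<ᵇ n) ≡ true
<ᵇ-true {zero}  {suc n} _         = refl
<ᵇ-true {suc m} {suc n} (ℕ.s≤s h) = <ᵇ-true h

<ᵇ-false : ∀ {m n} → n ℕ.≤ m → (m ℕ.<ᵇ n) ≡ false
<ᵇ-false {m}     {zero}  _         = refl
<ᵇ-false {suc m} {suc n} (ℕ.s≤s h) = <ᵇ-false h

<ᵇ-true⁻¹ : ∀ {m n} → (m ℕ.<ᵇ n) ≡ true → m ℕ.< n
<ᵇ-true⁻¹ {m} {n} h with m ℕ.<? n
... | yes p = p
... | no ¬p = case trans (sym h) (<ᵇ-false (ℕₚ.≮⇒≥ ¬p)) of λ ()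

<ᵇ-false⁻¹ : ∀ {m n} → (m ℕ.<ᵇ n) ≡ false → n ℕ.≤ m
<ᵇ-false⁻¹ {m} {n} h with m ℕ.<? n
... | yes p = case trans (sym h) (<ᵇ-true p) of λ ()
... | no ¬p = ℕₚ.≮⇒≥ ¬p

-- Prefix sums

prefix : ∀ {M} → (Fin M → ℚ) → ℕ → ℚ
prefix p k = sumℚ (λ r → ind (toℕ r ℕ.<ᵇ k) * p r)

ind-step : ∀ {M} (a : Fin M) (r : Fin M) → ind (toℕ r ℕ.<ᵇ suc (toℕ a)) ≡ ind (toℕ r ℕ.<ᵇ toℕ a) + δ a r
ind-step a r with ℕₚ.<-cmp (toℕ r) (toℕ a)
... | tri< lt ne _ rewrite <ᵇ-true lt | <ᵇ-true (ℕₚ.m<n⇒m<1+n lt) | ==-≢ {p = a} {r} (λ e → ne (cong toℕ (sym e))) = refl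
... | tri≈ _ eq _ rewrite Finₚ.toℕ-injective {i = r} {a} eq | ==-refl a | <ᵇ-true (ℕₚ.n<1+n (toℕ a)) | <ᵇ-false (ℕₚ.≤-refl {toℕ a}) = refl
... | tri> _ ne gt rewrite <ᵇ-false gt | <ᵇ-false (ℕₚ.<⇒≤ gt) | ==-≢ {p = a} {r} (λ e → ne (cong toℕ (sym e))) = refl

prefix-suc : ∀ {M} (p : Fin M → ℚ) (a : Fin M) → prefix p (suc (toℕ a)) ≡ prefix p (toℕ a) + p a
prefix-suc p a = begin
  prefix p (suc (toℕ a))
    ≡⟨ sum-cong (λ r → trans (cong (_* p r) (ind-step a r)) (ℚₚ.*-distribʳ-+ (p r) (ind (toℕ r ℕ.<ᵇ toℕ a)) (δ a r))) ⟩
  sumℚ (λ r → ind (toℕ r ℕ.<ᵇ toℕ a) * p r + δ a r * p r)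
    ≡⟨ sum-+ (λ r → ind (toℕ r ℕ.<ᵇ toℕ a) * p r) (λ r → δ a r * p r) ⟩
  prefix p (toℕ a) + sumℚ (λ r → δ a r * p r)
    ≡⟨ cong (prefix p (toℕ a) +_) (sum-δ a p) ⟩
  prefix p (toℕ a) + p a ∎
  where open ≡-Reasoning

prefix-0 : ∀ {M} (p : Fin M → ℚ) → prefix p 0 ≡ 0ℚ
prefix-0 p = sum-zero (λ r → ℚₚ.*-zeroˡ (p r))

prefix-all : ∀ {M} (p : Fin M → ℚ) → prefix p M ≡ sumℚ p
prefix-all p = sum-cong (λ r → trans (cong (λ b → ind b * p r) (<ᵇ-true (Finₚ.toℕ<n r))) (ℚₚ.*-identityˡ (p r)))

ind-mono : ∀ {a b} → (a ≡ true → b ≡ true) → ind a ≤q ind b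
ind-mono {false} {b} h = ind-nonneg b
ind-mono {true} h rewrite h refl = ℚₚ.≤-refl

prefix-mono : ∀ {M} {p : Fin M → ℚ} → (∀ r → 0ℚ ≤q p r) → ∀ {k l} → k ℕ.≤ l → prefix p k ≤q prefix p l
prefix-mono {p = p} h k≤l = sum-mono (λ r → ℚₚ.*-monoʳ-≤-nonNeg (p r) {{ℚ.nonNegative (h r)}}
  (ind-mono (λ e → <ᵇ-true (ℕₚ.<-≤-trans (<ᵇ-true⁻¹ e) k≤l))))

prefix-nonneg : ∀ {M} {p : Fin M → ℚ} → (∀ r → 0ℚ ≤q p r) → ∀ k → 0ℚ ≤q prefix p k
prefix-nonneg {p = p} h k = sum-nonneg (λ r → *-nonneg (ind-nonneg (toℕ r ℕ.<ᵇ k)) (h r))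

prefix≤sum : ∀ {M} {p : Fin M → ℚ} → (∀ r → 0ℚ ≤q p r) → ∀ k → prefix p k ≤q sumℚ p
prefix≤sum {p = p} h k = sum-mono (λ r → ℚₚ.≤-trans (ℚₚ.*-monoʳ-≤-nonNeg (p r) {{ℚ.nonNegative (h r)}} (ind≤1 (toℕ r ℕ.<ᵇ k)))
  (ℚₚ.≤-reflexive (ℚₚ.*-identityˡ (p r))))

sum-telescope : ∀ M (f : ℕ → ℚ) → sumℚ {M} (λ b → f (suc (toℕ b)) - f (toℕ b)) ≡ f M - f 0
sum-telescope zero    f = sym (ℚₚ.+-inverseʳ (f 0))
sum-telescope (suc M) f = trans (cong (f 1 - f 0 +_) (sum-telescope M (f ∘ suc))) (lem (f 0) (f 1) (f (suc M)))
  where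
  lem : ∀ a b c → b - a + (c - b) ≡ c - a
  lem = solve-∀ ℚ-ring

-- A nonnegative matrix whose support is a chain is determined by its margins

Matrix : ℕ → Set
Matrix M = Fin M → Fin M → ℚ

module _ {M : ℕ} where

  total : Matrix M → ℚ
  total c = sumℚ (λ a → sumℚ (c a))

  rowSum colSum : Matrix M → Fin M → ℚ
  rowSum c a = sumℚ (c a)
  colSum c b = sumℚ (λ a → c a b)

  total-cong : ∀ {c d : Matrix M} → (∀ a b → c a b ≡ d a b) → total c ≡ total d
  total-cong h = sum-cong (λ a → sum-cong (h a))

  total-- : ∀ (c d : Matrix M) → total (λ a b → c a b - d a b) ≡ total c - total d
  total-- c d = trans (sum-cong (λ a → sum-- (c a) (d a))) (sum-- (λ a → sumℚ (c a)) (λ a → sumℚ (d a)))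

  total-zero : ∀ {c : Matrix M} → (∀ a b → c a b ≡ 0ℚ) → total c ≡ 0ℚ
  total-zero h = sum-zero (λ a → sum-zero (h a))

  total-rows : ∀ (i : Fin M → ℚ) (c : Matrix M) → total (λ a b → i a * c a b) ≡ sumℚ (λ a → i a * rowSum c a)
  total-rows i c = sum-cong (λ a → sum-* (i a) (c a))

  total-cols : ∀ (j : Fin M → ℚ) (c : Matrix M) → total (λ a b → j b * c a b) ≡ sumℚ (λ b → j b * colSum c b)
  total-cols j c = trans (sum-swap (λ a b → j b * c a b)) (total-rows j (λ b a → c a b))

  Nonneg : Matrix M → Set
  Nonneg c = ∀ a b → 0ℚ ≤q c a b

  Chain : Matrix M → Set
  Chain c = ∀ a b a' b' → c a b ≢ 0ℚ → c a' b' ≢ 0ℚ → a Fin.< a' → b Fin.≤ b'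

  Alternating : Matrix M → Set
  Alternating c = ∀ a b a' b' → c a b ≢ 0ℚ → c a' b' ≢ 0ℚ → a ≢ b'

  -- `upper` is the mass in the rows before `s` and the columns from `t` on, `lower` that in the
  -- opposite corner.
  upper lower : Matrix M → ℕ → ℕ → ℚ
  upper c s t = total (λ a b → ind (toℕ a ℕ.<ᵇ s) * (1ℚ - ind (toℕ b ℕ.<ᵇ t)) * c a b)
  lower c s t = total (λ a b → (1ℚ - ind (toℕ a ℕ.<ᵇ s)) * ind (toℕ b ℕ.<ᵇ t) * c a b)

  weight-nonneg : ∀ x y {z} → 0ℚ ≤q z → 0ℚ ≤q ind x * (1ℚ - ind y) * z
  weight-nonneg x y h = *-nonneg (*-nonneg (ind-nonneg x) (x≤y⇒0≤y-x (ind≤1 y))) h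

  weight-nonneg′ : ∀ x y {z} → 0ℚ ≤q z → 0ℚ ≤q (1ℚ - ind x) * ind y * z
  weight-nonneg′ x y h = *-nonneg (*-nonneg (x≤y⇒0≤y-x (ind≤1 x)) (ind-nonneg y)) h

  upper-nonneg : ∀ {c} → Nonneg c → ∀ s t → 0ℚ ≤q upper c s t
  upper-nonneg h s t = sum-nonneg {M} (λ a → sum-nonneg {M} (λ b → weight-nonneg (toℕ a ℕ.<ᵇ s) (toℕ b ℕ.<ᵇ t) (h a b)))

  lower-nonneg : ∀ {c} → Nonneg c → ∀ s t → 0ℚ ≤q lower c s t
  lower-nonneg h s t = sum-nonneg {M} (λ a → sum-nonneg {M} (λ b → weight-nonneg′ (toℕ a ℕ.<ᵇ s) (toℕ b ℕ.<ᵇ t) (h a b)))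

  -- The block of rows before `s` and columns before `t` belongs to both marginal sums and cancels,
  -- so the difference is known from the margins alone.
  upper-lower : ∀ c s t → upper c s t - lower c s t ≡
    sumℚ (λ a → ind (toℕ a ℕ.<ᵇ s) * rowSum c a) - sumℚ (λ b → ind (toℕ b ℕ.<ᵇ t) * colSum c b)
  upper-lower c s t = begin
    upper c s t - lower c s t ≡⟨ total-- (λ a b → i a * (1ℚ - j b) * c a b) (λ a b → (1ℚ - i a) * j b * c a b) ⟨
    total (λ a b → i a * (1ℚ - j b) * c a b - (1ℚ - i a) * j b * c a b) ≡⟨ total-cong (λ a b → lem (i a) (j b) (c a b)) ⟩
    total (λ a b → i a * c a b - j b * c a b) ≡⟨ total-- (λ a b → i a * c a b) (λ a b → j b * c a b) ⟩
    total (λ a b → i a * c a b) - total (λ a b → j b * c a b) ≡⟨ cong₂ _-_ (total-rows i c) (total-cols j c) ⟩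
    sumℚ (λ a → i a * rowSum c a) - sumℚ (λ b → j b * colSum c b) ∎
    where
    open ≡-Reasoning
    i : Fin M → ℚ
    i a = ind (toℕ a ℕ.<ᵇ s)
    j : Fin M → ℚ
    j b = ind (toℕ b ℕ.<ᵇ t)
    lem : ∀ x y z → x * (1ℚ - y) * z - (1ℚ - x) * y * z ≡ x * z - y * z
    lem = solve-∀ ℚ-ring

  -- A nonzero entry in the upper corner and one in the lower corner would run in opposite
  -- directions, against the chain condition.
  upper-or-lower : ∀ c → Chain c → ∀ s t → upper c s t ≡ 0ℚ ⊎ lower c s t ≡ 0ℚ
  upper-or-lower c ch s t with Finₚ.any? (λ a → Finₚ.any? (λ b → (toℕ a ℕ.<? s) ×-dec (t ℕ.≤? toℕ b) ×-dec ¬? (c a b ℚₚ.≟ 0ℚ)))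
  ... | yes (a , b , a<s , t≤b , ne) = inj₂ (total-zero zr)
    where
    zr : ∀ a' b' → (1ℚ - ind (toℕ a' ℕ.<ᵇ s)) * ind (toℕ b' ℕ.<ᵇ t) * c a' b' ≡ 0ℚ
    zr a' b' with toℕ a' ℕ.<ᵇ s in e₁ | toℕ b' ℕ.<ᵇ t in e₂
    ... | true  | y     = trans (cong (_* c a' b') (ℚₚ.*-zeroˡ (ind y))) (ℚₚ.*-zeroˡ (c a' b'))
    ... | false | false = ℚₚ.*-zeroˡ (c a' b')
    ... | false | true with c a' b' ℚₚ.≟ 0ℚ
    ...   | yes e = trans (cong (1ℚ *_) e) refl
    ...   | no ne' = contradiction (ℕₚ.<-≤-trans (<ᵇ-true⁻¹ e₂) t≤b)
                       (ℕₚ.≤⇒≯ (ch a b a' b' ne ne' (ℕₚ.<-≤-trans a<s (<ᵇ-false⁻¹ e₁))))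
  ... | no none = inj₁ (total-zero zr)
    where
    zr : ∀ a b → ind (toℕ a ℕ.<ᵇ s) * (1ℚ - ind (toℕ b ℕ.<ᵇ t)) * c a b ≡ 0ℚ
    zr a b with toℕ a ℕ.<ᵇ s in e₁ | toℕ b ℕ.<ᵇ t in e₂
    ... | false | y     = trans (cong (_* c a b) (ℚₚ.*-zeroˡ (1ℚ - ind y))) (ℚₚ.*-zeroˡ (c a b))
    ... | true  | true  = ℚₚ.*-zeroˡ (c a b)
    ... | true  | false with c a b ℚₚ.≟ 0ℚ
    ...   | yes e = trans (cong (1ℚ *_) e) refl
    ...   | no ne = contradiction (a , b , <ᵇ-true⁻¹ e₁ , <ᵇ-false⁻¹ e₂ , ne) none

-- The hypotheses make `r` and `r'` the positive parts of the two equal differences.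
positive-part-unique : ∀ {r l r' l'} → 0ℚ ≤q r → 0ℚ ≤q l → 0ℚ ≤q r' → 0ℚ ≤q l' →
  r ≡ 0ℚ ⊎ l ≡ 0ℚ → r' ≡ 0ℚ ⊎ l' ≡ 0ℚ → r - l ≡ r' - l' → r ≡ r'
positive-part-unique _ _ _ _ (inj₁ refl) (inj₁ refl) e = refl
positive-part-unique {r} {r' = r'} _ _ _ _ (inj₂ refl) (inj₂ refl) e =
  trans (sym (ℚₚ.+-identityʳ r)) (trans e (ℚₚ.+-identityʳ r'))
positive-part-unique {l = l} {r'} hr hl hr' hl' (inj₁ refl) (inj₂ refl) e =
  sym (nonneg-sum-zeroˡ hr' hl (trans (cong (_+ l) (trans (sym (ℚₚ.+-identityʳ r')) (sym e))) (lem l)))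
  where
  lem : ∀ l → 0ℚ - l + l ≡ 0ℚ
  lem = solve-∀ ℚ-ring
positive-part-unique {r} {l' = l'} hr hl hr' hl' (inj₂ refl) (inj₁ refl) e =
  nonneg-sum-zeroˡ hr hl' (trans (cong (_+ l') (trans (sym (ℚₚ.+-identityʳ r)) e)) (lem l'))
  where
  lem : ∀ l → 0ℚ - l + l ≡ 0ℚ
  lem = solve-∀ ℚ-ring

module _ {M : ℕ} (c c' : Matrix M) (c≥0 : Nonneg c) (c'≥0 : Nonneg c') (ch : Chain c) (ch' : Chain c') where

  module _ (rows : ∀ a → rowSum c a ≡ rowSum c' a) (cols : ∀ b → colSum c b ≡ colSum c' b) where

    upper-unique : ∀ s t → upper c s t ≡ upper c' s t
    upper-unique s t = positive-part-unique
      (upper-nonneg c≥0 s t) (lower-nonneg c≥0 s t) (upper-nonneg c'≥0 s t) (lower-nonneg c'≥0 s t)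
      (upper-or-lower c ch s t) (upper-or-lower c' ch' s t)
      (trans (upper-lower c s t) (trans (cong₂ _-_
        (sum-cong (λ a → cong (ind (toℕ a ℕ.<ᵇ s) *_) (rows a)))
        (sum-cong (λ b → cong (ind (toℕ b ℕ.<ᵇ t) *_) (cols b))))
        (sym (upper-lower c' s t))))

    -- The mixed second difference of corner masses isolates a single entry.
    entry-upper : ∀ (d : Matrix M) p q → (upper d (suc (toℕ p)) (toℕ q) - upper d (toℕ p) (toℕ q)) -
      (upper d (suc (toℕ p)) (suc (toℕ q)) - upper d (toℕ p) (suc (toℕ q))) ≡ d p q
    entry-upper d p q = begin
      (upper d (suc P) Q - upper d P Q) - (upper d (suc P) (suc Q) - upper d P (suc Q))
        ≡⟨ cong₂ _-_ (total-- (U (suc P) Q) (U P Q)) (total-- (U (suc P) (suc Q)) (U P (suc Q))) ⟨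
      total (λ a b → U (suc P) Q a b - U P Q a b) - total (λ a b → U (suc P) (suc Q) a b - U P (suc Q) a b)
        ≡⟨ total-- (λ a b → U (suc P) Q a b - U P Q a b) (λ a b → U (suc P) (suc Q) a b - U P (suc Q) a b) ⟨
      total (λ a b → (U (suc P) Q a b - U P Q a b) - (U (suc P) (suc Q) a b - U P (suc Q) a b))
        ≡⟨ total-cong (λ a b → trans (cong₂ (λ u v → (u * (1ℚ - J Q b) * d a b - J P a * (1ℚ - J Q b) * d a b)
             - (u * (1ℚ - v) * d a b - J P a * (1ℚ - v) * d a b)) (ind-step p a) (ind-step q b))
             (lem (J P a) (δ p a) (J Q b) (δ q b) (d a b))) ⟩
      total (λ a b → δ p a * (δ q b * d a b))
        ≡⟨ total-rows (δ p) (λ a b → δ q b * d a b) ⟩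
      sumℚ (λ a → δ p a * sumℚ (λ b → δ q b * d a b))
        ≡⟨ sum-δ p (λ a → sumℚ (λ b → δ q b * d a b)) ⟩
      sumℚ (λ b → δ q b * d p b)
        ≡⟨ sum-δ q (d p) ⟩
      d p q ∎
      where
      open ≡-Reasoning
      P Q : ℕ
      P = toℕ p
      Q = toℕ q
      J : ℕ → Fin M → ℚ
      J s a = ind (toℕ a ℕ.<ᵇ s)
      U : ℕ → ℕ → Matrix M
      U s t a b = J s a * (1ℚ - J t b) * d a b
      lem : ∀ x e y f z → ((x + e) * (1ℚ - y) * z - x * (1ℚ - y) * z) -
        ((x + e) * (1ℚ - (y + f)) * z - x * (1ℚ - (y + f)) * z) ≡ e * (f * z)
      lem = solve-∀ ℚ-ring

    chain-unique : ∀ a b → c a b ≡ c' a b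
    chain-unique a b = trans (sym (entry-upper c a b)) (trans
      (cong₂ _-_ (cong₂ _-_ (upper-unique (suc (toℕ a)) (toℕ b)) (upper-unique (toℕ a) (toℕ b)))
                 (cong₂ _-_ (upper-unique (suc (toℕ a)) (suc (toℕ b))) (upper-unique (toℕ a) (suc (toℕ b)))))
      (entry-upper c' a b))

  -- Alternation makes each position a pure source or a pure sink, so that the divergence determines both margins.
  flow-unique : Alternating c → Alternating c' →
    (∀ r → rowSum c r - colSum c r ≡ rowSum c' r - colSum c' r) → ∀ a b → c a b ≡ c' a b
  flow-unique al al' div = chain-unique rows cols
    where
    row-or-col : ∀ (d : Matrix M) → Alternating d → ∀ r → rowSum d r ≡ 0ℚ ⊎ colSum d r ≡ 0ℚ
    row-or-col d al r with any-nonzero? (d r)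
    ... | inj₂ z = inj₁ (sum-zero z)
    ... | inj₁ (b , ne) with any-nonzero? (λ a → d a r)
    ...   | inj₂ z = inj₂ (sum-zero z)
    ...   | inj₁ (a , ne') = contradiction refl (al r b a r ne ne')
    rows : ∀ a → rowSum c a ≡ rowSum c' a
    rows r = positive-part-unique (sum-nonneg (c≥0 r)) (sum-nonneg (λ a → c≥0 a r))
      (sum-nonneg (c'≥0 r)) (sum-nonneg (λ a → c'≥0 a r)) (row-or-col c al r) (row-or-col c' al' r) (div r)
    cols : ∀ b → colSum c b ≡ colSum c' b
    cols r = begin
      colSum c r                              ≡⟨ lem (rowSum c r) (colSum c r) ⟩
      rowSum c r - (rowSum c r - colSum c r)  ≡⟨ cong₂ _-_ (rows r) (div r) ⟩
      rowSum c' r - (rowSum c' r - colSum c' r) ≡⟨ lem (rowSum c' r) (colSum c' r) ⟨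
      colSum c' r                             ∎
      where
      open ≡-Reasoning
      lem : ∀ x y → y ≡ x - (x - y)
      lem = solve-∀ ℚ-ring

-- The monotone coupling of two margins of equal mass

module Coupling {M : ℕ} (p q : Fin M → ℚ) (p≥0 : ∀ r → 0ℚ ≤q p r) (q≥0 : ∀ r → 0ℚ ≤q q r) (mass : sumℚ p ≡ sumℚ q) where

  -- For `u ≤ u'` and `v ≤ v'` this is the length of the intersection of the intervals [u, u'] and
  -- [v, v']. The minimum is the joint distribution function of the monotone coupling, and its
  -- second difference is the mass of a rectangle.
  rect : ℚ → ℚ → ℚ → ℚ → ℚ
  rect u u' v v' = (u' ⊓ v' - u ⊓ v') - (u' ⊓ v - u ⊓ v)

  rect-zeroʳ : ∀ {u u' v v'} → u ≤q u' → v ≤q v' → v' ≤q u → rect u u' v v' ≡ 0ℚ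
  rect-zeroʳ {u} {u'} {v} {v'} hu hv h
    rewrite ℚₚ.p≥q⇒p⊓q≡q h | ℚₚ.p≥q⇒p⊓q≡q (ℚₚ.≤-trans h hu)
          | ℚₚ.p≥q⇒p⊓q≡q (ℚₚ.≤-trans hv h) | ℚₚ.p≥q⇒p⊓q≡q (ℚₚ.≤-trans hv (ℚₚ.≤-trans h hu)) = lem v v'
    where
    lem : ∀ v v' → (v' - v') - (v - v) ≡ 0ℚ
    lem = solve-∀ ℚ-ring

  rect-zeroˡ : ∀ {u u' v v'} → u ≤q u' → v ≤q v' → u' ≤q v → rect u u' v v' ≡ 0ℚ
  rect-zeroˡ {u} {u'} {v} {v'} hu hv h
    rewrite ℚₚ.p≤q⇒p⊓q≡p h | ℚₚ.p≤q⇒p⊓q≡p (ℚₚ.≤-trans h hv)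
          | ℚₚ.p≤q⇒p⊓q≡p (ℚₚ.≤-trans hu h) | ℚₚ.p≤q⇒p⊓q≡p (ℚₚ.≤-trans hu (ℚₚ.≤-trans h hv)) = lem u u'
    where
    lem : ∀ v v' → (v' - v) - (v' - v) ≡ 0ℚ
    lem = solve-∀ ℚ-ring

  rect-nonneg : ∀ {u u' v v'} → u ≤q u' → v ≤q v' → 0ℚ ≤q rect u u' v v'
  rect-nonneg {u} {u'} {v} {v'} hu hv with ℚₚ.≤-total v' u | ℚₚ.≤-total u' v
  ... | inj₁ h | _ = ℚₚ.≤-reflexive (sym (rect-zeroʳ hu hv h))
  ... | inj₂ _ | inj₁ h = ℚₚ.≤-reflexive (sym (rect-zeroˡ hu hv h))
  ... | inj₂ h | inj₂ g with ℚₚ.≤-total u v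
  ...   | inj₁ f rewrite ℚₚ.p≤q⇒p⊓q≡p f | ℚₚ.p≤q⇒p⊓q≡p h | ℚₚ.p≥q⇒p⊓q≡q g =
          subst (0ℚ ≤q_) (sym (lem u v (u' ⊓ v'))) (x≤y⇒0≤y-x (ℚₚ.⊓-glb g hv))
    where
    lem : ∀ u v w → (w - u) - (v - u) ≡ w - v
    lem = solve-∀ ℚ-ring
  ...   | inj₂ f rewrite ℚₚ.p≥q⇒p⊓q≡q f | ℚₚ.p≤q⇒p⊓q≡p h | ℚₚ.p≥q⇒p⊓q≡q g =
          subst (0ℚ ≤q_) (sym (lem u v (u' ⊓ v'))) (x≤y⇒0≤y-x (ℚₚ.⊓-glb hu h))
    where
    lem : ∀ u v w → (w - u) - (v - v) ≡ w - u
    lem = solve-∀ ℚ-ring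

  P Q : ℕ → ℚ
  P = prefix p
  Q = prefix q

  coupling : Matrix M
  coupling a b = rect (P (toℕ a)) (P (suc (toℕ a))) (Q (toℕ b)) (Q (suc (toℕ b)))

  private
    P-step : ∀ a → P a ≤q P (suc a)
    P-step a = prefix-mono p≥0 (ℕₚ.n≤1+n a)
    Q-step : ∀ a → Q a ≤q Q (suc a)
    Q-step a = prefix-mono q≥0 (ℕₚ.n≤1+n a)

  coupling-nonneg : Nonneg coupling
  coupling-nonneg a b = rect-nonneg (P-step (toℕ a)) (Q-step (toℕ b))

  -- Intervals without common interior carry no common mass. The first inequality will put the pair
  -- into the ideal of the point, the second will keep its inner corner out.
  coupling-support : ∀ a b → coupling a b ≢ 0ℚ → P (toℕ a) < Q (suc (toℕ b)) × Q (toℕ b) < P (suc (toℕ a))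
  coupling-support a b ne =
    ℚₚ.≰⇒> (λ h → ne (rect-zeroʳ (P-step (toℕ a)) (Q-step (toℕ b)) h)) ,
    ℚₚ.≰⇒> (λ h → ne (rect-zeroˡ (P-step (toℕ a)) (Q-step (toℕ b)) h))

  coupling-row : ∀ a → rowSum coupling a ≡ p a
  coupling-row a = begin
    sumℚ (coupling a)     ≡⟨ sum-telescope M f ⟩
    f M - f 0             ≡⟨ cong₂ _-_ (cong₂ _-_ (at-end (suc (toℕ a))) (at-end (toℕ a))) (cong₂ _-_ (at-0 (suc (toℕ a))) (at-0 (toℕ a))) ⟩
    (P (suc (toℕ a)) - P (toℕ a)) - (0ℚ - 0ℚ)  ≡⟨ cong (λ z → (z - P (toℕ a)) - (0ℚ - 0ℚ)) (prefix-suc p a) ⟩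
    (P (toℕ a) + p a - P (toℕ a)) - (0ℚ - 0ℚ)  ≡⟨ lem (P (toℕ a)) (p a) ⟩
    p a                   ∎
    where
    open ≡-Reasoning
    f : ℕ → ℚ
    f t = P (suc (toℕ a)) ⊓ Q t - P (toℕ a) ⊓ Q t
    -- Equality of the two masses makes `Q M` an upper bound of every `P s`.
    at-end : ∀ s → P s ⊓ Q M ≡ P s
    at-end s = ℚₚ.p≤q⇒p⊓q≡p (ℚₚ.≤-trans (prefix≤sum p≥0 s) (ℚₚ.≤-reflexive (trans mass (sym (prefix-all q)))))
    at-0 : ∀ s → P s ⊓ Q 0 ≡ 0ℚ
    at-0 s = trans (cong (P s ⊓_) (prefix-0 q)) (ℚₚ.p≥q⇒p⊓q≡q (prefix-nonneg p≥0 s))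
    lem : ∀ x y → (x + y - x) - (0ℚ - 0ℚ) ≡ y
    lem = solve-∀ ℚ-ring

  coupling-col : ∀ b → colSum coupling b ≡ q b
  coupling-col b = begin
    colSum coupling b     ≡⟨ sum-cong {M} (λ a → lem₀ (P (suc (toℕ a)) ⊓ Q (suc (toℕ b))) (P (toℕ a) ⊓ Q (suc (toℕ b)))
                                                  (P (suc (toℕ a)) ⊓ Q (toℕ b)) (P (toℕ a) ⊓ Q (toℕ b))) ⟩
    sumℚ {M} (λ a → f (suc (toℕ a)) - f (toℕ a)) ≡⟨ sum-telescope M f ⟩
    f M - f 0             ≡⟨ cong₂ _-_ (cong₂ _-_ (at-end (suc (toℕ b))) (at-end (toℕ b))) (cong₂ _-_ (at-0 (suc (toℕ b))) (at-0 (toℕ b))) ⟩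
    (Q (suc (toℕ b)) - Q (toℕ b)) - (0ℚ - 0ℚ)  ≡⟨ cong (λ z → (z - Q (toℕ b)) - (0ℚ - 0ℚ)) (prefix-suc q b) ⟩
    (Q (toℕ b) + q b - Q (toℕ b)) - (0ℚ - 0ℚ)  ≡⟨ lem (Q (toℕ b)) (q b) ⟩
    q b                   ∎
    where
    open ≡-Reasoning
    f : ℕ → ℚ
    f t = P t ⊓ Q (suc (toℕ b)) - P t ⊓ Q (toℕ b)
    at-end : ∀ s → P M ⊓ Q s ≡ Q s
    at-end s = ℚₚ.p≥q⇒p⊓q≡q (ℚₚ.≤-trans (prefix≤sum q≥0 s) (ℚₚ.≤-reflexive (trans (sym mass) (sym (prefix-all p)))))
    at-0 : ∀ s → P 0 ⊓ Q s ≡ 0ℚ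
    at-0 s = trans (cong (_⊓ Q s) (prefix-0 p)) (ℚₚ.p≤q⇒p⊓q≡p (prefix-nonneg q≥0 s))
    lem₀ : ∀ a b c d → (a - b) - (c - d) ≡ (a - c) - (b - d)
    lem₀ = solve-∀ ℚ-ring
    lem : ∀ x y → (x + y - x) - (0ℚ - 0ℚ) ≡ y
    lem = solve-∀ ℚ-ring

-- Simplices with a vertex at 0 and their common faces

≡ᵣ-refl : ∀ {m} {R : Region m} → R ≡ᵣ R
≡ᵣ-refl = (λ _ h → h) , (λ _ h → h)

≡ᵣ-sym : ∀ {m} {R S : Region m} → R ≡ᵣ S → S ≡ᵣ R
≡ᵣ-sym (f , g) = g , f

≡ᵣ-trans : ∀ {m} {R S T : Region m} → R ≡ᵣ S → S ≡ᵣ T → R ≡ᵣ T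
≡ᵣ-trans (f , g) (f' , g') = (λ x h → f' x (f x h)) , (λ x h → g x (g' x h))

∩ᵣ-cong : ∀ {m} {R R' S S' : Region m} → R ≡ᵣ R' → S ≡ᵣ S' → (R ∩ᵣ S) ≡ᵣ (R' ∩ᵣ S')
∩ᵣ-cong (f , g) (f' , g') = (λ x (a , b) → f x a , f' x b) , (λ x (a , b) → g x a , g' x b)

-- Simplices are described by vertex lists, whereas cells are compared as subsets of one family
-- `vec`; `origin` translates between the two.
record Selection {m K} (vec : Fin K → V m) (S : Fin K → Bool) : Set where
  field
    list     : List (V m)
    origin   : Fin (length list) → Fin K
    lookup-≡ : ∀ j → lookup list j ≡ vec (origin j)
    selected : ∀ j → S (origin j) ≡ true
    distinct : ∀ {i j} → origin i ≡ origin j → i ≡ j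
    complete : ∀ k → S k ≡ true → ∃ λ j → origin j ≡ k

select : ∀ {m K} (vec : Fin K → V m) (S : Fin K → Bool) → Selection vec S
select {K = zero} vec S = record
  { list = [] ; origin = λ () ; lookup-≡ = λ () ; selected = λ () ; distinct = λ { {()} } ; complete = λ () }
select {K = suc K} vec S with S zero in e | select (vec ∘ suc) (S ∘ suc)
... | false | r = record
  { list = list ; origin = suc ∘ origin ; lookup-≡ = lookup-≡ ; selected = selected
  ; distinct = distinct ∘ Finₚ.suc-injective
  ; complete = λ { zero h → case trans (sym e) h of λ () ; (suc k) h → let j , q = complete k h in j , cong suc q } }
  where open Selection r
... | true | r = record
  { list = vec zero ∷ list
  ; origin = λ { zero → zero ; (suc j) → suc (origin j) }
  ; lookup-≡ = λ { zero → refl ; (suc j) → lookup-≡ j }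
  ; selected = λ { zero → e ; (suc j) → selected j }
  ; distinct = λ { {zero} {zero} _ → refl ; {suc i} {suc j} q → cong suc (distinct (Finₚ.suc-injective q)) }
  ; complete = λ { zero h → zero , refl ; (suc k) h → let j , q = complete k h in suc j , cong suc q } }
  where open Selection r

0≤⊔0 : ∀ x → 0ℚ ≤q x ⊔ 0ℚ
0≤⊔0 x = ℚₚ.p≤q⊔p x 0ℚ

pos-neg : ∀ x → x ⊔ 0ℚ ≡ x + ((- x) ⊔ 0ℚ)
pos-neg x with ℚₚ.≤-total x 0ℚ
... | inj₁ h = trans (ℚₚ.p≤q⇒p⊔q≡q h) (trans (sym (ℚₚ.+-inverseʳ x)) (cong (x +_) (sym (ℚₚ.p≥q⇒p⊔q≡p (neg-nonpos h)))))
... | inj₂ h = trans (ℚₚ.p≥q⇒p⊔q≡p h) (trans (sym (ℚₚ.+-identityʳ x)) (cong (x +_) (sym (ℚₚ.p≤q⇒p⊔q≡q (ℚₚ.neg-antimono-≤ h)))))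

module Cells {m K : ℕ} (vec : Fin K → V m) where

  Chosen : (Fin K → Bool) → V m → Set
  Chosen S v = ∃ λ k → S k ≡ true × v ≐ vec k

  cell : (Fin K → Bool) → Region m
  cell S = Conv₀ (Chosen S)

  Supp : (Fin K → Bool) → (Fin K → ℚ) → Set
  Supp S c = (∀ k → 0ℚ ≤q c k) × (∀ k → c k ≢ 0ℚ → S k ≡ true)

  -- `unique` compares combinations from two possibly different cells. Applied to one cell it yields
  -- affine independence, applied to two it identifies their intersection.
  module _ (OK : (Fin K → Bool) → Set₁)
    (unique : ∀ {S S'} → OK S → OK S' → ∀ {c c'} → Supp S c → Supp S' c' →
       sumV (λ k → c k ·v vec k) ≐ sumV (λ k → c' k ·v vec k) → ∀ k → c k ≡ c' k) where

    module _ {S : Fin K → Bool} (ok : OK S) where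

      open Selection (select vec S)

      vertices : List (V m)
      vertices = 0v ∷ list

      private
        push : (Fin (length list) → ℚ) → Fin K → ℚ
        push c k = sumℚ (λ j → δ (origin j) k * c j)

        push-supp : ∀ c → (∀ j → 0ℚ ≤q c j) → Supp S (push c)
        push-supp c c≥0 = (λ k → sum-nonneg (λ j → *-nonneg (ind-nonneg (origin j == k)) (c≥0 j))) , supp
          where
          supp : ∀ k → push c k ≢ 0ℚ → S k ≡ true
          supp k ne with any-nonzero? (λ j → δ (origin j) k * c j)
          ... | inj₂ z = contradiction (sum-zero z) ne
          ... | inj₁ (j , nz) with origin j Fin.≟ k
          ...   | yes refl = selected j
          ...   | no _ = contradiction (ℚₚ.*-zeroˡ (c j)) nz

        push-origin : ∀ c j → push c (origin j) ≡ c j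
        push-origin c j = trans (sum-cong (λ i → cong (_* c i)
          (δ-iff {p = origin i} {origin j} {i} {j} distinct (cong origin)))) (sum-δ′ j c)

        push-vec : ∀ c → sumV (λ k → push c k ·v vec k) ≐ sumV (λ j → c j ·v lookup list j)
        push-vec c i = begin
          sumV (λ k → push c k ·v vec k) i
            ≡⟨ sumV-at (λ k → push c k ·v vec k) i ⟩
          sumℚ (λ k → push c k * vec k i)
            ≡⟨ sum-cong (λ k → sum-*ʳ (λ j → δ (origin j) k * c j) (vec k i)) ⟨
          sumℚ (λ k → sumℚ (λ j → δ (origin j) k * c j * vec k i))
            ≡⟨ sum-swap (λ k j → δ (origin j) k * c j * vec k i) ⟩
          sumℚ (λ j → sumℚ (λ k → δ (origin j) k * c j * vec k i))
            ≡⟨ sum-cong (λ j → trans (sum-cong (λ k → ℚₚ.*-assoc (δ (origin j) k) (c j) (vec k i)))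
                 (sum-δ (origin j) (λ k → c j * vec k i))) ⟩
          sumℚ (λ j → c j * vec (origin j) i)
            ≡⟨ sum-cong (λ j → cong (λ v → c j * v i) (lookup-≡ j)) ⟨
          sumℚ (λ j → c j * lookup list j i)
            ≡⟨ sumV-at (λ j → c j ·v lookup list j) i ⟨
          sumV (λ j → c j ·v lookup list j) i ∎
          where open ≡-Reasoning

      -- A vanishing signed combination splits into two nonnegative combinations of the cell with the same value.
      vertices-independent : AffInd vertices
      vertices-independent c c-sum c-vec = all-zero
        where
        d⁺ d⁻ : Fin (length list) → ℚ
        d⁺ j = c (suc j) ⊔ 0ℚ
        d⁻ j = (- c (suc j)) ⊔ 0ℚ
        vec-eq : sumV (λ k → push d⁺ k ·v vec k) ≐ sumV (λ k → push d⁻ k ·v vec k)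
        vec-eq i = begin
          sumV (λ k → push d⁺ k ·v vec k) i          ≡⟨ push-vec d⁺ i ⟩
          sumV (λ j → d⁺ j ·v lookup list j) i       ≡⟨ sumV-at (λ j → d⁺ j ·v lookup list j) i ⟩
          sumℚ (λ j → d⁺ j * lookup list j i)        ≡⟨ sum-cong (λ j → trans (cong (_* lookup list j i) (pos-neg (c (suc j))))
                                                          (ℚₚ.*-distribʳ-+ (lookup list j i) (c (suc j)) (d⁻ j))) ⟩
          sumℚ (λ j → c (suc j) * lookup list j i + d⁻ j * lookup list j i)
            ≡⟨ sum-+ (λ j → c (suc j) * lookup list j i) (λ j → d⁻ j * lookup list j i) ⟩
          sumℚ (λ j → c (suc j) * lookup list j i) + sumℚ (λ j → d⁻ j * lookup list j i)
            ≡⟨ cong₂ _+_ (trans (sym (sumV-at (λ j → c (suc j) ·v lookup list j) i))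
                 (trans (sym (zero-head (c zero) (sumV (λ j → c (suc j) ·v lookup list j) i))) (c-vec i)))
               (trans (sym (sumV-at (λ j → d⁻ j ·v lookup list j) i)) (sym (push-vec d⁻ i))) ⟩
          0ℚ + sumV (λ k → push d⁻ k ·v vec k) i     ≡⟨ ℚₚ.+-identityˡ (sumV (λ k → push d⁻ k ·v vec k) i) ⟩
          sumV (λ k → push d⁻ k ·v vec k) i          ∎
          where open ≡-Reasoning
        pieces : ∀ j → d⁺ j ≡ d⁻ j
        pieces j = trans (sym (push-origin d⁺ j)) (trans
          (unique ok ok (push-supp d⁺ (λ j → 0≤⊔0 (c (suc j)))) (push-supp d⁻ (λ j → 0≤⊔0 (- c (suc j)))) vec-eq (origin j))
          (push-origin d⁻ j))
        tail-zero : ∀ j → c (suc j) ≡ 0ℚ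
        tail-zero j = begin
          c (suc j)                    ≡⟨ lem (c (suc j)) (d⁻ j) ⟩
          (c (suc j) + d⁻ j) - d⁻ j    ≡⟨ cong (_- d⁻ j) (trans (sym (pos-neg (c (suc j)))) (pieces j)) ⟩
          d⁻ j - d⁻ j                  ≡⟨ ℚₚ.+-inverseʳ (d⁻ j) ⟩
          0ℚ                           ∎
          where
          open ≡-Reasoning
          lem : ∀ x y → x ≡ (x + y) - y
          lem = solve-∀ ℚ-ring
        all-zero : ∀ j → c j ≡ 0ℚ
        all-zero zero    = trans (sym (ℚₚ.+-identityʳ (c zero))) (trans (cong (c zero +_) (sym (sum-zero tail-zero))) c-sum)
        all-zero (suc j) = tail-zero j

      -- The vertex 0 is common to all cells, so every face keeps it.
      face : (Fin K → Bool) → Fin (length vertices) → Bool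
      face G zero    = true
      face G (suc j) = G (origin j)

      cell-face : ∀ G → cell (λ k → S k ∧ G k) ≡ᵣ ConvSub vertices (λ j → face G j ≡ true)
      cell-face G = (λ x h → Conv₀⇒ConvSub list _ refl x (Conv₀-mono to x h)) ,
                    (λ x h → Conv₀-mono from x (ConvSub⇒Conv₀ list _ refl x h))
        where
        to : ∀ {v} → Chosen (λ k → S k ∧ G k) v → In list (λ j → face G j ≡ true) refl v
        to (k , h , e) with S k in s | complete k
        ... | true | f with f refl
        ...   | j , refl = j , h , subst (_ ≐_) (sym (lookup-≡ j)) e
        from : ∀ {v} → In list (λ j → face G j ≡ true) refl v → Chosen (λ k → S k ∧ G k) v
        from (j , h , e) = origin j , cong₂ _∧_ (selected j) h , subst (_ ≐_) (lookup-≡ j) e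

      cell-conv : cell S ≡ᵣ Conv vertices
      cell-conv = (λ x h → Conv₀⇒ConvSub list _ tt x (Conv₀-mono to x h)) ,
                  (λ x h → Conv₀-mono from x (ConvSub⇒Conv₀ list _ tt x h))
        where
        to : ∀ {v} → Chosen S v → In list (λ _ → ⊤) tt v
        to (k , h , e) with complete k h
        ... | j , refl = j , tt , subst (_ ≐_) (sym (lookup-≡ j)) e
        from : ∀ {v} → In list (λ _ → ⊤) tt v → Chosen S v
        from (j , _ , e) = origin j , selected j , subst (_ ≐_) (lookup-≡ j) e

    -- The two representations of a common point have equal coefficients, so every vector used by
    -- one of them is available in the other cell as well.
    cell-∩ : ∀ {S S'} → OK S → OK S' → (cell S ∩ᵣ cell S') ≡ᵣ cell (λ k → S k ∧ S' k)
    cell-∩ {S} {S'} ok ok' = to , from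
      where
      to : (cell S ∩ᵣ cell S') ⊆ᵣ cell (λ k → S k ∧ S' k)
      to x ((s , s≤1 , C) , (s' , _ , C')) with Comb-coeffs vec (λ k → S k ≡ true) id C | Comb-coeffs vec (λ k → S' k ≡ true) id C'
      ... | c , c≥0 , cS , c-sum , cx | c' , c'≥0 , c'S , _ , cx' =
        s , s≤1 , Comb-resp c-sum cx (Comb-fin c vec c≥0 (λ k ne →
          k , cong₂ _∧_ (cS k ne) (c'S k (λ z → ne (trans (same k) z))) , ≐-refl))
        where
        same : ∀ k → c k ≡ c' k
        same = unique ok ok' (c≥0 , cS) (c'≥0 , c'S) (≐-trans cx (≐-sym cx'))
      ∧-l : ∀ a {b} → a ∧ b ≡ true → a ≡ true
      ∧-l true _ = refl
      ∧-r : ∀ a {b} → a ∧ b ≡ true → b ≡ true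
      ∧-r true h = h
      from : cell (λ k → S k ∧ S' k) ⊆ᵣ (cell S ∩ᵣ cell S')
      from x h = Conv₀-mono (λ (k , h , e) → k , ∧-l (S k) h , e) x h ,
                 Conv₀-mono (λ (k , h , e) → k , ∧-r (S k) h , e) x h

    cell-comm : ∀ (S S' : Fin K → Bool) → cell (λ k → S k ∧ S' k) ≡ᵣ cell (λ k → S' k ∧ S k)
    cell-comm S S' =
      (λ x → Conv₀-mono {P = Chosen (λ k → S k ∧ S' k)} (λ (k , h , e) → k , trans (Boolₚ.∧-comm (S' k) (S k)) h , e) x) ,
      (λ x → Conv₀-mono {P = Chosen (λ k → S' k ∧ S k)} (λ (k , h , e) → k , trans (Boolₚ.∧-comm (S k) (S' k)) h , e) x)

    module _ {Ix : Set} (reg : Ix → Region m) (S : Ix → Fin K → Bool)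
             (ok : ∀ t → OK (S t)) (eq : ∀ t → reg t ≡ᵣ cell (S t)) where

      cells-simplex : ∀ t → IsSimplex (reg t)
      cells-simplex t = vertices (ok t) , vertices-independent (ok t) , ≡ᵣ-trans (eq t) (cell-conv (ok t))

      cells-meet : ∀ t t' → CommonFace (reg t) (reg t')
      cells-meet t t' =
        vertices (ok t) , vertices-independent (ok t) , ≡ᵣ-trans (eq t) (cell-conv (ok t)) ,
        vertices (ok t') , vertices-independent (ok t') , ≡ᵣ-trans (eq t') (cell-conv (ok t')) ,
        face (ok t) (S t') , face (ok t') (S t) ,
        ≡ᵣ-trans common (cell-face (ok t) (S t')) ,
        ≡ᵣ-trans common (≡ᵣ-trans (cell-comm (S t) (S t')) (cell-face (ok t') (S t)))
        where
        common : (reg t ∩ᵣ reg t') ≡ᵣ cell (λ k → S t k ∧ S t' k)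
        common = ≡ᵣ-trans (∩ᵣ-cong (eq t) (eq t')) (cell-∩ (ok t) (ok t'))

-- Counting and initial segments

count : ∀ {k} → (Fin k → Bool) → ℕ
count {zero}  f = 0
count {suc k} f = (if f zero then 1 else 0) ℕ.+ count (f ∘ suc)

bit-mono : ∀ {a b} → (a ≡ true → b ≡ true) → (if a then 1 else 0) ℕ.≤ (if b then 1 else 0)
bit-mono {false} h = ℕ.z≤n
bit-mono {true} h rewrite h refl = ℕₚ.≤-refl

count-mono : ∀ {k} {f g : Fin k → Bool} → (∀ r → f r ≡ true → g r ≡ true) → count f ℕ.≤ count g
count-mono {zero}  h = ℕ.z≤n
count-mono {suc k} h = ℕₚ.+-mono-≤ (bit-mono (h zero)) (count-mono (h ∘ suc))

count-strict : ∀ {k} {f g : Fin k → Bool} → (∀ r → f r ≡ true → g r ≡ true) →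
  ∀ r → f r ≡ false → g r ≡ true → count f ℕ.< count g
count-strict {suc k} {f} {g} h zero e e' rewrite e | e' = ℕ.s≤s (count-mono (h ∘ suc))
count-strict {suc k} h (suc r) e e' = ℕₚ.+-mono-≤-< (bit-mono (h zero)) (count-strict (h ∘ suc) r e e')

-- Both sets are closed downward, hence nested, and nested sets of equal size coincide.
initial-unique : ∀ {M} h (f : Fin M → Bool) → (∀ p q → p Fin.≤ q → f q ≡ true → f p ≡ true) →
  sumℚ (λ r → ind (f r)) ≡ sumℚ {M} (λ r → ind (toℕ r ℕ.<ᵇ h)) → ∀ r → f r ≡ (toℕ r ℕ.<ᵇ h)
initial-unique {M} h f down e r with f r in er | toℕ r ℕ.<ᵇ h in eh
... | true  | true  = refl
... | false | false = refl
... | true  | false = sym (trans (sym eh) (ind-injective (trans (sum-≤-≡ below (sym e) r) (cong ind er))))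
  where
  below : ∀ s → ind (toℕ s ℕ.<ᵇ h) ≤q ind (f s)
  below s = ind-mono (λ t → down s r (ℕₚ.<⇒≤ (ℕₚ.<-≤-trans (<ᵇ-true⁻¹ t) (<ᵇ-false⁻¹ {toℕ r} {h} eh))) er)
... | false | true = sym (trans (sym eh) (ind-injective (trans (sym (sum-≤-≡ above e r)) (cong ind er))))
  where
  above : ∀ s → ind (f s) ≤q ind (toℕ s ℕ.<ᵇ h)
  above s = ind-mono λ t → case toℕ s ℕ.<? h of λ where
    (yes p) → <ᵇ-true p
    (no ¬p) → case trans (sym er) (down r s (ℕₚ.≤-trans (ℕₚ.<⇒≤ (<ᵇ-true⁻¹ eh)) (ℕₚ.≮⇒≥ ¬p)) t) of λ ()

boundary : ∀ {m} (f : Fin (suc m) → Bool) → f zero ≡ true → f (fromℕ m) ≡ false →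
  ∃ λ (k : Fin m) → f (inject₁ k) ≡ true × f (suc k) ≡ false
boundary {zero}  f e e' = case trans (sym e) e' of λ ()
boundary {suc m} f e e' with f (suc zero) in e₁
... | false = zero , e , e₁
... | true  = let k , a , b = boundary (f ∘ suc) e₁ e' in suc k , a , b

-- Maps that increase on two blocks

module _ {M : ℕ} (h : ℕ) where

  SameBlock : Fin M → Fin M → Set
  SameBlock p q = (toℕ p ℕ.<ᵇ h) ≡ (toℕ q ℕ.<ᵇ h)

  BlockIncreasing : (Fin M → Fin M) → Set
  BlockIncreasing f = ∀ p q → SameBlock p q → p Fin.< q → f p Fin.< f q

  -- Induction on the position: its predecessor lies in the same block, where `f` increases
  -- strictly, or the position opens the second block, whose image stays at `h` or beyond.
  block-inflationary : ∀ f → (∀ r → SameBlock (f r) r) → BlockIncreasing f → ∀ k (r : Fin M) → toℕ r ≡ k → k ℕ.≤ toℕ (f r)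
  block-inflationary f pres inc zero r e = ℕ.z≤n
  block-inflationary f pres inc (suc k) r e = step
    where
    k<M : k ℕ.< M
    k<M = ℕₚ.<-trans (ℕₚ.n<1+n k) (subst (ℕ._< M) e (Finₚ.toℕ<n r))
    s : Fin M
    s = Fin.fromℕ< k<M
    s≡ : toℕ s ≡ k
    s≡ = Finₚ.toℕ-fromℕ< k<M
    s<r : s Fin.< r
    s<r = subst₂ ℕ._<_ (sym s≡) (sym e) (ℕₚ.n<1+n k)
    step : suc k ℕ.≤ toℕ (f r)
    step with toℕ s ℕ.<ᵇ h in es | toℕ r ℕ.<ᵇ h in er
    ... | true  | true  = ℕₚ.≤-<-trans (block-inflationary f pres inc k s s≡) (inc s r (trans es (sym er)) s<r)
    ... | false | false = ℕₚ.≤-<-trans (block-inflationary f pres inc k s s≡) (inc s r (trans es (sym er)) s<r)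
    ... | true  | false = ℕₚ.≤-trans (subst (λ z → suc z ℕ.≤ h) s≡ (<ᵇ-true⁻¹ es)) (<ᵇ-false⁻¹ (trans (pres r) er))
    ... | false | true  = contradiction (ℕₚ.<-trans s<r (<ᵇ-true⁻¹ {toℕ r} {h} er)) (ℕₚ.≤⇒≯ (<ᵇ-false⁻¹ {toℕ s} {h} es))

  -- Neither `f` nor its inverse moves a position to the left.
  block-identity : ∀ f g → (∀ r → g (f r) ≡ r) → (∀ r → f (g r) ≡ r) → (∀ r → SameBlock (f r) r) →
    BlockIncreasing f → BlockIncreasing g → ∀ r → f r ≡ r
  block-identity f g gf fg pres inc-f inc-g r = Finₚ.toℕ-injective (ℕₚ.≤-antisym
    (subst (λ z → toℕ (f r) ℕ.≤ toℕ z) (gf r) (block-inflationary g pres-g inc-g _ (f r) refl))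
    (block-inflationary f pres inc-f _ r refl))
    where
    pres-g : ∀ r → SameBlock (g r) r
    pres-g r = trans (sym (pres (g r))) (cong (λ z → toℕ z ℕ.<ᵇ h) (fg r))

-- Transpositions and reflections of positions

module _ {M : ℕ} where

  tr : Fin M → Fin M → Fin M → Fin M
  tr p q r = if r == p then q else (if r == q then p else r)

  tr-left : ∀ p q → tr p q p ≡ q
  tr-left p q rewrite ==-refl p = refl

  tr-right : ∀ p q → tr p q q ≡ p
  tr-right p q with q Fin.≟ p
  ... | yes e = e
  ... | no _ rewrite ==-refl q = refl

  tr-other : ∀ {p q r} → r ≢ p → r ≢ q → tr p q r ≡ r
  tr-other np nq rewrite ==-≢ np | ==-≢ nq = refl

  module _ (ρ : Fin M → ℕ) (ρ-inj : ∀ {r s} → ρ r ≡ ρ s → r ≡ s) where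

    -- Any third element lies on the same side of two consecutive ranks, so only the exchanged pair
    -- changes its order. The rank `ρ` is arbitrary because the affine case sorts in a rotated
    -- order.
    tr-order : ∀ {p q} → ρ q ≡ suc (ρ p) → ∀ {r s} → ρ r ℕ.< ρ s → ρ (tr p q s) ℕ.< ρ (tr p q r) → r ≡ p × s ≡ q
    tr-order {p} {q} adj {r} {s} r<s flip with r Fin.≟ p | r Fin.≟ q | s Fin.≟ p | s Fin.≟ q
    ... | yes e | _ | _ | yes e' = e , e'
    ... | yes refl | _ | yes refl | _ = contradiction r<s (ℕₚ.<-irrefl refl)
    ... | yes refl | _ | no s≢p | no s≢q = contradiction
          (ℕₚ.≤∧≢⇒< (subst (ℕ._≤ ρ s) (sym adj) r<s) (λ e → s≢q (ρ-inj (sym e))))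
          (ℕₚ.<-asym flip)
    ... | no _ | yes refl | yes refl | _ = contradiction (subst (ℕ._< ρ p) adj r<s) (ℕₚ.<⇒≯ (ℕₚ.n<1+n (ρ p)))
    ... | no r≢p | yes refl | no _ | yes refl = contradiction r<s (ℕₚ.<-irrefl refl)
    ... | no r≢p | yes refl | no _ | no _ = contradiction (ℕₚ.<-trans flip (ℕₚ.n<1+n (ρ p)))
          (ℕₚ.<-asym (subst (ℕ._< ρ s) adj r<s))
    ... | no _ | no r≢q | yes refl | _ = contradiction (ℕₚ.<-trans r<s (ℕₚ.n<1+n (ρ p))) (ℕₚ.<-asym (subst (ℕ._< ρ r) adj flip))
    ... | no r≢p | no _ | no _ | yes refl = contradiction
          (ℕₚ.≤∧≢⇒< (ℕₚ.≤-pred (subst (suc (ρ r) ℕ.≤_) adj r<s)) (λ e → r≢p (ρ-inj e)))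
          (ℕₚ.<-asym flip)
    ... | no _ | no _ | no _ | no _ = contradiction r<s (ℕₚ.<-asym flip)

module Reflect {M : ℕ} (symm : Bool) (opp-free : symm ≡ true → ∀ (r : Fin M) → opposite r ≢ r) where

  o : Fin M → Fin M
  o = opposite

  o-o : ∀ r → o (o r) ≡ r
  o-o = Finₚ.opposite-involutive

  o-swap : ∀ {p q} → o p ≡ q → p ≡ o q
  o-swap {p} e = trans (sym (o-o p)) (cong o e)

  o-inj : ∀ {p q} → o p ≡ o q → p ≡ q
  o-inj {p} {q} e = trans (o-swap e) (o-o q)

  -- In a symmetric system the reflection is a product of two transpositions, except when `q` is the
  -- mirror image of `p` and the two would coincide.
  separate : Fin M → Fin M → Bool
  separate p q = symm ∧ not (q == o p)

  -- The reflection in e p − e q; for a symmetric system e (o r) = − e r, so it moves o p and o q as well.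
  rf : Fin M → Fin M → Fin M → Fin M
  rf p q r = if separate p q then tr p q (tr (o q) (o p) r) else tr p q r

  data Separation (p q : Fin M) : Set where
    sep    : symm ≡ true → q ≢ o p → (∀ r → rf p q r ≡ tr p q (tr (o q) (o p) r)) → Separation p q
    joined : symm ≡ false ⊎ (symm ≡ true × q ≡ o p) → (∀ r → rf p q r ≡ tr p q r) → Separation p q

  separation : ∀ p q → Separation p q
  separation p q = cases (separate p q) refl
    where
    ∧-not : ∀ {a b} → a ∧ not b ≡ true → a ≡ true × b ≡ false
    ∧-not {true} {false} _ = refl , refl
    ∧-not′ : ∀ {a b} → a ∧ not b ≡ false → a ≡ false ⊎ (a ≡ true × b ≡ true)
    ∧-not′ {false} _ = inj₁ refl
    ∧-not′ {true} {true} _ = inj₂ (refl , refl)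
    cases : ∀ b → separate p q ≡ b → Separation p q
    cases true  e = sep (proj₁ (∧-not e))
      (λ z → case trans (sym (proj₂ (∧-not {symm} e))) (trans (cong (_== o p) z) (==-refl (o p))) of λ ())
      (λ r → cong (λ b → if b then tr p q (tr (o q) (o p) r) else tr p q r) e)
    cases false e = joined (Sum.map₂ (λ (a , b) → a , ==-true b) (∧-not′ {symm} e))
      (λ r → cong (λ b → if b then tr p q (tr (o q) (o p) r) else tr p q r) e)

  rf-left : ∀ p q → rf p q p ≡ q
  rf-left p q with separation p q
  ... | sep s ne eq = trans (eq p) (trans (cong (tr p q) (tr-other (λ e → ne (sym (trans (cong o e) (o-o q)))) (λ e → opp-free s p (sym e)))) (tr-left p q))
  ... | joined _ eq = trans (eq p) (tr-left p q)

  rf-right : ∀ p q → rf p q q ≡ p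
  rf-right p q with separation p q
  ... | sep s ne eq = trans (eq q) (trans (cong (tr p q) (tr-other (λ e → opp-free s q (sym e)) ne)) (tr-right p q))
  ... | joined _ eq = trans (eq q) (tr-right p q)

  module _ (ρ : Fin M → ℕ) (ρ-inj : ∀ {r s} → ρ r ≡ ρ s → r ≡ s)
           (ρ-sym : symm ≡ true → ∀ r s → ρ r ℕ.+ ρ (o r) ≡ ρ s ℕ.+ ρ (o s)) where

    -- The mirror pair has consecutive ranks too, because `ρ r + ρ (o r)` is constant; so each of
    -- the two transpositions reverses one pair only.
    rf-order : ∀ {p q} → ρ q ≡ suc (ρ p) → ∀ {r s} → ρ r ℕ.< ρ s → ρ (rf p q s) ℕ.< ρ (rf p q r) →
      (r ≡ p × s ≡ q) ⊎ (symm ≡ true × r ≡ o q × s ≡ o p)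
    rf-order {p} {q} adj {r} {s} r<s flip with separation p q
    ... | joined _ eq rewrite eq r | eq s = inj₁ (tr-order ρ ρ-inj adj r<s flip)
    ... | sep sy ne eq rewrite eq r | eq s with ℕₚ.<-cmp (ρ (tr (o q) (o p) r)) (ρ (tr (o q) (o p) s))
    ...   | tri> _ _ gt = inj₂ (sy , tr-order ρ ρ-inj adj' r<s gt)
      where
      adj' : ρ (o p) ≡ suc (ρ (o q))
      adj' = ℕₚ.+-cancelˡ-≡ (ρ p) _ _ (trans (ρ-sym sy p q) (trans (cong (ℕ._+ ρ (o q)) adj) (sym (ℕₚ.+-suc (ρ p) (ρ (o q))))))
    ...   | tri≈ _ e _ = contradiction flip (ℕₚ.<-irrefl (cong (λ z → ρ (tr p q z)) (sym (ρ-inj e))))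
    ...   | tri< lt _ _ with tr-order ρ ρ-inj adj lt flip
    ...     | e , e' = inj₁ (back e p≢oq p≢op , back e' q≢oq (λ z → ne z))
      where
      p≢op : p ≢ o p
      p≢op z = opp-free sy p (sym z)
      p≢oq : p ≢ o q
      p≢oq z = ne (sym (trans (cong o z) (o-o q)))
      q≢oq : q ≢ o q
      q≢oq z = opp-free sy q (sym z)
      back : ∀ {x y} → tr (o q) (o p) x ≡ y → y ≢ o q → y ≢ o p → x ≡ y
      back {x} {y} h n₁ n₂ with x Fin.≟ o q | x Fin.≟ o p
      ... | yes refl | _ = contradiction (sym h) n₂
      ... | no _ | yes refl = contradiction (sym h) n₁
      ... | no _ | no _ = h

-- Words acting on positions

module Words {M : ℕ} {J : Set} (τ : J → Fin M → Fin M) (τ-invol : ∀ j r → τ j (τ j r) ≡ r) where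

  act : List J → Fin M → Fin M
  act []      r = r
  act (j ∷ w) r = τ j (act w r)

  act-++ : ∀ u w r → act (u ++ w) r ≡ act u (act w r)
  act-++ []      w r = refl
  act-++ (j ∷ u) w r = cong (τ j) (act-++ u w r)

  act-reverse : ∀ w r → act (reverse w) (act w r) ≡ r
  act-reverse [] r = refl
  act-reverse (j ∷ w) r = begin
    act (reverse (j ∷ w)) (τ j (act w r))          ≡⟨ cong (λ z → act z (τ j (act w r))) (Listₚ.unfold-reverse j w) ⟩
    act (reverse w ++ j ∷ []) (τ j (act w r))      ≡⟨ act-++ (reverse w) (j ∷ []) (τ j (act w r)) ⟩
    act (reverse w) (τ j (τ j (act w r)))          ≡⟨ cong (act (reverse w)) (τ-invol j (act w r)) ⟩
    act (reverse w) (act w r)                      ≡⟨ act-reverse w r ⟩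
    r                                              ∎
    where open ≡-Reasoning

  reverse-act : ∀ w r → act w (act (reverse w) r) ≡ r
  reverse-act w r = subst (λ z → act z (act (reverse w) r) ≡ r) (Listₚ.reverse-involutive w) (act-reverse (reverse w) r)

  act-inj : ∀ w {r s} → act w r ≡ act w s → r ≡ s
  act-inj w {r} {s} e = trans (sym (act-reverse w r)) (trans (cong (act (reverse w)) e) (act-reverse w s))

  act-sum : ∀ w (f : Fin M → ℚ) → sumℚ (λ r → f (act w r)) ≡ sumℚ f
  act-sum w = sum-reindex (act w) (act (reverse w)) (act-reverse w) (reverse-act w)

-- Every total order compatible with the symmetry is sorted by a word: as long as two neighbours
-- are in the wrong order, reflecting them lowers the number of inverted pairs.

module Sort {M : ℕ} (symm : Bool) (opp-free : symm ≡ true → ∀ (r : Fin M) → opposite r ≢ r)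
  (ρ : Fin M → ℕ) (ρ-inj : ∀ {r s} → ρ r ≡ ρ s → r ≡ s)
  (ρ-sym : symm ≡ true → ∀ r s → ρ r ℕ.+ ρ (opposite r) ≡ ρ s ℕ.+ ρ (opposite s))
  (ρ-next : ∀ r s → ρ r ℕ.< ρ s → ∃ λ r' → ρ r' ≡ suc (ρ r))
  {J : Set} (τ : J → Fin M → Fin M) (τ-invol : ∀ j r → τ j (τ j r) ≡ r)
  (τ-opp : symm ≡ true → ∀ j r → τ j (opposite r) ≡ opposite (τ j r))
  (Allowed : J → Set)
  (gen : ∀ p q → ρ q ≡ suc (ρ p) → ∃ λ j → Allowed j × (∀ r → τ j r ≡ Reflect.rf symm opp-free p q r))
  (lt : Fin M → Fin M → Bool)
  (lt-irrefl : ∀ p → lt p p ≢ true)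
  (lt-trans : ∀ {p q r} → lt p q ≡ true → lt q r ≡ true → lt p r ≡ true)
  (lt-total : ∀ {p q} → p ≢ q → lt p q ≡ true ⊎ lt q p ≡ true)
  (lt-sym : symm ≡ true → ∀ {p q} → lt p q ≡ true → lt (opposite q) (opposite p) ≡ true)
  where

  open Reflect symm opp-free
  open Words τ τ-invol

  act-opp : symm ≡ true → ∀ w r → act w (o r) ≡ o (act w r)
  act-opp s [] r = refl
  act-opp s (j ∷ w) r = trans (cong (τ j) (act-opp s w r)) (τ-opp s j (act w r))

  private
    inverted : List J → Fin M → Fin M → Bool
    inverted u p q = (ρ (act u p) ℕ.<ᵇ ρ (act u q)) ∧ lt q p

    inverted-pairs : List J → Fin (M ℕ.* M) → Bool
    inverted-pairs u i = inverted u (proj₁ (Fin.remQuot {M} M i)) (proj₂ (Fin.remQuot {M} M i))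

    ∧-split : ∀ {a b} → a ∧ b ≡ true → a ≡ true × b ≡ true
    ∧-split {true} {true} _ = refl , refl

    -- A new inversion could only arise at the reflected pair or its mirror image, and there it
    -- would contradict `bad`.
    step : ∀ u p q → ρ (act u q) ≡ suc (ρ (act u p)) → lt q p ≡ true → ∀ j →
      (∀ r → τ j r ≡ rf (act u p) (act u q) r) → count (inverted-pairs (j ∷ u)) ℕ.< count (inverted-pairs u)
    step u p q adj bad j eq = count-strict
      (λ i → sub (proj₁ (Fin.remQuot {M} M i)) (proj₂ (Fin.remQuot {M} M i)))
      (Fin.combine p q)
      (subst (λ z → inverted (j ∷ u) (proj₁ z) (proj₂ z) ≡ false) (sym (Finₚ.remQuot-combine p q)) now)
      (subst (λ z → inverted u (proj₁ z) (proj₂ z) ≡ true) (sym (Finₚ.remQuot-combine p q)) before)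
      where
      before : inverted u p q ≡ true
      before = cong₂ _∧_ (<ᵇ-true (subst (ρ (act u p) ℕ.<_) (sym adj) (ℕₚ.n<1+n (ρ (act u p))))) bad
      now : inverted (j ∷ u) p q ≡ false
      now rewrite trans (eq (act u p)) (rf-left (act u p) (act u q)) | trans (eq (act u q)) (rf-right (act u p) (act u q))
        | <ᵇ-false {ρ (act u q)} {ρ (act u p)} (subst (ρ (act u p) ℕ.≤_) (sym adj) (ℕₚ.n≤1+n (ρ (act u p)))) = refl
      sub : ∀ a b → inverted (j ∷ u) a b ≡ true → inverted u a b ≡ true
      sub a b h with ∧-split {ρ (act (j ∷ u) a) ℕ.<ᵇ ρ (act (j ∷ u) b)} h
      ... | flip , lba with ℕₚ.<-cmp (ρ (act u a)) (ρ (act u b))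
      ...   | tri< l _ _ = cong₂ _∧_ (<ᵇ-true l) lba
      ...   | tri≈ _ e _ = contradiction (<ᵇ-true⁻¹ flip) (ℕₚ.<-irrefl (cong (λ z → ρ (τ j z)) (ρ-inj e)))
      ...   | tri> _ _ g with rf-order ρ ρ-inj ρ-sym adj g (subst₂ (λ x y → ρ x ℕ.< ρ y) (eq (act u a)) (eq (act u b)) (<ᵇ-true⁻¹ flip))
      ...     | inj₁ (e , e') = contradiction (lt-trans bad (subst₂ (λ x y → lt x y ≡ true) (act-inj u e) (act-inj u e') lba)) (lt-irrefl q)
      ...     | inj₂ (s , e , e') = contradiction
                  (lt-trans (lt-sym s bad) (subst₂ (λ x y → lt x y ≡ true)
                    (act-inj u (trans e (sym (act-opp s u q)))) (act-inj u (trans e' (sym (act-opp s u p)))) lba))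
                  (lt-irrefl (o p))

    Sorted : List J → Set
    Sorted u = ∀ p q → ρ (act u q) ≡ suc (ρ (act u p)) → lt q p ≢ true

    -- The bound `n` on the number of inverted pairs makes the recursion terminate.
    bubble : ∀ n u → All Allowed u → count (inverted-pairs u) ℕ.≤ n → ∃ λ w → All Allowed w × Sorted w
    bubble n u al le with Finₚ.any? (λ p → Finₚ.any? (λ q → (ρ (act u q) ℕ.≟ suc (ρ (act u p))) ×-dec (lt q p Boolₚ.≟ true)))
    ... | no none = u , al , λ p q a b → none (p , q , a , b)
    ... | yes (p , q , adj , bad) with gen (act u p) (act u q) adj
    ...   | j , aj , eq with n | ℕₚ.<-≤-trans (step u p q adj bad j eq) le
    ...     | suc n' | lt' = bubble n' (j ∷ u) (aj ∷ al) (ℕₚ.≤-pred lt')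

    -- Neighbours are in the right order, and larger differences of rank follow by transitivity
    -- through the elements that `ρ-next` provides.
    sorted-lt : ∀ u → Sorted u → ∀ d p q → ρ (act u q) ≡ suc d ℕ.+ ρ (act u p) → lt p q ≡ true
    sorted-lt u so zero p q e with lt-total {p} {q} (λ { refl → ℕₚ.m≢1+m+n (ρ (act u p)) (trans e (cong suc (sym (ℕₚ.+-identityʳ _)))) })
    ... | inj₁ l = l
    ... | inj₂ g = contradiction g (so p q e)
    sorted-lt u so (suc d) p q e with ρ-next (act u p) (act u q) (subst (ρ (act u p) ℕ.<_) (sym e) (ℕ.s≤s (ℕₚ.m≤n+m (ρ (act u p)) (suc d))))
    ... | r' , e' = lt-trans (sorted-lt u so zero p r adj) (sorted-lt u so d r q (trans e (sym (trans (cong (suc d ℕ.+_) adj) (ℕₚ.+-suc (suc d) (ρ (act u p)))))))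
      where
      r : Fin M
      r = act (reverse u) r'
      adj : ρ (act u r) ≡ suc (ρ (act u p))
      adj = trans (cong ρ (reverse-act u r')) e'

  sort : ∃ λ u → All Allowed u × (∀ p q → lt p q ≡ true → ρ (act u p) ℕ.< ρ (act u q))
  sort with bubble _ [] [] ℕₚ.≤-refl
  ... | u , al , so = u , al , sorted
    where
    sorted : ∀ p q → lt p q ≡ true → ρ (act u p) ℕ.< ρ (act u q)
    sorted p q l with ℕₚ.<-cmp (ρ (act u p)) (ρ (act u q))
    ... | tri< x _ _ = x
    ... | tri≈ _ e _ = contradiction (subst (λ z → lt p z ≡ true) (sym (act-inj u (ρ-inj e))) l) (lt-irrefl p)
    ... | tri> _ _ g = contradiction (lt-trans l (sorted-lt u so d q p
            (trans (sym (ℕₚ.m+[n∸m]≡n g)) (cong suc (ℕₚ.+-comm (ρ (act u q)) d))))) (lt-irrefl p)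
      where
      d : ℕ
      d = ρ (act u p) ℕ.∸ suc (ρ (act u q))

-- Search for shortest words

module _ {k : ℕ} where

  word-of-length? : ∀ {P : List (Fin k) → Set} → (∀ w → Dec (P w)) → ∀ l → Dec (∃ λ w → length w ≡ l × P w)
  word-of-length? P? zero = map′ (λ p → [] , refl , p) (λ { ([] , _ , p) → p }) (P? [])
  word-of-length? P? (suc l) = map′ (λ (j , w , e , p) → j ∷ w , cong suc e , p)
    (λ { (j ∷ w , e , p) → j , w , ℕₚ.suc-injective e , p })
    (Finₚ.any? (λ j → word-of-length? (λ w → P? (j ∷ w)) l))

  -- There are finitely many words shorter than a given one; each hit among them lowers the bound
  -- `n`.
  shortest : ∀ {P : List (Fin k) → Set} → (∀ w → Dec (P w)) → ∀ w → P w →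
    ∃ λ w' → P w' × (∀ x → P x → length w' ℕ.≤ length x)
  shortest {P} P? w pw = go (length w) w pw ℕₚ.≤-refl
    where
    go : ∀ n w → P w → length w ℕ.≤ n → ∃ λ w' → P w' × (∀ x → P x → length w' ℕ.≤ length x)
    go n w pw le with Finₚ.any? {n = length w} (λ i → word-of-length? P? (toℕ i))
    ... | no none = w , pw , λ x px → ℕₚ.≮⇒≥ (λ l → none (Fin.fromℕ< l , x , sym (Finₚ.toℕ-fromℕ< l) , px))
    ... | yes (i , x , e , px) with n | ℕₚ.<-≤-trans (subst (ℕ._< length w) (sym e) (Finₚ.toℕ<n i)) le
    ...   | suc n' | l = go n' x px (ℕₚ.≤-pred l)

-- Finite enumerations

consᶠ : ∀ {k} → Bool → (Fin k → Bool) → Fin (suc k) → Bool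
consᶠ b f zero    = b
consᶠ b f (suc r) = f r

subsets : ∀ k → List (Fin k → Bool)
subsets zero    = (λ ()) ∷ []
subsets (suc k) = List.map (consᶠ true) (subsets k) ++ List.map (consᶠ false) (subsets k)

subsets-complete : ∀ {k} (f : Fin k → Bool) → ∃ λ g → g ∈ subsets k × (∀ r → g r ≡ f r)
subsets-complete {zero}  f = (λ ()) , here refl , λ ()
subsets-complete {suc k} f with subsets-complete (f ∘ suc) | f zero in e
... | g , g∈ , eq | true  = consᶠ true g , ∈ₚ.∈-++⁺ˡ (∈ₚ.∈-map⁺ (consᶠ true) g∈) , λ { zero → sym e ; (suc r) → eq r }
... | g , g∈ , eq | false = consᶠ false g , ∈ₚ.∈-++⁺ʳ (List.map (consᶠ true) (subsets k)) (∈ₚ.∈-map⁺ (consᶠ false) g∈) ,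
  λ { zero → sym e ; (suc r) → eq r }

module _ {X Y : Set} {Code : X → Y → Set} (decide : ∀ x → Dec (∃ (Code x))) where

  collect : List X → List Y
  collect []       = []
  collect (x ∷ xs) with decide x
  ... | yes (y , _) = y ∷ collect xs
  ... | no _        = collect xs

  -- The element found need not be `y`: it only shares a code with it, which is why codes must
  -- determine regions.
  collect-hit : ∀ {x xs y} → x ∈ xs → Code x y → ∃ λ j → Code x (lookup (collect xs) j)
  collect-hit {x} (here refl) c with decide x
  ... | yes (y , c') = zero , c'
  ... | no ¬c        = contradiction (_ , c) ¬c
  collect-hit {xs = x' ∷ xs} (there i) c with decide x' | collect-hit i c
  ... | yes _ | j , c' = suc j , c'
  ... | no _  | r      = r

-- Reflections

divq-spec : ∀ p q → q ≢ 0ℚ → divq p q * q ≡ p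
divq-spec p q ne with q ℚₚ.≟ 0ℚ
... | yes e = contradiction e ne
... | no  z = trans (ℚₚ.*-assoc p _ q) (trans (cong (p *_) (ℚₚ.*-inverseˡ q {{ℚ.≢-nonZero z}})) (ℚₚ.*-identityʳ p))

divq-inv : ∀ p q → divq p q ≡ p * divq 1ℚ q
divq-inv p q with q ℚₚ.≟ 0ℚ
... | yes _ = sym (ℚₚ.*-zeroʳ p)
... | no  _ = cong (p *_) (sym (ℚₚ.*-identityˡ _))

cancel-nonzero : ∀ {a b c} → c ≢ 0ℚ → a * c ≡ b * c → a ≡ b
cancel-nonzero {a} {b} {c} ne e = trans (sym (lem a)) (trans (cong (_* inv) e) (lem b))
  where
  inv : ℚ
  inv = ℚ.1/_ c {{ℚ.≢-nonZero ne}}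
  lem : ∀ x → x * c * inv ≡ x
  lem x = trans (ℚₚ.*-assoc x c inv) (trans (cong (x *_) (ℚₚ.*-inverseʳ c {{ℚ.≢-nonZero ne}})) (ℚₚ.*-identityʳ x))

module _ {d : ℕ} where

  coef-spec : ∀ (x β : V d) → ⟨ β , β ⟩ ≢ 0ℚ → coef x β * ⟨ β , β ⟩ ≡ 2ℚ * ⟨ x , β ⟩
  coef-spec x β ne = divq-spec (2ℚ * ⟨ x , β ⟩) ⟨ β , β ⟩ ne

  coef-≡ : ∀ {x β : V d} {c} → ⟨ β , β ⟩ ≢ 0ℚ → c * ⟨ β , β ⟩ ≡ 2ℚ * ⟨ x , β ⟩ → coef x β ≡ c
  coef-≡ {x} {β} ne e = cancel-nonzero ne (trans (coef-spec x β ne) (sym e))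

  coef-cong : ∀ {x y β γ : V d} → x ≐ y → β ≐ γ → coef x β ≡ coef y γ
  coef-cong h g = cong₂ divq (cong (2ℚ *_) (ip-cong h g)) (ip-cong g g)

  coef-form : ∀ (β : V d) → LinearForm (λ x → coef x β)
  coef-form β = record
    { form-cong = λ h → coef-cong h (≐-refl {u = β})
    ; form-+ = λ u v → trans (expand (u +v v)) (trans (cong (λ z → 2ℚ * z * k) (ip-+ˡ u v β))
        (trans (lem₁ ⟨ u , β ⟩ ⟨ v , β ⟩ k) (sym (cong₂ _+_ (expand u) (expand v)))))
    ; form-· = λ c u → trans (expand (c ·v u)) (trans (cong (λ z → 2ℚ * z * k) (ip-·ˡ c u β))
        (trans (lem₂ c ⟨ u , β ⟩ k) (sym (cong (c *_) (expand u))))) }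
    where
    k : ℚ
    k = divq 1ℚ ⟨ β , β ⟩
    expand : ∀ x → coef x β ≡ 2ℚ * ⟨ x , β ⟩ * k
    expand x = divq-inv (2ℚ * ⟨ x , β ⟩) ⟨ β , β ⟩
    lem₁ : ∀ a b k → 2ℚ * (a + b) * k ≡ 2ℚ * a * k + 2ℚ * b * k
    lem₁ = solve-∀ ℚ-ring
    lem₂ : ∀ c a k → 2ℚ * (c * a) * k ≡ c * (2ℚ * a * k)
    lem₂ = solve-∀ ℚ-ring

  sref-cong : ∀ {β γ x y : V d} → β ≐ γ → x ≐ y → sref β x ≐ sref γ y
  sref-cong {β} {γ} {x} {y} h g = -v-cong g (·v-cong (coef-cong {x} {y} {β} {γ} g h) h)

  sref-map : ∀ (β : V d) → LinearMap (sref β)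
  sref-map β = record
    { map-cong = λ h → sref-cong {β} {β} ≐-refl h
    ; map-+ = λ u v k → trans (cong (λ z → u k + v k - z * β k) (form-+ u v)) (lem₁ (u k) (v k) (coef u β) (coef v β) (β k))
    ; map-· = λ c u k → trans (cong (λ z → c * u k - z * β k) (form-· c u)) (lem₂ c (u k) (coef u β) (β k)) }
    where
    open LinearForm (coef-form β)
    lem₁ : ∀ u v a b k → u + v - (a + b) * k ≡ (u - a * k) + (v - b * k)
    lem₁ = solve-∀ ℚ-ring
    lem₂ : ∀ c u a k → c * u - c * a * k ≡ c * (u - a * k)
    lem₂ = solve-∀ ℚ-ring

  coef-self : ∀ (β : V d) → ⟨ β , β ⟩ ≢ 0ℚ → coef β β ≡ 2ℚ
  coef-self β ne = coef-≡ {β} {β} ne refl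

  sref-invol : ∀ (β x : V d) → ⟨ β , β ⟩ ≢ 0ℚ → sref β (sref β x) ≐ x
  sref-invol β x ne k = trans (cong (λ z → x k - coef x β * β k - z * β k)
    (trans (form-- x (coef x β ·v β)) (cong (λ z → coef x β - z) (trans (form-· (coef x β) β) (cong (coef x β *_) (coef-self β ne))))))
    (lem (x k) (coef x β) (β k))
    where
    open LinearForm (coef-form β)
    lem : ∀ x c b → x - c * b - (c - c * 2ℚ) * b ≡ x
    lem = solve-∀ ℚ-ring

  sref-isometry : ∀ (β x y : V d) → ⟨ β , β ⟩ ≢ 0ℚ → ⟨ sref β x , sref β y ⟩ ≡ ⟨ x , y ⟩
  sref-isometry β x y ne = begin
    ⟨ x -v a ·v β , y -v b ·v β ⟩
      ≡⟨ ip--ˡ x (a ·v β) (y -v b ·v β) ⟩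
    ⟨ x , y -v b ·v β ⟩ - ⟨ a ·v β , y -v b ·v β ⟩
      ≡⟨ cong₂ _-_ (trans (ip--ʳ y (b ·v β) x) (cong (λ z → ⟨ x , y ⟩ - z) (ip-·ʳ b β x)))
           (trans (ip-·ˡ a β (y -v b ·v β)) (cong (a *_) (trans (ip--ʳ y (b ·v β) β) (cong₂ _-_ (ip-comm β y) (ip-·ʳ b β β))))) ⟩
    (⟨ x , y ⟩ - b * ⟨ x , β ⟩) - a * (⟨ y , β ⟩ - b * ⟨ β , β ⟩)
      ≡⟨ lem ⟨ x , y ⟩ a b ⟨ x , β ⟩ ⟨ y , β ⟩ ⟨ β , β ⟩ ⟩
    -- The cross terms are split evenly, so that each half is a multiple of a defect that vanishes
    -- by `coef-spec`.
    ⟨ x , y ⟩ + ½ * (b * (a * ⟨ β , β ⟩ - 2ℚ * ⟨ x , β ⟩) + a * (b * ⟨ β , β ⟩ - 2ℚ * ⟨ y , β ⟩))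
      ≡⟨ cong₂ (λ u v → ⟨ x , y ⟩ + ½ * (b * (u - 2ℚ * ⟨ x , β ⟩) + a * (v - 2ℚ * ⟨ y , β ⟩))) (coef-spec x β ne) (coef-spec y β ne) ⟩
    ⟨ x , y ⟩ + ½ * (b * (2ℚ * ⟨ x , β ⟩ - 2ℚ * ⟨ x , β ⟩) + a * (2ℚ * ⟨ y , β ⟩ - 2ℚ * ⟨ y , β ⟩))
      ≡⟨ lem₂ ⟨ x , y ⟩ a b (2ℚ * ⟨ x , β ⟩) (2ℚ * ⟨ y , β ⟩) ⟩
    ⟨ x , y ⟩ ∎
    where
    open ≡-Reasoning
    a b : ℚ
    a = coef x β
    b = coef y β
    lem : ∀ s a b p q n → (s - b * p) - a * (q - b * n) ≡ s + ½ * (b * (a * n - 2ℚ * p) + a * (b * n - 2ℚ * q))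
    lem = solve-∀ ℚ-ring
    lem₂ : ∀ s a b p q → s + ½ * (b * (p - p) + a * (q - q)) ≡ s
    lem₂ = solve-∀ ℚ-ring

-- A common form of A_n and C_n: the roots are the differences e p − e q of distinct positions, positive iff p < q.
-- In type C the positions are 1 < … < n < −n < … < −1 and opposite is the sign change.

record Model (R : RootData) : Set where
  open RS R
  field
    m           : ℕ
    symm        : Bool
    opp-free    : symm ≡ true → ∀ (r : Fin (suc m)) → opposite r ≢ r
    e           : Fin (suc m) → V dim
    gram        : ∀ p r → ⟨ e p , e r ⟩ ≡ δ p r - ind symm * δ p (opposite r)
    separating  : ∀ x y → (∀ r → ⟨ x , e r ⟩ ≡ ⟨ y , e r ⟩) → x ≐ y
    node        : Fin rank → Fin m
    node-inj    : ∀ {i j} → node i ≡ node j → i ≡ j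
    simple-e    : ∀ j → simple j ≐ (e (inject₁ (node j)) -v e (suc (node j)))
    -- In type C an adjacent pair beyond the centre is the mirror image of the pair of a simple
    -- root, so `letter` need not invert `node`.
    letter      : ∀ k → ∃ λ j → simple j ≐ (e (inject₁ k) -v e (suc k))
    -- In the symmetric case the premise says that the pair is astride the centre, as the pair of
    -- the long simple root is.
    long-letter : ∀ k → (symm ≡ true → suc k ≡ opposite (inject₁ k)) → ∃ λ j → node j ≡ k
    θ-e         : θ ≐ (e zero -v e (fromℕ m))
    pos-pair    : ∀ a → ∃₂ λ p q → p Fin.< q × pos a ≐ (e p -v e q)
    pair-pos    : ∀ p q → p Fin.< q → IsPos (e p -v e q)
    -- Decides whether a position with vanishing coordinate counts as a source.
    tie         : Fin (suc m) → Bool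
    tie-first   : tie zero ≡ true
    tie-last    : tie (fromℕ m) ≡ false
    tie-opp     : symm ≡ true → ∀ r → tie (opposite r) ≡ not (tie r)

module Generic {R : RootData} (𝓜 : Model R) where
  open RS R public
  open Model 𝓜 public

  M : ℕ
  M = suc m

  φ : ℚ
  φ = ind symm

  open Reflect symm opp-free public

  last : Fin M
  last = fromℕ m

  first≢last : zero ≢ last
  first≢last z = case trans (sym tie-first) (trans (cong tie z) tie-last) of λ ()

  symm-cases : (symm ≡ true × φ ≡ 1ℚ) ⊎ (symm ≡ false × φ ≡ 0ℚ)
  symm-cases = aux symm refl
    where
    aux : ∀ b → symm ≡ b → (symm ≡ true × φ ≡ 1ℚ) ⊎ (symm ≡ false × φ ≡ 0ℚ)
    aux true  s = inj₁ (s , cong ind s)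
    aux false s = inj₂ (s , cong ind s)

  φ-nonneg : 0ℚ ≤q φ
  φ-nonneg = ind-nonneg symm

  φ-self : ∀ r → φ * δ r (o r) ≡ 0ℚ
  φ-self r with symm-cases
  ... | inj₁ (s , e) = trans (cong (φ *_) (δ-≢ (λ z → opp-free s r (sym z)))) (ℚₚ.*-zeroʳ φ)
  ... | inj₂ (s , e) = trans (cong (_* δ r (o r)) e) (ℚₚ.*-zeroˡ (δ r (o r)))

  gram-self : ∀ r → ⟨ e r , e r ⟩ ≡ 1ℚ
  gram-self r = trans (gram r r) (cong₂ _-_ (δ-refl r) (φ-self r))

  gram-≤ : ∀ p r → ⟨ e p , e r ⟩ ≤q δ p r
  gram-≤ p r = ℚₚ.≤-trans (ℚₚ.≤-reflexive (gram p r))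
    (≤-by (φ * δ p (o r)) (*-nonneg φ-nonneg (ind-nonneg (p == o r))) (lem (δ p r) (φ * δ p (o r))))
    where
    lem : ∀ a b → a - b + b ≡ a
    lem = solve-∀ ℚ-ring

  δ-pos : ∀ {n} {p q : Fin n} → 0ℚ < δ p q → p ≡ q
  δ-pos {p = p} {q} h with p Fin.≟ q
  ... | yes e = e
  ... | no _ = contradiction h (ℚₚ.<-irrefl refl)

  0<1 : 0ℚ < 1ℚ
  0<1 = ℚₚ.positive⁻¹ 1ℚ

  -- Each `e q` has norm 1, while the product of two distinct ones is never positive.
  e-inj : ∀ {p q} → e p ≐ e q → p ≡ q
  e-inj {p} {q} h = δ-pos (ℚₚ.<-≤-trans 0<1 (ℚₚ.≤-trans
    (ℚₚ.≤-reflexive (trans (sym (gram-self q)) (sym (ip-cong h (≐-refl {u = e q}))))) (gram-≤ p q)))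

  δ-o : ∀ p r → δ (o p) r ≡ δ p (o r)
  δ-o p r = δ-iff {p = o p} {r} {p} {o r} o-swap (λ z → trans (cong o z) (o-o r))

  -- The Gram matrix forces this, because a vector is determined by its products with all `e t`.
  e-opp : symm ≡ true → ∀ r → e (o r) ≐ (-v e r)
  e-opp s r = separating (e (o r)) (-v e r) (λ t → begin
    ⟨ e (o r) , e t ⟩                 ≡⟨ gram (o r) t ⟩
    δ (o r) t - φ * δ (o r) (o t)     ≡⟨ cong₂ (λ x y → x - y * δ (o r) (o t)) (δ-o r t) (cong ind s) ⟩
    δ r (o t) - 1ℚ * δ (o r) (o t)    ≡⟨ cong (λ x → δ r (o t) - 1ℚ * x) (trans (δ-o r (o t)) (cong (δ r) (o-o t))) ⟩
    δ r (o t) - 1ℚ * δ r t            ≡⟨ lem (δ r t) (δ r (o t)) ⟩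
    - (δ r t - 1ℚ * δ r (o t))        ≡⟨ cong (λ y → - (δ r t - y * δ r (o t))) (cong ind s) ⟨
    - (δ r t - φ * δ r (o t))         ≡⟨ cong -_ (gram r t) ⟨
    - ⟨ e r , e t ⟩                   ≡⟨ ip-negˡ (e r) (e t) ⟨
    ⟨ -v e r , e t ⟩                  ∎)
    where
    open ≡-Reasoning
    lem : ∀ a b → b - 1ℚ * a ≡ - (a - 1ℚ * b)
    lem = solve-∀ ℚ-ring

  root : Fin M → Fin M → V dim
  root p q = e p -v e q

  neg-root : ∀ p q → (-v root p q) ≐ root q p
  neg-root p q = neg-sub (e p) (e q)

  root-opp : symm ≡ true → ∀ p q → root (o q) (o p) ≐ root p q
  root-opp s p q k = trans (cong₂ _-_ (e-opp s q k) (e-opp s p k)) (lem (e p k) (e q k))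
    where
    lem : ∀ a b → - b - (- a) ≡ a - b
    lem = solve-∀ ℚ-ring

  root-e : ∀ p q r → ⟨ root p q , e r ⟩ ≡ (δ p r - φ * δ p (o r)) - (δ q r - φ * δ q (o r))
  root-e p q r = trans (ip--ˡ (e p) (e q) (e r)) (cong₂ _-_ (gram p r) (gram q r))

  -- If `p ≢ p'`, pairing both sides with `e p` gives at least 1 on the left, while on the right
  -- only the term `φ * δ q' (o p)` can be positive. So the system is symmetric and the second pair
  -- is the mirror image of the first.
  root-≡ : ∀ {p q p' q'} → p ≢ q → root p q ≐ root p' q' →
    (p ≡ p' × q ≡ q') ⊎ (symm ≡ true × p ≡ o q' × q ≡ o p')
  root-≡ {p} {q} {p'} {q'} p≢q h with p Fin.≟ p'
  ... | yes refl = inj₁ (refl , e-inj (λ k → lem (e p k) (e q k) (e q' k) (h k)))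
    where
    lem : ∀ a b c → a - b ≡ a - c → b ≡ c
    lem a b c z = ℚₚ.neg-injective (trans (l a b) (trans (cong (λ w → w - a) z) (sym (l a c))))
      where
      l : ∀ a b → - b ≡ a - b - a
      l = solve-∀ ℚ-ring
  ... | no p≢p' = inj₂ (opposite-case symm-cases)
    where
    open ℚₚ.≤-Reasoning
    key : 1ℚ ≤q φ * δ q' (o p)
    key = begin
      1ℚ ≤⟨ ≤-by (φ * δ q (o p)) (*-nonneg φ-nonneg (ind-nonneg (q == o p))) refl ⟩
      1ℚ + φ * δ q (o p) ≡⟨ trans (root-e p q p) (trans (cong₂ (λ x y → x - (y - φ * δ q (o p))) (cong₂ _-_ (δ-refl p) (φ-self p)) (δ-≢ (λ z → p≢q (sym z)))) (l₁ (φ * δ q (o p)))) ⟨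
      ⟨ root p q , e p ⟩ ≡⟨ ip-cong h (≐-refl {u = e p}) ⟩
      ⟨ root p' q' , e p ⟩ ≡⟨ root-e p' q' p ⟩
      (δ p' p - φ * δ p' (o p)) - (δ q' p - φ * δ q' (o p)) ≡⟨ cong (λ x → (x - φ * δ p' (o p)) - (δ q' p - φ * δ q' (o p))) (δ-≢ (λ z → p≢p' (sym z))) ⟩
      (0ℚ - φ * δ p' (o p)) - (δ q' p - φ * δ q' (o p))
        ≤⟨ ≤-by (φ * δ p' (o p) + δ q' p) (+-nonneg (*-nonneg φ-nonneg (ind-nonneg (p' == o p))) (ind-nonneg (q' == p))) (l₂ (φ * δ p' (o p)) (δ q' p) (φ * δ q' (o p))) ⟩
      φ * δ q' (o p) ∎
      where
      l₁ : ∀ a → 1ℚ - 0ℚ - (0ℚ - a) ≡ 1ℚ + a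
      l₁ = solve-∀ ℚ-ring
      l₂ : ∀ a b c → (0ℚ - a) - (b - c) + (a + b) ≡ c
      l₂ = solve-∀ ℚ-ring
    opposite-case : (symm ≡ true × φ ≡ 1ℚ) ⊎ (symm ≡ false × φ ≡ 0ℚ) → symm ≡ true × p ≡ o q' × q ≡ o p'
    opposite-case (inj₂ (_ , z)) = contradiction (ℚₚ.<-≤-trans 0<1 (subst (λ y → 1ℚ ≤q y) (trans (cong (_* δ q' (o p)) z) (ℚₚ.*-zeroˡ (δ q' (o p)))) key)) (ℚₚ.<-irrefl refl)
    opposite-case (inj₁ (s , z)) = s , sym (trans (cong o q'≡) (o-o p)) , o-swap (e-inj (λ k →
        trans (e-opp s q k) (lem (e p k) (e q k) (e p' k) (trans (h k) (cong (λ y → e p' k - y) (trans (cong (λ y → e y k) q'≡) (e-opp s p k)))))))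
      where
      q'≡ : q' ≡ o p
      q'≡ = δ-pos (ℚₚ.<-≤-trans 0<1 (subst (λ y → 1ℚ ≤q y) (trans (cong (_* δ q' (o p)) z) (ℚₚ.*-identityˡ (δ q' (o p)))) key))
      lem : ∀ a b c → a - b ≡ c - (- a) → - b ≡ c
      lem a b c z = trans (l a b) (trans (cong (_- a) z) (l' a c))
        where
        l : ∀ a b → - b ≡ a - b - a
        l = solve-∀ ℚ-ring
        l' : ∀ a c → c - (- a) - a ≡ c
        l' = solve-∀ ℚ-ring

  -- The value is 2, or 4 for a mirror pair of a symmetric system; this is how long roots are
  -- recognised.
  root-norm : ∀ {p q} → p ≢ q → ⟨ root p q , root p q ⟩ ≡ 2ℚ + 2ℚ * (φ * δ q (o p))
  root-norm {p} {q} ne = begin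
    ⟨ root p q , root p q ⟩ ≡⟨ ip--ʳ (e p) (e q) (root p q) ⟩
    ⟨ root p q , e p ⟩ - ⟨ root p q , e q ⟩ ≡⟨ cong₂ _-_ (root-e p q p) (root-e p q q) ⟩
    ((δ p p - φ * δ p (o p)) - (δ q p - φ * δ q (o p))) - ((δ p q - φ * δ p (o q)) - (δ q q - φ * δ q (o q)))
      ≡⟨ cong₂ _-_
           (cong₂ (λ x y → x - (y - φ * δ q (o p))) (cong₂ _-_ (δ-refl p) (φ-self p)) (δ-≢ (λ z → ne (sym z))))
           (cong₂ _-_ (cong₂ (λ x y → x - φ * y) (δ-≢ ne) (trans (sym (δ-o p q)) (δ-sym (o p) q))) (cong₂ _-_ (δ-refl q) (φ-self q))) ⟩
    ((1ℚ - 0ℚ) - (0ℚ - φ * δ q (o p))) - ((0ℚ - φ * δ q (o p)) - (1ℚ - 0ℚ)) ≡⟨ lem (φ * δ q (o p)) ⟩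
    2ℚ + 2ℚ * (φ * δ q (o p)) ∎
    where
    open ≡-Reasoning
    lem : ∀ a → ((1ℚ - 0ℚ) - (0ℚ - a)) - ((0ℚ - a) - (1ℚ - 0ℚ)) ≡ 2ℚ + 2ℚ * a
    lem = solve-∀ ℚ-ring

  root-norm-≢0 : ∀ {p q} → p ≢ q → ⟨ root p q , root p q ⟩ ≢ 0ℚ
  root-norm-≢0 {p} {q} ne z = ℚₚ.<-irrefl {0ℚ} refl (ℚₚ.<-≤-trans (ℚₚ.positive⁻¹ 2ℚ) (subst (2ℚ ≤q_) (trans (sym (root-norm ne)) z)
    (≤-by {2ℚ} (2ℚ * (φ * δ q (o p))) (*-nonneg {2ℚ} (ℚₚ.nonNegative⁻¹ 2ℚ) (*-nonneg φ-nonneg (ind-nonneg (q == o p)))) refl)))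

  module _ {p q : Fin M} (p≢q : p ≢ q) where

    e-root : ∀ r → ⟨ e r , root p q ⟩ ≡ (δ r p - φ * δ r (o p)) - (δ r q - φ * δ r (o q))
    e-root r = trans (ip--ʳ (e p) (e q) (e r)) (cong₂ _-_ (gram r p) (gram r q))

    joined-coef : symm ≡ false ⊎ (symm ≡ true × q ≡ o p) → ∀ r → coef (e r) (root p q) ≡ δ r p - δ r q
    joined-coef c r = coef-≡ {x = e r} {β = root p q} (root-norm-≢0 p≢q)
      (trans (cong ((δ r p - δ r q) *_) (root-norm p≢q)) (trans (go c) (cong (2ℚ *_) (sym (e-root r)))))
      where
      go : symm ≡ false ⊎ (symm ≡ true × q ≡ o p) → (δ r p - δ r q) * (2ℚ + 2ℚ * (φ * δ q (o p))) ≡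
        2ℚ * ((δ r p - φ * δ r (o p)) - (δ r q - φ * δ r (o q)))
      go (inj₁ s) rewrite s = lem (δ r p) (δ r q) (δ q (o p)) (δ r (o p)) (δ r (o q))
        where
        lem : ∀ a b x y z → (a - b) * (2ℚ + 2ℚ * (0ℚ * x)) ≡ 2ℚ * ((a - 0ℚ * y) - (b - 0ℚ * z))
        lem = solve-∀ ℚ-ring
      go (inj₂ (s , refl)) rewrite s | δ-refl (o p) | o-o p = lem (δ r p) (δ r (o p))
        where
        lem : ∀ a b → (a - b) * (2ℚ + 2ℚ * (1ℚ * 1ℚ)) ≡ 2ℚ * ((a - 1ℚ * b) - (b - 1ℚ * a))
        lem = solve-∀ ℚ-ring

    sep-coef : symm ≡ true → q ≢ o p → ∀ r → coef (e r) (root p q) ≡ (δ r p - δ r (o p)) - (δ r q - δ r (o q))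
    sep-coef s ne r = coef-≡ {x = e r} {β = root p q} (root-norm-≢0 p≢q) (trans
      (cong (((δ r p - δ r (o p)) - (δ r q - δ r (o q))) *_) (trans (root-norm p≢q) (cong (λ z → 2ℚ + 2ℚ * (φ * z)) (δ-≢ ne))))
      (trans (lem (δ r p) (δ r (o p)) (δ r q) (δ r (o q)) φ)
        (cong (2ℚ *_) (trans (cong (λ z → (δ r p - z * δ r (o p)) - (δ r q - z * δ r (o q))) (sym (cong ind s))) (sym (e-root r))))))
      where
      lem : ∀ a b c d f → ((a - b) - (c - d)) * (2ℚ + 2ℚ * (f * 0ℚ)) ≡ 2ℚ * ((a - 1ℚ * b) - (c - 1ℚ * d))
      lem = solve-∀ ℚ-ring

    -- This turns a linear reflection into the permutation `rf`, so that arguments about words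
    -- become arguments about positions.
    sref-e : ∀ r → sref (root p q) (e r) ≐ e (rf p q r)
    sref-e r k with separation p q
    ... | joined c eq = trans (cong (λ z → e r k - z * (e p k - e q k)) (joined-coef c r)) (trans (go r) (cong (λ z → e z k) (sym (eq r))))
      where
      l₁ : ∀ a b → a - (1ℚ - 0ℚ) * (a - b) ≡ b
      l₁ = solve-∀ ℚ-ring
      l₂ : ∀ a b → b - (0ℚ - 1ℚ) * (a - b) ≡ a
      l₂ = solve-∀ ℚ-ring
      l₃ : ∀ a b c → c - (0ℚ - 0ℚ) * (a - b) ≡ c
      l₃ = solve-∀ ℚ-ring
      go : ∀ r → e r k - (δ r p - δ r q) * (e p k - e q k) ≡ e (tr p q r) k
      go r with r Fin.≟ p | r Fin.≟ q
      ... | yes refl | yes e' = contradiction e' p≢q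
      ... | yes refl | no _ = l₁ (e p k) (e q k)
      ... | no _ | yes refl = l₂ (e p k) (e q k)
      ... | no _ | no _ = l₃ (e p k) (e q k) (e r k)
    ... | sep s ne eq = trans (cong (λ z → e r k - z * (e p k - e q k)) (sep-coef s ne r)) (trans (go r) (cong (λ z → e z k) (sym (eq r))))
      where
      p≢op : p ≢ o p
      p≢op z = opp-free s p (sym z)
      q≢oq : q ≢ o q
      q≢oq z = opp-free s q (sym z)
      p≢oq : p ≢ o q
      p≢oq z = ne (sym (trans (cong o z) (o-o q)))
      op≢oq : o p ≢ o q
      op≢oq z = p≢q (o-inj z)
      l₁ : ∀ a b → a - ((1ℚ - 0ℚ) - (0ℚ - 0ℚ)) * (a - b) ≡ b
      l₁ = solve-∀ ℚ-ring
      l₂ : ∀ a b → b - ((0ℚ - 0ℚ) - (1ℚ - 0ℚ)) * (a - b) ≡ a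
      l₂ = solve-∀ ℚ-ring
      l₃ : ∀ a b → - a - ((0ℚ - 1ℚ) - (0ℚ - 0ℚ)) * (a - b) ≡ - b
      l₃ = solve-∀ ℚ-ring
      l₄ : ∀ a b → - b - ((0ℚ - 0ℚ) - (0ℚ - 1ℚ)) * (a - b) ≡ - a
      l₄ = solve-∀ ℚ-ring
      l₅ : ∀ a b c → c - ((0ℚ - 0ℚ) - (0ℚ - 0ℚ)) * (a - b) ≡ c
      l₅ = solve-∀ ℚ-ring
      go : ∀ r → e r k - ((δ r p - δ r (o p)) - (δ r q - δ r (o q))) * (e p k - e q k) ≡ e (tr p q (tr (o q) (o p) r)) k
      go r with r Fin.≟ p | r Fin.≟ q | r Fin.≟ o p | r Fin.≟ o q
      ... | yes refl | yes z | _ | _ = contradiction z p≢q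
      ... | yes refl | no _ | yes z | _ = contradiction z p≢op
      ... | yes refl | no _ | no _ | yes z = contradiction z p≢oq
      ... | yes refl | no _ | no _ | no _ = trans (l₁ (e p k) (e q k)) (cong (λ z → e z k) (sym (tr-left p q)))
      ... | no _ | yes refl | yes z | _ = contradiction z ne
      ... | no _ | yes refl | no _ | yes z = contradiction z q≢oq
      ... | no _ | yes refl | no _ | no _ = trans (l₂ (e p k) (e q k)) (cong (λ z → e z k) (sym (tr-right p q)))
      ... | no _ | no _ | yes refl | yes z = contradiction z op≢oq
      ... | no _ | no _ | yes refl | no _ = trans (cong (λ z → z - ((0ℚ - 1ℚ) - (0ℚ - 0ℚ)) * (e p k - e q k)) (e-opp s p k))
              (trans (l₃ (e p k) (e q k)) (trans (sym (e-opp s q k)) (cong (λ z → e z k) (sym (tr-other (λ z → p≢oq (sym z)) (λ z → q≢oq (sym z)))))))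
      ... | no _ | no _ | no _ | yes refl = trans (cong (λ z → z - ((0ℚ - 0ℚ) - (0ℚ - 1ℚ)) * (e p k - e q k)) (e-opp s q k))
              (trans (l₄ (e p k) (e q k)) (trans (sym (e-opp s p k)) (cong (λ z → e z k) (sym (tr-other (λ z → p≢op (sym z)) (λ z → ne (sym z)))))))
      ... | no np | no nq | no _ | no _ = trans (l₅ (e p k) (e q k) (e r k)) (cong (λ z → e z k) (sym (tr-other np nq)))

  -- Read off from the linear reflection through `e-inj`, which avoids a case analysis on `rf`.
  rf-invol : ∀ {p q} → p ≢ q → ∀ r → rf p q (rf p q r) ≡ r
  rf-invol {p} {q} ne r = e-inj (≐-trans (≐-sym (sref-e ne (rf p q r))) (≐-trans
    (sref-cong {β = root p q} {γ = root p q} ≐-refl (≐-sym (sref-e ne r))) (sref-invol (root p q) (e r) (root-norm-≢0 ne))))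

  rf-opp : ∀ {p q} → p ≢ q → symm ≡ true → ∀ r → rf p q (o r) ≡ o (rf p q r)
  rf-opp {p} {q} ne s r = e-inj (≐-trans (≐-sym (sref-e ne (o r))) (≐-trans
    (sref-cong {β = root p q} {γ = root p q} ≐-refl (e-opp s r)) (≐-trans (LinearMap.map-neg (sref-map (root p q)) (e r))
    (≐-trans (negv-cong (sref-e ne r)) (≐-sym (e-opp s (rf p q r)))))))

-- The Weyl group as permutations of positions

module Weyl {R : RootData} (𝓜 : Model R) where
  open Generic 𝓜 public

  left right : Fin rank → Fin M
  left j  = inject₁ (node j)
  right j = suc (node j)

  adjacent : ∀ (k : Fin m) → toℕ (suc k) ≡ suc (toℕ (inject₁ k))
  adjacent k = cong suc (sym (Finₚ.toℕ-inject₁ k))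

  adjacent-< : ∀ (k : Fin m) → inject₁ k Fin.< suc k
  adjacent-< k = subst (toℕ (inject₁ k) ℕ.<_) (sym (adjacent k)) (ℕₚ.n<1+n (toℕ (inject₁ k)))

  adjacent-≢ : ∀ (k : Fin m) → inject₁ k ≢ suc k
  adjacent-≢ k e = ℕₚ.<-irrefl (cong toℕ e) (adjacent-< k)

  <⇒≢ᶠ : ∀ {p q : Fin M} → p Fin.< q → p ≢ q
  <⇒≢ᶠ l e = ℕₚ.<-irrefl (cong toℕ e) l

  τ : Fin rank → Fin M → Fin M
  τ j = rf (left j) (right j)

  τ-invol : ∀ j r → τ j (τ j r) ≡ r
  τ-invol j = rf-invol (adjacent-≢ (node j))

  open Words τ τ-invol public

  simple-norm : ∀ j → ⟨ simple j , simple j ⟩ ≢ 0ℚ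
  simple-norm j z = root-norm-≢0 (adjacent-≢ (node j)) (trans (ip-cong (≐-sym (simple-e j)) (≐-sym (simple-e j))) z)

  sref-simple : ∀ j r → sref (simple j) (e r) ≐ e (τ j r)
  sref-simple j r = ≐-trans (sref-cong (simple-e j) (≐-refl {u = e r})) (sref-e (adjacent-≢ (node j)) r)

  letter-τ : ∀ {j p q} → p ≢ q → simple j ≐ root p q → ∀ r → τ j r ≡ rf p q r
  letter-τ {j} ne h r = e-inj (≐-trans (≐-sym (sref-simple j r)) (≐-trans (sref-cong h (≐-refl {u = e r})) (sref-e ne r)))

  actW-map : ∀ w → LinearMap (actW w)
  actW-map [] = record { map-cong = id ; map-+ = λ u v → ≐-refl ; map-· = λ c u → ≐-refl }
  actW-map (j ∷ w) = record
    { map-cong = λ h → S.map-cong (W.map-cong h)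
    ; map-+ = λ u v → ≐-trans (S.map-cong (W.map-+ u v)) (S.map-+ (actW w u) (actW w v))
    ; map-· = λ c u → ≐-trans (S.map-cong (W.map-· c u)) (S.map-· c (actW w u)) }
    where
    module S = LinearMap (sref-map (simple j))
    module W = LinearMap (actW-map w)

  actW-cong : ∀ w {x y} → x ≐ y → actW w x ≐ actW w y
  actW-cong w = LinearMap.map-cong (actW-map w)

  actW-e : ∀ w r → actW w (e r) ≐ e (act w r)
  actW-e [] r = ≐-refl
  actW-e (j ∷ w) r = ≐-trans (LinearMap.map-cong (sref-map (simple j)) (actW-e w r)) (sref-simple j (act w r))

  actW-root : ∀ w p q → actW w (root p q) ≐ root (act w p) (act w q)
  actW-root w p q = ≐-trans (LinearMap.map-- (actW-map w) (e p) (e q)) (-v-cong (actW-e w p) (actW-e w q))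

  actW-++ : ∀ u w x → actW (u ++ w) x ≡ actW u (actW w x)
  actW-++ [] w x = refl
  actW-++ (j ∷ u) w x = cong (sref (simple j)) (actW-++ u w x)

  actW-reverse : ∀ w x → actW (reverse w) (actW w x) ≐ x
  actW-reverse [] x = ≐-refl
  actW-reverse (j ∷ w) x = ≐-trans (λ k → cong (λ y → y k)
      (trans (cong (λ z → actW z (actW (j ∷ w) x)) (Listₚ.unfold-reverse j w)) (actW-++ (reverse w) (j ∷ []) (actW (j ∷ w) x))))
    (≐-trans (actW-cong (reverse w) (sref-invol (simple j) (actW w x) (simple-norm j))) (actW-reverse w x))

  reverse-actW : ∀ w x → actW w (actW (reverse w) x) ≐ x
  reverse-actW w x = subst (λ z → actW z (actW (reverse w) x) ≐ x) (Listₚ.reverse-involutive w) (actW-reverse (reverse w) x)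

  actW-isometry : ∀ w x y → ⟨ actW w x , actW w y ⟩ ≡ ⟨ x , y ⟩
  actW-isometry [] x y = refl
  actW-isometry (j ∷ w) x y = trans (sref-isometry (simple j) (actW w x) (actW w y) (simple-norm j)) (actW-isometry w x y)

  toℕ-opp : ∀ (r : Fin M) → toℕ r ℕ.+ toℕ (o r) ≡ m
  toℕ-opp r = trans (cong (toℕ r ℕ.+_) (Finₚ.opposite-prop r)) (ℕₚ.m+[n∸m]≡n (Finₚ.toℕ≤pred[n] r))

  -- Only the pair of `k` and its mirror image are reversed, and both have the same root.
  flipped : ∀ {k p q} → p Fin.< q → τ k q Fin.< τ k p → simple k ≐ root p q
  flipped {k} {p} {q} lt fl with rf-order toℕ Finₚ.toℕ-injective (λ _ r s → trans (toℕ-opp r) (sym (toℕ-opp s)))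
                                   (adjacent (node k)) {p} {q} lt fl
  ... | inj₁ (refl , refl) = simple-e k
  ... | inj₂ (s , refl , refl) = ≐-trans (simple-e k) (≐-sym (root-opp s (left k) (right k)))

  -- The conjugate by `w` of a reflection is the reflection in the image root: `w` is an isometry
  -- and preserves the coefficient `coef`.
  conjugate : ∀ {k w j} → simple k ≐ actW w (simple j) → ∀ v → actW w (sref (simple j) v) ≐ sref (simple k) (actW w v)
  conjugate {k} {w} {j} h v = ≐-trans (LinearMap.map-- (actW-map w) v (coef v (simple j) ·v simple j))
    (-v-cong {u = actW w v} ≐-refl (≐-trans (LinearMap.map-· (actW-map w) (coef v (simple j)) (simple j))
      (·v-cong (sym coefs) (≐-sym h))))
    where
    coefs : coef (actW w v) (simple k) ≡ coef v (simple j)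
    coefs = trans (coef-cong (≐-refl {u = actW w v}) h)
      (cong₂ divq (cong (2ℚ *_) (actW-isometry w v (simple j))) (actW-isometry w (simple j) (simple j)))

  -- The exchange condition
  exchange : ∀ w j {r s} → r Fin.< s → simple j ≐ root r s →
    act w r Fin.< act w s ⊎
    (∃ λ x → suc (length x) ≡ length w × (∀ v → actW x v ≐ actW w (sref (simple j) v)))
  exchange [] j lt h = inj₁ lt
  exchange (k ∷ w) j {r} {s} lt h = case exchange w j lt h of λ where
    (inj₂ (x , len , eq)) → inj₂ (k ∷ x , cong suc len , λ v → LinearMap.map-cong (sref-map (simple k)) (eq v))
    (inj₁ lt') → case ℕₚ.<-cmp (toℕ (τ k (act w r))) (toℕ (τ k (act w s))) of λ where
      (tri< l _ _) → inj₁ l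
      (tri≈ _ z _) → contradiction (act-inj (k ∷ w) (Finₚ.toℕ-injective z)) (<⇒≢ᶠ lt)
      -- Here `simple k` is the image of `simple j` under `w`, so the product of `k ∷ w` with the
      -- reflection in `simple j` is `w` itself: the letter `k` is deleted.
      (tri> _ _ g) → inj₂ (w , refl , λ v → ≐-trans (≐-sym (sref-invol (simple k) (actW w v) (simple-norm k)))
            (LinearMap.map-cong (sref-map (simple k)) (≐-sym (conjugate {k} {w} {j}
              (≐-trans (flipped lt' g) (≐-sym (≐-trans (actW-cong w h) (actW-root w r s)))) v))))

  -- The two blocks fixed by the parabolic subgroup of i

  h : Fin rank → ℕ
  h i = suc (toℕ (node i))

  inject₁-false : ∀ {k l : Fin m} → toℕ (inject₁ k) ℕ.< suc (toℕ l) → ¬ (suc (toℕ k) ℕ.< suc (toℕ l)) → k ≡ l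
  inject₁-false {k} {l} p q = Finₚ.toℕ-injective (ℕₚ.≤-antisym (subst (ℕ._≤ toℕ l) (Finₚ.toℕ-inject₁ k) (ℕₚ.≤-pred p)) (ℕₚ.≤-pred (ℕₚ.≮⇒≥ q)))

  adjacent-block : ∀ i k → k ≢ node i → SameBlock (h i) (inject₁ k) (suc k)
  adjacent-block i k ne = case suc (toℕ k) ℕ.<? h i of λ where
    (yes a) → trans (<ᵇ-true (ℕₚ.<-trans (adjacent-< k) a)) (sym (<ᵇ-true a))
    (no a)  → case toℕ (inject₁ k) ℕ.<? h i of λ where
      (no b)  → trans (<ᵇ-false (ℕₚ.≮⇒≥ b)) (sym (<ᵇ-false (ℕₚ.≮⇒≥ a)))
      (yes b) → contradiction (inject₁-false b a) ne

  first-block : ∀ i → (toℕ (left i) ℕ.<ᵇ h i) ≡ true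
  first-block i = <ᵇ-true (subst (ℕ._< h i) (sym (Finₚ.toℕ-inject₁ (node i))) (ℕₚ.n<1+n (toℕ (node i))))

  second-block : ∀ i → (toℕ (right i) ℕ.<ᵇ h i) ≡ false
  second-block i = <ᵇ-false {h i} ℕₚ.≤-refl

  opp-last : o last ≡ zero
  opp-last = o-o zero

  module Block (i : Fin rank) (long : Long i) where

    H : ℕ
    H = h i

    -- `long` gives `simple i` the norm of `θ`, and in a symmetric system `root-norm` reaches this
    -- value only at mirror pairs.
    middle : symm ≡ true → right i ≡ o (left i)
    middle s = δ-pos (subst (0ℚ <_) (sym δ≡1) 0<1)
      where
      norms : 2ℚ + 2ℚ * (φ * δ (right i) (o (left i))) ≡ 2ℚ + 2ℚ * (φ * δ last (o zero))
      norms = trans (sym (root-norm (adjacent-≢ (node i)))) (trans (ip-cong (≐-sym (simple-e i)) (≐-sym (simple-e i)))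
        (trans long (trans (ip-cong θ-e θ-e) (root-norm first≢last))))
      lem : ∀ a → ½ * (2ℚ + 2ℚ * (1ℚ * a)) - 1ℚ ≡ a
      lem = solve-∀ ℚ-ring
      δ≡1 : δ (right i) (o (left i)) ≡ 1ℚ
      δ≡1 = trans (sym (lem (δ (right i) (o (left i)))))
        (trans (cong (λ z → ½ * z - 1ℚ) (subst (λ f → 2ℚ + 2ℚ * (f * δ (right i) (o (left i))) ≡ 2ℚ + 2ℚ * (f * δ last (o zero))) (cong ind s) norms))
        (trans (lem (δ last (o zero))) (δ-refl last)))

    -- The cut of a long simple root lies in the centre, so the mirror exchanges the two blocks.
    block-opp : symm ≡ true → ∀ r → (toℕ (o r) ℕ.<ᵇ H) ≡ not (toℕ r ℕ.<ᵇ H)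
    block-opp s r = case toℕ r ℕ.<? H of λ where
        (yes p) → trans (<ᵇ-false {toℕ (o r)} {H} (ℕₚ.+-cancelˡ-≤ (toℕ (node i)) _ _ (begin
          toℕ (node i) ℕ.+ H         ≡⟨ half ⟩
          m                          ≡⟨ toℕ-opp r ⟨
          toℕ r ℕ.+ toℕ (o r)        ≤⟨ ℕₚ.+-monoˡ-≤ (toℕ (o r)) (ℕₚ.≤-pred p) ⟩
          toℕ (node i) ℕ.+ toℕ (o r) ∎))) (sym (cong not (<ᵇ-true p)))
        (no ¬p) → trans (<ᵇ-true {toℕ (o r)} {H} (ℕ.s≤s (ℕₚ.+-cancelˡ-≤ H _ _ (begin
          H ℕ.+ toℕ (o r)            ≤⟨ ℕₚ.+-monoˡ-≤ (toℕ (o r)) (ℕₚ.≮⇒≥ ¬p) ⟩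
          toℕ r ℕ.+ toℕ (o r)        ≡⟨ toℕ-opp r ⟩
          m                          ≡⟨ half ⟨
          toℕ (node i) ℕ.+ H         ≡⟨ ℕₚ.+-comm (toℕ (node i)) H ⟩
          H ℕ.+ toℕ (node i)         ∎)))) (sym (cong not (<ᵇ-false (ℕₚ.≮⇒≥ ¬p))))
      where
      open ℕₚ.≤-Reasoning
      half : toℕ (node i) ℕ.+ H ≡ m
      half = trans (cong₂ ℕ._+_ (sym (Finₚ.toℕ-inject₁ (node i))) (cong toℕ (middle s))) (toℕ-opp (left i))

    tr-block : ∀ (p q : Fin M) → SameBlock H p q → ∀ r → SameBlock H (tr p q r) r
    tr-block p q same r with r Fin.≟ p | r Fin.≟ q
    ... | yes refl | _ = sym same
    ... | no _ | yes refl = same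
    ... | no _ | no _ = refl

    rf-block : ∀ (p q : Fin M) → SameBlock H p q → ∀ r → SameBlock H (rf p q r) r
    rf-block p q same r = case separation p q of λ where
      (joined _ eq) → trans (cong (λ z → toℕ z ℕ.<ᵇ H) (eq r)) (tr-block p q same r)
      (sep s _ eq)  → trans (cong (λ z → toℕ z ℕ.<ᵇ H) (eq r)) (trans (tr-block p q same (tr (o q) (o p) r))
            (tr-block (o q) (o p) (trans (block-opp s q) (trans (cong not (sym same)) (sym (block-opp s p)))) r))

    τ-block : ∀ {j} → j ≢ i → ∀ r → SameBlock H (τ j r) r
    τ-block {j} ne = rf-block (left j) (right j) (adjacent-block i (node j) (λ z → ne (node-inj z)))

    -- A root fixes its pair up to the mirror, and the pair of `i` is its own mirror image by
    -- `middle`.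
    letter-≢ : ∀ {j k} → simple j ≐ root (inject₁ k) (suc k) → k ≢ node i → j ≢ i
    letter-≢ {j} {k} eq ne refl = case root-≡ (adjacent-≢ (node i)) (≐-trans (≐-sym (simple-e i)) eq) of λ where
      (inj₁ (_ , z)) → ne (sym (Finₚ.suc-injective z))
      (inj₂ (s , z , _)) → ne (sym (Finₚ.suc-injective (trans (middle s) (trans (cong o z) (o-o (suc k))))))

    -- Monotonicity spreads from adjacent pairs; the pair astride the cut is the only one that never
    -- occurs inside a block.
    blockwise : ∀ (f : Fin M → Fin M) → (∀ k → k ≢ node i → f (inject₁ k) Fin.< f (suc k)) → BlockIncreasing H f
    blockwise f one p q same lt = go (toℕ q) q refl same lt
      where
      go : ∀ n q → toℕ q ≡ n → SameBlock H p q → p Fin.< q → f p Fin.< f q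
      go zero zero _ _ ()
      go (suc n) (suc k) z same lt = case k Fin.≟ node i of λ where
        (yes refl) → contradiction (<ᵇ-true⁻¹ {toℕ p} {H} (<ᵇ-true lt)) (ℕₚ.≤⇒≯ (<ᵇ-false⁻¹ {toℕ p} {H} (trans same (second-block i))))
        (no ne) → case p Fin.≟ inject₁ k of λ where
          (yes refl) → one k ne
          (no p≢k) → ℕₚ.<-trans (go n (inject₁ k) (trans (Finₚ.toℕ-inject₁ k) (ℕₚ.suc-injective z))
                (trans same (sym (adjacent-block i k ne)))
                (ℕₚ.≤∧≢⇒< (subst (toℕ p ℕ.≤_) (sym (Finₚ.toℕ-inject₁ k)) (ℕₚ.≤-pred lt)) (λ y → p≢k (Finₚ.toℕ-injective y))))
                (one k ne)

    -- If an adjacent pair inside a block were reversed, `exchange` would give a shorter word for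
    -- `w` times a letter other than `i`, against minimality in the coset.
    minrep-increasing : ∀ {w} → MinRep i w → BlockIncreasing H (act w)
    minrep-increasing {w} mr = blockwise (act w) λ k ne →
      let j , eq = letter k in case exchange w j (adjacent-< k) eq of λ where
        (inj₁ l) → l
        (inj₂ (x , len , xs)) → contradiction (mr (j ∷ []) (letter-≢ eq ne ∷ []) x xs) (ℕₚ.<⇒≱ (ℕₚ.≤-reflexive len))

  -- The affine Weyl group as permutations with levels

  τ̂ : Fin (suc rank) → Fin M → Fin M
  τ̂ zero    = rf last zero
  τ̂ (suc j) = τ j

  last≢first : last ≢ zero
  last≢first z = first≢last (sym z)

  τ̂-invol : ∀ j r → τ̂ j (τ̂ j r) ≡ r
  τ̂-invol zero    = rf-invol last≢first
  τ̂-invol (suc j) = τ-invol j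

  τ̂-opp : symm ≡ true → ∀ j r → τ̂ j (o r) ≡ o (τ̂ j r)
  τ̂-opp s zero    = rf-opp last≢first s
  τ̂-opp s (suc j) = rf-opp (adjacent-≢ (node j)) s

  module Aff = Words τ̂ τ̂-invol

  bit : Bool → ℤ
  bit true  = ℤ.+ 1
  bit false = ℤ.+ 0

  toQ-bit : ∀ b → toQ (bit b) ≡ ind b
  toQ-bit true  = refl
  toQ-bit false = refl

  -- Distributes the change of the δ-coefficient of `root p q` over its two end points: only the
  -- reflection in `α₀` alters it, and only through the first and the last position.
  shift : Fin (suc rank) → Fin M → ℤ
  shift zero    r = bit (r == zero) ℤ.- bit (r == last)
  shift (suc j) r = ℤ.+ 0

  -- The translation part of an affine permutation: the word permutes the positions of `root p q`
  -- and adds `level u p - level u q` to the coefficient of δ.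
  level : List (Fin (suc rank)) → Fin M → ℤ
  level []      r = ℤ.+ 0
  level (j ∷ u) r = level u r ℤ.+ shift j (Aff.act u r)

  ≐h-trans : ∀ {x y z} → x ≐h y → y ≐h z → x ≐h z
  ≐h-trans (a , b) (c , d) = ≐-trans a c , trans b d

  ≐h-sym : ∀ {x y} → x ≐h y → y ≐h x
  ≐h-sym (a , b) = ≐-sym a , sym b

  srefh-cong : ∀ β {x y} → x ≐h y → srefh β x ≐h srefh β y
  srefh-cong (β , k) {x , d} {y , d'} (a , b) = sref-cong {β = β} {γ = β} ≐-refl a ,
    cong₂ _-_ b (cong (_* k) (coef-cong {x = x} {y = y} {β = β} a ≐-refl))

  -θ-root : (-v θ) ≐ root last zero
  -θ-root = ≐-trans (negv-cong θ-e) (neg-root zero last)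

  srefh-root : ∀ j p q z → srefh (affSimple j) (root p q , toQ z) ≐h
    (root (τ̂ j p) (τ̂ j q) , toQ (z ℤ.+ (shift j p ℤ.- shift j q)))
  srefh-root zero p q z = ≐-trans (sref-cong {β = -v θ} {γ = root last zero} {x = root p q} -θ-root ≐-refl)
      (≐-trans (LinearMap.map-- (sref-map (root last zero)) (e p) (e q)) (-v-cong (sref-e last≢first p) (sref-e last≢first q))) ,
    (begin
      toQ z - coef (root p q) (-v θ) * 1ℚ
        ≡⟨ cong (λ y → toQ z - y * 1ℚ) (trans (coef-cong {x = root p q} ≐-refl -θ-root)
             (trans (LinearForm.form-- (coef-form (root last zero)) (e p) (e q)) (cong₂ _-_ (c p) (c q)))) ⟩
      toQ z - ((δ p last - δ p zero) - (δ q last - δ q zero)) * 1ℚ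
        ≡⟨ lem (toQ z) (δ p last) (δ p zero) (δ q last) (δ q zero) ⟩
      toQ z + ((δ p zero - δ p last) - (δ q zero - δ q last))
        ≡⟨ cong (toQ z +_) (cong₂ _-_ (s p) (s q)) ⟨
      toQ z + (toQ (shift zero p) - toQ (shift zero q))
        ≡⟨ trans (toQ-+ z (shift zero p ℤ.- shift zero q)) (cong (toQ z +_) (toQ-- (shift zero p) (shift zero q))) ⟨
      toQ (z ℤ.+ (shift zero p ℤ.- shift zero q)) ∎)
    where
    open ≡-Reasoning
    c : ∀ r → coef (e r) (root last zero) ≡ δ r last - δ r zero
    c = joined-coef last≢first (Sum.map₂ id (aux symm refl))
      where
      aux : ∀ b → symm ≡ b → symm ≡ false ⊎ (symm ≡ true × zero ≡ o last)
      aux true  s = inj₂ (s , sym opp-last)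
      aux false s = inj₁ s
    s : ∀ r → toQ (shift zero r) ≡ δ r zero - δ r last
    s r = trans (toQ-- (bit (r == zero)) (bit (r == last))) (cong₂ _-_ (toQ-bit (r == zero)) (toQ-bit (r == last)))
    lem : ∀ z a b c d → z - ((a - b) - (c - d)) * 1ℚ ≡ z + ((b - a) - (d - c))
    lem = solve-∀ ℚ-ring
  srefh-root (suc j) p q z = ≐-trans (LinearMap.map-- (sref-map (simple j)) (e p) (e q)) (-v-cong (sref-simple j p) (sref-simple j q)) ,
    trans (cong (λ y → toQ z - y) (ℚₚ.*-zeroʳ (coef (root p q) (simple j)))) (trans (ℚₚ.+-identityʳ (toQ z)) (cong toQ (sym (ℤₚ.+-identityʳ z))))

  actŴ-root : ∀ u {x d} p q z → (x , d) ≐h (root p q , toQ z) →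
    actŴ u (x , d) ≐h (root (Aff.act u p) (Aff.act u q) , toQ (z ℤ.+ (level u p ℤ.- level u q)))
  actŴ-root [] p q z eq = ≐h-trans eq (≐-refl , cong toQ (sym (ℤₚ.+-identityʳ z)))
  actŴ-root (j ∷ u) p q z eq = ≐h-trans (srefh-cong (affSimple j) (actŴ-root u p q z eq))
    (≐h-trans (srefh-root j (Aff.act u p) (Aff.act u q) (z ℤ.+ (level u p ℤ.- level u q)))
      (≐-refl , cong toQ (lem z (level u p) (level u q) (shift j (Aff.act u p)) (shift j (Aff.act u q)))))
    where
    lem : ∀ z a b c d → z ℤ.+ (a ℤ.- b) ℤ.+ (c ℤ.- d) ≡ z ℤ.+ ((a ℤ.+ c) ℤ.- (b ℤ.+ d))
    lem = ℤ-Solver.solve-∀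

  -- The shifts of `α₀` are 1 and -1, and permuting the positions does not alter their total.
  level-sum : ∀ u → sumℚ (λ r → toQ (level u r)) ≡ 0ℚ
  level-sum [] = sum-zero {M} (λ _ → refl)
  level-sum (j ∷ u) = trans (sum-cong (λ r → toQ-+ (level u r) (shift j (Aff.act u r))))
    (trans (sum-+ (λ r → toQ (level u r)) (λ r → toQ (shift j (Aff.act u r))))
    (trans (cong₂ _+_ (level-sum u) (trans (Aff.act-sum u (λ r → toQ (shift j r))) (shift-sum j))) (ℚₚ.+-identityˡ 0ℚ)))
    where
    shift-sum : ∀ j → sumℚ (λ r → toQ (shift j r)) ≡ 0ℚ
    shift-sum zero = trans (sum-cong (λ r → trans (toQ-- (bit (r == zero)) (bit (r == last)))
        (cong₂ _-_ (trans (toQ-bit (r == zero)) (δ-sym r zero)) (trans (toQ-bit (r == last)) (δ-sym r last)))))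
      (trans (sum-- (δ zero) (δ last)) (trans (cong₂ _-_ (sum-δ1 {M} zero) (sum-δ1 last)) (ℚₚ.+-inverseʳ 1ℚ)))
    shift-sum (suc j) = sum-zero {M} (λ _ → refl)

AffinePositive : ∀ {M} → Fin M → Fin M → ℤ → Set
AffinePositive p q z = (z ≡ ℤ.+ 0 × p Fin.< q) ⊎ (∃ λ k → z ≡ ℤ.+ suc k)

affine-nonneg : ∀ {M} {p q : Fin M} {z} → AffinePositive p q z → ∃ λ n → z ≡ ℤ.+ n
affine-nonneg (inj₁ (e , _)) = 0 , e
affine-nonneg (inj₂ (k , e)) = suc k , e

affine-dichotomy : ∀ {M} {p q : Fin M} z → p ≢ q → AffinePositive p q z ⊎ AffinePositive q p (ℤ.- z)
affine-dichotomy {p = p} {q} (ℤ.+ zero) ne with ℕₚ.<-cmp (toℕ p) (toℕ q)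
... | tri< l _ _ = inj₁ (inj₁ (refl , l))
... | tri≈ _ e _ = contradiction (Finₚ.toℕ-injective e) ne
... | tri> _ _ g = inj₂ (inj₁ (refl , g))
affine-dichotomy (ℤ.+ suc k) ne = inj₁ (inj₂ (k , refl))
affine-dichotomy ℤ.-[1+ k ]  ne = inj₂ (inj₂ (k , refl))

-- An element of the affine Weyl group permutes the positions by v while shifting the coefficients of δ by lev.
-- The idea is that it leaves the functional e r + kδ ↦ [r < h] + k invariant: [v r < h] + lev r takes the values
-- 0 and 1, is decreasing in r, and has the same sum as [r < h].

module LevelArgument {m : ℕ} (h : ℕ) (v : Fin (suc m) → Fin (suc m))
  (v-inj : ∀ {r s} → v r ≡ v s → r ≡ s)
  (v-sum : sumℚ (λ r → ind (toℕ (v r) ℕ.<ᵇ h)) ≡ sumℚ {suc m} (λ r → ind (toℕ r ℕ.<ᵇ h)))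
  (lev : Fin (suc m) → ℤ) (lev-sum : sumℚ (λ r → toQ (lev r)) ≡ 0ℚ)
  (In : Fin (suc m) → Fin (suc m) → Set)
  (level0 : ∀ p q → p Fin.< q → AffinePositive (v p) (v q) (lev p ℤ.- lev q))
  (In⇒ : ∀ p q → p Fin.< q → In p q → AffinePositive (v p) (v q) (ℤ.- (ℤ.+ 1 ℤ.+ (lev q ℤ.- lev p))))
  (⇒In : ∀ p q → p Fin.< q → AffinePositive (v p) (v q) (ℤ.- (ℤ.+ 1 ℤ.+ (lev q ℤ.- lev p))) → In p q)
  (v-first : toℕ (v zero) ≡ h) (v-last : suc (toℕ (v (fromℕ m))) ≡ h)
  (ends : lev zero ℤ.- lev (fromℕ m) ≡ ℤ.+ 2)
  where

  private
    last : Fin (suc m)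
    last = fromℕ m

    ≤-last : ∀ r → r ≢ last → r Fin.< last
    ≤-last r ne = ℕₚ.≤∧≢⇒< (Finₚ.≤fromℕ r) (λ e → ne (Finₚ.toℕ-injective e))

    >-first : ∀ (r : Fin (suc m)) → r ≢ zero → zero {m} Fin.< r
    >-first zero    ne = contradiction refl ne
    >-first (suc r) ne = ℕ.s≤s ℕ.z≤n

    below-first : ∀ r → ∃ λ n → lev zero ℤ.- lev r ≡ ℤ.+ n
    below-first r with r Fin.≟ zero
    ... | yes refl = 0 , ℤₚ.+-inverseʳ (lev zero)
    ... | no ne = affine-nonneg (level0 zero r (>-first r ne))

    above-last : ∀ r → ∃ λ n → lev r ℤ.- lev last ≡ ℤ.+ n
    above-last r with r Fin.≟ last
    ... | yes refl = 0 , ℤₚ.+-inverseʳ (lev last)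
    ... | no ne = affine-nonneg (level0 r last (≤-last r ne))

    not-constant : ¬ (∀ r → lev r ≡ ℤ.+ 0)
    not-constant z with trans (sym ends) (cong₂ ℤ._-_ (z zero) (z last))
    ... | ()

    -- The level is least at the last position. If it were nonnegative there, all levels would be
    -- nonnegative with sum zero, hence zero, against `ends`.
    last-negative : ∀ n → lev last ≢ ℤ.+ n
    last-negative n e = not-constant (λ r → toQ-injective (sum-nonneg-zero (λ s → nn s) lev-sum r))
      where
      lem : ∀ a b → a ≡ (a ℤ.- b) ℤ.+ b
      lem = ℤ-Solver.solve-∀
      nn : ∀ s → 0ℚ ≤q toQ (lev s)
      nn s with above-last s
      ... | k , e' = subst (0ℚ ≤q_) (cong toQ (sym (trans (lem (lev s) (lev last)) (cong₂ ℤ._+_ e' e)))) (toQ-nonneg (k ℕ.+ n))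

    first-positive : ∀ n → lev zero ≢ ℤ.- (ℤ.+ n)
    first-positive n e = not-constant (λ r → trans (sym (ℤₚ.neg-involutive (lev r))) (cong ℤ.-_ (toQ-injective {ℤ.- lev r} {ℤ.+ 0} (sum-nonneg-zero (λ s → nn s)
        (trans (sum-cong (λ s → toQ-neg (lev s))) (trans (sum-neg (λ s → toQ (lev s))) (cong -_ lev-sum))) r))))
      where
      lem : ∀ a b → ℤ.- b ≡ (a ℤ.- b) ℤ.+ (ℤ.- a)
      lem = ℤ-Solver.solve-∀
      nn : ∀ s → 0ℚ ≤q toQ (ℤ.- lev s)
      nn s with below-first s
      ... | k , e' = subst (0ℚ ≤q_) (cong toQ (sym (trans (lem (lev zero) (lev s)) (cong₂ ℤ._+_ e' (trans (cong ℤ.-_ e) (ℤₚ.neg-involutive (ℤ.+ n)))))))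
                       (toQ-nonneg (k ℕ.+ n))

    end-values : ∀ a c → lev zero ≡ a → lev last ≡ c → a ℤ.- c ≡ ℤ.+ 2 → lev zero ≡ ℤ.+ 1 × lev last ≡ ℤ.-[1+ 0 ]
    end-values a (ℤ.+ n) _ e' _ = contradiction e' (last-negative n)
    end-values (ℤ.+ zero) ℤ.-[1+ n ] e e' _ = contradiction e (first-positive 0)
    end-values ℤ.-[1+ k ] ℤ.-[1+ n ] e e' _ = contradiction e (first-positive (suc k))
    end-values (ℤ.+ suc zero) ℤ.-[1+ zero ] e e' _ = e , e'
    end-values (ℤ.+ suc zero) ℤ.-[1+ suc n ] e e' ()
    end-values (ℤ.+ suc (suc k)) ℤ.-[1+ n ] e e' z =
      case trans (sym (ℕₚ.+-suc k n)) (ℕₚ.suc-injective (ℕₚ.suc-injective (ℤₚ.+-injective z))) of λ ()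

    lev-first : lev zero ≡ ℤ.+ 1
    lev-first = proj₁ (end-values _ _ refl refl ends)

    lev-last : lev last ≡ ℤ.-[1+ 0 ]
    lev-last = proj₂ (end-values _ _ refl refl ends)

    -- Level 1 is that of the first position, whose image opens the second block; level -1 is that
    -- of the last position, whose image closes the first block. Between equal levels `level0`
    -- compares the images, which gives the side of the cut.
    data Level (r : Fin (suc m)) : Set where
      up   : lev r ≡ ℤ.+ 1 → h ℕ.≤ toℕ (v r) → Level r
      flat : lev r ≡ ℤ.+ 0 → Level r
      down : lev r ≡ ℤ.-[1+ 0 ] → toℕ (v r) ℕ.< h → Level r

    view : ∀ r → Level r
    view r = go (lev r) refl (below-first r) (above-last r)
      where
      go : ∀ z → lev r ≡ z → (∃ λ n → lev zero ℤ.- lev r ≡ ℤ.+ n) → (∃ λ n → lev r ℤ.- lev last ≡ ℤ.+ n) → Level r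
      go (ℤ.+ 0) e _ _ = flat e
      go (ℤ.+ 1) e _ _ with r Fin.≟ zero
      ... | yes refl = up e (ℕₚ.≤-reflexive (sym v-first))
      ... | no ne with level0 zero r (>-first r ne)
      ...   | inj₁ (_ , l) = up e (ℕₚ.<⇒≤ (subst (ℕ._< toℕ (v r)) v-first l))
      ...   | inj₂ (k , z) = case trans (sym (cong₂ ℤ._-_ lev-first e)) z of λ ()
      go (ℤ.+ suc (suc n)) e (k , z) _ = case trans (sym (cong₂ ℤ._-_ lev-first e)) z of λ ()
      go ℤ.-[1+ 0 ] e _ _ with r Fin.≟ last
      ... | yes refl = down e (ℕₚ.≤-reflexive v-last)
      ... | no ne with level0 r last (≤-last r ne)
      ...   | inj₁ (_ , l) = down e (ℕₚ.<-trans l (ℕₚ.≤-reflexive v-last))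
      ...   | inj₂ (k , z) = case trans (sym (cong₂ ℤ._-_ e lev-last)) z of λ ()
      go ℤ.-[1+ suc n ] e _ (k , z) = case trans (sym (cong₂ ℤ._-_ e lev-last)) z of λ ()

    g : ∀ {r} → Level r → Bool
    g {r} (up _ _)   = true
    g {r} (flat _)   = toℕ (v r) ℕ.<ᵇ h
    g {r} (down _ _) = false

    g-ind : ∀ {r} (l : Level r) → ind (g l) ≡ ind (toℕ (v r) ℕ.<ᵇ h) + toQ (lev r)
    g-ind (up e x) rewrite e | <ᵇ-false x = refl
    g-ind {r} (flat e) rewrite e = sym (ℚₚ.+-identityʳ (ind (toℕ (v r) ℕ.<ᵇ h)))
    g-ind (down e x) rewrite e | <ᵇ-true x = refl

    drop : ∀ {p q} → p Fin.< q → ∀ {a b} → lev p ≡ a → lev q ≡ b → AffinePositive (v p) (v q) (a ℤ.- b)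
    drop l refl refl = level0 _ _ l

    g-down : ∀ {p q} (lp : Level p) (lq : Level q) → p Fin.< q → g lq ≡ true → g lp ≡ true
    g-down (up _ _) lq l t = refl
    g-down {p} {q} (flat e) (flat e') l t with drop l e e'
    ... | inj₁ (_ , l') = <ᵇ-true (ℕₚ.<-trans l' (<ᵇ-true⁻¹ {toℕ (v q)} {h} t))
    g-down (flat e) (up e' _) l t with drop l e e'
    ... | inj₁ (() , _)
    ... | inj₂ (_ , ())
    g-down (down e _) (up e' _) l t with drop l e e'
    ... | inj₁ (() , _)
    ... | inj₂ (_ , ())
    g-down (down e _) (flat e') l t with drop l e e'
    ... | inj₁ (() , _)
    ... | inj₂ (_ , ())

    block : ∀ r → g (view r) ≡ (toℕ r ℕ.<ᵇ h)
    block = initial-unique h (λ r → g (view r)) mono sums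
      where
      mono : ∀ p q → p Fin.≤ q → g (view q) ≡ true → g (view p) ≡ true
      mono p q l t with p Fin.≟ q
      ... | yes refl = t
      ... | no ne = g-down (view p) (view q) (ℕₚ.≤∧≢⇒< l (λ e → ne (Finₚ.toℕ-injective e))) t
      sums : sumℚ (λ r → ind (g (view r))) ≡ sumℚ {suc m} (λ r → ind (toℕ r ℕ.<ᵇ h))
      sums = trans (sum-cong (λ r → g-ind (view r))) (trans (sum-+ (λ r → ind (toℕ (v r) ℕ.<ᵇ h)) (λ r → toQ (lev r)))
        (trans (cong₂ _+_ v-sum lev-sum) (ℚₚ.+-identityʳ _)))

    member : ∀ {p q} → p Fin.< q → ∀ {a b} → lev p ≡ a → lev q ≡ b → In p q → AffinePositive (v p) (v q) (ℤ.- (ℤ.+ 1 ℤ.+ (b ℤ.- a)))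
    member l refl refl = In⇒ _ _ l

    member⁻¹ : ∀ {p q} → p Fin.< q → ∀ {a b} → lev p ≡ a → lev q ≡ b → AffinePositive (v p) (v q) (ℤ.- (ℤ.+ 1 ℤ.+ (b ℤ.- a))) → In p q
    member⁻¹ l refl refl = ⇒In _ _ l

    -- Membership requires `lev p - lev q - 1` to be nonnegative, so the level drops from `p` to
    -- `q`. Where it drops by exactly one, the order of the images decides the blocks.
    rectangle′ : ∀ {p q} (lp : Level p) (lq : Level q) → p Fin.< q → In p q → g lp ≡ true × g lq ≡ false
    rectangle′ (up _ _) (down _ _) l i = refl , refl
    rectangle′ (up e x) (flat e') l i with member l e e' i
    ... | inj₁ (_ , l') = refl , <ᵇ-false (ℕₚ.<⇒≤ (ℕₚ.≤-<-trans x l'))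
    ... | inj₂ (_ , ())
    rectangle′ (flat e) (down e' x) l i with member l e e' i
    ... | inj₁ (_ , l') = <ᵇ-true (ℕₚ.<-trans l' x) , refl
    ... | inj₂ (_ , ())
    rectangle′ (up e _) (up e' _) l i with member l e e' i
    ... | inj₁ (() , _)
    ... | inj₂ (_ , ())
    rectangle′ (flat e) (flat e') l i with member l e e' i
    ... | inj₁ (() , _)
    ... | inj₂ (_ , ())
    rectangle′ (down e _) (down e' _) l i with member l e e' i
    ... | inj₁ (() , _)
    ... | inj₂ (_ , ())
    rectangle′ (flat e) (up e' _) l i with member l e e' i
    ... | inj₁ (() , _)
    ... | inj₂ (_ , ())
    rectangle′ (down e _) (up e' _) l i with member l e e' i
    ... | inj₁ (() , _)
    ... | inj₂ (_ , ())
    rectangle′ (down e _) (flat e') l i with member l e e' i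
    ... | inj₁ (() , _)
    ... | inj₂ (_ , ())

    -- The first position has level 1 and its image is the least position of the second block, so a
    -- drop of one level already suffices.
    row′ : ∀ {q} (lq : Level q) → zero {m} Fin.< q → g lq ≡ false → In zero q
    row′ (down e _) l b = member⁻¹ l lev-first e (inj₂ (0 , refl))
    row′ (up _ _) l ()
    row′ {q} (flat e) l b = member⁻¹ l lev-first e (inj₁ (refl , ℕₚ.≤∧≢⇒<
      (ℕₚ.≤-trans (ℕₚ.≤-reflexive v-first) (<ᵇ-false⁻¹ b)) (λ z → ℕₚ.<-irrefl (cong toℕ (v-inj (Finₚ.toℕ-injective z))) l)))

    column′ : ∀ {p} (lp : Level p) → p Fin.< last → g lp ≡ true → In p last
    column′ (up e _) l b = member⁻¹ l e lev-last (inj₂ (0 , refl))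
    column′ (down _ _) l ()
    column′ {p} (flat e) l b = member⁻¹ l e lev-last (inj₁ (refl , ℕₚ.≤∧≢⇒<
      (ℕₚ.≤-pred (subst (suc (toℕ (v p)) ℕ.≤_) (sym v-last) (<ᵇ-true⁻¹ b))) (λ z → ℕₚ.<-irrefl (cong toℕ (v-inj (Finₚ.toℕ-injective z))) l)))

  rectangle : ∀ p q → p Fin.< q → In p q → (toℕ p ℕ.<ᵇ h) ≡ true × (toℕ q ℕ.<ᵇ h) ≡ false
  rectangle p q l i with rectangle′ (view p) (view q) l i
  ... | a , b = trans (sym (block p)) a , trans (sym (block q)) b

  first-row : ∀ q → zero {m} Fin.< q → (toℕ q ℕ.<ᵇ h) ≡ false → In zero q
  first-row q l b = row′ (view q) l (trans (block q) b)

  last-column : ∀ p → p Fin.< fromℕ m → (toℕ p ℕ.<ᵇ h) ≡ true → In p (fromℕ m)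
  last-column p l b = column′ (view p) l (trans (block p) b)

neg-neg : ∀ x → - (- x) ≡ x
neg-neg = solve-∀ ℚ-ring

-- Roots, coweights and the root order

module Roots {R : RootData} (𝓜 : Model R) where
  open Weyl 𝓜 public

  o-anti : ∀ {p q} → p Fin.≤ q → o q Fin.≤ o p
  o-anti {p} {q} l = ℕₚ.+-cancelˡ-≤ (toℕ p) _ _ (begin
    toℕ p ℕ.+ toℕ (o q) ≤⟨ ℕₚ.+-monoˡ-≤ (toℕ (o q)) l ⟩
    toℕ q ℕ.+ toℕ (o q) ≡⟨ trans (toℕ-opp q) (sym (toℕ-opp p)) ⟩
    toℕ p ℕ.+ toℕ (o p) ∎)
    where open ℕₚ.≤-Reasoning

  o-anti-< : ∀ {p q} → p Fin.< q → o q Fin.< o p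
  o-anti-< {p} {q} l = ℕₚ.≤∧≢⇒< (o-anti (ℕₚ.<⇒≤ l)) (λ z → <⇒≢ᶠ l (sym (o-inj (Finₚ.toℕ-injective z))))

  o-anti-<⁻¹ : ∀ {p q} → o q Fin.< o p → p Fin.< q
  o-anti-<⁻¹ {p} {q} l = subst₂ Fin._<_ (o-o p) (o-o q) (o-anti-< l)

  IsPos-resp : ∀ {x y} → x ≐ y → IsPos x → IsPos y
  IsPos-resp h (a , z) = a , ≐-trans (≐-sym h) z

  root-order : ∀ {p q p' q'} → p' Fin.< q' → root p' q' ≐ root p q → p Fin.< q
  root-order {p} {q} lt h = case root-≡ (<⇒≢ᶠ lt) h of λ where
    (inj₁ (a , b)) → subst₂ Fin._<_ a b lt
    (inj₂ (_ , a , b)) → o-anti-<⁻¹ (subst₂ Fin._<_ a b lt)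

  pos-order : ∀ {p q x} → x ≐ root p q → IsPos x → p Fin.< q
  pos-order h (a , z) = let p' , q' , lt , z' = pos-pair a in root-order lt (≐-trans (≐-sym (≐-trans z z')) h)

  pos-root : ∀ {x} → IsPos x → ∃₂ λ p q → p Fin.< q × x ≐ root p q
  pos-root (a , z) = let p , q , lt , z' = pos-pair a in p , q , lt , ≐-trans z z'

  IsRoot-pair : ∀ {x} → IsRoot x → ∃₂ λ p q → p ≢ q × x ≐ root p q
  IsRoot-pair (inj₁ h) = let p , q , lt , z = pos-root h in p , q , <⇒≢ᶠ lt , z
  IsRoot-pair {x} (inj₂ h) = let p , q , lt , z = pos-root h in q , p , (λ y → <⇒≢ᶠ lt (sym y)) ,
    ≐-trans (λ k → sym (neg-neg (x k))) (≐-trans (negv-cong z) (neg-root p q))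

  pair-IsRoot : ∀ {x p q} → p ≢ q → x ≐ root p q → IsRoot x
  pair-IsRoot {x} {p} {q} ne h = case ℕₚ.<-cmp (toℕ p) (toℕ q) of λ where
    (tri< l _ _) → inj₁ (IsPos-resp (≐-sym h) (pair-pos p q l))
    (tri≈ _ z _) → contradiction (Finₚ.toℕ-injective z) ne
    (tri> _ _ g) → inj₂ (IsPos-resp (≐-sym (≐-trans (negv-cong h) (neg-root p q))) (pair-pos q p g))

  negh-root : ∀ z {x p q} → x ≐h (root p q , toQ z) → negh x ≐h (root q p , toQ (ℤ.- z))
  negh-root z {p = p} {q} (a , b) = ≐-trans (negv-cong a) (neg-root p q) , trans (cong -_ b) (sym (toQ-neg z))

  AffPos⇒ : ∀ {x p q z} → x ≐h (root p q , toQ z) → AffPos x → AffinePositive p q z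
  AffPos⇒ (a , b) (inj₁ (h , e)) = inj₁ (toQ-injective {b = ℤ.+ 0} (trans (sym b) e) , pos-order a h)
  AffPos⇒ (a , b) (inj₂ (_ , k , e)) = inj₂ (k , toQ-injective {b = ℤ.+ suc k} (trans (sym b) e))

  ⇒AffPos : ∀ {x p q z} → p ≢ q → x ≐h (root p q , toQ z) → AffinePositive p q z → AffPos x
  ⇒AffPos {p = p} {q} ne (a , b) (inj₁ (refl , l)) = inj₁ (IsPos-resp (≐-sym a) (pair-pos p q l) , b)
  ⇒AffPos ne (a , b) (inj₂ (k , refl)) = inj₂ (pair-IsRoot ne a , k , b)

  AffPos-root : ∀ {x} → AffPos x → ∃ λ p → ∃ λ q → ∃ λ z → p ≢ q × x ≐h (root p q , toQ z)
  AffPos-root (inj₁ (h , e)) = let p , q , lt , z = pos-root h in p , q , ℤ.+ 0 , <⇒≢ᶠ lt , z , e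
  AffPos-root (inj₂ (h , k , e)) = let p , q , ne , z = IsRoot-pair h in p , q , ℤ.+ suc k , ne , z , e

  InI-resp : ∀ I {x y} → x ≐ y → InI I x → InI I y
  InI-resp I h (a , b , z) = a , b , ≐-trans (≐-sym h) z

  InI-order : ∀ I {p q} → InI I (root p q) → p Fin.< q
  InI-order I (a , _ , z) = pos-order ≐-refl (a , z)

  IsPos? : ∀ x → Dec (IsPos x)
  IsPos? x = Finₚ.any? (λ a → x ≐? pos a)

  InI? : ∀ I x → Dec (InI I x)
  InI? I x = Finₚ.any? (λ a → (I a Boolₚ.≟ true) ×-dec (x ≐? pos a))

  Border? : ∀ I a → Dec (Border I a)
  Border? I a = (I a Boolₚ.≟ true) ×-dec Finₚ.all? (λ i → Finₚ.all? (λ j →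
    IsPos? (pos a -v simple i) →-dec (IsPos? (pos a -v simple j) →-dec ¬? (InI? I ((pos a -v simple i) -v simple j)))))

  -- On initial segments these partial sums of coordinates are zero or positive multiples of
  -- fundamental coweights; on the first block of a long simple root they give the coweight that
  -- singles this root out.
  Ω : (Fin M → Bool) → V dim → ℚ
  Ω A x = sumℚ (λ r → ind (A r) * ⟨ x , e r ⟩)

  Ω-form : ∀ A → LinearForm (Ω A)
  Ω-form A = sum-form (λ r → scale-form (ind (A r)) (ip-form (e r)))

  Ω-e : ∀ A p → Ω A (e p) ≡ ind (A p) - φ * ind (A (o p))
  Ω-e A p = begin
    sumℚ (λ r → ind (A r) * ⟨ e p , e r ⟩)
      ≡⟨ sum-cong (λ r → trans (cong (ind (A r) *_) (trans (gram p r) (cong (λ z → δ p r - φ * z) (sym (δ-o p r))))) (lem (ind (A r)) (δ p r) φ (δ (o p) r))) ⟩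
    sumℚ (λ r → δ p r * ind (A r) - φ * (δ (o p) r * ind (A r)))
      ≡⟨ sum-- (λ r → δ p r * ind (A r)) (λ r → φ * (δ (o p) r * ind (A r))) ⟩
    sumℚ (λ r → δ p r * ind (A r)) - sumℚ (λ r → φ * (δ (o p) r * ind (A r)))
      ≡⟨ cong₂ _-_ (sum-δ p (λ r → ind (A r))) (trans (sum-* φ (λ r → δ (o p) r * ind (A r))) (cong (φ *_) (sum-δ (o p) (λ r → ind (A r))))) ⟩
    ind (A p) - φ * ind (A (o p)) ∎
    where
    open ≡-Reasoning
    lem : ∀ a b f d → a * (b - f * d) ≡ b * a - f * (d * a)
    lem = solve-∀ ℚ-ring

  Ω-root : ∀ A p q → Ω A (root p q) ≡ (ind (A p) - φ * ind (A (o p))) - (ind (A q) - φ * ind (A (o q)))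
  Ω-root A p q = trans (LinearForm.form-- (Ω-form A) (e p) (e q)) (cong₂ _-_ (Ω-e A p) (Ω-e A q))

  Good : (Fin M → Bool) → Set
  Good A = symm ≡ true → ∀ r → A (o r) ≡ not (A r)

  -- In the symmetric case `A` contains exactly one of `r` and `o r`, and their coordinates are
  -- opposite, so each end point is counted twice; this is the factor `1ℚ + φ`.
  Ω-good : ∀ {A} → Good A → ∀ p q → Ω A (root p q) ≡ (1ℚ + φ) * (ind (A p) - ind (A q))
  Ω-good {A} good p q = trans (Ω-root A p q) (case symm-cases of λ where
      (inj₁ (s , z)) → trans (cong₂ (λ x y → (ind (A p) - φ * x) - (ind (A q) - φ * y))
          (trans (cong ind (good s p)) (ind-not (A p))) (trans (cong ind (good s q)) (ind-not (A q))))
        (trans (cong (λ f → (ind (A p) - f * (1ℚ - ind (A p))) - (ind (A q) - f * (1ℚ - ind (A q)))) z)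
        (trans (lem₁ (ind (A p)) (ind (A q))) (cong (λ f → (1ℚ + f) * (ind (A p) - ind (A q))) (sym z))))
      (inj₂ (_ , z)) → trans (cong (λ f → (ind (A p) - f * ind (A (o p))) - (ind (A q) - f * ind (A (o q)))) z)
        (trans (lem₀ (ind (A p)) (ind (A q)) (ind (A (o p))) (ind (A (o q)))) (cong (λ f → (1ℚ + f) * (ind (A p) - ind (A q))) (sym z))))
    where
    lem₁ : ∀ a b → (a - 1ℚ * (1ℚ - a)) - (b - 1ℚ * (1ℚ - b)) ≡ (1ℚ + 1ℚ) * (a - b)
    lem₁ = solve-∀ ℚ-ring
    lem₀ : ∀ a b c d → (a - 0ℚ * c) - (b - 0ℚ * d) ≡ (1ℚ + 0ℚ) * (a - b)
    lem₀ = solve-∀ ℚ-ring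

  initial : ℕ → Fin M → Bool
  initial k r = toℕ r ℕ.<ᵇ k

  Ω-initial-nonneg : ∀ k {p q} → p Fin.< q → 0ℚ ≤q Ω (initial k) (root p q)
  Ω-initial-nonneg k {p} {q} l = subst (0ℚ ≤q_) (trans (lem (ind (initial k p)) (ind (initial k q)) φ (ind (initial k (o p))) (ind (initial k (o q)))) (sym (Ω-root (initial k) p q)))
    (+-nonneg (x≤y⇒0≤y-x (down l)) (*-nonneg φ-nonneg (x≤y⇒0≤y-x (down (o-anti-< l)))))
    where
    down : ∀ {r s} → r Fin.< s → ind (initial k s) ≤q ind (initial k r)
    down {r} {s} l = ind-mono (λ t → <ᵇ-true (ℕₚ.<-trans l (<ᵇ-true⁻¹ {toℕ s} {k} t)))
    lem : ∀ a b f c d → (a - b) + f * (d - c) ≡ (a - f * c) - (b - f * d)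
    lem = solve-∀ ℚ-ring

  -- `β ≼ γ` holds exactly when `γ -v β` is a `Heap`. It is stated for a single vector, so that it
  -- can be added up along adjacent pairs.
  record Heap (x : V dim) : Set where
    constructor heap
    field
      mult : Fin rank → ℕ
      sums : x ≐ sumV (λ j → toQ (ℤ.+ mult j) ·v simple j)

  Heap-resp : ∀ {x y} → x ≐ y → Heap x → Heap y
  Heap-resp h (heap c z) = heap c (≐-trans (≐-sym h) z)

  Heap-0 : ∀ {x} → x ≐ 0v → Heap x
  Heap-0 h = heap (λ _ → 0) (λ k → trans (h k) (sym (trans (sumV-at (λ j → toQ (ℤ.+ 0) ·v simple j) k) (sum-zero (λ j → ℚₚ.*-zeroˡ (simple j k))))))

  Heap-+ : ∀ {x y} → Heap x → Heap y → Heap (x +v y)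
  Heap-+ {x} {y} (heap c z) (heap d z') = heap (λ j → c j ℕ.+ d j) (λ k → begin
    x k + y k
      ≡⟨ cong₂ _+_ (trans (z k) (sumV-at (λ j → toQ (ℤ.+ c j) ·v simple j) k)) (trans (z' k) (sumV-at (λ j → toQ (ℤ.+ d j) ·v simple j) k)) ⟩
    sumℚ (λ j → toQ (ℤ.+ c j) * simple j k) + sumℚ (λ j → toQ (ℤ.+ d j) * simple j k)
      ≡⟨ sum-+ (λ j → toQ (ℤ.+ c j) * simple j k) (λ j → toQ (ℤ.+ d j) * simple j k) ⟨
    sumℚ (λ j → toQ (ℤ.+ c j) * simple j k + toQ (ℤ.+ d j) * simple j k)
      ≡⟨ sum-cong (λ j → trans (sym (ℚₚ.*-distribʳ-+ (simple j k) (toQ (ℤ.+ c j)) (toQ (ℤ.+ d j)))) (cong (_* simple j k) (sym (toQ-+ (ℤ.+ c j) (ℤ.+ d j))))) ⟩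
    sumℚ (λ j → toQ (ℤ.+ (c j ℕ.+ d j)) * simple j k)
      ≡⟨ sumV-at (λ j → toQ (ℤ.+ (c j ℕ.+ d j)) ·v simple j) k ⟨
    sumV (λ j → toQ (ℤ.+ (c j ℕ.+ d j)) ·v simple j) k ∎)
    where open ≡-Reasoning

  Heap-simple : ∀ j → Heap (simple j)
  Heap-simple j = heap (λ i → if j == i then 1 else 0) (λ k → sym (begin
    sumV (λ i → toQ (ℤ.+ (if j == i then 1 else 0)) ·v simple i) k ≡⟨ sumV-at (λ i → toQ (ℤ.+ (if j == i then 1 else 0)) ·v simple i) k ⟩
    sumℚ (λ i → toQ (ℤ.+ (if j == i then 1 else 0)) * simple i k)  ≡⟨ sum-cong (λ i → cong (_* simple i k) (lem (j == i))) ⟩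
    sumℚ (λ i → δ j i * simple i k)                                ≡⟨ sum-δ j (λ i → simple i k) ⟩
    simple j k ∎))
    where
    open ≡-Reasoning
    lem : ∀ b → toQ (ℤ.+ (if b then 1 else 0)) ≡ ind b
    lem true  = refl
    lem false = refl

  Heap-root : ∀ {p q} → p Fin.≤ q → Heap (root p q)
  Heap-root {p} {q} l = next (toℕ q) q refl l
    where
    lem : ∀ a b c → (a - b) + (b - c) ≡ a - c
    lem = solve-∀ ℚ-ring
    next : ∀ n q → toℕ q ≡ n → p Fin.≤ q → Heap (root p q)
    next n zero z l = subst (λ y → Heap (root y zero)) (sym (Finₚ.toℕ-injective {i = p} {zero} (ℕₚ.n≤0⇒n≡0 l))) (Heap-0 (λ k → ℚₚ.+-inverseʳ (e zero k)))
    next (suc n) (suc k) z l = case p Fin.≟ suc k of λ where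
      (yes refl) → Heap-0 (λ i → ℚₚ.+-inverseʳ (e (suc k) i))
      (no ne) → Heap-resp (λ i → lem (e p i) (e (inject₁ k) i) (e (suc k) i))
        (Heap-+ (next n (inject₁ k) (trans (Finₚ.toℕ-inject₁ k) (ℕₚ.suc-injective z))
            (ℕₚ.≤-pred (subst (suc (toℕ p) ℕ.≤_) (adjacent k) (ℕₚ.≤∧≢⇒< l (λ y → ne (Finₚ.toℕ-injective y))))))
          (let j , eq = letter k in Heap-resp eq (Heap-simple j)))

  ≼-order : ∀ {p q p' q'} → p' Fin.≤ p → q Fin.≤ q' → Heap (root p' q' -v root p q)
  ≼-order {p} {q} {p'} {q'} l l' = Heap-resp (λ k → lem (e p' k) (e p k) (e q k) (e q' k)) (Heap-+ (Heap-root l) (Heap-root l'))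
    where
    lem : ∀ a b c d → (a - b) + (c - d) ≡ (a - d) - (b - c)
    lem = solve-∀ ℚ-ring

  -- Gives necessary conditions for `_≼_`, from which the comparison of pairs is recovered in
  -- `≼-pairs`.
  Heap-Ω : ∀ k {x} → Heap x → 0ℚ ≤q Ω (initial k) x
  Heap-Ω k {x} (heap c z) = subst (0ℚ ≤q_) (sym (trans (LinearForm.form-cong (Ω-form (initial k)) z)
      (LinearForm.form-sum (Ω-form (initial k)) (λ j → toQ (ℤ.+ c j)) simple)))
    (sum-nonneg (λ j → *-nonneg (toQ-nonneg (c j)) (subst (0ℚ ≤q_) (LinearForm.form-cong (Ω-form (initial k)) (≐-sym (simple-e j)))
      (Ω-initial-nonneg k (adjacent-< (node j))))))

-- The ideals attached to a long simple root

module Ideals {R : RootData} (𝓜 : Model R) (i : Fin (RootData.rank R)) (long : RS.Long R i) where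
  open Roots 𝓜 public
  open Block i long public

  -- By InIab⇒Hook and Hook⇒InIab these are exactly the ideals of 𝓘ab(α_i).
  record Hook (I : Subset⁺) : Set where
    field
      ≐-closed  : ∀ a b → pos a ≐ pos b → I a ≡ true → I b ≡ true
      rectangle : ∀ p q → InI I (root p q) → initial H p ≡ true × initial H q ≡ false
      upward    : ∀ p q p' q' → InI I (root p q) → p' Fin.≤ p → q Fin.≤ q' → InI I (root p' q')
      row       : ∀ q → initial H q ≡ false → InI I (root zero q)
      column    : ∀ p → initial H p ≡ true → InI I (root p last)

  H≤m : H ℕ.≤ m
  H≤m = Finₚ.toℕ<n (node i)

  zero-block : initial H zero ≡ true
  zero-block = refl

  last-block : initial H last ≡ false
  last-block = <ᵇ-false (subst (H ℕ.≤_) (sym (Finₚ.toℕ-fromℕ m)) H≤m)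

  block-< : ∀ {p q} → initial H p ≡ true → initial H q ≡ false → p Fin.< q
  block-< {p} {q} a b = ℕₚ.<-≤-trans (<ᵇ-true⁻¹ {toℕ p} {H} a) (<ᵇ-false⁻¹ {toℕ q} {H} b)

  module FromIab (I : Subset⁺) (w : List (Fin (suc rank))) (ideal : IsAbelianIdeal I) (isw : IsWI I w)
    (target : actŴinv w (-v θ , 2ℚ) ≐h (simple i , 0ℚ)) where

    private
      u : List (Fin (suc rank))
      -- The inverse of `w`: this is the element that occurs in N(w) and in the condition on
      -- `-θ + 2δ`.
      u = reverse w

      v : Fin M → Fin M
      v = Aff.act u

      lev : Fin M → ℤ
      lev = level u

      image : ∀ {x} p q z → x ≐h (root p q , toQ z) → actŴinv w x ≐h (root (v p) (v q) , toQ (z ℤ.+ (lev p ℤ.- lev q)))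
      image p q z h = actŴ-root u p q z h

      -- All elements of N(w) have δ-coefficient 1, so no positive root of the finite system is
      -- inverted.
      level0 : ∀ p q → p Fin.< q → AffinePositive (v p) (v q) (lev p ℤ.- lev q)
      level0 p q l = case affine-dichotomy (lev p ℤ.- lev q) (λ z → <⇒≢ᶠ l (Aff.act-inj u z)) of λ where
          (inj₁ h) → h
          (inj₂ h) → ⊥-elim (bad h)
        where
        bad : ¬ AffinePositive (v q) (v p) (ℤ.- (lev p ℤ.- lev q))
        bad h = case proj₂ (proj₂ (proj₂ (proj₁ (isw (root p q , 0ℚ))
            ( inj₁ (pair-pos p q l , refl)
            , ⇒AffPos (λ z → <⇒≢ᶠ l (sym (Aff.act-inj u z))) (negh-root (ℤ.+ 0 ℤ.+ (lev p ℤ.- lev q)) (image p q (ℤ.+ 0) (≐-refl , refl)))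
                (subst (AffinePositive (v q) (v p)) (cong ℤ.-_ (sym (ℤₚ.+-identityˡ (lev p ℤ.- lev q)))) h))))) of λ ()

      In⇒ : ∀ p q → p Fin.< q → InI I (root p q) → AffinePositive (v p) (v q) (ℤ.- (ℤ.+ 1 ℤ.+ (lev q ℤ.- lev p)))
      In⇒ p q l (a , Ia , h) = AffPos⇒ (negh-root (ℤ.+ 1 ℤ.+ (lev q ℤ.- lev p)) (image q p (ℤ.+ 1) (≐-refl , refl)))
        (proj₂ (proj₂ (isw (root q p , 1ℚ)) (a , Ia , ≐-trans (≐-sym (neg-root p q)) (negv-cong h) , refl)))

      ⇒In : ∀ p q → p Fin.< q → AffinePositive (v p) (v q) (ℤ.- (ℤ.+ 1 ℤ.+ (lev q ℤ.- lev p))) → InI I (root p q)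
      ⇒In p q l h =
        let a , Ia , x≐ , _ = proj₁ (isw (root q p , 1ℚ))
              ( inj₂ (pair-IsRoot (λ z → <⇒≢ᶠ l (sym z)) ≐-refl , 0 , refl)
              , ⇒AffPos (λ z → <⇒≢ᶠ l (Aff.act-inj u z)) (negh-root (ℤ.+ 1 ℤ.+ (lev q ℤ.- lev p)) (image q p (ℤ.+ 1) (≐-refl , refl))) h)
        in a , Ia , ≐-trans (≐-sym (neg-root q p)) (≐-trans (negv-cong x≐) (λ k → neg-neg (pos a k)))

      α-image : root (v last) (v zero) ≐ simple i × toQ (ℤ.+ 2 ℤ.+ (lev last ℤ.- lev zero)) ≡ 0ℚ
      α-image = ≐h-trans (≐h-sym (image last zero (ℤ.+ 2) (-θ-root , refl))) target

      -- The finite part of the condition says that `root (v last) (v zero)` is `simple i`. In the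
      -- symmetric case the mirrored solution is the same one, since the pair of `i` is its own
      -- mirror image.
      v-ends : v last ≡ left i × v zero ≡ right i
      v-ends = case root-≡ (λ z → last≢first (Aff.act-inj u z)) (≐-trans (proj₁ α-image) (simple-e i)) of λ where
        (inj₁ h) → h
        (inj₂ (s , a , b)) → trans a (trans (cong o (middle s)) (o-o (left i))) , trans b (sym (middle s))

      ends : lev zero ℤ.- lev last ≡ ℤ.+ 2
      ends = trans (lem (lev zero) (lev last)) (cong (λ z → ℤ.+ 2 ℤ.- z) (toQ-injective {ℤ.+ 2 ℤ.+ (lev last ℤ.- lev zero)} {ℤ.+ 0} (proj₂ α-image)))
        where
        lem : ∀ a b → a ℤ.- b ≡ ℤ.+ 2 ℤ.- (ℤ.+ 2 ℤ.+ (b ℤ.- a))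
        lem = ℤ-Solver.solve-∀

      module L = LevelArgument H v (Aff.act-inj u) (Aff.act-sum u (λ r → ind (initial H r))) lev (level-sum u)
        (λ p q → InI I (root p q)) level0 In⇒ ⇒In (cong toℕ (proj₂ v-ends))
        (trans (cong (suc ∘ toℕ) (proj₁ v-ends)) (cong suc (Finₚ.toℕ-inject₁ (node i)))) ends

      ideal-up : ∀ {x y} → InI I x → IsPos y → Heap (y -v x) → InI I y
      ideal-up {x} {y} (a , Ia , xa) (b , yb) hp = b , proj₁ ideal a b Ia
        (Heap.mult hp , ≐-trans (-v-cong (≐-sym yb) (≐-sym xa)) (Heap.sums hp)) , yb

    fromIab : Hook I
    fromIab = record
      { ≐-closed = λ a b h Ia → proj₁ ideal a b Ia (let hp = Heap-0 {pos b -v pos a} (λ k → trans (cong (λ z → pos b k - z) (h k)) (ℚₚ.+-inverseʳ (pos b k))) in Heap.mult hp , Heap.sums hp)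
      ; rectangle = λ p q h → L.rectangle p q (InI-order I h) h
      ; upward = λ p q p' q' h l l' → ideal-up h (pair-pos p' q' (ℕₚ.≤-<-trans l (ℕₚ.<-≤-trans (InI-order I h) l'))) (≼-order l l')
      ; row = λ q b → L.first-row q (block-< zero-block b) b
      ; column = λ p b → L.last-column p (block-< b last-block) b }

  InIab⇒Hook : ∀ {I} → InIab (simple i) I → Hook I
  InIab⇒Hook {I} (ideal , w , isw , target) = FromIab.fromIab I w ideal isw target

  -- `InIab` quantifies over all affine words; this equivalent condition is a finite check, which
  -- the enumeration of simplices needs.
  Hook? : ∀ I → Dec (Hook I)
  Hook? I = map′
    (λ (a , b , c , d , f) → record { ≐-closed = a ; rectangle = b ; upward = c ; row = d ; column = f })
    (λ k → let open Hook k in ≐-closed , rectangle , upward , row , column)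
    (Finₚ.all? (λ a → Finₚ.all? (λ b → (pos a ≐? pos b) →-dec ((I a Boolₚ.≟ true) →-dec (I b Boolₚ.≟ true))))
    ×-dec Finₚ.all? (λ p → Finₚ.all? (λ q → InI? I (root p q) →-dec ((initial H p Boolₚ.≟ true) ×-dec (initial H q Boolₚ.≟ false))))
    ×-dec Finₚ.all? (λ p → Finₚ.all? (λ q → Finₚ.all? (λ p' → Finₚ.all? (λ q' →
            InI? I (root p q) →-dec ((p' Fin.≤? p) →-dec ((q Fin.≤? q') →-dec InI? I (root p' q')))))))
    ×-dec Finₚ.all? (λ q → (initial H q Boolₚ.≟ false) →-dec InI? I (root zero q))
    ×-dec Finₚ.all? (λ p → (initial H p Boolₚ.≟ true) →-dec InI? I (root p last)))

not-true : ∀ {b} → b ≢ true → b ≡ false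
not-true {true} h = contradiction refl h
not-true {false} _ = refl

not-false : ∀ {b} → b ≡ false → b ≢ true
not-false refl ()

-- Merging two blocks of positions: r in the first block precedes s in the second one iff J r s.

module Merge {M : ℕ} (B : Fin M → Bool) (J : Fin M → Fin M → Bool)
  (J-up : ∀ {p q p' q'} → J p q ≡ true → p' Fin.≤ p → q Fin.≤ q' → J p' q' ≡ true) where

  merge : Bool → Bool → Fin M → Fin M → Bool
  merge true  true  r s = toℕ r ℕ.<ᵇ toℕ s
  merge true  false r s = J r s
  merge false true  r s = not (J s r)
  merge false false r s = toℕ r ℕ.<ᵇ toℕ s

  lt : Fin M → Fin M → Bool
  lt r s = merge (B r) (B s) r s

  not-intro : ∀ {b} → b ≢ true → not b ≡ true
  not-intro h rewrite not-true h = refl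

  not-elim : ∀ {b} → not b ≡ true → b ≢ true
  not-elim {false} _ ()

  lt-irrefl : ∀ p → lt p p ≢ true
  lt-irrefl p = go (B p)
    where
    go : ∀ b → merge b b p p ≢ true
    go true  t = ℕₚ.<-irrefl refl (<ᵇ-true⁻¹ {toℕ p} t)
    go false t = ℕₚ.<-irrefl refl (<ᵇ-true⁻¹ {toℕ p} t)

  -- The patterns that mix the blocks all come down to `J` being closed upward.
  lt-trans : ∀ {p q r} → lt p q ≡ true → lt q r ≡ true → lt p r ≡ true
  lt-trans {p} {q} {r} = go (B p) (B q) (B r)
    where
    order : ∀ {x y z : Fin M} → (toℕ x ℕ.<ᵇ toℕ y) ≡ true → (toℕ y ℕ.<ᵇ toℕ z) ≡ true → (toℕ x ℕ.<ᵇ toℕ z) ≡ true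
    order {x} {y} {z} a b = <ᵇ-true (ℕₚ.<-trans (<ᵇ-true⁻¹ {toℕ x} {toℕ y} a) (<ᵇ-true⁻¹ {toℕ y} {toℕ z} b))
    lo : ∀ {x y : Fin M} → (toℕ x ℕ.<ᵇ toℕ y) ≡ true → x Fin.≤ y
    lo {x} {y} a = ℕₚ.<⇒≤ (<ᵇ-true⁻¹ {toℕ x} {toℕ y} a)
    between : ∀ {x y : Fin M} → (y Fin.≤ x → ⊥) → (toℕ x ℕ.<ᵇ toℕ y) ≡ true
    between f = <ᵇ-true (ℕₚ.≰⇒> f)
    go : ∀ a b c → merge a b p q ≡ true → merge b c q r ≡ true → merge a c p r ≡ true
    go true  true  true  x y = order {p} {q} {r} x y
    go true  true  false x y = J-up y (lo {p} {q} x) ℕₚ.≤-refl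
    go true  false true  x y = between {p} {r} (λ l → not-elim y (J-up x l ℕₚ.≤-refl))
    go true  false false x y = J-up x ℕₚ.≤-refl (lo {q} {r} y)
    go false true  true  x y = not-intro (λ j → not-elim x (J-up j (lo {q} {r} y) ℕₚ.≤-refl))
    go false true  false x y = between {p} {r} (λ l → not-elim x (J-up y ℕₚ.≤-refl l))
    go false false true  x y = not-intro (λ j → not-elim y (J-up j ℕₚ.≤-refl (lo {p} {q} x)))
    go false false false x y = order {p} {q} {r} x y

  lt-total : ∀ {p q} → p ≢ q → lt p q ≡ true ⊎ lt q p ≡ true
  lt-total {p} {q} ne = go (B p) (B q)
    where
    order : (toℕ p ℕ.<ᵇ toℕ q) ≡ true ⊎ (toℕ q ℕ.<ᵇ toℕ p) ≡ true
    order with ℕₚ.<-cmp (toℕ p) (toℕ q)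
    ... | tri< l _ _ = inj₁ (<ᵇ-true l)
    ... | tri≈ _ z _ = contradiction (Finₚ.toℕ-injective z) ne
    ... | tri> _ _ g = inj₂ (<ᵇ-true g)
    dec : ∀ b → b ≡ true ⊎ not b ≡ true
    dec true  = inj₁ refl
    dec false = inj₂ refl
    go : ∀ a b → merge a b p q ≡ true ⊎ merge b a q p ≡ true
    go true  true  = order
    go false false = order
    go true  false = dec (J p q)
    go false true  = Sum.swap (dec (J q p))

  lt-opp : (∀ r → B (opposite r) ≡ not (B r)) → (∀ {p q} → J p q ≡ true → J (opposite q) (opposite p) ≡ true) →
    (∀ {p q : Fin M} → p Fin.< q → opposite q Fin.< opposite p) → ∀ {p q} → lt p q ≡ true → lt (opposite q) (opposite p) ≡ true
  lt-opp B-opp J-opp anti {p} {q} x = subst₂ (λ a b → merge a b (opposite q) (opposite p) ≡ true) (sym (B-opp q)) (sym (B-opp p)) (go (B p) (B q) x)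
    where
    order : (toℕ p ℕ.<ᵇ toℕ q) ≡ true → (toℕ (opposite q) ℕ.<ᵇ toℕ (opposite p)) ≡ true
    order a = <ᵇ-true (anti (<ᵇ-true⁻¹ {toℕ p} {toℕ q} a))
    go : ∀ a b → merge a b p q ≡ true → merge (not b) (not a) (opposite q) (opposite p) ≡ true
    go true  true  x = order x
    go false false x = order x
    go true  false x = J-opp x
    go false true  x = not-intro (λ j → not-elim x (subst₂ (λ y z → J y z ≡ true) (Finₚ.opposite-involutive q) (Finₚ.opposite-involutive p) (J-opp j)))

⌊⌋-true : ∀ {P : Set} {d : Dec P} → P → ⌊ d ⌋ ≡ true
⌊⌋-true {d = yes _} p = refl
⌊⌋-true {d = no ¬p} p = contradiction p ¬p

⌊⌋-true⁻¹ : ∀ {P : Set} {d : Dec P} → ⌊ d ⌋ ≡ true → P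
⌊⌋-true⁻¹ {d = yes p} _ = p

-- The root order on the rectangle

module _ (H x y x' y' : ℕ) (x<H : x ℕ.< H) (y<H : y ℕ.< H)
  (cuts : ∀ k → k ℕ.≤ H → ind (x ℕ.<ᵇ k) + ind (y ℕ.<ᵇ k) ≤q ind (x' ℕ.<ᵇ k) + ind (y' ℕ.<ᵇ k)) where

  private
    both : ∀ {a b} → 1ℚ + 1ℚ ≤q ind a + ind b → a ≡ true × b ≡ true
    both {true}  {true}  _ = refl , refl
    both {true}  {false} h = contradiction h (from-no (1ℚ + 1ℚ ℚₚ.≤? 1ℚ + 0ℚ))
    both {false} {true}  h = contradiction h (from-no (1ℚ + 1ℚ ℚₚ.≤? 0ℚ + 1ℚ))
    both {false} {false} h = contradiction h (from-no (1ℚ + 1ℚ ℚₚ.≤? 0ℚ + 0ℚ))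

    either : ∀ {a b} → 1ℚ ≤q ind a + ind b → a ≡ true ⊎ b ≡ true
    either {true}  {b}     _ = inj₁ refl
    either {false} {true}  h = inj₂ refl
    either {false} {false} h = contradiction h (from-no (1ℚ ℚₚ.≤? 0ℚ + 0ℚ))

    below : ∀ {a b} → (a ℕ.<ᵇ suc b) ≡ true → a ℕ.≤ b
    below {a} {b} t = ℕₚ.≤-pred (<ᵇ-true⁻¹ {a} {suc b} t)

    at : ∀ z → (z ℕ.<ᵇ suc z) ≡ true
    at z = <ᵇ-true (ℕₚ.n<1+n z)

  -- `cuts` compares how many of the two points lie before `k`. Just past the larger of `x` and `y`
  -- both `x'` and `y'` have occurred, just past the smaller at least one of them has.
  dominate : (x' ℕ.≤ x × y' ℕ.≤ y) ⊎ (y' ℕ.≤ x × x' ℕ.≤ y)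
  dominate = case ℕₚ.≤-total x y of λ where
    (inj₁ x≤y) →
      let b = both (subst₂ (λ a c → ind a + ind c ≤q ind (x' ℕ.<ᵇ suc y) + ind (y' ℕ.<ᵇ suc y)) (<ᵇ-true (ℕ.s≤s x≤y)) (at y) (cuts (suc y) y<H)) in
      case either (ℚₚ.≤-trans (≤-by (ind (y ℕ.<ᵇ suc x)) (ind-nonneg (y ℕ.<ᵇ suc x)) refl)
             (subst (λ a → ind a + ind (y ℕ.<ᵇ suc x) ≤q ind (x' ℕ.<ᵇ suc x) + ind (y' ℕ.<ᵇ suc x)) (at x) (cuts (suc x) x<H))) of λ where
        (inj₁ t) → inj₁ (below t , below (proj₂ b))
        (inj₂ t) → inj₂ (below t , below (proj₁ b))
    (inj₂ y≤x) →
      let b = both (subst₂ (λ a c → ind a + ind c ≤q ind (x' ℕ.<ᵇ suc x) + ind (y' ℕ.<ᵇ suc x)) (at x) (<ᵇ-true (ℕ.s≤s y≤x)) (cuts (suc x) x<H)) in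
      case either (ℚₚ.≤-trans (≤-by (ind (x ℕ.<ᵇ suc y)) (ind-nonneg (x ℕ.<ᵇ suc y)) (ℚₚ.+-comm 1ℚ (ind (x ℕ.<ᵇ suc y))))
             (subst (λ a → ind (x ℕ.<ᵇ suc y) + ind a ≤q ind (x' ℕ.<ᵇ suc y) + ind (y' ℕ.<ᵇ suc y)) (at y) (cuts (suc y) y<H))) of λ where
        (inj₁ t) → inj₂ (below (proj₂ b) , below t)
        (inj₂ t) → inj₁ (below (proj₁ b) , below t)

module FromHook {R : RootData} (𝓜 : Model R) (i : Fin (RootData.rank R)) (long : RS.Long R i) where
  open Ideals 𝓜 i long public

  block-good : Good (initial H)
  block-good = block-opp

  private
    ≼-cut : ∀ {p q p' q'} → Heap (root p' q' -v root p q) → ∀ k → Ω (initial k) (root p q) ≤q Ω (initial k) (root p' q')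
    ≼-cut {p} {q} {p'} {q'} hp k = 0≤y-x⇒x≤y (subst (0ℚ ≤q_) (LinearForm.form-- (Ω-form (initial k)) (root p' q') (root p q)) (Heap-Ω k hp))

    cut : ℕ → Fin M → ℚ
    cut k p = ind (toℕ p ℕ.<ᵇ k)

    Ω-plain : φ ≡ 0ℚ → ∀ k p q → Ω (initial k) (root p q) ≡ cut k p - cut k q
    Ω-plain z k p q = trans (Ω-root (initial k) p q) (trans
      (cong (λ f → (cut k p - f * cut k (o p)) - (cut k q - f * cut k (o q))) z) (lem (cut k p) (cut k q) (cut k (o p)) (cut k (o q))))
      where
      lem : ∀ a b c d → (a - 0ℚ * c) - (b - 0ℚ * d) ≡ a - b
      lem = solve-∀ ℚ-ring

    Ω-symm : φ ≡ 1ℚ → ∀ k p q → Ω (initial k) (root p q) ≡ (cut k p + cut k (o q)) - (cut k q + cut k (o p))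
    Ω-symm z k p q = trans (Ω-root (initial k) p q) (trans
      (cong (λ f → (cut k p - f * cut k (o p)) - (cut k q - f * cut k (o q))) z) (lem (cut k p) (cut k q) (cut k (o p)) (cut k (o q))))
      where
      lem : ∀ a b c d → (a - 1ℚ * c) - (b - 1ℚ * d) ≡ (a + d) - (b + c)
      lem = solve-∀ ℚ-ring

    above : ∀ {k} {q : Fin M} → k ℕ.≤ toℕ q → cut k q ≡ 0ℚ
    above l = cong ind (<ᵇ-false l)

    below : ∀ {k} {q : Fin M} → toℕ q ℕ.< k → cut k q ≡ 1ℚ
    below l = cong ind (<ᵇ-true l)

    1≤ind : ∀ {b c} → 1ℚ ≤q ind b - ind c → b ≡ true × c ≡ false
    1≤ind {true}  {false} _ = refl , refl
    1≤ind {true}  {true}  h = contradiction h (from-no (1ℚ ℚₚ.≤? 1ℚ - 1ℚ))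
    1≤ind {false} {true}  h = contradiction h (from-no (1ℚ ℚₚ.≤? 0ℚ - 1ℚ))
    1≤ind {false} {false} h = contradiction h (from-no (1ℚ ℚₚ.≤? 0ℚ - 0ℚ))

  -- On the rectangle the root order is the product order of pairs, up to the mirror. In the plain
  -- case the coweights cutting just after `p` and just before `q` suffice. In the symmetric case
  -- the cuts up to `H` see only `p` and `o q` of the smaller root, and `dominate` matches these
  -- with `p'` and `o q'`.
  ≼-pairs : ∀ {p q p' q'} → initial H p ≡ true → initial H q ≡ false → Heap (root p' q' -v root p q) →
    (p' Fin.≤ p × q Fin.≤ q') ⊎ (symm ≡ true × o q' Fin.≤ p × q Fin.≤ o p')
  ≼-pairs {p} {q} {p'} {q'} bp bq hp = case symm-cases of λ where
      (inj₂ (_ , z)) → inj₁ (plain z)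
      (inj₁ (s , z)) → case dominate H (toℕ p) (toℕ (o q)) (toℕ p') (toℕ (o q')) p<H (oq<H s) (cuts s z) of λ where
        (inj₁ (a , b)) → inj₁ (a , subst₂ Fin._≤_ (o-o q) (o-o q') (o-anti b))
        (inj₂ (a , b)) → inj₂ (s , a , subst (Fin._≤ o p') (o-o q) (o-anti b))
    where
    p<H : toℕ p ℕ.< H
    p<H = <ᵇ-true⁻¹ {toℕ p} {H} bp
    H≤q : H ℕ.≤ toℕ q
    H≤q = <ᵇ-false⁻¹ {toℕ q} {H} bq
    oq<H : symm ≡ true → toℕ (o q) ℕ.< H
    oq<H s = <ᵇ-true⁻¹ {toℕ (o q)} {H} (trans (block-opp s q) (cong not bq))
    H≤op : symm ≡ true → H ℕ.≤ toℕ (o p)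
    H≤op s = <ᵇ-false⁻¹ {toℕ (o p)} {H} (trans (block-opp s p) (cong not bp))
    plain : φ ≡ 0ℚ → p' Fin.≤ p × q Fin.≤ q'
    plain z = ℕₚ.≤-pred (<ᵇ-true⁻¹ {toℕ p'} {suc (toℕ p)} (proj₁ (1≤ind {toℕ p' ℕ.<ᵇ suc (toℕ p)} {toℕ q' ℕ.<ᵇ suc (toℕ p)} (compare (suc (toℕ p)) (ℕₚ.n<1+n (toℕ p)) (ℕₚ.≤-trans p<H H≤q))))) ,
              <ᵇ-false⁻¹ {toℕ q'} {toℕ q} (proj₂ (1≤ind {toℕ p' ℕ.<ᵇ toℕ q} {toℕ q' ℕ.<ᵇ toℕ q} (compare (toℕ q) (ℕₚ.<-≤-trans p<H H≤q) ℕₚ.≤-refl)))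
      where
      compare : ∀ k → toℕ p ℕ.< k → k ℕ.≤ toℕ q → 1ℚ ≤q cut k p' - cut k q'
      compare k l l' = subst₂ _≤q_ (trans (Ω-plain z k p q) (cong₂ _-_ (below {q = p} l) (above {q = q} l'))) (Ω-plain z k p' q') (≼-cut hp k)
    cuts : symm ≡ true → φ ≡ 1ℚ → ∀ k → k ℕ.≤ H → cut k p + cut k (o q) ≤q cut k p' + cut k (o q')
    cuts s z k k≤H = begin
      cut k p + cut k (o q)                              ≡⟨ lem (cut k p + cut k (o q)) ⟩
      (cut k p + cut k (o q)) - (0ℚ + 0ℚ)                ≡⟨ cong₂ (λ a b → (cut k p + cut k (o q)) - (a + b))
          (above {q = q} (ℕₚ.≤-trans k≤H H≤q)) (above {q = o p} (ℕₚ.≤-trans k≤H (H≤op s))) ⟨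
      (cut k p + cut k (o q)) - (cut k q + cut k (o p))  ≡⟨ Ω-symm z k p q ⟨
      Ω (initial k) (root p q)                           ≤⟨ ≼-cut hp k ⟩
      Ω (initial k) (root p' q')                         ≡⟨ Ω-symm z k p' q' ⟩
      (cut k p' + cut k (o q')) - (cut k q' + cut k (o p'))
        ≤⟨ ≤-by (cut k q' + cut k (o p')) (+-nonneg (ind-nonneg (initial k q')) (ind-nonneg (initial k (o p')))) (lem₂ (cut k p' + cut k (o q')) (cut k q' + cut k (o p'))) ⟩
      cut k p' + cut k (o q')                            ∎
      where
      open ℚₚ.≤-Reasoning
      lem : ∀ a → a ≡ a - (0ℚ + 0ℚ)
      lem = solve-∀ ℚ-ring
      lem₂ : ∀ a b → a - b + b ≡ a
      lem₂ = solve-∀ ℚ-ring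

  module _ (I : Subset⁺) (hook : Hook I) where
    open Hook hook

    hook-ideal : IsAbelianIdeal I
    hook-ideal = up , abelian
      where
      up : ∀ a b → I a ≡ true → pos a ≼ pos b → I b ≡ true
      up a b Ia (c , cs) =
        let p , q , _ , za = pos-pair a
            p' , q' , _ , zb = pos-pair b
            inp = (a , Ia , ≐-sym za)
            bp , bq = rectangle p q inp
            back : InI I (pos b) → I b ≡ true
            back = λ (b' , Ib' , z) → ≐-closed b' b (≐-sym z) Ib'
        in case ≼-pairs bp bq (heap c (≐-trans (-v-cong (≐-sym zb) (≐-sym za)) cs)) of λ where
          (inj₁ (l , l')) → back (InI-resp I (≐-sym zb) (upward p q p' q' inp l l'))
          (inj₂ (s , l , l')) → back (InI-resp I (≐-trans (root-opp s p' q') (≐-sym zb)) (upward p q (o q') (o p') inp l l'))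
      weight : ∀ a → I a ≡ true → Ω (initial H) (pos a) ≡ 1ℚ + φ
      weight a Ia =
        let p , q , _ , za = pos-pair a
            bp , bq = rectangle p q (a , Ia , ≐-sym za)
        in trans (LinearForm.form-cong (Ω-form (initial H)) za) (trans (Ω-good block-good p q)
             (trans (cong₂ (λ x y → (1ℚ + φ) * (ind x - ind y)) bp bq) (lem φ)))
        where
        lem : ∀ f → (1ℚ + f) * (1ℚ - 0ℚ) ≡ 1ℚ + f
        lem = solve-∀ ℚ-ring
      -- On the ideal `Ω (initial H)` takes the largest value it has on roots, `1ℚ + φ`, so a sum of
      -- two elements is too high to be a root.
      abelian : ∀ a b → I a ≡ true → I b ≡ true → ¬ IsRoot (pos a +v pos b)
      abelian a b Ia Ib h =
        let p , q , _ , z = IsRoot-pair h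
            total : (1ℚ + φ) + (1ℚ + φ) ≡ (1ℚ + φ) * (ind (initial H p) - ind (initial H q))
            total = trans (sym (cong₂ _+_ (weight a Ia) (weight b Ib))) (trans (sym (LinearForm.form-+ (Ω-form (initial H)) (pos a) (pos b)))
              (trans (LinearForm.form-cong (Ω-form (initial H)) z) (Ω-good block-good p q)))
        in ℚₚ.<-irrefl {0ℚ} refl (ℚₚ.<-≤-trans 0<1 (too-big (ind (initial H p) - ind (initial H q))
             (≤-by {ind (initial H p) - ind (initial H q)} ((1ℚ - ind (initial H p)) + ind (initial H q))
                (+-nonneg (x≤y⇒0≤y-x (ind≤1 (initial H p))) (ind-nonneg (initial H q))) (lem₃ (ind (initial H p)) (ind (initial H q)))) total))
        where
        lem₃ : ∀ a b → (a - b) + ((1ℚ - a) + b) ≡ 1ℚ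
        lem₃ = solve-∀ ℚ-ring
        too-big : ∀ d → d ≤q 1ℚ → (1ℚ + φ) + (1ℚ + φ) ≡ (1ℚ + φ) * d → 1ℚ ≤q 0ℚ
        too-big d d≤1 z = 0≤y-x⇒x≤y (subst (0ℚ ≤q_) (lem₄ φ d) (+-nonneg (+-nonneg (*-nonneg (+-nonneg 0≤1 φ-nonneg) (x≤y⇒0≤y-x d≤1)) φ-nonneg)
            (ℚₚ.≤-reflexive (sym (trans (cong (λ y → (1ℚ + φ) * d - y) z) (ℚₚ.+-inverseʳ ((1ℚ + φ) * d)))))))
          where
          lem₄ : ∀ f d → (1ℚ + f) * (1ℚ - d) + f + ((1ℚ + f) * d - ((1ℚ + f) + (1ℚ + f))) ≡ 0ℚ - 1ℚ
          lem₄ = solve-∀ ℚ-ring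

-- The rank function of the order H < H+1 < … < m < 0 < … < H − 1 of the positions 0, …, m

module Rotation {m : ℕ} (H : ℕ) (H≤m : H ℕ.≤ m) where

  M₁ : ℕ
  M₁ = suc m

  wrap : Bool → ℕ
  wrap true  = M₁
  wrap false = 0

  rot : Fin M₁ → ℕ
  rot r = toℕ r ℕ.+ wrap (toℕ r ℕ.<ᵇ H)

  data Side (r : Fin M₁) : Set where
    low  : toℕ r ℕ.< H → rot r ≡ toℕ r ℕ.+ M₁ → Side r
    high : H ℕ.≤ toℕ r → rot r ≡ toℕ r → Side r

  side : ∀ r → Side r
  side r with toℕ r ℕ.<? H
  ... | yes l = low l (cong (λ b → toℕ r ℕ.+ wrap b) (<ᵇ-true l))
  ... | no  l = high (ℕₚ.≮⇒≥ l) (trans (cong (λ b → toℕ r ℕ.+ wrap b) (<ᵇ-false (ℕₚ.≮⇒≥ l))) (ℕₚ.+-identityʳ (toℕ r)))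

  <M : ∀ (r : Fin M₁) k → toℕ r ℕ.< k ℕ.+ M₁
  <M r k = ℕₚ.<-≤-trans (Finₚ.toℕ<n r) (ℕₚ.m≤n+m M₁ k)

  rot-inj : ∀ {r s} → rot r ≡ rot s → r ≡ s
  rot-inj {r} {s} z with side r | side s
  ... | low _ a  | low _ b  = Finₚ.toℕ-injective (ℕₚ.+-cancelʳ-≡ M₁ _ _ (trans (sym a) (trans z b)))
  ... | high _ a | high _ b = Finₚ.toℕ-injective (trans (sym a) (trans z b))
  ... | low _ a  | high _ b = contradiction (trans (sym b) (trans (sym z) a)) (ℕₚ.<⇒≢ (<M s (toℕ r)))
  ... | high _ a | low _ b  = contradiction (trans (sym a) (trans z b)) (ℕₚ.<⇒≢ (<M r (toℕ s)))

  rot-low-high : ∀ {r s} → toℕ r ℕ.< H → H ℕ.≤ toℕ s → rot s ℕ.< rot r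
  rot-low-high {r} {s} l g with side r | side s
  ... | low _ a | high _ b = subst₂ ℕ._<_ (sym b) (sym a) (<M s (toℕ r))
  ... | high g' _ | _ = contradiction l (ℕₚ.≤⇒≯ g')
  ... | low _ _ | low l' _ = contradiction l' (ℕₚ.≤⇒≯ g)

  rot-same : ∀ {r s} → SameBlock H r s → r Fin.< s → rot r ℕ.< rot s
  rot-same {r} {s} same l = subst (λ b → toℕ r ℕ.+ wrap b ℕ.< rot s) (sym same) (ℕₚ.+-monoˡ-< (wrap (toℕ s ℕ.<ᵇ H)) l)

  rot-same⁻¹ : ∀ {r s} → SameBlock H r s → rot r ℕ.< rot s → r Fin.< s
  rot-same⁻¹ {r} {s} same l = ℕₚ.+-cancelʳ-< (wrap (toℕ s ℕ.<ᵇ H)) _ _ (subst (λ b → toℕ r ℕ.+ wrap b ℕ.< rot s) same l)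

  rot-≥H : ∀ r → H ℕ.≤ rot r
  rot-≥H r with side r
  ... | low _ a  = subst (H ℕ.≤_) (sym a) (ℕₚ.≤-trans H≤m (ℕₚ.≤-trans (ℕₚ.n≤1+n m) (ℕₚ.m≤n+m M₁ (toℕ r))))
  ... | high g a = subst (H ℕ.≤_) (sym a) g

  rot-<H+M : ∀ r → rot r ℕ.< H ℕ.+ M₁
  rot-<H+M r with side r
  ... | low l a  = subst (ℕ._< H ℕ.+ M₁) (sym a) (ℕₚ.+-monoˡ-< M₁ l)
  ... | high g a = subst (ℕ._< H ℕ.+ M₁) (sym a) (<M r H)

  rot-opp : (∀ r → (toℕ (opposite r) ℕ.<ᵇ H) ≡ not (toℕ r ℕ.<ᵇ H)) → ∀ r → rot r ℕ.+ rot (opposite r) ≡ m ℕ.+ M₁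
  rot-opp opp r = begin
    (toℕ r ℕ.+ wrap b) ℕ.+ (toℕ (opposite r) ℕ.+ wrap (toℕ (opposite r) ℕ.<ᵇ H))
      ≡⟨ cong (λ c → (toℕ r ℕ.+ wrap b) ℕ.+ (toℕ (opposite r) ℕ.+ wrap c)) (opp r) ⟩
    (toℕ r ℕ.+ wrap b) ℕ.+ (toℕ (opposite r) ℕ.+ wrap (not b))
      ≡⟨ lem (toℕ r) (wrap b) (toℕ (opposite r)) (wrap (not b)) ⟩
    (toℕ r ℕ.+ toℕ (opposite r)) ℕ.+ (wrap b ℕ.+ wrap (not b))
      ≡⟨ cong₂ ℕ._+_ (trans (cong (toℕ r ℕ.+_) (Finₚ.opposite-prop r)) (ℕₚ.m+[n∸m]≡n (Finₚ.toℕ≤pred[n] r))) (wraps b) ⟩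
    m ℕ.+ M₁ ∎
    where
    open ≡-Reasoning
    b : Bool
    b = toℕ r ℕ.<ᵇ H
    lem : ∀ a b c d → (a ℕ.+ b) ℕ.+ (c ℕ.+ d) ≡ (a ℕ.+ c) ℕ.+ (b ℕ.+ d)
    lem = ℕ-Solver.solve-∀
    wraps : ∀ b → wrap b ℕ.+ wrap (not b) ≡ M₁
    wraps true  = ℕₚ.+-identityʳ M₁
    wraps false = refl

  -- The neighbours of the rotated order are the adjacent pairs other than the one astride the cut
  -- `H`, together with the pair of `α₀`: all affine simple reflections except that of `α_i`.
  data Consecutive : Fin M₁ → Fin M₁ → Set where
    step : ∀ k → suc (toℕ k) ≢ H → Consecutive (inject₁ k) (suc k)
    wrap-around : Consecutive (fromℕ m) zero

  suc-pair : ∀ {p q : Fin M₁} → toℕ q ≡ suc (toℕ p) → suc (toℕ p) ≢ H → Consecutive p q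
  suc-pair {p} {suc k} z ne = subst (λ y → Consecutive y (suc k)) (sym p≡) (step k (λ y → ne (trans (sym z) y)))
    where
    p≡ : p ≡ inject₁ k
    p≡ = Finₚ.toℕ-injective (trans (ℕₚ.suc-injective (sym z)) (sym (Finₚ.toℕ-inject₁ k)))

  consecutive : ∀ {p q} → rot q ≡ suc (rot p) → Consecutive p q
  consecutive {p} {q} z with side p | side q
  ... | low l a | low l' b = suc-pair q≡ (λ y → ℕₚ.<-irrefl (trans q≡ y) l')
    where
    q≡ : toℕ q ≡ suc (toℕ p)
    q≡ = ℕₚ.+-cancelʳ-≡ M₁ (toℕ q) (suc (toℕ p)) (trans (sym b) (trans z (cong suc a)))
  ... | high l a | high l' b = suc-pair (trans (sym b) (trans z (cong suc a))) (λ y → ℕₚ.<-irrefl (sym y) (ℕ.s≤s l))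
  ... | low l a | high l' b = contradiction (trans (sym b) (trans z (cong suc a))) (ℕₚ.<⇒≢ (ℕₚ.<-trans (<M q (toℕ p)) (ℕₚ.n<1+n (toℕ p ℕ.+ M₁))))
  ... | high l a | low l' b = subst₂ Consecutive (sym p≡) (sym q≡) wrap-around
    where
    p+1≡q+M : suc (toℕ p) ≡ toℕ q ℕ.+ M₁
    p+1≡q+M = trans (cong suc (sym a)) (trans (sym z) b)
    q0 : toℕ q ≡ 0
    q0 = ℕₚ.n≤0⇒n≡0 (ℕₚ.+-cancelʳ-≤ M₁ (toℕ q) 0 (subst (ℕ._≤ M₁) p+1≡q+M (Finₚ.toℕ<n p)))
    q≡ : q ≡ zero
    q≡ = Finₚ.toℕ-injective q0
    p≡ : p ≡ fromℕ m
    p≡ = Finₚ.toℕ-injective (trans (ℕₚ.suc-injective (trans p+1≡q+M (cong (ℕ._+ M₁) q0))) (sym (Finₚ.toℕ-fromℕ m)))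

  successor : ∀ r → r ≢ fromℕ m → ∃ λ (r' : Fin M₁) → toℕ r' ≡ suc (toℕ r)
  successor r ne = Fin.fromℕ< l , Finₚ.toℕ-fromℕ< l
    where
    l : suc (toℕ r) ℕ.< M₁
    l = ℕ.s≤s (ℕₚ.≤∧≢⇒< (Finₚ.toℕ≤pred[n] r) (λ z → ne (Finₚ.toℕ-injective (trans z (sym (Finₚ.toℕ-fromℕ m))))))

  rot-next : 0 ℕ.< H → ∀ r s → rot r ℕ.< rot s → ∃ λ r' → rot r' ≡ suc (rot r)
  rot-next 0<H r s l with r Fin.≟ fromℕ m
  ... | yes refl = zero , trans (cong wrap (<ᵇ-true {0} {H} 0<H)) (sym (cong suc (trans (cong (λ b → toℕ (fromℕ m) ℕ.+ wrap b)
          (<ᵇ-false (subst (H ℕ.≤_) (sym (Finₚ.toℕ-fromℕ m)) H≤m))) (trans (ℕₚ.+-identityʳ _) (Finₚ.toℕ-fromℕ m)))))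
  ... | no ne with successor r ne
  ...   | r' , z with side r
  ...     | high g a = r' , trans (trans (cong (λ b → toℕ r' ℕ.+ wrap b) (<ᵇ-false (subst (H ℕ.≤_) (sym z) (ℕₚ.≤-trans g (ℕₚ.n≤1+n _))))) (ℕₚ.+-identityʳ _)) (trans z (cong suc (sym a)))
  ...     | low g a = r' , trans (cong₂ (λ x b → x ℕ.+ wrap b) z (<ᵇ-true (subst (ℕ._< H) (sym z)
              (ℕₚ.≤∧≢⇒< g (λ y → ℕₚ.<⇒≱ (rot-<H+M s) (subst (λ x → x ℕ.+ M₁ ℕ.≤ rot s) y (subst (λ x → suc x ℕ.≤ rot s) a l))))))) (cong suc (sym a))

-- The affine Weyl group element of an ideal

module HookWord {R : RootData} (𝓜 : Model R) (i : Fin (RootData.rank R)) (long : RS.Long R i) where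
  open FromHook 𝓜 i long public
  open Rotation H H≤m

  private
    b : Fin M → ℤ
    b r = bit (initial H r)

    RotPositive : Fin M → Fin M → ℤ → Set
    RotPositive p q z = (z ≡ ℤ.+ 0 × rot p ℕ.< rot q) ⊎ (∃ λ k → z ≡ ℤ.+ suc k)

    cases : ∀ {P : Bool → Bool → Set} p q → (∀ x y → initial H p ≡ x → initial H q ≡ y → P x y) → P (initial H p) (initial H q)
    cases p q f = f (initial H p) (initial H q) refl refl

    rot-block : ∀ {p q} → initial H p ≡ true → initial H q ≡ false → rot q ℕ.< rot p
    rot-block {p} {q} x y = rot-low-high {p} {q} (<ᵇ-true⁻¹ {toℕ p} {H} x) (<ᵇ-false⁻¹ {toℕ q} {H} y)

    -- In rotated coordinates e r − [r < H] δ positivity of affine roots is governed by the rotated order.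
    to-rot : ∀ {p q} z → AffinePositive p q z → RotPositive p q (z ℤ.+ (b p ℤ.- b q))
    to-rot {p} {q} z h = cases {λ x y → RotPositive p q (z ℤ.+ (bit x ℤ.- bit y))} p q (go h)
      where
      go : AffinePositive p q z → ∀ x y → initial H p ≡ x → initial H q ≡ y → RotPositive p q (z ℤ.+ (bit x ℤ.- bit y))
      go (inj₁ (refl , l)) true  true  ep eq = inj₁ (refl , rot-same {p} {q} (trans ep (sym eq)) l)
      go (inj₁ (refl , l)) false false ep eq = inj₁ (refl , rot-same {p} {q} (trans ep (sym eq)) l)
      go (inj₁ (refl , l)) true  false ep eq = inj₂ (0 , refl)
      go (inj₁ (refl , l)) false true  ep eq = contradiction l (ℕₚ.<-asym (block-< {q} {p} eq ep))
      go (inj₂ (k , refl)) true  true  ep eq = inj₂ (k , ℤₚ.+-identityʳ (ℤ.+ suc k))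
      go (inj₂ (k , refl)) false false ep eq = inj₂ (k , ℤₚ.+-identityʳ (ℤ.+ suc k))
      go (inj₂ (k , refl)) true  false ep eq = inj₂ (k ℕ.+ 1 , refl)
      go (inj₂ (zero , refl)) false true ep eq = inj₁ (refl , rot-block {q} {p} eq ep)
      go (inj₂ (suc k , refl)) false true ep eq = inj₂ (k , refl)

    from-rot : ∀ {p q} z → RotPositive p q (z ℤ.+ (b p ℤ.- b q)) → AffinePositive p q z
    from-rot {p} {q} z h = subst (AffinePositive p q) (lem z (b p ℤ.- b q))
      (cases {λ x y → RotPositive p q (z ℤ.+ (bit x ℤ.- bit y)) → AffinePositive p q ((z ℤ.+ (bit x ℤ.- bit y)) ℤ.- (bit x ℤ.- bit y))} p q
        (λ x y ep eq → go (z ℤ.+ (bit x ℤ.- bit y)) x y ep eq) h)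
      where
      lem : ∀ z d → (z ℤ.+ d) ℤ.- d ≡ z
      lem = ℤ-Solver.solve-∀
      go : ∀ z x y → initial H p ≡ x → initial H q ≡ y → RotPositive p q z → AffinePositive p q (z ℤ.- (bit x ℤ.- bit y))
      go z true  true  ep eq (inj₁ (refl , l)) = inj₁ (refl , rot-same⁻¹ {p} {q} (trans ep (sym eq)) l)
      go z false false ep eq (inj₁ (refl , l)) = inj₁ (refl , rot-same⁻¹ {p} {q} (trans ep (sym eq)) l)
      go z true  false ep eq (inj₁ (refl , l)) = contradiction l (ℕₚ.<-asym (rot-block {p} {q} ep eq))
      go z false true  ep eq (inj₁ (refl , l)) = inj₂ (0 , refl)
      go z true  true  ep eq (inj₂ (k , refl)) = inj₂ (k , ℤₚ.+-identityʳ (ℤ.+ suc k))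
      go z false false ep eq (inj₂ (k , refl)) = inj₂ (k , ℤₚ.+-identityʳ (ℤ.+ suc k))
      go z true  false ep eq (inj₂ (zero , refl)) = inj₁ (refl , block-< {p} {q} ep eq)
      go z true  false ep eq (inj₂ (suc k , refl)) = inj₂ (k , refl)
      go z false true  ep eq (inj₂ (k , refl)) = inj₂ (k ℕ.+ 1 , refl)

    -- Without `α_i` there remain the reflections between neighbours of the rotated order, and these
    -- suffice to sort.
    Allowed : Fin (suc rank) → Set
    Allowed j = j ≢ suc i

    gen : ∀ {p q} → Consecutive p q → ∃ λ j → Allowed j × (∀ r → τ̂ j r ≡ rf p q r)
    gen (step k ne) = let j , eq = letter k in
      suc j , (λ z → letter-≢ eq (λ y → ne (cong (suc ∘ toℕ) y)) (Finₚ.suc-injective z)) , letter-τ (adjacent-≢ k) eq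
    gen wrap-around = zero , (λ ()) , λ r → refl

    -- In the coordinates `e r − [r < H] δ` an allowed letter is a pure permutation, so its shift is
    -- the change of the block indicator. Along a word these changes telescope.
    shift-block : ∀ j → Allowed j → ∀ r → shift j r ≡ b r ℤ.- b (τ̂ j r)
    shift-block (suc j) ne r = sym (trans (cong (λ x → b r ℤ.- bit x) (τ-block (λ z → ne (cong suc z)) r)) (ℤₚ.+-inverseʳ (b r)))
    shift-block zero ne r = case separation last zero of λ where
        (sep _ n _)   → contradiction (sym opp-last) n
        (joined _ eq) → trans (swap r) (cong (λ y → b r ℤ.- b y) (sym (eq r)))
      where
      swap : ∀ r → bit (r == zero) ℤ.- bit (r == last) ≡ b r ℤ.- b (tr last zero r)
      swap r = case r Fin.≟ last of λ where
        (yes refl) → trans (cong₂ (λ x y → bit x ℤ.- bit y) (==-≢ last≢first) (==-refl last))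
          (sym (cong₂ (λ x y → bit x ℤ.- b y) last-block (tr-left last zero)))
        (no n) → case r Fin.≟ zero of λ where
          (yes refl) → trans (cong (λ y → ℤ.+ 1 ℤ.- bit y) (==-≢ first≢last))
            (sym (cong (λ y → ℤ.+ 1 ℤ.- y) (trans (cong b (tr-right last zero)) (cong bit last-block))))
          (no n') → trans (cong₂ (λ x y → bit x ℤ.- bit y) (==-≢ n') (==-≢ n))
            (sym (trans (cong (λ y → b r ℤ.- b y) (tr-other n n')) (ℤₚ.+-inverseʳ (b r))))

    level-block : ∀ u → All Allowed u → ∀ r → level u r ≡ b r ℤ.- b (Aff.act u r)
    level-block [] [] r = sym (ℤₚ.+-inverseʳ (b r))
    level-block (j ∷ u) (a ∷ al) r = trans (cong₂ ℤ._+_ (level-block u al r) (shift-block j a (Aff.act u r)))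
      (lem (b r) (b (Aff.act u r)) (b (Aff.act (j ∷ u) r)))
      where
      lem : ∀ x y z → (x ℤ.- y) ℤ.+ (y ℤ.- z) ≡ x ℤ.- z
      lem = ℤ-Solver.solve-∀

  module _ (I : Subset⁺) (hook : Hook I) where
    open Hook hook

    private
      J : Fin M → Fin M → Bool
      J r s = ⌊ InI? I (root r s) ⌋

      J-true : ∀ {r s} → InI I (root r s) → J r s ≡ true
      J-true {r} {s} = ⌊⌋-true {d = InI? I (root r s)}

      J-true⁻¹ : ∀ {r s} → J r s ≡ true → InI I (root r s)
      J-true⁻¹ {r} {s} = ⌊⌋-true⁻¹ {d = InI? I (root r s)}

      module Mg = Merge (initial H) J (λ {p} {q} {p'} {q'} t l l' → J-true (upward p q p' q' (J-true⁻¹ t) l l'))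

      sorted-word : ∃ λ u → All Allowed u × (∀ p q → Mg.lt p q ≡ true → rot (Aff.act u p) ℕ.< rot (Aff.act u q))
      sorted-word = Sort.sort symm opp-free rot rot-inj
        (λ s r t → trans (rot-opp (block-opp s) r) (sym (rot-opp (block-opp s) t)))
        (rot-next (ℕ.s≤s ℕ.z≤n)) τ̂ τ̂-invol τ̂-opp Allowed (λ p q z → gen (consecutive z))
        Mg.lt Mg.lt-irrefl (λ {p} {q} {r} → Mg.lt-trans {p} {q} {r}) Mg.lt-total
        (λ s {p} {q} → Mg.lt-opp (block-opp s) (λ {p} {q} t → J-true (InI-resp I (≐-sym (root-opp s p q)) (J-true⁻¹ t))) o-anti-< {p} {q})

      module FromWord (u : List (Fin (suc rank))) (al : All Allowed u)
        (sorted-u : ∀ p q → Mg.lt p q ≡ true → rot (Aff.act u p) ℕ.< rot (Aff.act u q)) where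

        v : Fin M → Fin M
        v = Aff.act u

        sorted : ∀ {p q} → Mg.lt p q ≡ true → rot (v p) ℕ.< rot (v q)
        sorted {p} {q} = sorted-u p q

        lt-from : ∀ {p q x y} → initial H p ≡ x → initial H q ≡ y → Mg.merge x y p q ≡ true → Mg.lt p q ≡ true
        lt-from {p} {q} ep eq t = subst₂ (λ x y → Mg.merge x y p q ≡ true) (sym ep) (sym eq) t

        v-inj : ∀ {p q} → v p ≡ v q → p ≡ q
        v-inj = Aff.act-inj u

        w : List (Fin (suc rank))
        w = reverse u

        img : ℤ → Fin M → Fin M → ℤ
        img z p q = z ℤ.+ (level u p ℤ.- level u q)

        image : ∀ {x} p q z → x ≐h (root p q , toQ z) → actŴinv w x ≐h (root (v p) (v q) , toQ (img z p q))
        image {x} p q z h = subst (λ y → actŴ y x ≐h (root (v p) (v q) , toQ (img z p q))) (sym (Listₚ.reverse-involutive u)) (actŴ-root u p q z h)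

        -- The word keeps the level in rotated coordinates. So an inverted root has both its level
        -- and the negative of its level nonnegative, and lies at rotated level 0.
        img-rot : ∀ z p q → ℤ.- img z p q ℤ.+ (b (v q) ℤ.- b (v p)) ≡ ℤ.- (z ℤ.+ (b p ℤ.- b q))
        img-rot z p q = trans (cong₂ (λ x y → ℤ.- (z ℤ.+ (x ℤ.- y)) ℤ.+ (b (v q) ℤ.- b (v p))) (level-block u al p) (level-block u al q))
          (lem z (b p) (b q) (b (v p)) (b (v q)))
          where
          lem : ∀ z x y x' y' → ℤ.- (z ℤ.+ ((x ℤ.- x') ℤ.- (y ℤ.- y'))) ℤ.+ (y' ℤ.- x') ≡ ℤ.- (z ℤ.+ (x ℤ.- y))
          lem = ℤ-Solver.solve-∀

        inverted : ∀ {p q} z → RotPositive p q z → RotPositive (v q) (v p) (ℤ.- z) → z ≡ ℤ.+ 0 × rot p ℕ.< rot q × rot (v q) ℕ.< rot (v p)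
        inverted z (inj₁ (refl , l)) (inj₁ (_ , l')) = refl , l , l'
        inverted z (inj₁ (refl , l)) (inj₂ (_ , ()))
        inverted z (inj₂ (_ , refl)) (inj₁ (() , _))
        inverted z (inj₂ (_ , refl)) (inj₂ (_ , ()))

        -- Rotation puts the second block first and the word sorts the merged order, so the inverted
        -- pairs are exactly those that `I` carries across the blocks.
        inverted-member : ∀ {p q} → p ≢ q → rot p ℕ.< rot q → rot (v q) ℕ.< rot (v p) →
          initial H p ≡ false × initial H q ≡ true × InI I (root q p)
        inverted-member {p} {q} ne l l' = go (initial H p) (initial H q) refl refl
          where
          wrong : Mg.lt p q ≡ true → ⊥
          wrong t = ℕₚ.<-asym (sorted {p} {q} t) l'
          right-way : ∀ {x} → initial H p ≡ x → initial H q ≡ x → p Fin.< q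
          right-way ep eq = rot-same⁻¹ {p} {q} (trans ep (sym eq)) l
          go : ∀ x y → initial H p ≡ x → initial H q ≡ y → initial H p ≡ false × initial H q ≡ true × InI I (root q p)
          go true  true  ep eq = ⊥-elim (wrong (lt-from {p} {q} ep eq (<ᵇ-true (right-way ep eq))))
          go false false ep eq = ⊥-elim (wrong (lt-from {p} {q} ep eq (<ᵇ-true (right-way ep eq))))
          go true  false ep eq = contradiction l (ℕₚ.<-asym (rot-block {p} {q} ep eq))
          go false true  ep eq = ep , eq , (case J q p Boolₚ.≟ true of λ where
            (yes t) → J-true⁻¹ t
            (no f)  → ⊥-elim (wrong (lt-from {p} {q} ep eq (Mg.not-intro f))))

        rotated : Fin M → Fin M → ℤ → ℤ
        rotated p q z = z ℤ.+ (b p ℤ.- b q)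

        rot-pos : ∀ {x} p q z → x ≐h (root p q , toQ z) → AffPos x → RotPositive p q (rotated p q z)
        rot-pos p q z h px = to-rot z (AffPos⇒ {z = z} h px)

        rot-neg : ∀ {x} p q z → x ≐h (root p q , toQ z) → AffPos (negh (actŴinv w x)) → RotPositive (v q) (v p) (ℤ.- rotated p q z)
        rot-neg {x} p q z h nx = subst (RotPositive (v q) (v p)) (img-rot z p q) (to-rot (ℤ.- img z p q) affine)
          where
          affine : AffinePositive (v q) (v p) (ℤ.- img z p q)
          affine = AffPos⇒ {negh (actŴinv w x)} {v q} {v p} {ℤ.- img z p q} (negh-root (img z p q) (image p q z h)) nx

        level-one : ∀ z s t → z ℤ.+ (bit s ℤ.- bit t) ≡ ℤ.+ 0 → s ≡ false → t ≡ true → z ≡ ℤ.+ 1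
        level-one z false true e refl refl = trans (lem z) (cong (ℤ._+ ℤ.+ 1) e)
          where
          lem : ∀ z → z ≡ (z ℤ.+ (ℤ.+ 0 ℤ.- ℤ.+ 1)) ℤ.+ ℤ.+ 1
          lem = ℤ-Solver.solve-∀

        found : ∀ {x} p q z → x ≐h (root p q , toQ z) → rotated p q z ≡ ℤ.+ 0 →
          initial H p ≡ false × initial H q ≡ true × InI I (root q p) → Σ (Fin N) λ a → (I a ≡ true) × (x ≐h (-v pos a , 1ℚ))
        found p q z h z'≡0 (ep , eq , a , Ia , ma) = a , Ia ,
          ≐-trans (proj₁ h) (≐-trans (≐-sym (neg-root q p)) (negv-cong ma)) ,
          trans (proj₂ h) (cong toQ (level-one z (initial H p) (initial H q) z'≡0 ep eq))

        isw⇒′ : ∀ {x} p q z → p ≢ q → x ≐h (root p q , toQ z) → RotPositive p q (rotated p q z) → RotPositive (v q) (v p) (ℤ.- rotated p q z) →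
          Σ (Fin N) λ a → (I a ≡ true) × (x ≐h (-v pos a , 1ℚ))
        isw⇒′ p q z ne h rp rn = found p q z h (proj₁ inv) (inverted-member ne (proj₁ (proj₂ inv)) (proj₂ (proj₂ inv)))
          where
          inv : rotated p q z ≡ ℤ.+ 0 × rot p ℕ.< rot q × rot (v q) ℕ.< rot (v p)
          inv = inverted (rotated p q z) rp rn

        isw⇒ : ∀ x → InN w x → Σ (Fin N) λ a → (I a ≡ true) × (x ≐h (-v pos a , 1ℚ))
        isw⇒ x (px , nx) = go (AffPos-root px)
          where
          go : (∃ λ p → ∃ λ q → ∃ λ z → p ≢ q × x ≐h (root p q , toQ z)) → Σ (Fin N) λ a → (I a ≡ true) × (x ≐h (-v pos a , 1ℚ))
          go (p , q , z , ne , h) = isw⇒′ p q z ne h (rot-pos p q z h px) (rot-neg p q z h nx)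

        ⇒isw′ : ∀ {x} p q → p Fin.< q → x ≐h (root q p , toQ (ℤ.+ 1)) → initial H p ≡ true → initial H q ≡ false → InI I (root p q) → InN w x
        ⇒isw′ {x} p q lt h ep eq inp =
            ⇒AffPos {x} {q} {p} {ℤ.+ 1} (λ z → <⇒≢ᶠ lt (sym z)) h (inj₂ (0 , refl)) ,
            ⇒AffPos {negh (actŴinv w x)} {v p} {v q} {ℤ.- img (ℤ.+ 1) q p} (λ z → <⇒≢ᶠ lt (v-inj z)) (negh-root (img (ℤ.+ 1) q p) (image q p (ℤ.+ 1) h))
               (from-rot (ℤ.- img (ℤ.+ 1) q p) (inj₁ (zero-level , sorted {p} {q} (lt-from {p} {q} ep eq (J-true inp)))))
          where
          zero-level : ℤ.- img (ℤ.+ 1) q p ℤ.+ (b (v p) ℤ.- b (v q)) ≡ ℤ.+ 0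
          zero-level = trans (img-rot (ℤ.+ 1) q p) (cong₂ (λ s t → ℤ.- (ℤ.+ 1 ℤ.+ (bit s ℤ.- bit t))) eq ep)

        ⇒isw : ∀ x → (Σ (Fin N) λ a → (I a ≡ true) × (x ≐h (-v pos a , 1ℚ))) → InN w x
        ⇒isw x (a , Ia , x≐ , d≡) = go (pos-pair a)
          where
          go : (∃₂ λ p q → p Fin.< q × pos a ≐ (e p -v e q)) → InN w x
          go (p , q , lt , za) = ⇒isw′ p q lt (≐-trans x≐ (≐-trans (negv-cong za) (neg-root p q)) , d≡)
            (proj₁ (rectangle p q inp)) (proj₂ (rectangle p q inp)) inp
            where
            inp : InI I (root p q)
            inp = a , Ia , ≐-sym za

        -- By the first row of the ideal, position zero precedes all others in the merged order, so
        -- it is sent to the least rotated position, which is `right i`.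
        v-zero : v zero ≡ right i
        v-zero = case s Fin.≟ zero of λ where
            (yes z) → trans (cong v (sym z)) vs
            (no ne) → contradiction (subst (λ y → rot (v zero) ℕ.< y) (trans (cong rot vs) rot-right) (sorted {zero} {s} (first s ne))) (ℕₚ.≤⇒≯ (rot-≥H (v zero)))
          where
          s : Fin M
          s = Aff.act (reverse u) (right i)
          vs : v s ≡ right i
          vs = Aff.reverse-act u (right i)
          rot-right : rot (right i) ≡ H
          rot-right = trans (cong (λ y → H ℕ.+ wrap y) (second-block i)) (ℕₚ.+-identityʳ H)
          first : ∀ s → s ≢ zero → Mg.lt zero s ≡ true
          first s ne = go (initial H s) refl
            where
            go : ∀ y → initial H s ≡ y → Mg.lt zero s ≡ true
            go false eq = lt-from {zero} {s} zero-block eq (J-true (row s eq))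
            go true  eq = lt-from {zero} {s} zero-block eq (<ᵇ-true (ℕₚ.≤∧≢⇒< ℕ.z≤n (λ z → ne (Finₚ.toℕ-injective (sym z)))))

        v-last : v last ≡ left i
        v-last = case s Fin.≟ last of λ where
            (yes z) → trans (cong v (sym z)) vs
            (no ne) → contradiction (rot-<H+M (v last))
              (ℕₚ.≤⇒≯ (subst (ℕ._≤ rot (v last)) (cong suc (trans (cong rot vs) rot-left)) (sorted {s} {last} (final s ne))))
          where
          s : Fin M
          s = Aff.act (reverse u) (left i)
          vs : v s ≡ left i
          vs = Aff.reverse-act u (left i)
          rot-left : rot (left i) ≡ toℕ (node i) ℕ.+ M₁
          rot-left = cong₂ (λ x y → x ℕ.+ wrap y) (Finₚ.toℕ-inject₁ (node i)) (first-block i)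
          final : ∀ s → s ≢ last → Mg.lt s last ≡ true
          final s ne = go (initial H s) refl
            where
            go : ∀ y → initial H s ≡ y → Mg.lt s last ≡ true
            go true  eq = lt-from {s} {last} eq last-block (J-true (column s eq))
            go false eq = lt-from {s} {last} eq last-block (<ᵇ-true (ℕₚ.≤∧≢⇒< (Finₚ.≤fromℕ s) (λ z → ne (Finₚ.toℕ-injective z))))

        target : actŴinv w (-v θ , 2ℚ) ≐h (simple i , 0ℚ)
        target = ≐h-trans (image last zero (ℤ.+ 2) (-θ-root , refl))
          (≐-trans (-v-cong (λ k → cong (λ y → e y k) v-last) (λ k → cong (λ y → e y k) v-zero)) (≐-sym (simple-e i)) , cong toQ level-0)
          where
          level-0 : img (ℤ.+ 2) last zero ≡ ℤ.+ 0
          level-0 = cong₂ (λ x y → ℤ.+ 2 ℤ.+ (x ℤ.- y))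
            (trans (level-block u al last) (cong₂ (λ x y → bit x ℤ.- bit y) last-block (trans (cong (initial H) v-last) (first-block i))))
            (trans (level-block u al zero) (cong (λ y → ℤ.+ 1 ℤ.- bit y) (trans (cong (initial H) v-zero) (second-block i))))

        in-ab : InIab (simple i) I
        in-ab = hook-ideal I hook , w , (λ x → isw⇒ x , ⇒isw x) , target

    Hook⇒InIab : InIab (simple i) I
    Hook⇒InIab = FromWord.in-ab (proj₁ sorted-word) (proj₁ (proj₂ sorted-word)) (proj₂ (proj₂ sorted-word))

-- Uniqueness of combinations supported on cells

sum-split : ∀ k {l} (f : Fin (k ℕ.+ l) → ℚ) → sumℚ f ≡ sumℚ (λ i → f (i Fin.↑ˡ l)) + sumℚ (λ j → f (k Fin.↑ʳ j))
sum-split zero    f = sym (ℚₚ.+-identityˡ (sumℚ f))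
sum-split (suc k) {l} f = trans (cong (f zero +_) (sum-split k (f ∘ suc)))
  (sym (ℚₚ.+-assoc (f zero) (sumℚ (λ i → f (suc (i Fin.↑ˡ l)))) (sumℚ (λ j → f (suc (k Fin.↑ʳ j))))))

sum-combine : ∀ k l (f : Fin (k ℕ.* l) → ℚ) → sumℚ f ≡ sumℚ {k} (λ p → sumℚ {l} (λ q → f (Fin.combine {k} {l} p q)))
sum-combine zero    l f = refl
sum-combine (suc k) l f = trans (sum-split l f) (cong (sumℚ (λ q → f (q Fin.↑ˡ (k ℕ.* l))) +_) (sum-combine k l (λ j → f (l Fin.↑ʳ j))))

∧-elim : ∀ {a b} → a ∧ b ≡ true → a ≡ true × b ≡ true
∧-elim {true} {true} _ = refl , refl

module CellsOf {R : RootData} (𝓜 : Model R) where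
  open Roots 𝓜 public

  K : ℕ
  K = M ℕ.* M

  fst snd : Fin K → Fin M
  fst k = proj₁ (Fin.remQuot {M} M k)
  snd k = proj₂ (Fin.remQuot {M} M k)

  vec : Fin K → V dim
  vec k = root (fst k) (snd k)

  -- In the symmetric case root p q = root (o q) (o p); half selects one of the two pairs.
  half : Fin M → Fin M → Bool
  half p q = not symm ∨ not (toℕ (o q) ℕ.<ᵇ toℕ p)

  half-plain : symm ≡ false → ∀ p q → half p q ≡ true
  half-plain s p q = cong (λ b → not b ∨ not (toℕ (o q) ℕ.<ᵇ toℕ p)) s

  half-symm : symm ≡ true → ∀ p q → half p q ≡ not (toℕ (o q) ℕ.<ᵇ toℕ p)
  half-symm s p q = cong (λ b → not b ∨ not (toℕ (o q) ℕ.<ᵇ toℕ p)) s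

  half-or : ∀ p q → half p q ≡ true ⊎ (symm ≡ true × half (o q) (o p) ≡ true)
  half-or p q = case symm-cases of λ where
    (inj₂ (s , _)) → inj₁ (half-plain s p q)
    (inj₁ (s , _)) → case toℕ (o q) ℕ.<? toℕ p of λ where
      (no l)  → inj₁ (trans (half-symm s p q) (cong not (<ᵇ-false (ℕₚ.≮⇒≥ l))))
      (yes l) → inj₂ (s , trans (half-symm s (o q) (o p)) (cong not (<ᵇ-false (subst (λ z → toℕ (o q) ℕ.≤ toℕ z) (sym (o-o p)) (ℕₚ.<⇒≤ l)))))

  half-both : symm ≡ true → ∀ p q → half p q ≡ true → half (o q) (o p) ≡ true → p ≡ o q
  half-both s p q h h' = Finₚ.toℕ-injective (ℕₚ.≤-antisym (un (trans (sym (half-symm s p q)) h))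
      (subst (λ z → toℕ (o q) ℕ.≤ toℕ z) (o-o p) (un (trans (sym (half-symm s (o q) (o p))) h'))))
    where
    un : ∀ {x y} → not (y ℕ.<ᵇ x) ≡ true → x ℕ.≤ y
    un {x} {y} t = <ᵇ-false⁻¹ {y} {x} (Boolₚ.not-injective t)

  -- `S` keeps only one of the two pairs of a root, whereas symmetrized coefficients live on both.
  -- So the chain conditions are imposed on a relation `Edge` closed under the mirror, of which `S`
  -- selects a part.
  record OK (S : Fin K → Bool) : Set₁ where
    field
      Edge     : Fin M → Fin M → Set
      selected : ∀ k → S k ≡ true → half (fst k) (snd k) ≡ true × Edge (fst k) (snd k)
      mirror   : symm ≡ true → ∀ {p q} → Edge p q → Edge (o q) (o p)
      monotone : ∀ {p q p' q'} → Edge p q → Edge p' q' → p Fin.< p' → q Fin.≤ q'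
      disjoint : ∀ {p q p' q'} → Edge p q → Edge p' q' → p ≢ q'

  open Cells vec public

  module Flow (c : Fin K → ℚ) where

    -- `Ĉ` adds the coefficient of the mirror pair, which represents the same root.
    C Ĉ : Matrix M
    C p q = c (Fin.combine p q)
    Ĉ p q = C p q + φ * C (o q) (o p)

    row-o : ∀ r → sumℚ (λ q → C (o q) r) ≡ colSum C r
    row-o r = sum-reindex o o o-o o-o (λ p → C p r)

    col-o : ∀ r → sumℚ (λ p → C r (o p)) ≡ rowSum C r
    col-o r = sum-reindex o o o-o o-o (λ q → C r q)

    pairing : ∀ r → ⟨ sumV (λ k → c k ·v vec k) , e r ⟩ ≡ (rowSum C r - φ * rowSum C (o r)) - (colSum C r - φ * colSum C (o r))
    pairing r = begin
      ⟨ sumV (λ k → c k ·v vec k) , e r ⟩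
        ≡⟨ LinearForm.form-sum (ip-form (e r)) c vec ⟩
      sumℚ (λ k → c k * ⟨ vec k , e r ⟩)
        ≡⟨ sum-combine M M (λ k → c k * ⟨ vec k , e r ⟩) ⟩
      total (λ p q → C p q * ⟨ vec (Fin.combine p q) , e r ⟩)
        ≡⟨ total-cong (λ p q → cong (C p q *_) (trans (cong (λ z → ⟨ root (proj₁ z) (proj₂ z) , e r ⟩) (Finₚ.remQuot-combine p q)) (root-e p q r))) ⟩
      total (λ p q → C p q * ((δ p r - φ * δ p (o r)) - (δ q r - φ * δ q (o r))))
        ≡⟨ total-cong (λ p q → lem (C p q) (δ p r) (δ p (o r)) (δ q r) (δ q (o r)) φ) ⟩
      total (λ p q → (δ p r - φ * δ p (o r)) * C p q - (δ q r - φ * δ q (o r)) * C p q)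
        ≡⟨ total-- (λ p q → (δ p r - φ * δ p (o r)) * C p q) (λ p q → (δ q r - φ * δ q (o r)) * C p q) ⟩
      total (λ p q → (δ p r - φ * δ p (o r)) * C p q) - total (λ p q → (δ q r - φ * δ q (o r)) * C p q)
        ≡⟨ cong₂ _-_ (trans (total-rows (λ p → δ p r - φ * δ p (o r)) C) (pick (rowSum C)))
                     (trans (total-cols (λ q → δ q r - φ * δ q (o r)) C) (pick (colSum C))) ⟩
      (rowSum C r - φ * rowSum C (o r)) - (colSum C r - φ * colSum C (o r)) ∎
      where
      open ≡-Reasoning
      lem : ∀ c a b d g f → c * ((a - f * b) - (d - f * g)) ≡ (a - f * b) * c - (d - f * g) * c
      lem = solve-∀ ℚ-ring
      lem₃ : ∀ a b f x → (a - f * b) * x ≡ a * x - f * (b * x)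
      lem₃ = solve-∀ ℚ-ring
      pick : ∀ (f : Fin M → ℚ) → sumℚ (λ p → (δ p r - φ * δ p (o r)) * f p) ≡ f r - φ * f (o r)
      pick f = trans (sum-cong (λ p → lem₃ (δ p r) (δ p (o r)) φ (f p))) (trans (sum-- (λ p → δ p r * f p) (λ p → φ * (δ p (o r) * f p)))
        (cong₂ _-_ (sum-δ′ r f) (trans (sum-* φ (λ p → δ p (o r) * f p)) (cong (φ *_) (sum-δ′ (o r) f)))))

    -- The mirror terms of the Gram matrix are absorbed by those of `Ĉ`; the coordinates of the
    -- value thus become the divergence of a flow, and `flow-unique` applies.
    divergence : ∀ r → ⟨ sumV (λ k → c k ·v vec k) , e r ⟩ ≡ rowSum Ĉ r - colSum Ĉ r
    divergence r = trans (pairing r) (begin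
      (rowSum C r - φ * rowSum C (o r)) - (colSum C r - φ * colSum C (o r))
        ≡⟨ lem₂ (rowSum C r) (rowSum C (o r)) (colSum C r) (colSum C (o r)) φ ⟩
      (rowSum C r + φ * colSum C (o r)) - (colSum C r + φ * rowSum C (o r))
        ≡⟨ cong₂ _-_ (trans (sum-+ (C r) (λ q → φ * C (o q) (o r))) (cong (rowSum C r +_) (trans (sum-* φ (λ q → C (o q) (o r))) (cong (φ *_) (row-o (o r))))))
                     (trans (sum-+ (λ p → C p r) (λ p → φ * C (o r) (o p))) (cong (colSum C r +_) (trans (sum-* φ (λ p → C (o r) (o p))) (cong (φ *_) (col-o (o r)))))) ⟨
      rowSum Ĉ r - colSum Ĉ r ∎)
      where
      open ≡-Reasoning
      lem₂ : ∀ a b c d f → (a - f * b) - (c - f * d) ≡ (a + f * d) - (c + f * b)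
      lem₂ = solve-∀ ℚ-ring

    module _ {S : Fin K → Bool} (ok : OK S) (supp : Supp S c) where
      open OK ok

      C-edge : ∀ p q → C p q ≢ 0ℚ → half p q ≡ true × Edge p q
      C-edge p q ne = subst (λ z → half (proj₁ z) (proj₂ z) ≡ true × Edge (proj₁ z) (proj₂ z)) (Finₚ.remQuot-combine p q)
        (selected (Fin.combine p q) (proj₂ supp (Fin.combine p q) ne))

      Ĉ-edge : ∀ p q → Ĉ p q ≢ 0ℚ → Edge p q
      Ĉ-edge p q ne = case C p q ℚₚ.≟ 0ℚ of λ where
          (no n) → proj₂ (C-edge p q n)
          (yes z) → case symm-cases of λ where
            (inj₂ (_ , f)) → contradiction (trans (cong₂ _+_ z (trans (cong (_* C (o q) (o p)) f) (ℚₚ.*-zeroˡ (C (o q) (o p))))) (ℚₚ.+-identityˡ 0ℚ)) ne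
            (inj₁ (s , f)) → subst₂ Edge (o-o p) (o-o q) (mirror s (proj₂ (C-edge (o q) (o p)
              (λ z' → ne (trans (cong₂ _+_ z (trans (cong (φ *_) z') (ℚₚ.*-zeroʳ φ))) (ℚₚ.+-identityˡ 0ℚ))))))

      Ĉ-nonneg : Nonneg Ĉ
      Ĉ-nonneg p q = +-nonneg (proj₁ supp (Fin.combine p q)) (*-nonneg φ-nonneg (proj₁ supp (Fin.combine (o q) (o p))))

      Ĉ-chain : Chain Ĉ
      Ĉ-chain p q p' q' n n' = monotone (Ĉ-edge p q n) (Ĉ-edge p' q' n')

      Ĉ-alternating : Alternating Ĉ
      Ĉ-alternating p q p' q' n n' = disjoint (Ĉ-edge p q n) (Ĉ-edge p' q' n')

      C-half : ∀ p q → half p q ≢ true → C p q ≡ 0ℚ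
      C-half p q nh = case C p q ℚₚ.≟ 0ℚ of λ where
        (yes z) → z
        (no n)  → contradiction (proj₁ (C-edge p q n)) nh

  -- The symmetrized coefficients agree by `flow-unique`. In the symmetric case `half` selects at
  -- most one of two distinct mirror pairs, so the sum is that coefficient; a pair that is its own
  -- mirror image is counted twice, hence the halving.
  cells-unique : ∀ {S S'} → OK S → OK S' → ∀ {c c'} → Supp S c → Supp S' c' →
    sumV (λ k → c k ·v vec k) ≐ sumV (λ k → c' k ·v vec k) → ∀ k → c k ≡ c' k
  cells-unique {S} {S'} ok ok' {c} {c'} supp supp' eq k = subst (λ z → c z ≡ c' z) (Finₚ.combine-remQuot {M} M k) (entry (fst k) (snd k))
    where
    module F = Flow c
    module F' = Flow c'
    same : ∀ p q → F.Ĉ p q ≡ F'.Ĉ p q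
    same = flow-unique F.Ĉ F'.Ĉ (F.Ĉ-nonneg ok supp) (F'.Ĉ-nonneg ok' supp') (F.Ĉ-chain ok supp) (F'.Ĉ-chain ok' supp')
      (F.Ĉ-alternating ok supp) (F'.Ĉ-alternating ok' supp')
      (λ r → trans (sym (F.divergence r)) (trans (ip-cong eq (≐-refl {u = e r})) (F'.divergence r)))
    cancel : ∀ x y x' y' → y ≡ 0ℚ → y' ≡ 0ℚ → x + φ * y ≡ x' + φ * y' → x ≡ x'
    cancel x _ x' _ refl refl z = trans (lem x φ) (trans z (sym (lem x' φ)))
      where
      lem : ∀ x f → x ≡ x + f * 0ℚ
      lem = solve-∀ ℚ-ring
    entry : ∀ p q → F.C p q ≡ F'.C p q
    entry p q = case symm-cases of λ where
        (inj₂ (_ , f)) → trans (plain (F.C p q) (F.C (o q) (o p)) f) (trans (same p q) (sym (plain (F'.C p q) (F'.C (o q) (o p)) f)))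
        (inj₁ (s , f)) → case half p q Boolₚ.≟ true of λ where
          (no nh) → trans (F.C-half ok supp p q nh) (sym (F'.C-half ok' supp' p q nh))
          (yes h) → case half (o q) (o p) Boolₚ.≟ true of λ where
            (no nh) → cancel (F.C p q) (F.C (o q) (o p)) (F'.C p q) (F'.C (o q) (o p))
                        (F.C-half ok supp (o q) (o p) nh) (F'.C-half ok' supp' (o q) (o p) nh) (same p q)
            (yes h') → self s f (half-both s p q h h')
      where
      plain : ∀ x y → φ ≡ 0ℚ → x ≡ x + φ * y
      plain x y f = trans (lem x y) (cong (λ g → x + g * y) (sym f))
        where
        lem : ∀ x y → x ≡ x + 0ℚ * y
        lem = solve-∀ ℚ-ring
      self : symm ≡ true → φ ≡ 1ℚ → p ≡ o q → F.C p q ≡ F'.C p q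
      self s f z = trans (halve (F.C p q) f) (trans (cong (½ *_) (trans (cong (λ y → F.C p q + φ * y) (at F.C)) (trans (same p q)
          (cong (λ y → F'.C p q + φ * y) (sym (at F'.C)))))) (sym (halve (F'.C p q) f)))
        where
        at : ∀ (D : Matrix M) → D p q ≡ D (o q) (o p)
        at D = cong₂ D z (sym (trans (cong o z) (o-o q)))
        halve : ∀ x → φ ≡ 1ℚ → x ≡ ½ * (x + φ * x)
        halve x f = trans (lem x) (cong (λ g → ½ * (x + g * x)) (sym f))
          where
          lem : ∀ x → x ≡ ½ * (x + 1ℚ * x)
          lem = solve-∀ ℚ-ring

-- Borders and the cells they span

module Borders {R : RootData} (𝓜 : Model R) where
  open CellsOf 𝓜 public

  τ-opp : symm ≡ true → ∀ j r → τ j (o r) ≡ o (τ j r)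
  τ-opp s j = rf-opp (adjacent-≢ (node j)) s

  act-opp : symm ≡ true → ∀ w r → act w (o r) ≡ o (act w r)
  act-opp s [] r = refl
  act-opp s (j ∷ w) r = trans (cong (τ j) (act-opp s w r)) (τ-opp s j (act w r))

  act⁻¹ : List (Fin rank) → Fin M → Fin M
  act⁻¹ w = act (reverse w)

  InBorder : Subset⁺ → V dim → Set
  InBorder I v = ∃ λ a → Border I a × v ≐ pos a

  InBorder? : ∀ I v → Dec (InBorder I v)
  InBorder? I v = Finₚ.any? (λ a → Border? I a ×-dec (v ≐? pos a))

  InBorder-resp : ∀ I {x y} → x ≐ y → InBorder I x → InBorder I y
  InBorder-resp I h (a , b , z) = a , b , ≐-trans (≐-sym h) z

  -- Pairs are pulled back by `w`, so that being an edge is a statement about the border of `I` and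
  -- is decided there.
  EdgeOf : List (Fin rank) → Subset⁺ → Fin M → Fin M → Set
  EdgeOf w I p q = InBorder I (root (act⁻¹ w p) (act⁻¹ w q))

  EdgeOf? : ∀ w I p q → Dec (EdgeOf w I p q)
  EdgeOf? w I p q = InBorder? I (root (act⁻¹ w p) (act⁻¹ w q))

  edge-mirror : symm ≡ true → ∀ w I {p q} → EdgeOf w I p q → EdgeOf w I (o q) (o p)
  edge-mirror s w I {p} {q} = InBorder-resp I (≐-sym (≐-trans
    (λ k → cong₂ (λ x y → e x k - e y k) (act-opp s (reverse w) q) (act-opp s (reverse w) p))
    (root-opp s (act⁻¹ w p) (act⁻¹ w q))))

  cellOf : List (Fin rank) → Subset⁺ → Fin K → Bool
  cellOf w I k = half (fst k) (snd k) ∧ ⌊ EdgeOf? w I (fst k) (snd k) ⌋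

  cellOf-edge : ∀ w I k → cellOf w I k ≡ true → half (fst k) (snd k) ≡ true × EdgeOf w I (fst k) (snd k)
  cellOf-edge w I k t = let x , y = ∧-elim t in x , ⌊⌋-true⁻¹ {d = EdgeOf? w I (fst k) (snd k)} y

  -- The cell contains one of two mirror pairs, and both give the same vector.
  edge-chosen : ∀ w I p q {v} → v ≐ root p q → EdgeOf w I p q → Chosen (cellOf w I) v
  edge-chosen w I p q {v} h ed = case half-or p q of λ where
      (inj₁ t)       → go p q t h ed
      (inj₂ (s , t)) → go (o q) (o p) t (≐-trans h (≐-sym (root-opp s p q))) (edge-mirror s w I ed)
    where
    go : ∀ p q → half p q ≡ true → v ≐ root p q → EdgeOf w I p q → Chosen (cellOf w I) v
    go p q t h ed = Fin.combine p q , subst (λ z → half (proj₁ z) (proj₂ z) ∧ ⌊ EdgeOf? w I (proj₁ z) (proj₂ z) ⌋ ≡ true) (sym (Finₚ.remQuot-combine p q))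
        (cong₂ _∧_ t (⌊⌋-true {d = EdgeOf? w I p q} ed)) ,
      subst (λ z → v ≐ root (proj₁ z) (proj₂ z)) (sym (Finₚ.remQuot-combine p q)) h

  Moved : List (Fin rank) → Subset⁺ → Region dim
  Moved w I x = Σ (V dim) λ y → conv₀B I y × (x ≐ actW w y)

  EdgeVector : List (Fin rank) → Subset⁺ → V dim → Set
  EdgeVector w I v = ∃₂ λ p q → v ≐ root p q × EdgeOf w I p q

  border-edge : ∀ w I {v} → InBorder I v → EdgeVector w I (actW w v)
  border-edge w I {v} (a , bd , z) =
    let p , q , _ , za = pos-pair a in
    act w p , act w q , ≐-trans (actW-cong w (≐-trans z za)) (actW-root w p q) ,
    a , bd , ≐-trans (λ k → cong₂ (λ x y → e x k - e y k) (act-reverse w p) (act-reverse w q)) (≐-sym za)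

  edge-border : ∀ w I {v} → EdgeVector w I v → InBorder I (actW (reverse w) v)
  edge-border w I (p , q , h , ed) = InBorder-resp I (≐-sym (≐-trans (actW-cong (reverse w) h) (actW-root (reverse w) p q))) ed

  Moved⇒ : ∀ w I → Moved w I ⊆ᵣ Conv₀ (EdgeVector w I)
  Moved⇒ w I x (y , cb , eq) =
    let s , s≤1 , C = ConvSub⇒Conv₀ posRoots _ tt y cb
    in s , s≤1 , Comb-resp refl (≐-sym eq) (Comb-map (actW-map w) (λ (j , bd , z) → border-edge w I (j , bd , z)) C)

  ⇒Moved : ∀ w I → Conv₀ (EdgeVector w I) ⊆ᵣ Moved w I
  ⇒Moved w I x (s , s≤1 , C) = actW (reverse w) x ,
    Conv₀⇒ConvSub posRoots _ tt (actW (reverse w) x) (s , s≤1 , Comb-map (actW-map (reverse w)) (edge-border w I) C) ,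
    ≐-sym (reverse-actW w x)

  Moved-cell : ∀ w I → Moved w I ≡ᵣ cell (cellOf w I)
  Moved-cell w I =
    (λ x h → Conv₀-mono (λ (p , q , z , ed) → edge-chosen w I p q z ed) x (Moved⇒ w I x h)) ,
    (λ x h → ⇒Moved w I x (Conv₀-mono (λ (k , t , z) → fst k , snd k , z , proj₂ (cellOf-edge w I k t)) x h))

-- Borders as chains, and a criterion for lying on the border

module BorderFacts {R : RootData} (𝓜 : Model R) (i : Fin (RootData.rank R)) (long : RS.Long R i) where
  open Borders 𝓜
  open Ideals 𝓜 i long using (Hook; module Hook; block-<; H)
  open Block i long using (block-opp; middle; minrep-increasing)

  private
    lowᵇ highᵇ : Fin M → Set
    lowᵇ p  = initial H p ≡ true
    highᵇ p = initial H p ≡ false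

    low≢high : ∀ {p q} → lowᵇ p → highᵇ q → p ≢ q
    low≢high a b refl = case trans (sym a) b of λ ()

    inject-below : ∀ {a b : Fin M} → a Fin.< b → ∃ λ (k : Fin m) → inject₁ k ≡ a
    inject-below {a} {suc b} l = Fin.fromℕ< (ℕₚ.≤-<-trans (ℕₚ.≤-pred l) (Finₚ.toℕ<n b)) ,
      Finₚ.toℕ-injective (trans (Finₚ.toℕ-inject₁ _) (Finₚ.toℕ-fromℕ< _))

  module _ (I : Subset⁺) (hook : Hook I) where
    open Hook hook

    border-rect : ∀ {p q} → InBorder I (root p q) → lowᵇ p × highᵇ q
    border-rect {p} {q} (a , bd , z) = rectangle p q (a , proj₁ bd , z)

    -- The ideal is closed upward, so it would contain the pair obtained from (a, b) by moving both
    -- ends inward by one step; that is a subtraction of two simple roots, forbidden on the border.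
    not-nested : ∀ {a b a' b'} → InBorder I (root a b) → InI I (root a' b') → a Fin.< a' → b' Fin.< b → ⊥
    not-nested {a} {suc l} {a'} {b'} (α , bd , z) inn a<a' b'<b = go (inject-below a<a')
      where
      a'<b' : a' Fin.< b'
      a'<b' = InI-order I inn
      go : (∃ λ (k : Fin m) → inject₁ k ≡ a) → ⊥
      go (k , refl) = clash (letter k) (letter l)
        where
        l₁ : suc k Fin.≤ a'
        l₁ = subst (ℕ._≤ toℕ a') (sym (adjacent k)) a<a'
        l₂ : b' Fin.≤ inject₁ l
        l₂ = subst (toℕ b' ℕ.≤_) (sym (Finₚ.toℕ-inject₁ l)) (ℕₚ.≤-pred b'<b)
        lem₁ : ∀ a b c → (a - c) - (a - b) ≡ b - c
        lem₁ = solve-∀ ℚ-ring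
        lem₂ : ∀ a b c → (a - c) - (b - c) ≡ a - b
        lem₂ = solve-∀ ℚ-ring
        lem₃ : ∀ a b c d → ((a - d) - (a - b)) - (c - d) ≡ b - c
        lem₃ = solve-∀ ℚ-ring
        clash : (∃ λ j → simple j ≐ root (inject₁ k) (suc k)) → (∃ λ j → simple j ≐ root (inject₁ l) (suc l)) → ⊥
        clash (j₁ , e₁) (j₂ , e₂) = proj₂ bd j₁ j₂
          (IsPos-resp (λ t → trans (sym (lem₁ (e (inject₁ k) t) (e (suc k) t) (e (suc l) t))) (cong₂ _-_ (z t) (sym (e₁ t))))
            (pair-pos (suc k) (suc l) (ℕₚ.≤-<-trans l₁ (ℕₚ.<-trans a'<b' b'<b))))
          (IsPos-resp (λ t → trans (sym (lem₂ (e (inject₁ k) t) (e (inject₁ l) t) (e (suc l) t))) (cong₂ _-_ (z t) (sym (e₂ t))))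
            (pair-pos (inject₁ k) (inject₁ l) (ℕₚ.<-≤-trans a<a' (ℕₚ.≤-trans (ℕₚ.<⇒≤ a'<b') l₂))))
          (InI-resp I (λ t → trans (sym (lem₃ (e (inject₁ k) t) (e (suc k) t) (e (inject₁ l) t) (e (suc l) t)))
              (cong₂ _-_ (cong₂ _-_ (z t) (sym (e₁ t))) (sym (e₂ t))))
            (upward a' b' (suc k) (inject₁ l) inn l₁ l₂))

    -- `w` increases on each block, so a crossing of edges would come from a nesting inside the
    -- rectangle. Sources come from the first block and sinks from the second, which keeps them
    -- disjoint.
    cell-ok : ∀ {w} → MinRep i w → OK (cellOf w I)
    cell-ok {w} mr = record
        { Edge = EdgeOf w I
        ; selected = cellOf-edge w I
        ; mirror = λ s {p} {q} → edge-mirror s w I {p} {q}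
        ; monotone = λ {p} {q} {p'} {q'} → mono {p} {q} {p'} {q'}
        ; disjoint = λ {p} {q} {p'} {q'} e₁ e₂ z → low≢high (proj₁ (border-rect e₁)) (proj₂ (border-rect e₂)) (cong (act⁻¹ w) z) }
      where
      inc : BlockIncreasing H (act w)
      inc = minrep-increasing {w} mr
      inc⁻¹ : ∀ {p q} → SameBlock H (act⁻¹ w p) (act⁻¹ w q) → p Fin.< q → act⁻¹ w p Fin.< act⁻¹ w q
      inc⁻¹ {p} {q} same l = case ℕₚ.<-cmp (toℕ (act⁻¹ w p)) (toℕ (act⁻¹ w q)) of λ where
        (tri< x _ _) → x
        (tri≈ _ z _) → contradiction (act-inj (reverse w) (Finₚ.toℕ-injective z)) (<⇒≢ᶠ l)
        (tri> _ _ g) → contradiction l (ℕₚ.<-asym (subst₂ Fin._<_ (reverse-act w q) (reverse-act w p) (inc _ _ (sym same) g)))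
      mono : ∀ {p q p' q'} → EdgeOf w I p q → EdgeOf w I p' q' → p Fin.< p' → q Fin.≤ q'
      mono {p} {q} {p'} {q'} e₁ e₂ l = ℕₚ.≮⇒≥ (λ g → not-nested e₁ (proj₁ e₂ , proj₁ (proj₁ (proj₂ e₂)) , proj₂ (proj₂ e₂))
        (inc⁻¹ (trans (proj₁ (border-rect e₁)) (sym (proj₁ (border-rect e₂)))) l)
        (inc⁻¹ (trans (proj₂ (border-rect e₂)) (sym (proj₂ (border-rect e₁)))) g))

    private
      -- The mirror exchanges the blocks, so positions of one block are never mirror images of each
      -- other.
      φδ-zero : ∀ p r → initial H p ≡ initial H r → φ * δ p (o r) ≡ 0ℚ
      φδ-zero p r same = case symm-cases of λ where
          (inj₂ (_ , z)) → trans (cong (_* δ p (o r)) z) (ℚₚ.*-zeroˡ (δ p (o r)))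
          (inj₁ (s , _)) → trans (cong (φ *_) (δ-≢ {p = p} {o r} (λ y → absurd (initial H r) (trans (sym (trans (cong (initial H) y) (block-opp s r))) same))))
                           (ℚₚ.*-zeroʳ φ)
        where
        absurd : ∀ b → not b ≢ b
        absurd true  ()
        absurd false ()

      low-coord : ∀ p q r → lowᵇ p → highᵇ q → lowᵇ r → ⟨ root p q , e r ⟩ ≡ δ p r + φ * δ q (o r)
      low-coord p q r a b c = trans (root-e p q r) (trans
        (cong₂ (λ x y → (δ p r - x) - (y - φ * δ q (o r))) (φδ-zero p r (trans a (sym c))) (δ-≢ {p = q} {r} (λ z → low≢high c b (sym z)))) (lem (δ p r) (φ * δ q (o r))))
        where
        lem : ∀ a b → (a - 0ℚ) - (0ℚ - b) ≡ a + b
        lem = solve-∀ ℚ-ring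

      high-coord : ∀ p q r → lowᵇ p → highᵇ q → highᵇ r → ⟨ root p q , e r ⟩ ≡ - (δ q r + φ * δ p (o r))
      high-coord p q r a b c = trans (root-e p q r) (trans
        (cong₂ (λ x y → (x - φ * δ p (o r)) - (δ q r - y)) (δ-≢ {p = p} {r} (low≢high a c)) (φδ-zero q r (trans b (sym c)))) (lem (δ q r) (φ * δ p (o r))))
        where
        lem : ∀ a b → (0ℚ - b) - (a - 0ℚ) ≡ - (a + b)
        lem = solve-∀ ℚ-ring

      coord-nonneg : ∀ (x y z t : Fin M) → 0ℚ ≤q δ x y + φ * δ z t
      coord-nonneg x y z t = +-nonneg (ind-nonneg (x == y)) (*-nonneg φ-nonneg (ind-nonneg (z == t)))

      left-coord : ∀ k → SameBlock H (inject₁ k) (suc k) → ⟨ root (inject₁ k) (suc k) , e (inject₁ k) ⟩ ≡ 1ℚ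
      left-coord k same = trans (root-e (inject₁ k) (suc k) (inject₁ k)) (cong₂ _-_ (cong₂ _-_ (δ-refl (inject₁ k)) (φ-self (inject₁ k)))
        (cong₂ _-_ (δ-≢ {p = suc k} {inject₁ k} (λ z → adjacent-≢ k (sym z))) (φδ-zero (suc k) (inject₁ k) (sym same))))

      right-coord : ∀ k → SameBlock H (inject₁ k) (suc k) → ⟨ root (inject₁ k) (suc k) , e (suc k) ⟩ ≡ - 1ℚ
      right-coord k same = trans (root-e (inject₁ k) (suc k) (suc k)) (cong₂ _-_
        (cong₂ _-_ (δ-≢ {p = inject₁ k} {suc k} (adjacent-≢ k)) (φδ-zero (inject₁ k) (suc k) same)) (cong₂ _-_ (δ-refl (suc k)) (φ-self (suc k))))

      hit : ∀ {x y z t : Fin M} → 1ℚ ≤q δ x y + φ * δ z t → x ≡ y ⊎ (symm ≡ true × z ≡ t)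
      hit {x} {y} {z} {t} le = case x Fin.≟ y of λ where
          (yes p) → inj₁ p
          (no np) → inj₂ (go (subst (λ a → 1ℚ ≤q a + φ * δ z t) (δ-≢ np) le))
        where
        go : 1ℚ ≤q 0ℚ + φ * δ z t → symm ≡ true × z ≡ t
        go le = case symm-cases of λ where
          (inj₂ (_ , f)) → contradiction (subst (λ f → 1ℚ ≤q 0ℚ + f * δ z t) f le)
            (λ le' → ℚₚ.<-irrefl {0ℚ} refl (ℚₚ.<-≤-trans 0<1 (subst (1ℚ ≤q_) (trans (ℚₚ.+-identityˡ (0ℚ * δ z t)) (ℚₚ.*-zeroˡ (δ z t))) le')))
          (inj₁ (s , f)) → s , δ-pos (ℚₚ.<-≤-trans 0<1 (subst (1ℚ ≤q_) (trans (ℚₚ.+-identityˡ (φ * δ z t)) (trans (cong (_* δ z t) f) (ℚₚ.*-identityˡ (δ z t)))) le))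

      -- Subtracting a vector of `Down a` moves the left end of a pair from `a` to its successor;
      -- subtracting one of `Up b` moves the right end from `b` to its predecessor.
      Down Up : Fin M → V dim → Set
      Down a v = ∃ λ a⁺ → toℕ a⁺ ≡ suc (toℕ a) × v ≐ root a a⁺
      Up b v = ∃ λ b⁻ → toℕ b ≡ suc (toℕ b⁻) × v ≐ root b⁻ b

      opp-adjacent : ∀ {x y : Fin M} → toℕ y ≡ suc (toℕ x) → toℕ (o x) ≡ suc (toℕ (o y))
      opp-adjacent {x} {y} z = ℕₚ.+-cancelˡ-≡ (toℕ x) _ _ (trans (trans (toℕ-opp x) (sym (toℕ-opp y)))
        (trans (cong (ℕ._+ toℕ (o y)) z) (sym (ℕₚ.+-suc (toℕ x) (toℕ (o y))))))

      Down-Up : symm ≡ true → ∀ {a b v} → b ≡ o a → Down a v → Up b v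
      Down-Up s {a} refl (a⁺ , z , h) = o a⁺ , opp-adjacent z , ≐-trans h (≐-sym (root-opp s a a⁺))

      Up-Down : symm ≡ true → ∀ {a b v} → a ≡ o b → Up b v → Down a v
      Up-Down s {b = b} refl (b⁻ , z , h) = o b⁻ , opp-adjacent z , ≐-trans h (≐-sym (root-opp s b⁻ b))

      -- The simple root has coordinate 1 at its left end, used in the first block, and -1 at its
      -- right end, used in the second. The difference still has the sign of the block there, so
      -- `root a b` is nonzero at that position.
      classify : ∀ {a b p q} k → k ≢ node i → lowᵇ a → highᵇ b → lowᵇ p → highᵇ q →
        (root a b -v root (inject₁ k) (suc k)) ≐ root p q → Down a (root (inject₁ k) (suc k)) ⊎ Up b (root (inject₁ k) (suc k))
      classify {a} {b} {p} {q} k ne la hb lp hq eq = go (initial H (inject₁ k)) refl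
        where
        same : SameBlock H (inject₁ k) (suc k)
        same = adjacent-block i k ne
        pairing : ∀ r → ⟨ root a b , e r ⟩ - ⟨ root (inject₁ k) (suc k) , e r ⟩ ≡ ⟨ root p q , e r ⟩
        pairing r = trans (sym (ip--ˡ (root a b) (root (inject₁ k) (suc k)) (e r))) (ip-cong eq (≐-refl {u = e r}))
        self : Up (suc k) (root (inject₁ k) (suc k))
        self = inject₁ k , adjacent k , ≐-refl
        go : ∀ x → initial H (inject₁ k) ≡ x → Down a (root (inject₁ k) (suc k)) ⊎ Up b (root (inject₁ k) (suc k))
        go true lk = case hit {a} {inject₁ k} {b} {o (inject₁ k)} (0≤y-x⇒x≤y (subst (0ℚ ≤q_) (sym (trans
              (cong₂ _-_ (sym (low-coord a b (inject₁ k) la hb lk)) (sym (left-coord k same))) (trans (pairing (inject₁ k)) (low-coord p q (inject₁ k) lp hq lk))))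
              (coord-nonneg p (inject₁ k) q (o (inject₁ k))))) of λ where
          (inj₁ refl)       → inj₁ (suc k , adjacent k , ≐-refl)
          (inj₂ (s , refl)) → inj₂ (Down-Up s refl (suc k , adjacent k , ≐-refl))
        go false hk = case hit {b} {suc k} {a} {o (suc k)} (0≤y-x⇒x≤y (subst (0ℚ ≤q_) (lem (δ b (suc k) + φ * δ a (o (suc k))) (δ q (suc k) + φ * δ p (o (suc k)))
              (trans (cong₂ _-_ (sym (high-coord a b (suc k) la hb hk')) (sym (right-coord k same))) (trans (pairing (suc k)) (high-coord p q (suc k) lp hq hk'))))
              (coord-nonneg q (suc k) p (o (suc k))))) of λ where
            (inj₁ refl)       → inj₂ self
            (inj₂ (s , refl)) → inj₁ (Up-Down s refl self)
          where
          hk' : highᵇ (suc k)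
          hk' = trans (sym same) hk
          lem : ∀ x y → - x - (- 1ℚ) ≡ - y → y ≡ x - 1ℚ
          lem x y z = trans (sym (neg-neg y)) (trans (cong -_ (sym z)) (l x))
            where
            l : ∀ x → - (- x - (- 1ℚ)) ≡ x - 1ℚ
            l = solve-∀ ℚ-ring

      -- After two subtractions the coordinate at `a` is still nonnegative, so it was at least 2,
      -- which happens only for `b = o a`.
      cancel-down : ∀ {a b c d a⁺} → toℕ a⁺ ≡ suc (toℕ a) → lowᵇ a → highᵇ b → lowᵇ c → highᵇ d → lowᵇ a⁺ →
        ((root a b -v root a a⁺) -v root a a⁺) ≐ root c d → symm ≡ true × b ≡ o a
      cancel-down {a} {b} {c} {d} {a⁺} z la hb lc hd la⁺ eq =
        case hit {a} {a⁺} {b} {o a} (≤-by {1ℚ} (δ c a + φ * δ d (o a)) (coord-nonneg c a d (o a)) total-eq) of λ where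
          (inj₁ y) → contradiction (cong toℕ y) (ℕₚ.<⇒≢ (ℕₚ.≤-reflexive (sym z)))
          (inj₂ y) → y
        where
        ne : a⁺ ≢ a
        ne y = ℕₚ.<⇒≢ (ℕₚ.≤-reflexive (sym z)) (cong toℕ (sym y))
        step-coord : ⟨ root a a⁺ , e a ⟩ ≡ 1ℚ
        step-coord = trans (root-e a a⁺ a) (cong₂ _-_ (cong₂ _-_ (δ-refl a) (φ-self a)) (cong₂ _-_ (δ-≢ ne) (φδ-zero a⁺ a (trans la⁺ (sym la)))))
        lem : ∀ f x → (((1ℚ + f) - 1ℚ) - 1ℚ) ≡ x → 1ℚ + x ≡ 0ℚ + f
        lem f x refl = l f
          where
          l : ∀ f → 1ℚ + (((1ℚ + f) - 1ℚ) - 1ℚ) ≡ 0ℚ + f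
          l = solve-∀ ℚ-ring
        total-eq : 1ℚ + (δ c a + φ * δ d (o a)) ≡ δ a a⁺ + φ * δ b (o a)
        total-eq = trans (lem (φ * δ b (o a)) (δ c a + φ * δ d (o a)) (begin
            ((1ℚ + φ * δ b (o a)) - 1ℚ) - 1ℚ
              ≡⟨ cong₂ (λ x y → ((x + φ * δ b (o a)) - y) - y) (δ-refl a) step-coord ⟨
            ((δ a a + φ * δ b (o a)) - ⟨ root a a⁺ , e a ⟩) - ⟨ root a a⁺ , e a ⟩
              ≡⟨ cong (λ x → (x - ⟨ root a a⁺ , e a ⟩) - ⟨ root a a⁺ , e a ⟩) (low-coord a b a la hb la) ⟨
            (⟨ root a b , e a ⟩ - ⟨ root a a⁺ , e a ⟩) - ⟨ root a a⁺ , e a ⟩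
              ≡⟨ trans (ip--ˡ (root a b -v root a a⁺) (root a a⁺) (e a)) (cong (_- ⟨ root a a⁺ , e a ⟩) (ip--ˡ (root a b) (root a a⁺) (e a))) ⟨
            ⟨ (root a b -v root a a⁺) -v root a a⁺ , e a ⟩
              ≡⟨ ip-cong eq (≐-refl {u = e a}) ⟩
            ⟨ root c d , e a ⟩
              ≡⟨ low-coord c d a lc hd la ⟩
            δ c a + φ * δ d (o a) ∎))
          (cong (_+ φ * δ b (o a)) (sym (δ-≢ {p = a} {a⁺} (λ y → ne (sym y)))))
          where open ≡-Reasoning

      cancel-up : ∀ {a b c d b⁻} → toℕ b ≡ suc (toℕ b⁻) → lowᵇ a → highᵇ b → lowᵇ c → highᵇ d → highᵇ b⁻ →
        ((root a b -v root b⁻ b) -v root b⁻ b) ≐ root c d → symm ≡ true × a ≡ o b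
      cancel-up {a} {b} {c} {d} {b⁻} z la hb lc hd hb⁻ eq =
        case hit {b} {b⁻} {a} {o b} (≤-by {1ℚ} (δ d b + φ * δ c (o b)) (coord-nonneg d b c (o b)) total-eq) of λ where
          (inj₁ y) → contradiction (cong toℕ (sym y)) (ℕₚ.<⇒≢ (ℕₚ.≤-reflexive (sym z)))
          (inj₂ y) → y
        where
        ne : b⁻ ≢ b
        ne y = ℕₚ.<⇒≢ (ℕₚ.≤-reflexive (sym z)) (cong toℕ y)
        step-coord : ⟨ root b⁻ b , e b ⟩ ≡ - 1ℚ
        step-coord = trans (root-e b⁻ b b) (cong₂ _-_ (cong₂ _-_ (δ-≢ ne) (φδ-zero b⁻ b (trans hb⁻ (sym hb)))) (cong₂ _-_ (δ-refl b) (φ-self b)))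
        lem : ∀ f x → ((- (1ℚ + f) - (- 1ℚ)) - (- 1ℚ)) ≡ - x → 1ℚ + x ≡ 0ℚ + f
        lem f x z = trans (cong (1ℚ +_) (trans (sym (neg-neg x)) (cong -_ (sym z)))) (l f)
          where
          l : ∀ f → 1ℚ + (- ((- (1ℚ + f) - (- 1ℚ)) - (- 1ℚ))) ≡ 0ℚ + f
          l = solve-∀ ℚ-ring
        total-eq : 1ℚ + (δ d b + φ * δ c (o b)) ≡ δ b b⁻ + φ * δ a (o b)
        total-eq = trans (lem (φ * δ a (o b)) (δ d b + φ * δ c (o b)) (begin
            (- (1ℚ + φ * δ a (o b)) - (- 1ℚ)) - (- 1ℚ)
              ≡⟨ cong₂ (λ x y → (- (x + φ * δ a (o b)) - y) - y) (δ-refl b) step-coord ⟨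
            (- (δ b b + φ * δ a (o b)) - ⟨ root b⁻ b , e b ⟩) - ⟨ root b⁻ b , e b ⟩
              ≡⟨ cong (λ x → (x - ⟨ root b⁻ b , e b ⟩) - ⟨ root b⁻ b , e b ⟩) (high-coord a b b la hb hb) ⟨
            (⟨ root a b , e b ⟩ - ⟨ root b⁻ b , e b ⟩) - ⟨ root b⁻ b , e b ⟩
              ≡⟨ trans (ip--ˡ (root a b -v root b⁻ b) (root b⁻ b) (e b)) (cong (_- ⟨ root b⁻ b , e b ⟩) (ip--ˡ (root a b) (root b⁻ b) (e b))) ⟨
            ⟨ (root a b -v root b⁻ b) -v root b⁻ b , e b ⟩
              ≡⟨ ip-cong eq (≐-refl {u = e b}) ⟩
            ⟨ root c d , e b ⟩
              ≡⟨ high-coord c d b lc hd hb ⟩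
            - (δ d b + φ * δ c (o b)) ∎))
          (cong (_+ φ * δ a (o b)) (sym (δ-≢ {p = b} {b⁻} (λ y → ne (sym y)))))
          where open ≡-Reasoning

      ω : V dim → ℚ
      ω = Ω (initial H)

      0<1+φ : 0ℚ < 1ℚ + φ
      0<1+φ = ℚₚ.<-≤-trans 0<1 (≤-by φ φ-nonneg refl)

      level-full : ∀ x y → (1ℚ + φ) * (ind x - ind y) ≡ 1ℚ + φ → x ≡ true × y ≡ false
      level-full x y z = go x y (cancel-nonzero {ind x - ind y} {1ℚ} (λ w → ℚₚ.<-irrefl (sym w) 0<1+φ)
          (trans (ℚₚ.*-comm (ind x - ind y) (1ℚ + φ)) (trans z (sym (ℚₚ.*-identityˡ (1ℚ + φ))))))
        where
        go : ∀ x y → ind x - ind y ≡ 1ℚ → x ≡ true × y ≡ false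
        go true  false _ = refl , refl
        go true  true  ()
        go false true  ()
        go false false ()

      level-zero : ∀ x y → (1ℚ + φ) * (ind x - ind y) ≡ 0ℚ → x ≡ y
      level-zero x y z = ind-injective (x-y≡0⇒x≡y (cancel-nonzero {ind x - ind y} {0ℚ} (λ w → ℚₚ.<-irrefl (sym w) 0<1+φ)
          (trans (ℚₚ.*-comm (ind x - ind y) (1ℚ + φ)) (trans z (sym (ℚₚ.*-zeroˡ (1ℚ + φ)))))))

      ω-root : ∀ p q → ω (root p q) ≡ (1ℚ + φ) * (ind (initial H p) - ind (initial H q))
      ω-root = Ω-good block-opp

      ω-rect : ∀ {v p q} → v ≐ root p q → lowᵇ p → highᵇ q → ω v ≡ 1ℚ + φ
      ω-rect {v} {p} {q} h a b = trans (LinearForm.form-cong (Ω-form (initial H)) h) (trans (ω-root p q)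
          (trans (cong₂ (λ x y → (1ℚ + φ) * (ind x - ind y)) a b) (lem φ)))
        where
        lem : ∀ f → (1ℚ + f) * (1ℚ - 0ℚ) ≡ 1ℚ + f
        lem = solve-∀ ℚ-ring

      ω-simple : ∀ j → 0ℚ ≤q ω (simple j)
      ω-simple j = subst (0ℚ ≤q_) (LinearForm.form-cong (Ω-form (initial H)) (≐-sym (simple-e j))) (Ω-initial-nonneg H (adjacent-< (node j)))

      ω-zero-node : ∀ j → ω (simple j) ≡ 0ℚ → node j ≢ node i
      ω-zero-node j z n = ℚₚ.<-irrefl (trans (sym z) (ω-rect (≐-trans (simple-e j) (λ t → cong (λ k → e (inject₁ k) t - e (suc k) t) n))
        (first-block i) (second-block i))) 0<1+φ

      module _ {a b : Fin M} {α : Fin N} (la : lowᵇ a) (hb : highᵇ b) (αz : pos α ≐ root a b)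
        (corner : ∀ a⁺ b⁻ → toℕ a⁺ ≡ suc (toℕ a) → toℕ b ≡ suc (toℕ b⁻) → ¬ InI I (root a⁺ b⁻)) where

        finish : ∀ {s t} → Down a s → Up b t → ¬ InI I ((pos α -v s) -v t)
        finish {s} {t} (a⁺ , y , h) (b⁻ , y' , h') inn = corner a⁺ b⁻ y y' (InI-resp I
            (λ k → trans (cong₂ _-_ (cong₂ _-_ (αz k) (h k)) (h' k)) (lem (e a k) (e b k) (e a⁺ k) (e b⁻ k))) inn)
          where
          lem : ∀ a b c d → ((a - b) - (a - c)) - (d - b) ≡ c - d
          lem = solve-∀ ℚ-ring

        swap-sub : ∀ s t → ((pos α -v s) -v t) ≐ ((pos α -v t) -v s)
        swap-sub s t k = lem (pos α k) (s k) (t k)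
          where
          lem : ∀ a b c → (a - b) - c ≡ (a - c) - b
          lem = solve-∀ ℚ-ring

        -- The vanishing of `ω` excludes `α_i` and keeps the difference inside the rectangle, as
        -- `classify` demands.
        side-of : ∀ j → ω (simple j) ≡ 0ℚ → IsPos (pos α -v simple j) → Down a (simple j) ⊎ Up b (simple j)
        side-of j z pj = go (pos-root pj)
          where
          back : ∀ {x} → Down a (root (left j) (right j)) ⊎ Up b (root (left j) (right j)) → x ≐ root (left j) (right j) → Down a x ⊎ Up b x
          back (inj₁ (c , y , h)) eq = inj₁ (c , y , ≐-trans eq h)
          back (inj₂ (c , y , h)) eq = inj₂ (c , y , ≐-trans eq h)
          go : (∃₂ λ p q → p Fin.< q × (pos α -v simple j) ≐ root p q) → Down a (simple j) ⊎ Up b (simple j)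
          go (p , q , _ , h) = back (classify (node j) (ω-zero-node j z) la hb (proj₁ full) (proj₂ full)
              (≐-trans (-v-cong (≐-sym αz) (≐-sym (simple-e j))) h)) (simple-e j)
            where
            full : lowᵇ p × highᵇ q
            full = level-full (initial H p) (initial H q) (trans (sym (ω-root p q)) (trans (LinearForm.form-cong (Ω-form (initial H)) (≐-sym h))
              (trans (LinearForm.form-- (Ω-form (initial H)) (pos α) (simple j)) (trans (cong₂ _-_ (ω-rect αz la hb) z) (ℚₚ.+-identityʳ (1ℚ + φ))))))

        down-low : ∀ {s a⁺} → s ≐ root a a⁺ → ω s ≡ 0ℚ → lowᵇ a⁺
        down-low {s} {a⁺} h z = trans (sym (level-zero (initial H a) (initial H a⁺) (trans (sym (ω-root a a⁺))
          (trans (LinearForm.form-cong (Ω-form (initial H)) (≐-sym h)) z)))) la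

        up-high : ∀ {s b⁻} → s ≐ root b⁻ b → ω s ≡ 0ℚ → highᵇ b⁻
        up-high {s} {b⁻} h z = trans (level-zero (initial H b⁻) (initial H b) (trans (sym (ω-root b⁻ b))
          (trans (LinearForm.form-cong (Ω-form (initial H)) (≐-sym h)) z))) hb

        same-down : ∀ {a⁺ a⁺' : Fin M} → toℕ a⁺ ≡ suc (toℕ a) → toℕ a⁺' ≡ suc (toℕ a) → a⁺ ≡ a⁺'
        same-down y y' = Finₚ.toℕ-injective (trans y (sym y'))

        same-up : ∀ {b⁻ b⁻' : Fin M} → toℕ b ≡ suc (toℕ b⁻) → toℕ b ≡ suc (toℕ b⁻') → b⁻ ≡ b⁻'
        same-up y y' = Finₚ.toℕ-injective (ℕₚ.suc-injective (trans (sym y) y'))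

        -- Subtracting the same neighbour twice is only possible when b = o a, where both neighbours coincide.
        combine-sides : ∀ {s t c d} → ω s ≡ 0ℚ → Down a s ⊎ Up b s → Down a t ⊎ Up b t → lowᵇ c → highᵇ d →
          ((pos α -v s) -v t) ≐ root c d → ¬ InI I ((pos α -v s) -v t)
        combine-sides zs (inj₁ x) (inj₂ y) lc hd eq inn = finish x y inn
        combine-sides {s} {t} zs (inj₂ x) (inj₁ y) lc hd eq inn = finish y x (InI-resp I (swap-sub s t) inn)
        combine-sides {s} {t} zs (inj₁ (a⁺ , y , h)) (inj₁ (a⁺' , y' , h')) lc hd eq inn =
          let sy , z = cancel-down y la hb lc hd (down-low h zs)
                (≐-trans (-v-cong (-v-cong (≐-sym αz) (≐-sym h)) (≐-sym (subst (λ c → t ≐ root a c) (same-down y' y) h'))) eq)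
          in finish (a⁺ , y , h) (Down-Up sy z (a⁺' , y' , h')) inn
        combine-sides {s} {t} zs (inj₂ (b⁻ , y , h)) (inj₂ (b⁻' , y' , h')) lc hd eq inn =
          let sy , z = cancel-up y la hb lc hd (up-high h zs)
                (≐-trans (-v-cong (-v-cong (≐-sym αz) (≐-sym h)) (≐-sym (subst (λ c → t ≐ root c b) (same-up y' y) h'))) eq)
          in finish (Up-Down sy z (b⁻ , y , h)) (b⁻' , y' , h') inn

        -- `pos α` and the result of both subtractions lie in the rectangle, where `ω` is constant.
        -- Since `ω` is nonnegative on simple roots, it vanishes on the two subtracted ones.
        no-double : ∀ j k → IsPos (pos α -v simple j) → IsPos (pos α -v simple k) → ¬ InI I ((pos α -v simple j) -v simple k)
        no-double j k pj pk inn@(γ , Iγ , z) = go (pos-pair γ)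
          where
          go : (∃₂ λ c d → c Fin.< d × pos γ ≐ root c d) → ⊥
          go (c , d , _ , zc) = combine-sides (proj₁ zeros) (side-of j (proj₁ zeros) pj) (side-of k (proj₂ zeros) pk)
              (proj₁ rect-cd) (proj₂ rect-cd) u≐ inn
            where
            u≐ : ((pos α -v simple j) -v simple k) ≐ root c d
            u≐ = ≐-trans z zc
            rect-cd : lowᵇ c × highᵇ d
            rect-cd = rectangle c d (γ , Iγ , ≐-sym zc)
            sum-zero' : ω (simple j) + ω (simple k) ≡ 0ℚ
            sum-zero' = lem (1ℚ + φ) (ω (simple j)) (ω (simple k)) (trans (sym (trans (LinearForm.form-- (Ω-form (initial H)) (pos α -v simple j) (simple k))
                (cong (_- ω (simple k)) (trans (LinearForm.form-- (Ω-form (initial H)) (pos α) (simple j)) (cong (_- ω (simple j)) (ω-rect αz la hb))))))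
              (ω-rect u≐ (proj₁ rect-cd) (proj₂ rect-cd)))
              where
              lem : ∀ f x y → f - x - y ≡ f → x + y ≡ 0ℚ
              lem f x y z = trans (l f x y) (trans (cong (λ w → f - w) z) (ℚₚ.+-inverseʳ f))
                where
                l : ∀ f x y → x + y ≡ f - (f - x - y)
                l = solve-∀ ℚ-ring
            zeros : ω (simple j) ≡ 0ℚ × ω (simple k) ≡ 0ℚ
            zeros = nonneg-sum-zeroˡ (ω-simple j) (ω-simple k) sum-zero' , nonneg-sum-zeroʳ (ω-simple j) (ω-simple k) sum-zero'

    -- The border condition ranges over all pairs of simple roots, but only a subtraction that moves
    -- both ends inward can remain in the ideal.
    border-intro : ∀ {a b} → lowᵇ a → highᵇ b → InI I (root a b) →
      (∀ a⁺ b⁻ → toℕ a⁺ ≡ suc (toℕ a) → toℕ b ≡ suc (toℕ b⁻) → ¬ InI I (root a⁺ b⁻)) → InBorder I (root a b)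
    border-intro la hb (α , Iα , z) corner = α , (Iα , no-double la hb (≐-sym z) corner) , z

-- Minimal coset representatives with a prescribed image of the first block

module CosetWord {R : RootData} (𝓜 : Model R) where
  open Borders 𝓜 public

  CosetOf : (Fin M → Bool) → Set
  CosetOf g = Σ (Fin rank) λ i → Long i × Σ (List (Fin rank)) λ w → MinRep i w × (∀ r → initial (h i) r ≡ g (act w r))

  private
    adjacent-letter : ∀ k → ∃ λ j → ⊤ × (∀ r → τ j r ≡ rf (inject₁ k) (suc k) r)
    adjacent-letter k = let j , eq = letter k in j , tt , letter-τ (adjacent-≢ k) eq

    consecutive-letter : ∀ p q → toℕ q ≡ suc (toℕ p) → ∃ λ j → ⊤ × (∀ r → τ j r ≡ rf p q r)
    consecutive-letter p (suc k) z = subst (λ y → ∃ λ j → ⊤ × (∀ r → τ j r ≡ rf y (suc k) r)) p≡ (adjacent-letter k)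
      where
      p≡ : inject₁ k ≡ p
      p≡ = Finₚ.toℕ-injective (trans (Finₚ.toℕ-inject₁ k) (ℕₚ.suc-injective z))

  sorting : ∀ g → Good g → ∃ λ u → ∀ p q → g p ≡ true → g q ≡ false → act u p Fin.< act u q
  sorting g good = go result
    where
    -- With `J` constantly true every element of `g` precedes every other position.
    module Mg = Merge g (λ _ _ → true) (λ _ _ _ → refl)
    go : (∃ λ u → All (λ _ → ⊤) u × (∀ p q → Mg.lt p q ≡ true → toℕ (act u p) ℕ.< toℕ (act u q))) →
      ∃ λ u → ∀ p q → g p ≡ true → g q ≡ false → act u p Fin.< act u q
    go (u , _ , s) = u , λ p q gp gq → s p q (subst₂ (λ x y → Mg.merge x y p q ≡ true) (sym gp) (sym gq) refl)
    next : ∀ (r s : Fin M) → toℕ r ℕ.< toℕ s → ∃ λ (r' : Fin M) → toℕ r' ≡ suc (toℕ r)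
    next r s l = Fin.fromℕ< (ℕₚ.≤-<-trans l (Finₚ.toℕ<n s)) , Finₚ.toℕ-fromℕ< (ℕₚ.≤-<-trans l (Finₚ.toℕ<n s))
    result : ∃ λ u → All (λ _ → ⊤) u × (∀ p q → Mg.lt p q ≡ true → toℕ (act u p) ℕ.< toℕ (act u q))
    result = Sort.sort symm opp-free toℕ Finₚ.toℕ-injective (λ _ r s → trans (toℕ-opp r) (sym (toℕ-opp s)))
      next
      τ τ-invol τ-opp (λ _ → ⊤) consecutive-letter Mg.lt Mg.lt-irrefl (λ {p} {q} {r} → Mg.lt-trans {p} {q} {r}) Mg.lt-total
      (λ s {p} {q} → Mg.lt-opp (good s) (λ _ → refl) o-anti-< {p} {q})

  module FromSorting (g : Fin M → Bool) (good : Good g) (u : List (Fin rank))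
    (sorted : ∀ p q → g p ≡ true → g q ≡ false → act u p Fin.< act u q)
    (some : ∃ λ r → g r ≡ true) (other : ∃ λ r → g r ≡ false) where

    private
      f : Fin M → Bool
      f r = g (act (reverse u) r)

      f-act : ∀ r → f (act u r) ≡ g r
      f-act r = cong g (act-reverse u r)

      ordered : ∀ r s → f r ≡ true → f s ≡ false → r Fin.< s
      ordered r s a b = subst₂ Fin._<_ (reverse-act u r) (reverse-act u s) (sorted (act (reverse u) r) (act (reverse u) s) a b)

      down : ∀ r s → r Fin.≤ s → f s ≡ true → f r ≡ true
      down r s l t = case f r Boolₚ.≟ true of λ where
        (yes y) → y
        (no n)  → contradiction l (ℕₚ.<⇒≱ (ordered s r t (not-true n)))

      edge : ∃ λ (k : Fin m) → f (inject₁ k) ≡ true × f (suc k) ≡ false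
      edge = boundary f (down zero (act u (proj₁ some)) ℕ.z≤n (trans (f-act (proj₁ some)) (proj₂ some)))
        (not-true (λ t → not-false (trans (f-act (proj₁ other)) (proj₂ other)) (down (act u (proj₁ other)) last (Finₚ.≤fromℕ _) t)))

    module AtBoundary (k : Fin m) (inside : f (inject₁ k) ≡ true) (outside : f (suc k) ≡ false) where

      below : ∀ r → f r ≡ true → r Fin.≤ inject₁ k
      below r t = ℕₚ.≤-pred (subst (toℕ r ℕ.<_) (adjacent k) (ordered r (suc k) t outside))

      above : ∀ r → f r ≡ false → suc k Fin.≤ r
      above r t = subst (ℕ._≤ toℕ r) (sym (adjacent k)) (ordered (inject₁ k) r inside t)

      block : ∀ r → initial (suc (toℕ k)) r ≡ f r
      block r = case f r Boolₚ.≟ true of λ where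
        (yes t) → trans (<ᵇ-true (ℕ.s≤s (subst (toℕ r ℕ.≤_) (Finₚ.toℕ-inject₁ k) (below r t)))) (sym t)
        (no n)  → trans (<ᵇ-false (above r (not-true n))) (sym (not-true n))

      f-opp : symm ≡ true → ∀ r → f (o r) ≡ not (f r)
      f-opp s r = trans (cong g (act-opp s (reverse u) r)) (good s (act (reverse u) r))

      -- The mirror exchanges `g` and its complement, so their boundary is the centre; this makes
      -- the simple root there long.
      centre : symm ≡ true → suc k ≡ o (inject₁ k)
      centre s = Finₚ.toℕ-injective (ℕₚ.≤-antisym (above (o (inject₁ k)) (trans (f-opp s (inject₁ k)) (cong not inside)))
        (ℕₚ.+-cancelˡ-≤ (toℕ (inject₁ k)) _ _ (begin
          toℕ (inject₁ k) ℕ.+ toℕ (o (inject₁ k)) ≡⟨ trans (toℕ-opp (inject₁ k)) (sym (toℕ-opp (suc k))) ⟩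
          suc (toℕ k) ℕ.+ toℕ (o (suc k))         ≤⟨ ℕₚ.+-monoʳ-≤ (suc (toℕ k)) (below (o (suc k)) (trans (f-opp s (suc k)) (cong not outside))) ⟩
          suc (toℕ k) ℕ.+ toℕ (inject₁ k)         ≡⟨ ℕₚ.+-comm (suc (toℕ k)) (toℕ (inject₁ k)) ⟩
          toℕ (inject₁ k) ℕ.+ suc (toℕ k)         ∎)))
        where open ℕₚ.≤-Reasoning

      module AtLetter (i : Fin rank) (node-i : node i ≡ k) where

        long-i : Long i
        long-i = trans (trans (ip-cong (simple-e i) (simple-e i)) (root-norm (adjacent-≢ (node i)))) (trans
          (cong (λ z → 2ℚ + 2ℚ * z) same) (sym (trans (ip-cong θ-e θ-e) (root-norm first≢last))))
          where
          same : φ * δ (right i) (o (left i)) ≡ φ * δ last (o zero)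
          same = case symm-cases of λ where
            (inj₂ (_ , z)) → trans (cong (_* δ (right i) (o (left i))) z) (trans (trans (ℚₚ.*-zeroˡ (δ (right i) (o (left i)))) (sym (ℚₚ.*-zeroˡ (δ last (o zero)))))
                               (cong (_* δ last (o zero)) (sym z)))
            (inj₁ (s , _)) → cong (φ *_) (trans (cong (λ y → δ (suc y) (o (inject₁ y))) node-i)
                               (trans (cong (λ y → δ y (o (inject₁ k))) (centre s)) (trans (δ-refl (o (inject₁ k))) (sym (δ-refl last)))))

        open Block i long-i

        Reaches : List (Fin rank) → Set
        Reaches x = ∀ r → initial H r ≡ g (act x r)

        reaches-u : Reaches (reverse u)
        reaches-u r = trans (cong (λ y → initial (suc (toℕ y)) r) node-i) (block r)

        best : ∃ λ w → Reaches w × (∀ x → Reaches x → length w ℕ.≤ length x)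
        best = shortest (λ x → Finₚ.all? (λ r → initial H r Boolₚ.≟ g (act x r))) (reverse u) reaches-u

        parabolic : ∀ {x} → All (λ j → j ≢ i) x → ∀ r → initial H (act x r) ≡ initial H r
        parabolic [] r = refl
        parabolic {j ∷ x} (ne ∷ al) r = trans (τ-block ne (act x r)) (parabolic al r)

        -- Letters other than `i` preserve the blocks, so every word for an element of the coset of
        -- `w` also reaches `g`, and `w` is shortest among the words that do.
        minimal : ∀ w → Reaches w → (∀ x → Reaches x → length w ℕ.≤ length x) → MinRep i w
        minimal w rw mw x al y same = mw y λ r → trans (sym (parabolic al r)) (trans (rw (act x r)) (cong g (sym (moved r))))
          where
          moved : ∀ r → act y r ≡ act w (act x r)
          moved r = e-inj (≐-trans (≐-sym (actW-e y r)) (≐-trans (same (e r)) (≐-trans (actW-cong w (actW-e x r)) (actW-e w (act x r)))))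

        coset : CosetOf g
        coset = i , long-i , proj₁ best , minimal (proj₁ best) (proj₁ (proj₂ best)) (proj₂ (proj₂ best)) , proj₁ (proj₂ best)

      at-letter : (∃ λ i → node i ≡ k) → CosetOf g
      at-letter (i , z) = AtLetter.coset i z

      result : CosetOf g
      result = at-letter (long-letter k centre)

    coset : CosetOf g
    coset = AtBoundary.result (proj₁ edge) (proj₁ (proj₂ edge)) (proj₂ (proj₂ edge))

  cosetOf : ∀ g → Good g → (∃ λ r → g r ≡ true) → (∃ λ r → g r ≡ false) → CosetOf g
  cosetOf g good some other = FromSorting.coset g good (proj₁ (sorting g good)) (proj₂ (sorting g good)) some other

-- Sources and sinks of a point

module Signs {M : ℕ} (X : Fin M → ℚ) (tie : Fin M → Bool) where

  positive : Fin M → Bool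
  positive r = ⌊ 0ℚ ℚₚ.<? X r ⌋ ∨ (⌊ X r ℚₚ.≟ 0ℚ ⌋ ∧ tie r)

  data Sign (r : Fin M) : Set where
    pos′  : 0ℚ < X r → positive r ≡ true → Sign r
    zero′ : X r ≡ 0ℚ → positive r ≡ tie r → Sign r
    neg′  : X r < 0ℚ → positive r ≡ false → Sign r

  sign : ∀ r → Sign r
  sign r = go (0ℚ ℚₚ.<? X r) (X r ℚₚ.≟ 0ℚ) refl refl
    where
    go : ∀ (d : Dec (0ℚ < X r)) (d' : Dec (X r ≡ 0ℚ)) → (0ℚ ℚₚ.<? X r) ≡ d → (X r ℚₚ.≟ 0ℚ) ≡ d' → Sign r
    go (yes p) d' e e' = pos′ p (cong (λ d → ⌊ d ⌋ ∨ (⌊ X r ℚₚ.≟ 0ℚ ⌋ ∧ tie r)) e)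
    go (no n) (yes z) e e' = zero′ z (cong₂ (λ d d' → ⌊ d ⌋ ∨ (⌊ d' ⌋ ∧ tie r)) e e')
    go (no n) (no n') e e' = neg′ (≤∧≢⇒< (ℚₚ.≮⇒≥ n) n') (cong₂ (λ d d' → ⌊ d ⌋ ∨ (⌊ d' ⌋ ∧ tie r)) e e')

  positive⇒ : ∀ {r} → positive r ≡ true → 0ℚ ≤q X r
  positive⇒ {r} t with sign r
  ... | pos′ p _ = ℚₚ.<⇒≤ p
  ... | zero′ z _ = ℚₚ.≤-reflexive (sym z)
  ... | neg′ _ f = contradiction t (not-false f)

  negative⇒ : ∀ {r} → positive r ≡ false → X r ≤q 0ℚ
  negative⇒ {r} t with sign r
  ... | pos′ _ f = contradiction f (not-false t)
  ... | zero′ z _ = ℚₚ.≤-reflexive z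
  ... | neg′ n _ = ℚₚ.<⇒≤ n

  positive-tie : ∀ {r} → tie r ≡ true → 0ℚ ≤q X r → positive r ≡ true
  positive-tie {r} t le with sign r
  ... | pos′ _ p = p
  ... | zero′ _ p = trans p t
  ... | neg′ n _ = contradiction (ℚₚ.<-≤-trans n le) (ℚₚ.<-irrefl refl)

  negative-tie : ∀ {r} → tie r ≡ false → X r ≤q 0ℚ → positive r ≡ false
  negative-tie {r} t le with sign r
  ... | pos′ n _ = contradiction (ℚₚ.<-≤-trans n le) (ℚₚ.<-irrefl refl)
  ... | zero′ _ p = trans p t
  ... | neg′ _ p = p

  positive-opp : ∀ {r s} → X s ≡ - X r → tie s ≡ not (tie r) → positive s ≡ not (positive r)
  positive-opp {r} {s} x t with sign r
  ... | zero′ z p = trans (go (sign s)) (trans t (cong not (sym p)))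
    where
    Xs : X s ≡ 0ℚ
    Xs = trans x (cong -_ z)
    go : Sign s → positive s ≡ tie s
    go (pos′ n _) = contradiction n (ℚₚ.<-irrefl (sym Xs))
    go (zero′ _ p') = p'
    go (neg′ n _) = contradiction n (ℚₚ.<-irrefl Xs)
  ... | pos′ n p = trans (go (sign s)) (cong not (sym p))
    where
    Xs : X s < 0ℚ
    Xs = subst (_< 0ℚ) (sym x) (ℚₚ.neg-antimono-< n)
    go : Sign s → positive s ≡ false
    go (pos′ n _) = contradiction n (ℚₚ.<-asym Xs)
    go (zero′ z _) = contradiction Xs (ℚₚ.<-irrefl z)
    go (neg′ _ p') = p'
  ... | neg′ n p = trans (go (sign s)) (cong not (sym p))
    where
    Xs : 0ℚ < X s
    Xs = subst (0ℚ <_) (sym x) (ℚₚ.neg-antimono-< n)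
    go : Sign s → positive s ≡ true
    go (pos′ _ p') = p'
    go (zero′ z _) = contradiction Xs (ℚₚ.<-irrefl (sym z))
    go (neg′ n _) = contradiction n (ℚₚ.<-asym Xs)

  module _ (balanced : sumℚ X ≡ 0ℚ) where

    -- If there were no source, all coordinates would be nonpositive with sum zero, hence zero, and
    -- then `tie` would supply one.
    some-positive : ∀ {r} → tie r ≡ true → ∃ λ s → positive s ≡ true
    some-positive {r} t with Finₚ.any? (λ s → positive s Boolₚ.≟ true)
    ... | yes p = p
    ... | no none = r , positive-tie t (ℚₚ.≤-reflexive (sym (trans (sym (neg-neg (X r))) (cong -_ zr))))
      where
      zr : - X r ≡ 0ℚ
      zr = sum-nonneg-zero (λ s → neg-nonpos (negative⇒ (not-true (λ y → none (s , y))))) (trans (sum-neg X) (cong -_ balanced)) r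

    some-negative : ∀ {r} → tie r ≡ false → ∃ λ s → positive s ≡ false
    some-negative {r} t with Finₚ.any? (λ s → positive s Boolₚ.≟ false)
    ... | yes p = p
    ... | no none = r , negative-tie t (ℚₚ.≤-reflexive (sum-nonneg-zero (λ s → positive⇒ (yes-true (λ y → none (s , y)))) balanced r))
      where
      yes-true : ∀ {b} → b ≢ false → b ≡ true
      yes-true {true} _ = refl
      yes-true {false} h = contradiction refl h

  source sink : Fin M → ℚ
  source r = if positive r then X r else 0ℚ
  sink r = if positive r then 0ℚ else - X r

  source-nonneg : ∀ r → 0ℚ ≤q source r
  source-nonneg r = go (positive r) refl
    where
    go : ∀ b → positive r ≡ b → 0ℚ ≤q (if b then X r else 0ℚ)
    go true e = positive⇒ e
    go false _ = ℚₚ.≤-refl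

  sink-nonneg : ∀ r → 0ℚ ≤q sink r
  sink-nonneg r = go (positive r) refl
    where
    go : ∀ b → positive r ≡ b → 0ℚ ≤q (if b then 0ℚ else - X r)
    go true _ = ℚₚ.≤-refl
    go false e = neg-nonpos (negative⇒ e)

  source-sink : ∀ r → source r - sink r ≡ X r
  source-sink r = go (positive r)
    where
    lem : ∀ x → 0ℚ - (- x) ≡ x
    lem = solve-∀ ℚ-ring
    go : ∀ b → (if b then X r else 0ℚ) - (if b then 0ℚ else - X r) ≡ X r
    go true = ℚₚ.+-identityʳ (X r)
    go false = lem (X r)

  source-ind : ∀ r → source r ≡ ind (positive r) * X r
  source-ind r = go (positive r)
    where
    go : ∀ b → (if b then X r else 0ℚ) ≡ ind b * X r
    go true = sym (ℚₚ.*-identityˡ (X r))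
    go false = sym (ℚₚ.*-zeroˡ (X r))

  mass : sumℚ X ≡ 0ℚ → sumℚ source ≡ sumℚ sink
  mass balanced = x-y≡0⇒x≡y (trans (sym (sum-- source sink)) (trans (sum-cong source-sink) balanced))

  source-support : ∀ {r} → source r ≢ 0ℚ → positive r ≡ true
  source-support {r} ne = go (positive r) refl
    where
    go : ∀ b → positive r ≡ b → positive r ≡ true
    go true e = e
    go false e = contradiction (cong (λ b → if b then X r else 0ℚ) e) ne

  sink-support : ∀ {r} → sink r ≢ 0ℚ → positive r ≡ false
  sink-support {r} ne = go (positive r) refl
    where
    go : ∀ b → positive r ≡ b → positive r ≡ false
    go false e = e
    go true e = contradiction (cong (λ b → if b then 0ℚ else - X r) e) ne

-- The ideal attached to a point: the pair (a, b) belongs to it when the a-th interval of the source mass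
-- starts before the b-th interval of the sink mass ends. Only the first row and the last column are treated
-- as belonging to it in case of a tie, which keeps all its edges positive for points of the positive cone.

module Thresholds {m : ℕ} (H : ℕ) (H≤m : H ℕ.≤ m) (0<H : 0 ℕ.< H) (π : Fin (suc m) → Fin (suc m)) (π-inc : BlockIncreasing H π)
  (p q : Fin (suc m) → ℚ) (p≥0 : ∀ r → 0ℚ ≤q p r) (q≥0 : ∀ r → 0ℚ ≤q q r) where

  P Q : ℕ → ℚ
  P = prefix p
  Q = prefix q

  low : Fin (suc m) → Bool
  low r = toℕ r ℕ.<ᵇ H

  Before : Fin (suc m) → Fin (suc m) → Set
  Before a b = P (toℕ (π a)) < Q (suc (toℕ (π b))) ⊎ (a ≡ zero ⊎ b ≡ fromℕ m)

  Member : Fin (suc m) → Fin (suc m) → Set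
  Member a b = low a ≡ true × low b ≡ false × Before a b

  Member? : ∀ a b → Dec (Member a b)
  Member? a b = (low a Boolₚ.≟ true) ×-dec (low b Boolₚ.≟ false) ×-dec
    ((P (toℕ (π a)) ℚₚ.<? Q (suc (toℕ (π b)))) ⊎-dec ((a Fin.≟ zero) ⊎-dec (b Fin.≟ fromℕ m)))

  π-mono : ∀ {a b} → low a ≡ low b → a Fin.≤ b → π a Fin.≤ π b
  π-mono {a} {b} same l with a Fin.≟ b
  ... | yes refl = ℕₚ.≤-refl
  ... | no ne = ℕₚ.<⇒≤ (π-inc a b same (ℕₚ.≤∧≢⇒< l (λ z → ne (Finₚ.toℕ-injective z))))

  low-down : ∀ {a a'} → low a ≡ true → a' Fin.≤ a → low a' ≡ true
  low-down {a} {a'} t l = <ᵇ-true (ℕₚ.≤-<-trans l (<ᵇ-true⁻¹ {toℕ a} {H} t))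

  high-up : ∀ {b b'} → low b ≡ false → b Fin.≤ b' → low b' ≡ false
  high-up {b} {b'} t l = <ᵇ-false (ℕₚ.≤-trans (<ᵇ-false⁻¹ {toℕ b} {H} t) l)

  member-up : ∀ {a b a' b'} → Member a b → a' Fin.≤ a → b Fin.≤ b' → Member a' b'
  member-up {a} {b} {a'} {b'} (la , hb , bf) l l' = la' , hb' , go bf
    where
    la' : low a' ≡ true
    la' = low-down {a} {a'} la l
    hb' : low b' ≡ false
    hb' = high-up {b} {b'} hb l'
    go : Before a b → Before a' b'
    go (inj₁ x) = inj₁ (ℚₚ.≤-<-trans (prefix-mono p≥0 (π-mono {a'} {a} (trans la' (sym la)) l))
      (ℚₚ.<-≤-trans x (prefix-mono q≥0 (ℕ.s≤s (π-mono {b} {b'} (trans hb (sym hb')) l')))))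
    go (inj₂ (inj₁ refl)) = inj₂ (inj₁ (Finₚ.toℕ-injective (ℕₚ.n≤0⇒n≡0 l)))
    go (inj₂ (inj₂ refl)) = inj₂ (inj₂ (Finₚ.toℕ-injective (ℕₚ.≤-antisym (Finₚ.≤fromℕ b') l')))

  member-row : ∀ {b} → low b ≡ false → Member zero b
  member-row hb = <ᵇ-true 0<H , hb , inj₂ (inj₁ refl)

  member-column : ∀ {a} → low a ≡ true → Member a (fromℕ m)
  member-column la = la , <ᵇ-false (subst (H ℕ.≤_) (sym (Finₚ.toℕ-fromℕ m)) H≤m) , inj₂ (inj₂ refl)

  -- The last hypothesis lets the sink of `b` begin before the source of `a` ends. So the next
  -- source of the block begins after the previous sink has ended and the inequality of `Before`
  -- fails; an inner pair meets neither the first row nor the last column.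
  member-corner : ∀ {a b a⁺ b⁻} → low a ≡ true → low b ≡ false → toℕ a⁺ ≡ suc (toℕ a) → toℕ b ≡ suc (toℕ b⁻) →
    Q (toℕ (π b)) < P (suc (toℕ (π a))) → ¬ Member a⁺ b⁻
  member-corner {a} {b} {a⁺} {b⁻} la hb za zb lt (la⁺ , hb⁻ , bf) = go bf
    where
    π< : π a Fin.< π a⁺
    π< = π-inc a a⁺ (trans la (sym la⁺)) (ℕₚ.≤-reflexive (sym za))
    π<′ : π b⁻ Fin.< π b
    π<′ = π-inc b⁻ b (trans hb⁻ (sym hb)) (ℕₚ.≤-reflexive (sym zb))
    go : ¬ Before a⁺ b⁻
    go (inj₁ x) = ℚₚ.<-irrefl refl (ℚₚ.≤-<-trans (prefix-mono q≥0 π<′) (ℚₚ.<-trans lt (ℚₚ.≤-<-trans (prefix-mono p≥0 π<) x)))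
    go (inj₂ (inj₁ refl)) = case za of λ ()
    go (inj₂ (inj₂ refl)) = ℕₚ.<⇒≱ (ℕₚ.≤-reflexive (sym zb)) (Finₚ.≤fromℕ b)

  -- When `Q` stays below `P`, the strict inequality of `Before` rules out `π b < π a`; the two tie
  -- cases hold because `π` fixes the first and the last position.
  member-positive : (∀ k → Q k ≤q P k) → (∀ {a} → low a ≡ true → π zero Fin.≤ π a) →
    π zero ≡ zero → π (fromℕ m) ≡ fromℕ m → (∀ {a b} → π a ≡ π b → a ≡ b) → ∀ {a b} → Member a b → π a Fin.< π b
  member-positive QP first π0 πl inj {a} {b} (la , hb , bf) = ℕₚ.≤∧≢⇒< (go bf) (λ z → ne (inj (Finₚ.toℕ-injective z)))
    where
    ne : a ≢ b
    ne refl = case trans (sym la) hb of λ ()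
    go : Before a b → π a Fin.≤ π b
    go (inj₁ x) = ℕₚ.≮⇒≥ (λ l → ℚₚ.<-irrefl refl (ℚₚ.<-≤-trans x (ℚₚ.≤-trans (prefix-mono q≥0 l) (QP (toℕ (π a))))))
    go (inj₂ (inj₁ refl)) = subst (Fin._≤ π b) (sym π0) ℕ.z≤n
    go (inj₂ (inj₂ refl)) = subst (π a Fin.≤_) (sym πl) (Finₚ.≤fromℕ (π a))

  module _ (opp : ∀ r → low (opposite r) ≡ not (low r)) (π-opp : ∀ r → π (opposite r) ≡ opposite (π r))
    (p-opp : ∀ r → p (opposite r) ≡ q r) (balance : sumℚ p ≡ sumℚ q) where

    private
      o-o : ∀ (r : Fin (suc m)) → opposite (opposite r) ≡ r
      o-o = Finₚ.opposite-involutive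

      toℕ-o : ∀ (r : Fin (suc m)) → toℕ (opposite r) ≡ m ℕ.∸ toℕ r
      toℕ-o = Finₚ.opposite-prop

      cut-opp : ∀ r t → (toℕ (opposite t) ℕ.<ᵇ toℕ (opposite r)) ≡ not (toℕ t ℕ.<ᵇ suc (toℕ r))
      cut-opp r t with toℕ t ℕ.<? suc (toℕ r)
      ... | yes l = trans (<ᵇ-false (subst₂ ℕ._≤_ (sym (toℕ-o r)) (sym (toℕ-o t)) (ℕₚ.∸-monoʳ-≤ m (ℕₚ.≤-pred l)))) (sym (cong not (<ᵇ-true l)))
      ... | no n  = trans (<ᵇ-true (subst₂ ℕ._<_ (sym (toℕ-o t)) (sym (toℕ-o r))
              (ℕₚ.∸-monoʳ-< (ℕₚ.≮⇒≥ n) (Finₚ.toℕ≤pred[n] t)))) (sym (cong not (<ᵇ-false (ℕₚ.≮⇒≥ n))))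

      -- The mirror turns initial segments into complements of initial segments.
      prefix-opp : ∀ (f f' : Fin (suc m) → ℚ) → (∀ t → f (opposite t) ≡ f' t) → ∀ r →
        prefix f (toℕ (opposite r)) ≡ sumℚ f' - prefix f' (suc (toℕ r))
      prefix-opp f f' ff r = begin
        sumℚ (λ t → ind (toℕ t ℕ.<ᵇ toℕ (opposite r)) * f t)
          ≡⟨ sum-reindex opposite opposite o-o o-o (λ t → ind (toℕ t ℕ.<ᵇ toℕ (opposite r)) * f t) ⟨
        sumℚ (λ t → ind (toℕ (opposite t) ℕ.<ᵇ toℕ (opposite r)) * f (opposite t))
          ≡⟨ sum-cong (λ t → trans (cong₂ _*_ (trans (cong ind (cut-opp r t)) (ind-not (toℕ t ℕ.<ᵇ suc (toℕ r)))) (ff t)) (lem (ind (toℕ t ℕ.<ᵇ suc (toℕ r))) (f' t))) ⟩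
        sumℚ (λ t → f' t - ind (toℕ t ℕ.<ᵇ suc (toℕ r)) * f' t)
          ≡⟨ sum-- f' (λ t → ind (toℕ t ℕ.<ᵇ suc (toℕ r)) * f' t) ⟩
        sumℚ f' - prefix f' (suc (toℕ r)) ∎
        where
        open ≡-Reasoning
        lem : ∀ a b → (1ℚ - a) * b ≡ b - a * b
        lem = solve-∀ ℚ-ring

      P-opp : ∀ r → P (toℕ (opposite r)) ≡ sumℚ q - Q (suc (toℕ r))
      P-opp = prefix-opp p q p-opp

      Q-opp : ∀ r → Q (suc (toℕ (opposite r))) ≡ sumℚ p - P (toℕ r)
      Q-opp r = trans (lem (sumℚ q) (Q (suc (toℕ (opposite r)))))
        (cong₂ _-_ (sym balance) (trans (sym (P-opp (opposite r))) (cong (λ z → P (toℕ z)) (o-o r))))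
        where
        lem : ∀ s y → y ≡ s - (s - y)
        lem = solve-∀ ℚ-ring

    -- The mirror replaces `P` by the total minus `Q` and conversely, which preserves the
    -- inequality; it also exchanges the first row and the last column.
    member-opp : ∀ {a b} → Member a b → Member (opposite b) (opposite a)
    member-opp {a} {b} (la , hb , bf) = trans (opp b) (cong not hb) , trans (opp a) (cong not la) , go bf
      where
      go : Before a b → Before (opposite b) (opposite a)
      go (inj₂ (inj₁ refl)) = inj₂ (inj₂ refl)
      go (inj₂ (inj₂ refl)) = inj₂ (inj₁ (o-o zero))
      go (inj₁ x) = inj₁ (subst₂ _<_
        (sym (trans (cong (λ z → P (toℕ z)) (π-opp b)) (trans (P-opp (π b)) (cong (_- Q (suc (toℕ (π b)))) (sym balance)))))
        (sym (trans (cong (λ z → Q (suc (toℕ z))) (π-opp a)) (Q-opp (π a))))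
        (ℚₚ.+-monoʳ-< (sumℚ p) (ℚₚ.neg-antimono-< x)))

-- Covering of the polytope

Comb-zero : ∀ {m} {P : V m → Set} {φ : V m → ℚ} → LinearForm φ → (∀ {v} → P v → φ v ≡ 0ℚ) → ∀ {s x} → Comb P s x → φ x ≡ 0ℚ
Comb-zero {φ = φ} L h {s} {x} C = ℚₚ.≤-antisym
  (ℚₚ.≤-trans (Comb-bound L (λ p → ℚₚ.≤-reflexive (h p)) C) (ℚₚ.≤-reflexive (ℚₚ.*-zeroʳ s)))
  (subst (0ℚ ≤q_) (neg-neg (φ x)) (neg-nonpos (ℚₚ.≤-trans (Comb-bound (neg-form L) (λ p → ℚₚ.≤-reflexive (cong -_ (h p))) C) (ℚₚ.≤-reflexive (ℚₚ.*-zeroʳ s)))))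

Comb-nonneg-form : ∀ {m} {P : V m → Set} {φ : V m → ℚ} → LinearForm φ → (∀ {v} → P v → 0ℚ ≤q φ v) → ∀ {s x} → Comb P s x → 0ℚ ≤q φ x
Comb-nonneg-form {φ = φ} L h {s} {x} C =
  subst (0ℚ ≤q_) (neg-neg (φ x)) (neg-nonpos (ℚₚ.≤-trans (Comb-bound (neg-form L) (λ p → ℚₚ.neg-antimono-≤ (h p)) C) (ℚₚ.≤-reflexive (ℚₚ.*-zeroʳ s))))

module Cover {R : RootData} (𝓜 : Model R) where
  open CosetWord 𝓜 public

  RootVector : V dim → Set
  RootVector v = ∃₂ λ p q → p ≢ q × v ≐ root p q

  -- Nonnegative partial sums of the coordinates characterize the positive cone.
  Dominant : V dim → Set
  Dominant x = ∀ k → 0ℚ ≤q Ω (initial k) x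

  -- The coupling of sources and sinks represents `1ℚ + φ` times the point, because the Gram matrix
  -- lets each position act on its mirror image too; `κ` undoes this.
  κ : ℚ
  κ = if symm then ½ else 1ℚ

  κ-spec : κ * (1ℚ + φ) ≡ 1ℚ
  κ-spec = go symm
    where
    go : ∀ b → (if b then ½ else 1ℚ) * (1ℚ + ind b) ≡ 1ℚ
    go true  = refl
    go false = refl

  κ-nonneg : 0ℚ ≤q κ
  κ-nonneg = go symm
    where
    go : ∀ b → 0ℚ ≤q (if b then ½ else 1ℚ)
    go true  = ℚₚ.nonNegative⁻¹ ½
    go false = 0≤1

  module Point (x : V dim) (C : Comb RootVector 1ℚ x) where

    X : Fin M → ℚ
    X r = ⟨ x , e r ⟩

    open Signs X tie public

    balanced : sumℚ X ≡ 0ℚ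
    balanced = trans (sum-cong (λ r → sym (ℚₚ.*-identityˡ (X r)))) (Comb-zero (Ω-form (λ _ → true)) vanish C)
      where
      lem : ∀ f → (1ℚ - f * 1ℚ) - (1ℚ - f * 1ℚ) ≡ 0ℚ
      lem = solve-∀ ℚ-ring
      vanish : ∀ {v} → RootVector v → Ω (λ _ → true) v ≡ 0ℚ
      vanish (p , q , _ , h) = trans (LinearForm.form-cong (Ω-form (λ _ → true)) h) (trans (Ω-root (λ _ → true) p q) (lem φ))

    X-opp : symm ≡ true → ∀ r → X (o r) ≡ - X r
    X-opp s r = trans (ip-cong (≐-refl {u = x}) (e-opp s r)) (ip-negʳ (e r) x)

    φX-opp : ∀ r → φ * X (o r) ≡ - (φ * X r)
    φX-opp r = case symm-cases of λ where
      (inj₁ (s , _)) → trans (cong (φ *_) (X-opp s r)) (sym (ℚₚ.neg-distribʳ-* φ (X r)))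
      (inj₂ (_ , z)) → trans (cong (_* X (o r)) z) (trans (ℚₚ.*-zeroˡ (X (o r))) (sym (cong -_ (trans (cong (_* X r) z) (ℚₚ.*-zeroˡ (X r))))))

    good : Good positive
    good s r = positive-opp {r} {o r} (X-opp s r) (tie-opp s r)

    coset : CosetOf positive
    coset = cosetOf positive good (some-positive balanced tie-first) (some-negative balanced tie-last)

    module Cp = Coupling source sink source-nonneg sink-nonneg (mass balanced)

    -- The source mass is the value at `x` of the form `Ω positive`, which is at most `1ℚ + φ` on
    -- roots. This bound leaves room for the vertex 0.
    mass≤ : κ * sumℚ source ≤q 1ℚ
    mass≤ = begin
      κ * sumℚ source        ≡⟨ cong (κ *_) (sum-cong source-ind) ⟩
      κ * Ω positive x       ≤⟨ *-monoˡ κ-nonneg (Comb-bound (Ω-form positive) bound C) ⟩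
      κ * (1ℚ * (1ℚ + φ))    ≡⟨ cong (κ *_) (ℚₚ.*-identityˡ (1ℚ + φ)) ⟩
      κ * (1ℚ + φ)           ≡⟨ κ-spec ⟩
      1ℚ                     ∎
      where
      open ℚₚ.≤-Reasoning
      bound : ∀ {v} → RootVector v → Ω positive v ≤q 1ℚ + φ
      bound {v} (p , q , _ , h) = ≤-by ((1ℚ + φ) * ((1ℚ - ind (positive p)) + ind (positive q)))
        (*-nonneg (+-nonneg 0≤1 φ-nonneg) (+-nonneg (x≤y⇒0≤y-x (ind≤1 (positive p))) (ind-nonneg (positive q))))
        (trans (cong (_+ (1ℚ + φ) * ((1ℚ - ind (positive p)) + ind (positive q))) (trans (LinearForm.form-cong (Ω-form positive) h) (Ω-good good p q)))
          (lem (1ℚ + φ) (ind (positive p)) (ind (positive q))))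
        where
        lem : ∀ f a b → f * (a - b) + f * ((1ℚ - a) + b) ≡ f
        lem = solve-∀ ℚ-ring

    module Decomposition (P : V dim → Set) (edges : ∀ a b → Cp.coupling a b ≢ 0ℚ → P (root a b)) where

      c : Fin K → ℚ
      c k = κ * Cp.coupling (fst k) (snd k)

      entry : ∀ a b → Flow.C c a b ≡ κ * Cp.coupling a b
      entry a b = cong (λ z → κ * Cp.coupling (proj₁ z) (proj₂ z)) (Finₚ.remQuot-combine a b)

      rows : ∀ a → rowSum (Flow.C c) a ≡ κ * source a
      rows a = trans (sum-cong (entry a)) (trans (sum-* κ (Cp.coupling a)) (cong (κ *_) (Cp.coupling-row a)))

      cols : ∀ b → colSum (Flow.C c) b ≡ κ * sink b
      cols b = trans (sum-cong (λ a → entry a b)) (trans (sum-* κ (λ a → Cp.coupling a b)) (cong (κ *_) (Cp.coupling-col b)))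

      -- Paired with `e r` the coupling gives source minus sink at `r`, corrected by `φ` times the
      -- same at `o r`. These are coordinates of `x`, which change sign under the mirror in the
      -- symmetric case.
      value : sumV (λ k → c k ·v vec k) ≐ x
      value = separating (sumV (λ k → c k ·v vec k)) x λ r → begin
        ⟨ sumV (λ k → c k ·v vec k) , e r ⟩
          ≡⟨ Flow.pairing c r ⟩
        (rowSum (Flow.C c) r - φ * rowSum (Flow.C c) (o r)) - (colSum (Flow.C c) r - φ * colSum (Flow.C c) (o r))
          ≡⟨ cong₂ _-_ (cong₂ (λ u v → u - φ * v) (rows r) (rows (o r))) (cong₂ (λ u v → u - φ * v) (cols r) (cols (o r))) ⟩
        (κ * source r - φ * (κ * source (o r))) - (κ * sink r - φ * (κ * sink (o r)))
          ≡⟨ lem₁ κ φ (source r) (sink r) (source (o r)) (sink (o r)) ⟩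
        κ * ((source r - sink r) - φ * (source (o r) - sink (o r)))
          ≡⟨ cong₂ (λ u v → κ * (u - φ * v)) (source-sink r) (source-sink (o r)) ⟩
        κ * (X r - φ * X (o r))
          ≡⟨ cong (λ v → κ * (X r - v)) (φX-opp r) ⟩
        κ * (X r - (- (φ * X r)))
          ≡⟨ lem₂ κ φ (X r) ⟩
        κ * (1ℚ + φ) * X r
          ≡⟨ trans (cong (_* X r) κ-spec) (ℚₚ.*-identityˡ (X r)) ⟩
        X r ∎
        where
        open ≡-Reasoning
        lem₁ : ∀ k f a b c d → (k * a - f * (k * c)) - (k * b - f * (k * d)) ≡ k * ((a - b) - f * (c - d))
        lem₁ = solve-∀ ℚ-ring
        lem₂ : ∀ k f x → k * (x - (- (f * x))) ≡ k * (1ℚ + f) * x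
        lem₂ = solve-∀ ℚ-ring

      weight : sumℚ c ≡ κ * sumℚ source
      weight = trans (sum-combine M M c) (trans (sum-cong rows) (sum-* κ source))

      decomposition : Conv₀ P x
      decomposition = sumℚ c , ℚₚ.≤-trans (ℚₚ.≤-reflexive weight) mass≤ ,
        Comb-resp refl value (Comb-fin c vec (λ k → *-nonneg κ-nonneg (Cp.coupling-nonneg (fst k) (snd k)))
          (λ k ne → edges (fst k) (snd k) (λ z → ne (trans (cong (κ *_) z) (ℚₚ.*-zeroʳ κ)))))

    module AtCoset (i : Fin rank) (long : Long i) (w : List (Fin rank)) (mr : MinRep i w)
      (moves : ∀ r → initial (h i) r ≡ positive (act w r)) where

      open Ideals 𝓜 i long using (Hook; H≤m; block-<)
      open Block i long

      private
        π : Fin M → Fin M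
        π = act w

        inc : BlockIncreasing H π
        inc = minrep-increasing {w} mr

      module T = Thresholds H H≤m (ℕ.s≤s ℕ.z≤n) π inc source sink source-nonneg sink-nonneg

      source-opp : symm ≡ true → ∀ r → source (o r) ≡ sink r
      source-opp s r = trans (cong₂ (λ b y → if b then y else 0ℚ) (good s r) (X-opp s r)) (Boolₚ.if-not (positive r))

      member-mirror : symm ≡ true → ∀ {a b} → T.Member a b → T.Member (o b) (o a)
      member-mirror s {a} {b} = T.member-opp (block-opp s) (act-opp s w) (source-opp s) (mass balanced) {a} {b}

      -- `pos-pair` chooses one of the two pairs of a root, so membership has to be independent of
      -- this choice.
      member-transport : ∀ {a b a' b'} → a ≢ b → root a b ≐ root a' b' → T.Member a b → T.Member a' b'
      member-transport {a} {b} {a'} {b'} ne eq mb = case root-≡ ne eq of λ where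
        (inj₁ (y , z)) → subst₂ T.Member y z mb
        (inj₂ (s , y , z)) → subst₂ T.Member (trans (cong o z) (o-o a')) (trans (cong o y) (o-o b')) (member-mirror s mb)

      first second : Fin N → Fin M
      first α = proj₁ (pos-pair α)
      second α = proj₁ (proj₂ (pos-pair α))

      first<second : ∀ α → first α Fin.< second α
      first<second α = proj₁ (proj₂ (proj₂ (pos-pair α)))

      pos-≐ : ∀ α → pos α ≐ root (first α) (second α)
      pos-≐ α = proj₂ (proj₂ (proj₂ (pos-pair α)))

      module Built (I : Subset⁺) (spec : ∀ α → I α ≡ ⌊ T.Member? (first α) (second α) ⌋) where

        spec⇒ : ∀ α → I α ≡ true → T.Member (first α) (second α)
        spec⇒ α t = ⌊⌋-true⁻¹ {d = T.Member? (first α) (second α)} (trans (sym (spec α)) t)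

        ⇒spec : ∀ α → T.Member (first α) (second α) → I α ≡ true
        ⇒spec α mb = trans (spec α) (⌊⌋-true {d = T.Member? (first α) (second α)} mb)

        InI⇒Member : ∀ {a b} → InI I (root a b) → T.Member a b
        InI⇒Member (α , Iα , z) = member-transport (<⇒≢ᶠ (first<second α)) (≐-trans (≐-sym (pos-≐ α)) (≐-sym z)) (spec⇒ α Iα)

        Member⇒InI : ∀ {a b} → T.Member a b → InI I (root a b)
        Member⇒InI {a} {b} mb@(la , hb , _) = go (pair-pos a b l)
          where
          l : a Fin.< b
          l = block-< {a} {b} la hb
          go : IsPos (root a b) → InI I (root a b)
          go (α , z) = α , ⇒spec α (member-transport (<⇒≢ᶠ l) (≐-trans z (pos-≐ α)) mb) , z

        hook : Hook I
        hook = record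
          { ≐-closed = λ α β eq Iα → ⇒spec β (member-transport (<⇒≢ᶠ (first<second α)) (≐-trans (≐-sym (pos-≐ α)) (≐-trans eq (pos-≐ β))) (spec⇒ α Iα))
          ; rectangle = λ a b inn → proj₁ (InI⇒Member inn) , proj₁ (proj₂ (InI⇒Member inn))
          ; upward = λ a b a' b' inn l l' → Member⇒InI (T.member-up (InI⇒Member inn) l l')
          ; row = λ b hb → Member⇒InI (T.member-row hb)
          ; column = λ a la → Member⇒InI (T.member-column la) }

        open BorderFacts 𝓜 i long using (border-intro)

        coupled : ∀ a b → Cp.coupling a b ≢ 0ℚ → source a ≢ 0ℚ × sink b ≢ 0ℚ
        coupled a b ne =
          (λ z → ne (sum-nonneg-zero (Cp.coupling-nonneg a) (trans (Cp.coupling-row a) z) b)) ,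
          (λ z → ne (sum-nonneg-zero (λ a → Cp.coupling-nonneg a b) (trans (Cp.coupling-col b) z) a))

        -- The sink interval ends after the source interval begins, so the pair is in the ideal; it
        -- begins before the source interval ends, so the inner corner is not.
        coupling-edge : ∀ a b → Cp.coupling a b ≢ 0ℚ → EdgeOf w I a b
        coupling-edge a b ne = border-intro I hook la hb
            (Member⇒InI (la , hb , inj₁ (subst₂ (λ x y → T.P (toℕ x) < T.Q (suc (toℕ y))) (sym πa) (sym πb) (proj₁ supp))))
            (λ a⁺ b⁻ za zb inn → T.member-corner {act⁻¹ w a} {act⁻¹ w b} {a⁺} {b⁻} la hb za zb
              (subst₂ (λ x y → T.Q (toℕ y) < T.P (suc (toℕ x))) (sym πa) (sym πb) (proj₂ supp)) (InI⇒Member inn))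
          where
          supp : Cp.P (toℕ a) < Cp.Q (suc (toℕ b)) × Cp.Q (toℕ b) < Cp.P (suc (toℕ a))
          supp = Cp.coupling-support a b ne
          πa : π (act⁻¹ w a) ≡ a
          πa = reverse-act w a
          πb : π (act⁻¹ w b) ≡ b
          πb = reverse-act w b
          la : initial H (act⁻¹ w a) ≡ true
          la = trans (moves (act⁻¹ w a)) (trans (cong positive πa) (source-support (proj₁ (coupled a b ne))))
          hb : initial H (act⁻¹ w b) ≡ false
          hb = trans (moves (act⁻¹ w b)) (trans (cong positive πb) (sink-support (proj₂ (coupled a b ne))))

        region : Conv₀ (EdgeVector w I) x
        region = Decomposition.decomposition (EdgeVector w I) (λ a b ne → a , b , ≐-refl , coupling-edge a b ne)

        module _ (dominant : Dominant x) where

          private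
            -- Dominance says that in every initial segment the sources outweigh the sinks.
            Q≤P : ∀ k → T.Q k ≤q T.P k
            Q≤P k = 0≤y-x⇒x≤y (subst (0ℚ ≤q_) (trans (sum-cong (λ r → trans (cong (ind (initial k r) *_) (sym (source-sink r)))
                (lem (ind (initial k r)) (source r) (sink r)))) (sum-- (λ r → ind (initial k r) * source r) (λ r → ind (initial k r) * sink r))) (dominant k))
              where
              lem : ∀ a b c → a * (b - c) ≡ a * b - a * c
              lem = solve-∀ ℚ-ring

            first-positive : positive zero ≡ true
            first-positive = positive-tie tie-first (subst (0ℚ ≤q_) (trans (prefix-suc X zero) (trans (cong (_+ X zero) (prefix-0 X)) (ℚₚ.+-identityˡ (X zero)))) (dominant 1))

            last-negative : positive last ≡ false
            last-negative = negative-tie tie-last (0≤y-x⇒x≤y (subst (0ℚ ≤q_) prefix-last (dominant m)))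
              where
              prefix-last : prefix X m ≡ 0ℚ - X last
              prefix-last = trans (lem (prefix X m) (X last)) (cong (_- X last) (trans (sym (trans (cong (λ k → prefix X (suc k)) (sym (Finₚ.toℕ-fromℕ m)))
                (trans (prefix-suc X last) (cong (λ k → prefix X k + X last) (Finₚ.toℕ-fromℕ m))))) (trans (prefix-all X) balanced)))
                where
                lem : ∀ a b → a ≡ (a + b) - b
                lem = solve-∀ ℚ-ring

            zero-low : initial H (act⁻¹ w zero) ≡ true
            zero-low = trans (moves (act⁻¹ w zero)) (trans (cong positive (reverse-act w zero)) first-positive)

            last-high : initial H (act⁻¹ w last) ≡ false
            last-high = trans (moves (act⁻¹ w last)) (trans (cong positive (reverse-act w last)) last-negative)

            last-high′ : initial H last ≡ false
            last-high′ = T.high-up {act⁻¹ w last} {last} last-high (Finₚ.≤fromℕ (act⁻¹ w last))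

            -- Position zero is the image of a position of the first block. As `w` increases there,
            -- the image of the first position cannot be larger.
            π-zero : π zero ≡ zero
            π-zero = Finₚ.toℕ-injective (ℕₚ.n≤0⇒n≡0 (subst (π zero Fin.≤_) (reverse-act w zero) (T.π-mono {zero} {act⁻¹ w zero} (sym zero-low) ℕ.z≤n)))

            π-last : π last ≡ last
            π-last = Finₚ.toℕ-injective (ℕₚ.≤-antisym (Finₚ.≤fromℕ (π last))
              (subst (Fin._≤ π last) (reverse-act w last) (T.π-mono {act⁻¹ w last} {last} (trans last-high (sym last-high′)) (Finₚ.≤fromℕ (act⁻¹ w last)))))

          edges-positive : ∀ a b → EdgeOf w I a b → a Fin.< b
          edges-positive a b (α , bd , z) = subst₂ Fin._<_ (reverse-act w a) (reverse-act w b)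
            (T.member-positive Q≤P (λ {c} lc → T.π-mono {zero} {c} (sym lc) ℕ.z≤n) π-zero π-last (act-inj w)
              {act⁻¹ w a} {act⁻¹ w b} (InI⇒Member (α , proj₁ bd , z)))

      ideal : Subset⁺
      ideal α = ⌊ T.Member? (first α) (second α) ⌋

      module Ideal = Built ideal (λ α → refl)

  Covered : V dim → Set
  Covered x = Σ (Fin rank) λ i → Σ (Long i) λ long → Σ (List (Fin rank)) λ w → MinRep i w × Σ Subset⁺ λ I → InIab (simple i) I ×
    Conv₀ (EdgeVector w I) x × (Dominant x → ∀ a b → EdgeOf w I a b → a Fin.< b)

  covered : ∀ x → Comb RootVector 1ℚ x → Covered x
  covered x C = go (Point.coset x C)
    where
    go : CosetOf (Point.positive x C) → Covered x
    go (i , long , w , mr , moves) = i , long , w , mr , A.ideal , HookWord.Hook⇒InIab 𝓜 i long A.ideal A.Ideal.hook , A.Ideal.region , A.Ideal.edges-positive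
      where
      module A = Point.AtCoset x C i long w mr moves

-- The two triangulations

∈-index : ∀ {A : Set} {x : A} {xs} → x ∈ xs → ∃ λ j → x ≡ lookup xs j
∈-index p = Any.index p , Anyₚ.lookup-index p

module Result {R : RootData} (𝓜 : Model R) where
  open Cover 𝓜

  signed : List (V dim)
  signed = posRoots ++ List.map -v_ posRoots

  IsRoot-signed : ∀ {v} → IsRoot v → ∃ λ j → v ≐ lookup signed j
  IsRoot-signed {v} (inj₁ (a , z)) =
    let j , eq = ∈-index (∈ₚ.∈-++⁺ˡ {ys = List.map -v_ posRoots} (∈ₚ.∈-lookup {xs = posRoots} a))
    in j , ≐-trans z (λ k → cong (λ y → y k) eq)
  IsRoot-signed {v} (inj₂ (a , z)) =
    let j , eq = ∈-index (∈ₚ.∈-++⁺ʳ posRoots (∈ₚ.∈-map⁺ -v_ (∈ₚ.∈-lookup {xs = posRoots} a)))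
    in j , ≐-trans (λ k → trans (sym (neg-neg (v k))) (cong -_ (z k))) (λ k → cong (λ y → y k) eq)

  signed-IsRoot : ∀ j → IsRoot (lookup signed j)
  signed-IsRoot j = case ∈ₚ.∈-++⁻ posRoots (∈ₚ.∈-lookup {xs = signed} j) of λ where
    (inj₁ p) → let a , eq = ∈-index p in inj₁ (a , λ k → cong (λ y → y k) eq)
    (inj₂ p) → let y , y∈ , eq = ∈ₚ.∈-map⁻ -v_ p
                   a , eq' = ∈-index y∈
               in inj₂ (a , λ k → trans (cong (λ z → - z k) eq) (trans (neg-neg (y k)) (cong (λ z → z k) eq')))

  RootVector⇒IsRoot : ∀ {v} → RootVector v → IsRoot v
  RootVector⇒IsRoot (p , q , ne , h) = pair-IsRoot ne h

  𝓟⇒Comb : ∀ x → 𝓟 x → Comb RootVector 1ℚ x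
  𝓟⇒Comb x (c , c≥0 , _ , c1 , cx) = Comb-resp c1 cx (Comb-fin c (lookup signed) c≥0 (λ j _ → IsRoot-pair (signed-IsRoot j)))

  Comb⇒𝓟 : ∀ x → Comb RootVector 1ℚ x → 𝓟 x
  Comb⇒𝓟 x C =
    let c , c≥0 , _ , c1 , cx = Comb-coeffs (lookup signed) (λ _ → ⊤) (λ r → let j , z = IsRoot-signed (RootVector⇒IsRoot r) in j , tt , z) C
    in c , c≥0 , (λ _ _ → tt) , c1 , cx

  -- 0 is the midpoint of two opposite roots, which absorb the missing weight.
  Conv₀⇒𝓟 : Conv₀ RootVector ⊆ᵣ 𝓟
  Conv₀⇒𝓟 x (s , s≤1 , C) = Comb⇒𝓟 x (Comb-resp (lem s) vec-eq (Comb-+ C (Comb-+ (Comb-single {c = ½ * (1ℚ - s)} c≥0 (zero , last , first≢last , ≐-refl))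
      (Comb-single {c = ½ * (1ℚ - s)} c≥0 (last , zero , last≢first , ≐-refl)))))
    where
    c≥0 : 0ℚ ≤q ½ * (1ℚ - s)
    c≥0 = *-nonneg (ℚₚ.nonNegative⁻¹ ½) (x≤y⇒0≤y-x s≤1)
    lem : ∀ s → s + (½ * (1ℚ - s) + ½ * (1ℚ - s)) ≡ 1ℚ
    lem = solve-∀ ℚ-ring
    lem₂ : ∀ x c a b → x + (c * (a - b) + c * (b - a)) ≡ x
    lem₂ = solve-∀ ℚ-ring
    vec-eq : (x +v (((½ * (1ℚ - s)) ·v root zero last) +v ((½ * (1ℚ - s)) ·v root last zero))) ≐ x
    vec-eq k = lem₂ (x k) (½ * (1ℚ - s)) (e zero k) (e last k)

  𝓟⁺⇒ : 𝓟⁺ ⊆ᵣ Conv₀ IsPos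
  𝓟⁺⇒ x h = Conv₀-mono (λ (j , _ , z) → j , z) x (ConvSub⇒Conv₀ posRoots (λ _ → ⊤) tt x h)

  ⇒𝓟⁺ : Conv₀ IsPos ⊆ᵣ 𝓟⁺
  ⇒𝓟⁺ x h = Conv₀⇒ConvSub posRoots (λ _ → ⊤) tt x (Conv₀-mono (λ (j , z) → j , tt , z) x h)

  Comb-dominant : ∀ {s x} → Comb IsPos s x → Dominant x
  Comb-dominant C k = Comb-nonneg-form (Ω-form (initial k)) (λ {v} ps → let p , q , l , h = pos-root ps in
    subst (0ℚ ≤q_) (LinearForm.form-cong (Ω-form (initial k)) (≐-sym h)) (Ω-initial-nonneg k l)) C

  𝓒⁺-dominant : ∀ x → 𝓒⁺ x → Dominant x
  𝓒⁺-dominant x (c , c≥0 , cx) = Comb-dominant (Comb-resp refl cx (Comb-fin c pos c≥0 (λ a _ → a , ≐-refl)))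

  𝓟⁺⊆𝓒⁺ : 𝓟⁺ ⊆ᵣ 𝓒⁺
  𝓟⁺⊆𝓒⁺ x h =
    let s , _ , C = 𝓟⁺⇒ x h
        c , c≥0 , _ , _ , cx = Comb-coeffs pos (λ _ → ⊤) (λ (a , z) → a , tt , z) C
    in c , c≥0 , cx

  IsPos-RootVector : ∀ {v} → IsPos v → RootVector v
  IsPos-RootVector ps = IsRoot-pair (inj₁ ps)

  𝓟⁺⊆𝓟 : 𝓟⁺ ⊆ᵣ 𝓟
  𝓟⁺⊆𝓟 x h = Conv₀⇒𝓟 x (Conv₀-mono IsPos-RootVector x (𝓟⁺⇒ x h))

  dominant-root : ∀ {p q} → p ≢ q → Dominant (root p q) → p Fin.< q
  dominant-root {p} {q} ne dom = case ℕₚ.<-cmp (toℕ p) (toℕ q) of λ where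
      (tri< l _ _) → l
      (tri≈ _ z _) → contradiction (Finₚ.toℕ-injective z) ne
      (tri> _ _ g) → ⊥-elim (ℚₚ.<-irrefl {0ℚ} refl (ℚₚ.<-≤-trans 0<1 (impossible g)))
    where
    k : ℕ
    -- The initial segment that ends with `q` contains `q` but not `p`, so the partial sum over it
    -- is negative.
    k = suc (toℕ q)
    impossible : q Fin.< p → 1ℚ ≤q 0ℚ
    impossible g = 0≤y-x⇒x≤y (subst (0ℚ ≤q_) eq (+-nonneg (dom k) (*-nonneg φ-nonneg (x≤y⇒0≤y-x anti))))
      where
      anti : ind (initial k (o q)) ≤q ind (initial k (o p))
      anti = ind-mono (λ t → <ᵇ-true (ℕₚ.<-trans (o-anti-< g) (<ᵇ-true⁻¹ {toℕ (o q)} {k} t)))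
      lem : ∀ f a b → ((0ℚ - f * a) - (1ℚ - f * b)) + f * (a - b) ≡ 0ℚ - 1ℚ
      lem = solve-∀ ℚ-ring
      eq : Ω (initial k) (root p q) + φ * (ind (initial k (o p)) - ind (initial k (o q))) ≡ 0ℚ - 1ℚ
      eq = trans (cong (_+ φ * (ind (initial k (o p)) - ind (initial k (o q)))) (trans (Ω-root (initial k) p q)
        (cong₂ (λ x y → (ind x - φ * ind (initial k (o p))) - (ind y - φ * ind (initial k (o q)))) (<ᵇ-false {toℕ p} {k} g) (<ᵇ-true (ℕₚ.n<1+n (toℕ q))))))
        (lem φ (ind (initial k (o p))) (ind (initial k (o q))))

  wordOf : TIx → List (Fin rank)
  wordOf (_ , _ , w , _) = w

  idealOf : TIx → Subset⁺
  idealOf (_ , _ , _ , _ , I , _) = I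

  nodeOf : TIx → Fin rank
  nodeOf (i , _) = i

  cellT : TIx → Fin K → Bool
  cellT t = cellOf (wordOf t) (idealOf t)

  okT : ∀ t → OK (cellT t)
  okT (i , long , w , mr , I , iab) = BorderFacts.cell-ok 𝓜 i long I (Ideals.InIab⇒Hook 𝓜 i long iab) {w} mr

  regT-cell : ∀ t → regT t ≡ᵣ cell (cellT t)
  regT-cell t = Moved-cell (wordOf t) (idealOf t)

  edge-≢ : ∀ w I {p q} → EdgeOf w I p q → p ≢ q
  edge-≢ w I (a , bd , z) eq = <⇒≢ᶠ (pos-order ≐-refl (a , z)) (cong (act⁻¹ w) eq)

  EdgeVector-Root : ∀ w I {v} → EdgeVector w I v → RootVector v
  EdgeVector-Root w I (p , q , h , ed) = p , q , edge-≢ w I ed , h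

  regT⊆𝓟 : ∀ t → regT t ⊆ᵣ 𝓟
  regT⊆𝓟 t x h = Conv₀⇒𝓟 x (Conv₀-mono (EdgeVector-Root (wordOf t) (idealOf t)) x (Moved⇒ (wordOf t) (idealOf t) x h))

  PositiveEdges : List (Fin rank) → Subset⁺ → Set
  PositiveEdges w I = ∀ p q → EdgeOf w I p q → p Fin.< q

  PositiveEdges? : ∀ w I → Dec (PositiveEdges w I)
  PositiveEdges? w I = Finₚ.all? (λ p → Finₚ.all? (λ q → EdgeOf? w I p q →-dec (p Fin.<? q)))

  positive⇒𝓟⁺ : ∀ t → PositiveEdges (wordOf t) (idealOf t) → regT t ⊆ᵣ 𝓟⁺
  positive⇒𝓟⁺ t ps x h = ⇒𝓟⁺ x (Conv₀-mono (λ (p , q , z , ed) → IsPos-resp (≐-sym z) (pair-pos p q (ps p q ed))) x (Moved⇒ (wordOf t) (idealOf t) x h))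

  -- The root of each edge is a point of the simplex, so it lies in the positive cone and its pair
  -- is increasing by `dominant-root`.
  𝓟⁺⇒positive : ∀ t → regT t ⊆ᵣ 𝓟⁺ → PositiveEdges (wordOf t) (idealOf t)
  𝓟⁺⇒positive t sub p q ed = dominant-root (edge-≢ (wordOf t) (idealOf t) ed)
    (𝓒⁺-dominant (root p q) (𝓟⁺⊆𝓒⁺ (root p q) (sub (root p q) (⇒Moved (wordOf t) (idealOf t) (root p q)
      (1ℚ , ℚₚ.≤-refl , Comb-resp refl (λ k → ℚₚ.*-identityˡ (root p q k)) (Comb-single 0≤1 (p , q , ≐-refl , ed)))))))

  cover-point : ∀ x → 𝓟 x → Σ TIx λ t → regT t x × (Dominant x → regT t ⊆ᵣ 𝓟⁺)
  cover-point x h = go (covered x (𝓟⇒Comb x h))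
    where
    go : Covered x → Σ TIx λ t → regT t x × (Dominant x → regT t ⊆ᵣ 𝓟⁺)
    go (i , long , w , mr , I , iab , region , ps) = t , ⇒Moved w I x region , λ dom → positive⇒𝓟⁺ t (ps dom)
      where
      t : TIx
      t = i , long , w , mr , I , iab

  -- A point of the cone is dominant, and the simplex found for a dominant point lies in 𝓟⁺ as a
  -- whole.
  𝓟∩𝓒⁺⊆𝓟⁺ : (𝓟 ∩ᵣ 𝓒⁺) ⊆ᵣ 𝓟⁺
  𝓟∩𝓒⁺⊆𝓟⁺ x (a , b) = let t , r , sub = cover-point x a in sub (𝓒⁺-dominant x b) x r

  -- Finiteness: a cell is determined by the positions of its sources and by its ideal.

  sources : TIx → Fin M → Bool
  sources t r = initial (h (nodeOf t)) (act⁻¹ (wordOf t) r)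

  Code : (Fin M → Bool) × Subset⁺ → TIx → Set
  Code (g , J) t = (∀ r → g r ≡ sources t r) × (∀ a → J a ≡ idealOf t a)

  block-size : ∀ {k l : Fin m} → sumℚ (λ r → ind (initial (suc (toℕ k)) r)) ≡ sumℚ (λ r → ind (initial (suc (toℕ l)) r)) → k ≡ l
  block-size {k} {l} eq = Finₚ.toℕ-injective (ℕₚ.≤-antisym (bound k l same) (bound l k (λ r → sym (same r))))
    where
    same : ∀ r → initial (suc (toℕ k)) r ≡ initial (suc (toℕ l)) r
    same = initial-unique (suc (toℕ l)) (initial (suc (toℕ k))) (λ p q l' t → <ᵇ-true (ℕₚ.≤-<-trans l' (<ᵇ-true⁻¹ {toℕ q} {suc (toℕ k)} t))) eq
    bound : ∀ (k l : Fin m) → (∀ r → initial (suc (toℕ k)) r ≡ initial (suc (toℕ l)) r) → toℕ k ℕ.≤ toℕ l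
    bound k l same = subst (ℕ._≤ toℕ l) (Finₚ.toℕ-inject₁ k) (ℕₚ.≤-pred (<ᵇ-true⁻¹ {toℕ (inject₁ k)} {suc (toℕ l)}
      (trans (sym (same (inject₁ k))) (<ᵇ-true (subst (ℕ._< suc (toℕ k)) (sym (Finₚ.toℕ-inject₁ k)) (ℕₚ.n<1+n (toℕ k)))))))

  sources-sum : ∀ (i : Fin rank) (w : List (Fin rank)) → sumℚ (λ r → ind (initial (h i) (act⁻¹ w r))) ≡ sumℚ (λ r → ind (initial (h i) r))
  sources-sum i w = act-sum (reverse w) (λ r → ind (initial (h i) r))

  -- The number of sources is the size of the first block, which determines the node.
  same-node : ∀ {i i' w w'} → (∀ r → initial (h i) (act⁻¹ w r) ≡ initial (h i') (act⁻¹ w' r)) → i ≡ i'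
  same-node {i} {i'} {w} {w'} eq = node-inj (block-size (trans (sym (sources-sum i w)) (trans (sum-cong (λ r → cong ind (eq r))) (sources-sum i' w'))))

  module _ {I J : Subset⁺} (eq : ∀ a → I a ≡ J a) where

    InI-cong : ∀ {v} → InI I v → InI J v
    InI-cong (a , Ia , z) = a , trans (sym (eq a)) Ia , z

  InBorder-cong : ∀ {I J : Subset⁺} → (∀ a → I a ≡ J a) → ∀ {v} → InBorder I v → InBorder J v
  InBorder-cong {I} {J} eq (a , (Ia , bd) , z) = a ,
    (trans (sym (eq a)) Ia , λ j k pj pk inn → bd j k pj pk (InI-cong {J} {I} (λ b → sym (eq b)) inn)) , z

  module _ (i : Fin rank) (long : Long i) where
    open Ideals 𝓜 i long using (Hook; module Hook)

    Hook-cong : ∀ {I J : Subset⁺} → (∀ a → I a ≡ J a) → Hook I → Hook J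
    Hook-cong {I} {J} eq hk = record
      { ≐-closed = λ a b z t → trans (sym (eq b)) (≐-closed a b z (trans (eq a) t))
      ; rectangle = λ p q inn → rectangle p q (back inn)
      ; upward = λ p q p' q' inn l l' → InI-cong {I} {J} eq (upward p q p' q' (back inn) l l')
      ; row = λ q b → InI-cong {I} {J} eq (row q b)
      ; column = λ p b → InI-cong {I} {J} eq (column p b) }
      where
      open Hook hk
      back : ∀ {v} → InI J v → InI I v
      back = InI-cong {J} {I} (λ b → sym (eq b))

  -- The permutation `w'⁻¹ w` preserves the blocks and increases on each of them, and so does its
  -- inverse; `block-identity` applies.
  same-word : ∀ {i} (long : Long i) {w w'} → MinRep i w → MinRep i w' →
    (∀ r → initial (h i) (act⁻¹ w r) ≡ initial (h i) (act⁻¹ w' r)) → ∀ r → act⁻¹ w r ≡ act⁻¹ w' r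
  same-word {i} long {w} {w'} mr mr' eq r = trans (sym (identity (act⁻¹ w r))) (cong (act⁻¹ w') (reverse-act w r))
    where
    open Block i long using (minrep-increasing)
    f : List (Fin rank) → List (Fin rank) → Fin M → Fin M
    f w w' r = act⁻¹ w' (act w r)
    increasing : ∀ {w w'} → MinRep i w → MinRep i w' → (∀ r → initial (h i) (f w w' r) ≡ initial (h i) r) → BlockIncreasing (h i) (f w w')
    increasing {w} {w'} mr mr' pres p q same l = case ℕₚ.<-cmp (toℕ (f w w' p)) (toℕ (f w w' q)) of λ where
        (tri< x _ _) → x
        (tri≈ _ z _) → contradiction (act-inj w (act-inj (reverse w') (Finₚ.toℕ-injective z))) (<⇒≢ᶠ l)
        (tri> _ _ g) → contradiction (minrep-increasing {w} mr p q same l)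
          (ℕₚ.<-asym (subst₂ Fin._<_ (reverse-act w' (act w q)) (reverse-act w' (act w p))
            (minrep-increasing {w'} mr' (f w w' q) (f w w' p) (trans (pres q) (trans (sym same) (sym (pres p)))) g)))
    pres : ∀ r → initial (h i) (f w w' r) ≡ initial (h i) r
    pres r = trans (sym (eq (act w r))) (cong (initial (h i)) (act-reverse w r))
    pres' : ∀ r → initial (h i) (f w' w r) ≡ initial (h i) r
    pres' r = trans (eq (act w' r)) (cong (initial (h i)) (act-reverse w' r))
    identity : ∀ r → f w w' r ≡ r
    identity = block-identity (h i) (f w w') (f w' w)
      (λ r → trans (cong (act⁻¹ w) (reverse-act w' (act w r))) (act-reverse w r))
      (λ r → trans (cong (act⁻¹ w') (reverse-act w (act w' r))) (act-reverse w' r))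
      pres (increasing {w} {w'} mr mr' pres) (increasing {w'} {w} mr' mr pres')

  same-region : ∀ {w w' I I'} → (∀ r → act⁻¹ w r ≡ act⁻¹ w' r) → (∀ a → I a ≡ I' a) → Moved w I ⊆ᵣ Moved w' I'
  same-region {w} {w'} {I} {I'} ew eI x hx = ⇒Moved w' I' x (Conv₀-mono
    (λ (p , q , z , ed) → p , q , z , InBorder-resp I' (λ k → cong₂ (λ s t → e s k - e t k) (ew p) (ew q)) (InBorder-cong eI ed)) x (Moved⇒ w I x hx))

  Code-region⊆ : ∀ {c} t t' → Code c t → Code c t' → regT t ⊆ᵣ regT t'
  Code-region⊆ t@(i , long , w , mr , I , iab) t'@(i' , long' , w' , mr' , I' , iab') (a , b) (a' , b') =
    go (same-node {i} {i'} {w} {w'} both) mr' both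
    where
    both : ∀ r → initial (h i) (act⁻¹ w r) ≡ initial (h i') (act⁻¹ w' r)
    both r = trans (sym (a r)) (a' r)
    go : i ≡ i' → MinRep i' w' → (∀ r → initial (h i) (act⁻¹ w r) ≡ initial (h i') (act⁻¹ w' r)) → Moved w I ⊆ᵣ Moved w' I'
    go refl mr'' eq = same-region {w} {w'} {I} {I'} (same-word long {w} {w'} mr mr'' eq) (λ α → trans (sym (b α)) (b' α))

  Code-region : ∀ {c t t'} → Code c t → Code c t' → regT t ≡ᵣ regT t'
  Code-region {t = t} {t'} c c' = Code-region⊆ t t' c c' , Code-region⊆ t' t c' c

  Good? : ∀ g → Dec (Good g)
  Good? g = (symm Boolₚ.≟ true) →-dec Finₚ.all? (λ r → g (o r) Boolₚ.≟ not (g r))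

  Code-good : ∀ {c t} → Code c t → Good (proj₁ c)
  Code-good {g , J} {i , long , w , _} (a , _) s r = trans (a (o r)) (trans (cong (initial (h i)) (act-opp s (reverse w) r))
    (trans (Block.block-opp i long s (act⁻¹ w r)) (cong not (sym (a r)))))

  Code-some : ∀ {c t} → Code c t → ∃ λ r → proj₁ c r ≡ true
  Code-some {g , J} {i , long , w , _} (a , _) = act w zero , trans (a (act w zero)) (cong (initial (h i)) (act-reverse w zero))

  Code-other : ∀ {c t} → Code c t → ∃ λ r → proj₁ c r ≡ false
  Code-other {g , J} {i , long , w , _} (a , _) = act w last ,
    trans (a (act w last)) (trans (cong (initial (h i)) (act-reverse w last)) (Ideals.last-block 𝓜 i long))

  module _ (g : Fin M → Bool) (J : Subset⁺) where

    -- Every realization of the code has the node `i`, so the question is whether `J` is one of the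
    -- ideals of this node.
    from-coset : CosetOf g → Dec (∃ (Code (g , J)))
    from-coset (i , long , w , mr , moves) = case Ideals.Hook? 𝓜 i long J of λ where
        (yes hk) → yes ((i , long , w , mr , J , HookWord.Hook⇒InIab 𝓜 i long J hk) , (λ r → sym (set r)) , λ a → refl)
        (no ¬hk) → no (λ (t , c) → ¬hk (transport t c))
      where
      set : ∀ r → initial (h i) (act⁻¹ w r) ≡ g r
      set r = trans (moves (act⁻¹ w r)) (cong g (reverse-act w r))
      transport : ∀ t → Code (g , J) t → Ideals.Hook 𝓜 i long J
      transport (i' , long' , w' , mr' , I' , iab') (a , b) = go (same-node {i'} {i} {w'} {w} (λ r → trans (sym (a r)) (sym (set r)))) long'
          (Hook-cong i' long' (λ α → sym (b α)) (Ideals.InIab⇒Hook 𝓜 i' long' iab'))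
        where
        go : ∀ {i'} → i' ≡ i → (long' : Long i') → Ideals.Hook 𝓜 i' long' J → Ideals.Hook 𝓜 i long J
        -- `Hook` is indexed by the proof of `Long`, which is an equation between rationals and
        -- hence unique.
        go refl long' = subst (λ l → Ideals.Hook 𝓜 i l J) (≡-irrelevant long' long)

    decide-code : Dec (∃ (Code (g , J)))
    decide-code = case Good? g of λ where
      (no ¬g) → no (λ (t , c) → ¬g (Code-good {g , J} {t} c))
      (yes good) → case Finₚ.any? (λ r → g r Boolₚ.≟ true) of λ where
        (no ¬s) → no (λ (t , c) → ¬s (Code-some {g , J} {t} c))
        (yes some) → case Finₚ.any? (λ r → g r Boolₚ.≟ false) of λ where
          (no ¬o) → no (λ (t , c) → ¬o (Code-other {g , J} {t} c))
          (yes other) → from-coset (cosetOf g good some other)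

  codes : List ((Fin M → Bool) × Subset⁺)
  codes = List.cartesianProduct (subsets M) (subsets N)

  representatives : List TIx
  representatives = collect (λ (g , J) → decide-code g J) codes

  representative : ∀ t → ∃ λ j → regT t ≡ᵣ regT (lookup representatives j)
  representative t = go (subsets-complete (sources t)) (subsets-complete (idealOf t))
    where
    go : (∃ λ g → g ∈ subsets M × (∀ r → g r ≡ sources t r)) → (∃ λ J → J ∈ subsets N × (∀ a → J a ≡ idealOf t a)) →
      ∃ λ j → regT t ≡ᵣ regT (lookup representatives j)
    go (g , g∈ , a) (J , J∈ , b) =
      let j , c = collect-hit (λ (g , J) → decide-code g J) {g , J} {codes} {t} (∈ₚ.∈-cartesianProduct⁺ g∈ J∈) (a , b)
      in j , Code-region {g , J} {t} {lookup representatives j} (a , b) c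

  Same : TIx → TIx⁺ → Set
  Same t (t' , _) = regT t ≡ᵣ regT t'

  -- Inclusion in 𝓟⁺ speaks of all points of the simplex; it is decided through the finitely many
  -- edges.
  decide-positive : ∀ t → Dec (∃ (Same t))
  decide-positive t = case PositiveEdges? (wordOf t) (idealOf t) of λ where
    (yes ps) → yes ((t , positive⇒𝓟⁺ t ps) , ≡ᵣ-refl)
    (no ¬ps) → no (λ ((t' , sub) , same) → ¬ps (𝓟⁺⇒positive t (λ x hx → sub x (proj₁ same x hx))))

  representatives⁺ : List TIx⁺
  representatives⁺ = collect decide-positive representatives

  representative⁺ : ∀ t → ∃ λ j → regT⁺ t ≡ᵣ regT⁺ (lookup representatives⁺ j)
  representative⁺ (t , sub) = go (representative t)
    where
    go : (∃ λ j → regT t ≡ᵣ regT (lookup representatives j)) → ∃ λ j → regT t ≡ᵣ regT⁺ (lookup representatives⁺ j)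
    go (j , same) =
      let k , c = collect-hit decide-positive {lookup representatives j} {representatives} {t , sub} (∈ₚ.∈-lookup {xs = representatives} j) (≡ᵣ-sym same)
      in k , ≡ᵣ-trans same c

  conclusion : Conclusion
  conclusion =
    record
      { finite  = representatives , representative
      ; simplex = cells-simplex OK cells-unique regT cellT okT regT-cell
      ; cover   = (λ x hx → let t , r , _ = cover-point x hx in t , r) , (λ x (t , r) → regT⊆𝓟 t x r)
      ; meet    = cells-meet OK cells-unique regT cellT okT regT-cell } ,
    record
      { finite  = representatives⁺ , representative⁺
      ; simplex = λ (t , _) → cells-simplex OK cells-unique regT cellT okT regT-cell t
      ; cover   = (λ x hx → let t , r , sub = cover-point x (𝓟⁺⊆𝓟 x hx) in (t , sub (𝓒⁺-dominant x (𝓟⁺⊆𝓒⁺ x hx))) , r) , (λ x ((t , sub) , r) → sub x r)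
      ; meet    = λ (t , _) (t' , _) → cells-meet OK cells-unique regT cellT okT regT-cell t t' } ,
    (λ x hx → 𝓟⁺⊆𝓟 x hx , 𝓟⁺⊆𝓒⁺ x hx) , 𝓟∩𝓒⁺⊆𝓟⁺

-- The root data of types A and C

module _ {A : Set} (L : ℕ → ℕ → List A) (n : ℕ) where

  -- The pattern common to both lists of positive roots: in type A the whole list unfolds to it, in
  -- type C the part without the roots `2ℚ ·v eN i`.
  pairList : List A
  pairList = concatMap (λ i → concatMap (λ j → if i ℕ.<ᵇ j then L i j else []) (upTo n)) (upTo n)

  ∈-pairList⁺ : ∀ {i j v} → i ℕ.< j → j ℕ.< n → v ∈ L i j → v ∈ pairList
  ∈-pairList⁺ {i} {j} {v} i<j j<n p = ∈ₚ.∈-concatMap⁺ _ (lose (∈ₚ.∈-upTo⁺ (ℕₚ.<-trans i<j j<n))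
    (∈ₚ.∈-concatMap⁺ _ (lose (∈ₚ.∈-upTo⁺ j<n) (subst (λ b → v ∈ (if b then L i j else [])) (sym (<ᵇ-true i<j)) p))))

  ∈-pairList⁻ : ∀ {v} → v ∈ pairList → ∃₂ λ i j → i ℕ.< j × j ℕ.< n × v ∈ L i j
  ∈-pairList⁻ {v} p =
    let i , i∈ , p' = find (∈ₚ.∈-concatMap⁻ (λ i → concatMap (λ j → if i ℕ.<ᵇ j then L i j else []) (upTo n)) {xs = upTo n} p)
        j , j∈ , p'' = find (∈ₚ.∈-concatMap⁻ (λ j → if i ℕ.<ᵇ j then L i j else []) {xs = upTo n} p')
        i<j , q = choose i j p''
    in i , j , i<j , ∈ₚ.∈-upTo⁻ j∈ , q
    where
    choose : ∀ i j → v ∈ (if i ℕ.<ᵇ j then L i j else []) → i ℕ.< j × v ∈ L i j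
    choose i j p with i ℕ.<ᵇ j in e
    ... | true  = <ᵇ-true⁻¹ {i} {j} e , p
    ... | false = case p of λ ()

-- Standard basis vectors

eN-δ : ∀ {d} (p k : Fin d) → eN (toℕ p) k ≡ δ p k
eN-δ p k with p Fin.≟ k
... | yes refl = cong (λ b → if b then 1ℚ else 0ℚ) (≡ᵇ-refl (toℕ p))
  where
  ≡ᵇ-refl : ∀ n → (n ℕ.≡ᵇ n) ≡ true
  ≡ᵇ-refl zero    = refl
  ≡ᵇ-refl (suc n) = ≡ᵇ-refl n
... | no ne = cong (λ b → if b then 1ℚ else 0ℚ) (≡ᵇ-≢ (toℕ p) (toℕ k) (ne ∘ Finₚ.toℕ-injective))
  where
  ≡ᵇ-≢ : ∀ m n → m ≢ n → (m ℕ.≡ᵇ n) ≡ false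
  ≡ᵇ-≢ zero    zero    h = contradiction refl h
  ≡ᵇ-≢ zero    (suc n) h = refl
  ≡ᵇ-≢ (suc m) zero    h = refl
  ≡ᵇ-≢ (suc m) (suc n) h = ≡ᵇ-≢ m n (h ∘ cong suc)

ip-eN : ∀ {d} (x : V d) (k : Fin d) → ⟨ x , eN (toℕ k) ⟩ ≡ x k
ip-eN x k = trans (sum-cong (λ j → trans (cong (x j *_) (eN-δ k j)) (ℚₚ.*-comm (x j) (δ k j)))) (sum-δ k x)

eN-eN : ∀ {d} (p r : Fin d) → ⟨ eN {d} (toℕ p) , eN (toℕ r) ⟩ ≡ δ p r
eN-eN p r = trans (ip-eN (eN (toℕ p)) r) (eN-δ p r)

≡⇒≐ : ∀ {d} {u v : V d} → u ≡ v → u ≐ v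
≡⇒≐ refl k = refl

module TypeA (n : ℕ) (1≤n : 1 ℕ.≤ n) where
  open RS (typeA n)

  private
    L : ℕ → ℕ → List (V (suc n))
    L i j = (eN i -v eN j) ∷ []

    e : Fin (suc n) → V (suc n)
    e r = eN (toℕ r)

    pair : ∀ a → ∃₂ λ (p q : Fin (suc n)) → p Fin.< q × pos a ≐ (e p -v e q)
    pair a = go (∈-pairList⁻ L (suc n) (∈ₚ.∈-lookup {xs = posRoots} a))
      where
      go : (∃₂ λ i j → i ℕ.< j × j ℕ.< suc n × pos a ∈ L i j) → ∃₂ λ (p q : Fin (suc n)) → p Fin.< q × pos a ≐ (e p -v e q)
      go (i , j , i<j , j<n , here eq) = Fin.fromℕ< i<n , Fin.fromℕ< j<n ,
        subst₂ ℕ._<_ (sym (Finₚ.toℕ-fromℕ< i<n)) (sym (Finₚ.toℕ-fromℕ< j<n)) i<j ,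
        ≡⇒≐ (trans eq (cong₂ (λ x y → eN x -v eN y) (sym (Finₚ.toℕ-fromℕ< i<n)) (sym (Finₚ.toℕ-fromℕ< j<n))))
        where
        i<n : i ℕ.< suc n
        i<n = ℕₚ.<-trans i<j j<n

  model : Model (typeA n)
  model = record
    { m = n
    ; symm = false
    ; opp-free = λ ()
    ; e = e
    ; gram = λ p r → trans (eN-eN p r) (lem (δ p r) (δ p (opposite r)))
    ; separating = λ x y h k → trans (sym (ip-eN x k)) (trans (h k) (ip-eN y k))
    ; node = id
    ; node-inj = id
    ; simple-e = simple-e
    ; letter = λ k → k , simple-e k
    ; long-letter = λ k _ → k , refl
    ; θ-e = ≡⇒≐ (cong (λ z → eN 0 -v eN z) (sym (Finₚ.toℕ-fromℕ n)))
    ; pos-pair = pair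
    ; pair-pos = λ p q p<q → let a , eq = ∈-index (∈-pairList⁺ L (suc n) p<q (Finₚ.toℕ<n q) (here refl)) in a , ≡⇒≐ eq
    ; tie = λ r → toℕ r ℕ.<ᵇ n
    ; tie-first = <ᵇ-true 1≤n
    ; tie-last = <ᵇ-false (ℕₚ.≤-reflexive (sym (Finₚ.toℕ-fromℕ n)))
    ; tie-opp = λ () }
    where
    lem : ∀ a b → a ≡ a - 0ℚ * b
    lem = solve-∀ ℚ-ring
    simple-e : ∀ j → simple j ≐ (e (inject₁ j) -v e (suc j))
    simple-e j = ≡⇒≐ (cong (λ z → eN z -v eN (suc (toℕ j))) (sym (Finₚ.toℕ-inject₁ j)))

module TypeC (n' : ℕ) where

  n : ℕ
  n = suc n'

  open RS (typeC n)

  private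
    m : ℕ
    -- There are `2 n` positions, numbered from 0, and the last of them is `2 n - 1`.
    m = n' ℕ.+ n

    o : Fin (suc m) → Fin (suc m)
    o = opposite

    o-o : ∀ r → o (o r) ≡ r
    o-o = Finₚ.opposite-involutive

    o-sum : ∀ (r : Fin (suc m)) → toℕ r ℕ.+ toℕ (o r) ≡ m
    o-sum r = trans (cong (toℕ r ℕ.+_) (Finₚ.opposite-prop r)) (ℕₚ.m+[n∸m]≡n (Finₚ.toℕ≤pred[n] r))

    flip : ∀ r → (toℕ (o r) ℕ.<ᵇ n) ≡ not (toℕ r ℕ.<ᵇ n)
    flip r with toℕ r ℕ.<? n
    ... | yes l = trans (<ᵇ-false (ℕₚ.≮⇒≥ (λ l' → ℕₚ.<-irrefl (o-sum r)
            (ℕₚ.≤-<-trans (ℕₚ.+-mono-≤ (ℕₚ.≤-pred l) (ℕₚ.≤-pred l')) (ℕₚ.+-monoʳ-< n' (ℕₚ.n<1+n n')))))) (sym (cong not (<ᵇ-true l)))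
    ... | no g = trans (<ᵇ-true (ℕₚ.≰⇒> (λ g' → ℕₚ.<-irrefl (sym (o-sum r)) (ℕₚ.+-mono-≤ (ℕₚ.≮⇒≥ g) g')))) (sym (cong not (<ᵇ-false (ℕₚ.≮⇒≥ g))))

    o≢ : ∀ r → o r ≢ r
    o≢ r z = absurd (toℕ r ℕ.<ᵇ n) (trans (sym (flip r)) (cong (λ y → toℕ y ℕ.<ᵇ n) z))
      where
      absurd : ∀ b → not b ≢ b
      absurd true  ()
      absurd false ()

    -- The comparison with `n` is a separate argument, so that it can be replaced by its known
    -- value.
    signed-eN : Bool → Fin (suc m) → V n
    signed-eN b r = if b then eN (toℕ r) else -v eN (toℕ (o r))

    e : Fin (suc m) → V n
    e r = signed-eN (toℕ r ℕ.<ᵇ n) r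

    data Half (r : Fin (suc m)) : Set where
      low  : ∀ (i : Fin n) → toℕ r ≡ toℕ i → e r ≡ eN (toℕ i) → Half r
      high : ∀ (i : Fin n) → toℕ (o r) ≡ toℕ i → e r ≡ (-v eN (toℕ i)) → Half r

    half : ∀ r → Half r
    half r with toℕ r ℕ.<? n
    ... | yes l = low (Fin.fromℕ< l) (sym (Finₚ.toℕ-fromℕ< l)) (trans (cong (λ b → signed-eN b r) (<ᵇ-true l)) (cong eN (sym (Finₚ.toℕ-fromℕ< l))))
    ... | no g  = high (Fin.fromℕ< l) (sym (Finₚ.toℕ-fromℕ< l)) (trans (cong (λ b → signed-eN b r) (<ᵇ-false (ℕₚ.≮⇒≥ g))) (cong (λ z → -v eN z) (sym (Finₚ.toℕ-fromℕ< l))))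
      where
      l : toℕ (o r) ℕ.< n
      l = <ᵇ-true⁻¹ {toℕ (o r)} {n} (trans (flip r) (cong not (<ᵇ-false (ℕₚ.≮⇒≥ g))))

    e-low : ∀ {r : Fin (suc m)} {k} → toℕ r ≡ k → k ℕ.< n → e r ≡ eN k
    e-low {r} refl l = cong (λ b → signed-eN b r) (<ᵇ-true l)

    e-high : ∀ {r : Fin (suc m)} {k} → toℕ (o r) ≡ k → k ℕ.< n → e r ≡ (-v eN k)
    e-high {r} refl l = cong (λ b → signed-eN b r) (trans (cong (λ z → toℕ z ℕ.<ᵇ n) (sym (o-o r))) (trans (flip (o r)) (cong not (<ᵇ-true l))))

    low-below : ∀ {r : Fin (suc m)} {i : Fin n} → toℕ r ≡ toℕ i → toℕ r ℕ.< n
    low-below {i = i} z = subst (ℕ._< n) (sym z) (Finₚ.toℕ<n i)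

    high-above : ∀ {r : Fin (suc m)} {i : Fin n} → toℕ (o r) ≡ toℕ i → n ℕ.≤ toℕ r
    high-above {r} {i} z = <ᵇ-false⁻¹ {toℕ r} {n} (trans (cong (λ y → toℕ y ℕ.<ᵇ n) (sym (o-o r))) (trans (flip (o r))
      (cong not (<ᵇ-true (subst (ℕ._< n) (sym z) (Finₚ.toℕ<n i))))))

    apart : ∀ {p r : Fin (suc m)} → toℕ p ℕ.< n → n ℕ.≤ toℕ r → p ≢ r
    apart l g refl = ℕₚ.<⇒≱ l g

    δ-match : ∀ {p r : Fin (suc m)} {i j : Fin n} → toℕ p ≡ toℕ i → toℕ r ≡ toℕ j → δ i j ≡ δ p r
    δ-match {p} {r} {i} {j} a b = δ-iff {p = i} {j} {p} {r}
      (λ z → Finₚ.toℕ-injective (trans a (trans (cong toℕ z) (sym b)))) (λ z → Finₚ.toℕ-injective (trans (sym a) (trans (cong toℕ z) b)))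

    δ-o-o : ∀ p r → δ (o p) (o r) ≡ δ p r
    δ-o-o p r = δ-iff {p = o p} {o r} {p} {r} (λ z → trans (sym (o-o p)) (trans (cong o z) (o-o r))) (cong o)

    lem₁ : ∀ a → a ≡ a - 1ℚ * 0ℚ
    lem₁ = solve-∀ ℚ-ring
    lem₂ : ∀ a → - a ≡ 0ℚ - 1ℚ * a
    lem₂ = solve-∀ ℚ-ring

    gram : ∀ p r → ⟨ e p , e r ⟩ ≡ δ p r - 1ℚ * δ p (o r)
    gram p r = go (half p) (half r)
      where
      o-high : ∀ {r} {i : Fin n} → toℕ r ≡ toℕ i → n ℕ.≤ toℕ (o r)
      o-high {r} z = high-above {o r} (trans (cong toℕ (o-o r)) z)
      go : Half p → Half r → ⟨ e p , e r ⟩ ≡ δ p r - 1ℚ * δ p (o r)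
      go (low i a x) (low j b y) = trans (cong₂ (⟨_,_⟩ {n}) x y) (trans (eN-eN i j) (trans (δ-match {p} {r} a b)
        (trans (lem₁ (δ p r)) (cong (λ z → δ p r - 1ℚ * z) (sym (δ-≢ {p = p} {o r} (apart (low-below {p} a) (o-high {r} b))))))))
      go (low i a x) (high j b y) = trans (cong₂ (⟨_,_⟩ {n}) x y) (trans (ip-negʳ (eN {n} (toℕ j)) (eN (toℕ i))) (trans (cong -_ (trans (eN-eN i j) (δ-match {p} {o r} a b)))
        (trans (lem₂ (δ p (o r))) (cong (λ z → z - 1ℚ * δ p (o r)) (sym (δ-≢ {p = p} {r} (apart (low-below {p} a) (high-above {r} b))))))))
      go (high i a x) (low j b y) = trans (cong₂ (⟨_,_⟩ {n}) x y) (trans (ip-negˡ (eN {n} (toℕ i)) (eN (toℕ j))) (trans (cong -_ (trans (eN-eN i j) (trans (δ-match {o p} {r} a b)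
          (trans (cong (δ (o p)) (sym (o-o r))) (δ-o-o p (o r))))))
        (trans (lem₂ (δ p (o r))) (cong (λ z → z - 1ℚ * δ p (o r)) (sym (δ-≢ {p = p} {r} (λ z → apart (low-below {r} b) (high-above {p} a) (sym z))))))))
      go (high i a x) (high j b y) = trans (cong₂ (⟨_,_⟩ {n}) x y) (trans (ip-negˡ (eN {n} (toℕ i)) (-v eN (toℕ j))) (trans (cong -_ (ip-negʳ (eN {n} (toℕ j)) (eN (toℕ i)))) (trans (neg-neg ⟨ eN {n} (toℕ i) , eN (toℕ j) ⟩)
        (trans (eN-eN i j) (trans (trans (δ-match {o p} {o r} a b) (δ-o-o p r)) (trans (lem₁ (δ p r))
          (cong (λ z → δ p r - 1ℚ * z) (sym (δ-≢ {p = p} {o r} (λ z → apart (low-below {o r} b) (high-above {p} a) (sym z)))))))))))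

    n≤m : n ℕ.≤ m
    n≤m = ℕₚ.m≤n+m n n'

    position : ∀ {k} → k ℕ.< n → Fin (suc m)
    position l = Fin.fromℕ< (ℕₚ.<-≤-trans l (ℕₚ.≤-trans n≤m (ℕₚ.n≤1+n m)))

    toℕ-position : ∀ {k} (l : k ℕ.< n) → toℕ (position l) ≡ k
    toℕ-position l = Finₚ.toℕ-fromℕ< (ℕₚ.<-≤-trans l (ℕₚ.≤-trans n≤m (ℕₚ.n≤1+n m)))

    separating : ∀ x y → (∀ r → ⟨ x , e r ⟩ ≡ ⟨ y , e r ⟩) → x ≐ y
    separating x y h k = trans (sym (ip-eN x k)) (trans (subst (λ z → ⟨ x , z ⟩ ≡ ⟨ y , z ⟩)
      (e-low {position (Finₚ.toℕ<n k)} (toℕ-position (Finₚ.toℕ<n k)) (Finₚ.toℕ<n k)) (h (position (Finₚ.toℕ<n k)))) (ip-eN y k))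

    -- The simple roots occupy the adjacent pairs of the first half and the central pair; the latter
    -- belongs to the long one.
    node : Fin n → Fin m
    node i = Fin.inject≤ i n≤m

    toℕ-node : ∀ i → toℕ (node i) ≡ toℕ i
    toℕ-node i = Finₚ.toℕ-inject≤ i n≤m

    node-of : ∀ (k : Fin m) → toℕ k ℕ.< n → ∃ λ j → node j ≡ k
    node-of k l = Fin.fromℕ< l , Finₚ.toℕ-injective (trans (toℕ-node (Fin.fromℕ< l)) (Finₚ.toℕ-fromℕ< l))

    plus : ∀ (u v : V n) → (u +v v) ≐ (u -v (-v v))
    plus u v k = lem (u k) (v k)
      where
      lem : ∀ a b → a + b ≡ a - (- b)
      lem = solve-∀ ℚ-ring

    twice : ∀ (u : V n) → (2ℚ ·v u) ≐ (u -v (-v u))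
    twice u k = lem (u k)
      where
      lem : ∀ a → 2ℚ * a ≡ a - (- a)
      lem = solve-∀ ℚ-ring

    minus : ∀ (u v : V n) → (v -v u) ≐ ((-v u) -v (-v v))
    minus u v k = lem (u k) (v k)
      where
      lem : ∀ a b → b - a ≡ - a - (- b)
      lem = solve-∀ ℚ-ring

    simple-e : ∀ j → simple j ≐ (e (inject₁ (node j)) -v e (suc (node j)))
    simple-e j with suc (toℕ j) ℕ.<? n
    ... | yes l = ≡⇒≐ (trans (cong (λ b → if b then eN (toℕ j) -v eN (suc (toℕ j)) else 2ℚ ·v eN (toℕ j)) (<ᵇ-true l))
          (cong₂ _-v_ (sym (e-low (trans (Finₚ.toℕ-inject₁ (node j)) (toℕ-node j)) (Finₚ.toℕ<n j))) (sym (e-low (cong suc (toℕ-node j)) l))))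
    ... | no g = ≐-trans (≡⇒≐ (cong (λ b → if b then eN (toℕ j) -v eN (suc (toℕ j)) else 2ℚ ·v eN (toℕ j)) (<ᵇ-false (ℕₚ.≮⇒≥ g))))
          (≐-trans (twice (eN (toℕ j))) (≡⇒≐ (cong₂ _-v_ (sym (e-low (trans (Finₚ.toℕ-inject₁ (node j)) (toℕ-node j)) (Finₚ.toℕ<n j)))
            (sym (e-high {suc (node j)} opp-j (Finₚ.toℕ<n j))))))
      where
      j≡ : suc (toℕ j) ≡ n
      j≡ = ℕₚ.≤-antisym (Finₚ.toℕ<n j) (ℕₚ.≮⇒≥ g)
      opp-j : toℕ (o (suc (node j))) ≡ toℕ j
      opp-j = ℕₚ.+-cancelˡ-≡ n _ _ (trans (cong (ℕ._+ toℕ (o (suc (node j)))) (sym (trans (cong suc (toℕ-node j)) j≡)))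
        (trans (o-sum (suc (node j))) (trans (ℕₚ.+-comm n' n) (cong (n ℕ.+_) (sym (ℕₚ.suc-injective j≡))))))

    letter : ∀ k → ∃ λ j → simple j ≐ (e (inject₁ k) -v e (suc k))
    letter k with toℕ k ℕ.<? n
    ... | yes l = let j , z = node-of k l in j , ≐-trans (simple-e j) (≡⇒≐ (cong (λ y → e (inject₁ y) -v e (suc y)) z))
    ... | no g = Fin.fromℕ< t<n , ≐-trans (≡⇒≐ (trans (cong (λ b → if b then eN (toℕ (Fin.fromℕ< t<n)) -v eN (suc (toℕ (Fin.fromℕ< t<n))) else 2ℚ ·v eN (toℕ (Fin.fromℕ< t<n)))
              (<ᵇ-true (subst (λ z → suc z ℕ.< n) (sym (Finₚ.toℕ-fromℕ< t<n)) st<n)))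
              (cong (λ z → eN z -v eN (suc z)) (Finₚ.toℕ-fromℕ< t<n))))
            (≐-trans (minus (eN (suc t)) (eN t)) (≡⇒≐ (cong₂ _-v_ (sym (e-high {inject₁ k} opp-k st<n)) (sym (e-high {suc k} refl t<n)))))
      where
      t : ℕ
      -- Beyond the centre the pair of `k` and `k + 1` is the mirror image of that of `t` and
      -- `t + 1`, which belongs to a simple root.
      t = toℕ (o (suc k))
      opp-k : toℕ (o (inject₁ k)) ≡ suc t
      opp-k = ℕₚ.+-cancelˡ-≡ (toℕ k) _ _ (trans (cong (ℕ._+ toℕ (o (inject₁ k))) (sym (Finₚ.toℕ-inject₁ k)))
        (trans (o-sum (inject₁ k)) (trans (sym (o-sum (suc k))) (sym (ℕₚ.+-suc (toℕ k) t)))))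
      st<n : suc t ℕ.< n
      st<n = <ᵇ-true⁻¹ {suc t} {n} (trans (cong (ℕ._<ᵇ n) (sym opp-k)) (trans (flip (inject₁ k))
        (cong not (<ᵇ-false (subst (n ℕ.≤_) (sym (Finₚ.toℕ-inject₁ k)) (ℕₚ.≮⇒≥ g))))))
      t<n : t ℕ.< n
      t<n = ℕₚ.<-trans (ℕₚ.n<1+n t) st<n

    long-letter : ∀ k → (true ≡ true → suc k ≡ o (inject₁ k)) → ∃ λ j → node j ≡ k
    long-letter k h with toℕ k ℕ.<? n
    ... | yes l = node-of k l
    -- From the second half the mirror leads back to the first half, so the mirror image cannot be
    -- the successor.
    ... | no g = contradiction (<ᵇ-true⁻¹ {toℕ (o (inject₁ k))} {n} (trans (flip (inject₁ k))
            (cong not (<ᵇ-false (subst (n ℕ.≤_) (sym (Finₚ.toℕ-inject₁ k)) (ℕₚ.≮⇒≥ g))))))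
          (ℕₚ.≤⇒≯ (subst (λ z → n ℕ.≤ toℕ z) (h refl) (ℕₚ.≤-trans (ℕₚ.≮⇒≥ g) (ℕₚ.n≤1+n (toℕ k)))))

    L : ℕ → ℕ → List (V n)
    L i j = (eN i -v eN j) ∷ (eN i +v eN j) ∷ []

    opp-position : ∀ {k} (l : k ℕ.< n) → e (o (position l)) ≡ (-v eN k)
    opp-position l = e-high {o (position l)} (trans (cong toℕ (o-o (position l))) (toℕ-position l)) l

    at-position : ∀ {k} (l : k ℕ.< n) → e (position l) ≡ eN k
    at-position l = e-low (toℕ-position l) l

    position-< : ∀ {i j} (li : i ℕ.< n) (lj : j ℕ.< n) → position li Fin.< o (position lj)
    position-< {i} {j} li lj = ℕₚ.<-≤-trans (subst (ℕ._< n) (sym (toℕ-position li)) li)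
      (high-above {o (position lj)} {Fin.fromℕ< lj} (trans (cong toℕ (o-o (position lj))) (trans (toℕ-position lj) (sym (Finₚ.toℕ-fromℕ< lj)))))

    Pair : V n → Set
    Pair v = ∃₂ λ (p q : Fin (suc m)) → p Fin.< q × v ≐ (e p -v e q)

    pair : ∀ a → Pair (pos a)
    pair a = go (∈ₚ.∈-++⁻ (pairList L n) (∈ₚ.∈-lookup {xs = posRoots} a))
      where
      short : ∀ {i j} → i ℕ.< j → j ℕ.< n → pos a ∈ L i j → Pair (pos a)
      short i<j j<n (here eq) = position (ℕₚ.<-trans i<j j<n) , position j<n ,
        subst₂ ℕ._<_ (sym (toℕ-position (ℕₚ.<-trans i<j j<n))) (sym (toℕ-position j<n)) i<j ,
        ≡⇒≐ (trans eq (cong₂ _-v_ (sym (at-position (ℕₚ.<-trans i<j j<n))) (sym (at-position j<n))))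
      short {i} {j} i<j j<n (there (here eq)) = position i<n , o (position j<n) , position-< i<n j<n ,
        ≐-trans (≡⇒≐ eq) (≐-trans (plus (eN i) (eN j)) (≡⇒≐ (cong₂ _-v_ (sym (at-position i<n)) (sym (opp-position j<n)))))
        where
        i<n : i ℕ.< n
        i<n = ℕₚ.<-trans i<j j<n
      go : pos a ∈ pairList L n ⊎ pos a ∈ List.map (λ i → 2ℚ ·v eN i) (upTo n) → Pair (pos a)
      go (inj₁ p) = let i , j , i<j , j<n , p' = ∈-pairList⁻ L n p in short i<j j<n p'
      go (inj₂ p) =
        let i , i∈ , eq = ∈ₚ.∈-map⁻ (λ i → 2ℚ ·v eN i) p
            i<n = ∈ₚ.∈-upTo⁻ i∈
        in position i<n , o (position i<n) , position-< i<n i<n ,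
           ≐-trans (≡⇒≐ eq) (≐-trans (twice (eN i)) (≡⇒≐ (cong₂ _-v_ (sym (at-position i<n)) (sym (opp-position i<n)))))

    difference : ∀ {i j} → i ℕ.< j → j ℕ.< n → IsPos (eN i -v eN j) × IsPos (eN i +v eN j)
    difference i<j j<n =
      (let a , eq = ∈-index (∈ₚ.∈-++⁺ˡ (∈-pairList⁺ L n i<j j<n (here refl))) in a , ≡⇒≐ eq) ,
      (let a , eq = ∈-index (∈ₚ.∈-++⁺ˡ (∈-pairList⁺ L n i<j j<n (there (here refl)))) in a , ≡⇒≐ eq)

    double : ∀ {i} → i ℕ.< n → IsPos (2ℚ ·v eN i)
    double i<n = let a , eq = ∈-index (∈ₚ.∈-++⁺ʳ (pairList L n) (∈ₚ.∈-map⁺ (λ i → 2ℚ ·v eN i) (∈ₚ.∈-upTo⁺ i<n))) in a , ≡⇒≐ eq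

    IsPos-≐ : ∀ {x y : V n} → x ≐ y → IsPos x → IsPos y
    IsPos-≐ h (a , z) = a , ≐-trans (≐-sym h) z

    pair-pos : ∀ p q → p Fin.< q → IsPos (e p -v e q)
    pair-pos p q p<q = go (half p) (half q)
      where
      go : Half p → Half q → IsPos (e p -v e q)
      go (low i a x) (low j b y) = IsPos-≐ (≡⇒≐ (sym (cong₂ _-v_ x y))) (proj₁ (difference (subst₂ ℕ._<_ a b p<q) (Finₚ.toℕ<n j)))
      go (high i a x) (low j b y) = contradiction (ℕₚ.<-trans p<q (low-below {q} b)) (ℕₚ.≤⇒≯ (high-above {p} a))
      go (high i a x) (high j b y) = IsPos-≐ (≐-trans (minus (eN (toℕ i)) (eN (toℕ j))) (≡⇒≐ (sym (cong₂ _-v_ x y))))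
          (proj₁ (difference (subst₂ ℕ._<_ b a anti) (Finₚ.toℕ<n i)))
        where
        anti : toℕ (o q) ℕ.< toℕ (o p)
        anti = ℕₚ.≰⇒> (λ g → ℕₚ.<-irrefl (trans (o-sum p) (sym (o-sum q))) (ℕₚ.+-mono-<-≤ p<q g))
      go (low i a x) (high j b y) = IsPos-≐ (≡⇒≐ (sym (cong₂ _-v_ x y))) (IsPos-≐ (plus (eN (toℕ i)) (eN (toℕ j))) (sums (ℕₚ.<-cmp (toℕ i) (toℕ j))))
        where
        lem₃ : ∀ a → 2ℚ * a ≡ a + a
        lem₃ = solve-∀ ℚ-ring
        sums : _ → IsPos (eN (toℕ i) +v eN (toℕ j))
        sums (tri< l _ _) = proj₂ (difference l (Finₚ.toℕ<n j))
        sums (tri≈ _ z _) = IsPos-≐ (λ k → trans (lem₃ (eN (toℕ i) k)) (cong (λ t → eN (toℕ i) k + eN t k) z)) (double (Finₚ.toℕ<n i))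
        sums (tri> _ _ g) = IsPos-≐ (λ k → ℚₚ.+-comm (eN (toℕ j) k) (eN (toℕ i) k)) (proj₂ (difference g (Finₚ.toℕ<n i)))

  model : Model (typeC n)
  model = record
    { m = m
    ; symm = true
    ; opp-free = λ _ → o≢
    ; e = e
    ; gram = gram
    ; separating = separating
    ; node = node
    ; node-inj = λ {i} {j} z → Finₚ.toℕ-injective (trans (sym (toℕ-node i)) (trans (cong toℕ z) (toℕ-node j)))
    ; simple-e = simple-e
    ; letter = letter
    ; long-letter = long-letter
    ; θ-e = ≐-trans (twice (eN 0)) (≡⇒≐ (cong (λ y → eN 0 -v y) (sym (e-high {fromℕ m} (cong toℕ (o-o zero)) (ℕ.s≤s ℕ.z≤n)))))
    ; pos-pair = pair
    ; pair-pos = pair-pos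
    ; tie = λ r → toℕ r ℕ.<ᵇ n
    ; tie-first = refl
    ; tie-last = <ᵇ-false (subst (n ℕ.≤_) (sym (Finₚ.toℕ-fromℕ m)) n≤m)
    ; tie-opp = λ _ → flip }

theorem5p10 : ((n : ℕ) → 1 ≤ n → RS.Conclusion (typeA n))
    × ((n : ℕ) → 2 ≤ n → RS.Conclusion (typeC n))
theorem5p10 = (λ n 1≤n → Result.conclusion (TypeA.model n 1≤n)) , λ { (suc n') _ → Result.conclusion (TypeC.model n') }
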